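{- Let $(L,Q)$ and $(L',Q')$ be isospectral definite ternary quadratic lattices over $A=\mathbb F_q[t]$ whose successive minima $(\mu_1,\mu_2,\mu_3)$ satisfy $\mu_1<\mu_2<\mu_3$ and $\mu_1\equiv\mu_2\pmod 2$. Then $(L,Q)$ and $(L',Q')$ are isometric.
   Context: $\mathbb F_q$ is a finite field with $q$ odd, $A=\mathbb F_q[t]$, $K=\mathbb F_q(t)$, $K_\infty=\mathbb F_q((1/t))$. For $x\in K$, $\deg x$ is the degree of the numerator minus that of the denominator, $\deg 0=-\infty$. A quadratic lattice $(L,Q)$ over $A$ is a free $A$-module of finite rank with a $K$-valued quadratic form $Q$; $B(\mathbf x,\mathbf y)=Q(\mathbf x+\mathbf y)-Q(\mathbf x)-Q(\mathbf y)$. Ternary means rank 3; definite means $Q$ anisotropic over $K_\infty$. The Gram matrix of a basis $\mathbf v_1,\dots,\mathbf v_n$ is $(m_{ij})$, $m_{ij}=\frac12B(\mathbf v_i,\mathbf v_j)$; a basis is reduced if $\deg m_{ii}\le\deg m_{jj}$ for $i\le j$ and $\deg m_{ij}<\deg m_{ii}$ for $i<j$. Definite lattices have reduced bases and $(\deg m_{11},\dots,\deg m_{nn})$ is independent of the reduced basis: these are the successive minima. $R(L,Q,a)=|\{\mathbf v\in L:Q(\mathbf v)=a\}|$; isospectral means $R(L,Q,a)=R(L',Q',a)$ for all $a\in K$. Isometric means there is an $A$-module isomorphism $\sigma:L\to L'$ with $Q'\circ\sigma=Q$. -}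

module Defs where

open import Data.Nat as ℕ using (ℕ; zero; suc; _∸_; _%_)
open import Data.Integer as ℤ using (ℤ; +_; -[1+_])
open import Data.Fin as Fin using (Fin; zero; suc)
open import Data.List using (List; []; _∷_; length; map)
open import Data.Maybe using (Maybe; just; nothing)
open import Data.Product using (Σ; _×_; _,_; ∃; ∃-syntax)
open import Data.Unit using (⊤)
open import Data.Empty using (⊥)
open import Data.Bool using (if_then_else_)
open import Relation.Nullary using (¬_; yes; no)
open import Relation.Nullary.Decidable using (⌊_⌋)
open import Relation.Binary.PropositionalEquality using (_≡_)
open import Relation.Binary.Definitions using (DecidableEquality)
open import Algebra.Structures using (IsCommutativeRing)
open import Function.Bundles using (_↔_)

-- A finite field F_q (carrier with propositional equality; every finite
-- field is isomorphic to one presented this way).  q = size.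

record FiniteField : Set₁ where
  field
    F : Set
    _+_ _*_ : F → F → F
    -_ : F → F
    0# 1# : F
    _⁻¹ : F → F
    isCommutativeRing : IsCommutativeRing _≡_ _+_ _*_ -_ 0# 1#
    0≢1 : ¬ (0# ≡ 1#)
    inverseʳ : ∀ x → ¬ (x ≡ 0#) → x * (x ⁻¹) ≡ 1#
    _≟_ : DecidableEquality F
    size : ℕ
    enumeration : F ↔ Fin size
  infixl 6 _+_
  infixl 7 _*_
  infix 8 -_

module Over (𝔽 : FiniteField) where
  open FiniteField 𝔽

  OddOrder : Set
  OddOrder = size % 2 ≡ 1

  -- A = F_q[t]: coefficient lists (constant term first), compared
  -- coefficientwise (trailing zeros irrelevant).

  Poly : Set
  Poly = List F

  coeff : Poly → ℕ → F
  coeff []      n       = 0#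
  coeff (a ∷ p) zero    = a
  coeff (a ∷ p) (suc n) = coeff p n

  coeffℤ : Poly → ℤ → F
  coeffℤ p (+ n)      = coeff p n
  coeffℤ p -[1+ _ ]   = 0#

  _≈P_ : Poly → Poly → Set
  p ≈P r = ∀ n → coeff p n ≡ coeff r n

  0P 1P : Poly
  0P = []
  1P = 1# ∷ []

  _+P_ : Poly → Poly → Poly
  []      +P r       = r
  (a ∷ p) +P []      = a ∷ p
  (a ∷ p) +P (b ∷ r) = (a + b) ∷ (p +P r)

  -P_ : Poly → Poly
  -P p = map -_ p

  _*P_ : Poly → Poly → Poly
  []      *P r = []
  (a ∷ p) *P r = map (a *_) r +P (0# ∷ (p *P r))

  -- degree; nothing stands for deg 0 = -∞
  degP : Poly → Maybe ℕ
  degP []      = nothing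
  degP (a ∷ p) = step (degP p)
    where
      step : Maybe ℕ → Maybe ℕ
      step (just n) = just (suc n)
      step nothing with a ≟ 0#
      ... | yes _ = nothing
      ... | no  _ = just 0

  -- K = F_q(t): fractions num/den; an element of K is a fraction with
  -- den ≠ 0 (ValidFrac); equality by cross multiplication.

  record Frac : Set where
    constructor _/_
    field
      num den : Poly
  open Frac public

  ValidFrac : Frac → Set
  ValidFrac x = ¬ (den x ≈P 0P)

  _≈K_ : Frac → Frac → Set
  x ≈K y = (num x *P den y) ≈P (num y *P den x)

  _+K_ : Frac → Frac → Frac
  x +K y = ((num x *P den y) +P (num y *P den x)) / (den x *P den y)

  _*K_ : Frac → Frac → Frac
  x *K y = (num x *P num y) / (den x *P den y)

  fromPoly : Poly → Frac
  fromPoly p = p / 1P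

  -- degrees in ℤ ∪ {-∞}  (nothing = -∞)
  Deg : Set
  Deg = Maybe ℤ

  degK : Frac → Deg
  degK x with degP (num x) | degP (den x)
  ... | just n | just d = just (+ n ℤ.- + d)
  ... | _      | _      = nothing

  _≤D_ : Deg → Deg → Set
  nothing ≤D _       = ⊤
  just a  ≤D nothing = ⊥
  just a  ≤D just b  = a ℤ.≤ b

  _<D_ : Deg → Deg → Set
  _       <D nothing = ⊥
  nothing <D just _  = ⊤
  just a  <D just b  = a ℤ.< b

  -- K_∞ = F_q((1/t)): Laurent series  Σ_{i ≥ 0} c i · t^(top - i)

  record Laurent : Set where
    field
      top : ℤ
      c   : ℕ → F
  open Laurent public

  coeffL : Laurent → ℤ → F
  coeffL x n with top x ℤ.- n
  ... | + k      = c x k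
  ... | -[1+ _ ] = 0#

  _≈L_ : Laurent → Laurent → Set
  x ≈L y = ∀ n → coeffL x n ≡ coeffL y n

  0L : Laurent
  0L = record { top = + 0 ; c = λ _ → 0# }

  _+L_ : Laurent → Laurent → Laurent
  x +L y = record { top = T
                  ; c = λ i → coeffL x (T ℤ.- + i) + coeffL y (T ℤ.- + i) }
    where T = top x ℤ.⊔ top y

  sumUpTo : ℕ → (ℕ → F) → F
  sumUpTo zero    f = f 0
  sumUpTo (suc n) f = sumUpTo n f + f (suc n)

  _*L_ : Laurent → Laurent → Laurent
  x *L y = record { top = top x ℤ.+ top y
                  ; c = λ n → sumUpTo n (λ i → c x i * c y (n ∸ i)) }

  polyL : Poly → Laurent
  polyL p = record { top = + length p ; c = λ i → coeffℤ p (+ length p ℤ.- + i) }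

  headOr0 : List F → F
  headOr0 []      = 0#
  headOr0 (x ∷ _) = x

  -- inverse in K_∞ of a nonzero polynomial d
  -- (d = t^m (a_0 + a_1 t^-1 + …), a_0 ≠ 0, d⁻¹ = t^-m Σ b_n t^-n with
  --  b_0 = a_0⁻¹, b_n = - a_0⁻¹ Σ_{j=1}^{n} a_j b_{n-j})
  invPolyL : Poly → Laurent
  invPolyL d with degP d
  ... | nothing = 0L
  ... | just m  = record { top = ℤ.- (+ m) ; c = b }
    where
      lc : F
      lc = coeff d m
      a : ℕ → F
      a j = coeffℤ d (+ m ℤ.- + j)
      dot : ℕ → List F → F
      dot k []       = 0#
      dot k (x ∷ xs) = a (suc k) * x + dot (suc k) xs
      bsRev : ℕ → List F
      bsRev zero    = (lc ⁻¹) ∷ []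
      bsRev (suc n) = (- (lc ⁻¹ * dot 0 (bsRev n))) ∷ bsRev n
      b : ℕ → F
      b n = headOr0 (bsRev n)

  fracL : Frac → Laurent
  fracL x = polyL (num x) *L invPolyL (den x)

  -- Ternary quadratic lattices.  L = A^3 with standard basis e_i and
  -- Q(x) = Σ_{i,j} m_ij x_i x_j, where m_ij = ½ B(e_i,e_j) ∈ K is the
  -- (symmetric) Gram matrix.

  Vec3 : Set → Set
  Vec3 X = Fin 3 → X

  Mat3 : Set → Set
  Mat3 X = Fin 3 → Fin 3 → X

  Σ3 : {X : Set} → (X → X → X) → (Fin 3 → X) → X
  Σ3 _⊕_ f = f zero ⊕ (f (suc zero) ⊕ f (suc (suc zero)))

  record TernaryLattice : Set where
    field
      gram      : Mat3 Frac
      valid     : ∀ i j → ValidFrac (gram i j)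
      symmetric : ∀ i j → gram i j ≈K gram j i
  open TernaryLattice public

  -- ½ B(u, v)
  bil : TernaryLattice → Vec3 Poly → Vec3 Poly → Frac
  bil L u v = Σ3 _+K_ λ i → Σ3 _+K_ λ j → gram L i j *K fromPoly (u i *P v j)

  Q : TernaryLattice → Vec3 Poly → Frac
  Q L x = bil L x x

  Q∞ : TernaryLattice → Vec3 Laurent → Laurent
  Q∞ L x = Σ3 _+L_ λ i → Σ3 _+L_ λ j → fracL (gram L i j) *L (x i *L x j)

  Definite : TernaryLattice → Set
  Definite L = ∀ (x : Vec3 Laurent) → ¬ (∀ i → x i ≈L 0L) → ¬ (Q∞ L x ≈L 0L)

  _≈V_ : Vec3 Poly → Vec3 Poly → Set
  u ≈V v = ∀ i → u i ≈P v i

  _·v_ : Mat3 Poly → Vec3 Poly → Vec3 Poly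
  (P ·v x) i = Σ3 _+P_ λ j → P i j *P x j

  _·M_ : Mat3 Poly → Mat3 Poly → Mat3 Poly
  (P ·M R) i j = Σ3 _+P_ λ k → P i k *P R k j

  I3 : Mat3 Poly
  I3 i j = if ⌊ i Fin.≟ j ⌋ then 1P else 0P

  _≈M_ : Mat3 Poly → Mat3 Poly → Set
  P ≈M R = ∀ i j → P i j ≈P R i j

  Invertible : Mat3 Poly → Set
  Invertible P = Σ (Mat3 Poly) λ P⁻ → (P ·M P⁻) ≈M I3 × (P⁻ ·M P) ≈M I3

  Isometric : TernaryLattice → TernaryLattice → Set
  Isometric L L' = Σ (Mat3 Poly) λ P → Invertible P × (∀ x → Q L' (P ·v x) ≈K Q L x)

  HasCount : (Vec3 Poly → Set) → ℕ → Set
  HasCount P n = Σ (Fin n → Vec3 Poly) λ vs →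
      (∀ k → P (vs k))
    × (∀ k l → vs k ≈V vs l → k ≡ l)
    × (∀ v → P v → ∃[ k ] (v ≈V vs k))

  RepCount : TernaryLattice → Frac → ℕ → Set
  RepCount L a n = HasCount (λ v → Q L v ≈K a) n

  Isospectral : TernaryLattice → TernaryLattice → Set
  Isospectral L L' = ∀ (a : Frac) → ValidFrac a → ∀ n →
    (RepCount L a n → RepCount L' a n) × (RepCount L' a n → RepCount L a n)

  col : Mat3 Poly → Fin 3 → Vec3 Poly
  col P k i = P i k

  gramOf : TernaryLattice → Mat3 Poly → Mat3 Frac
  gramOf L P k l = bil L (col P k) (col P l)

  Reduced : TernaryLattice → Mat3 Poly → Set
  Reduced L P = Invertible P
    × (∀ i j → i Fin.≤ j → degK (gramOf L P i i) ≤D degK (gramOf L P j j))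
    × (∀ i j → i Fin.< j → degK (gramOf L P i j) <D degK (gramOf L P i i))

  SuccessiveMinima : TernaryLattice → ℤ → ℤ → ℤ → Set
  SuccessiveMinima L μ₁ μ₂ μ₃ = Σ (Mat3 Poly) λ P → Reduced L P
    × degK (gramOf L P zero zero) ≡ just μ₁
    × degK (gramOf L P (suc zero) (suc zero)) ≡ just μ₂
    × degK (gramOf L P (suc (suc zero)) (suc (suc zero))) ≡ just μ₃

  MinimaCondition : TernaryLattice → Set
  MinimaCondition L = ∃[ μ₁ ] ∃[ μ₂ ] ∃[ μ₃ ] (SuccessiveMinima L μ₁ μ₂ μ₃
    × μ₁ ℤ.< μ₂ × μ₂ ℤ.< μ₃ × ℤ.∣ μ₂ ℤ.- μ₁ ∣ % 2 ≡ 0)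

-- After clearing denominators both lattices become polynomial forms in reduced bases, and
-- isospectrality becomes a value-preserving bijection of their vectors.  The degree of a value bounds
-- the coordinates of the vector, so the images of suitable vectors determine the Gram matrices entry by
-- entry, up to scaling the basis vectors by constants.  The entries a₁₂, a₂₂ and a₂₃ come from whole
-- families x = atᵏ + wtᵏ⁻¹ + b with b ∈ F: completing the square, a vector matched with x satisfies
-- X² - Y² = G(c), and the leading coefficients lie on a conic η² - νc² = w₀².  If the entries differed,
-- only few b could share a point of the conic; but the points with c ≠ 0 are determined by their slopes
-- from (w₀ , 0), which are among the q - 1 nonzero elements of F.
-- For a₃₃, a vector x ≠ 0 with q(x , 1) = a₃₃' would give an injective self-map v ↦ to (v + v₃ x) of a
-- finite set that is not onto.  Over the field with three elements the conic has too few points; there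
-- -1 is not a square, and leading coefficients decide.

module Submission where

open import Defs
open import Level using (0ℓ)
open import Algebra.Bundles using (CommutativeRing; RawRing)
import Algebra.Solver.Ring
open import Algebra.Solver.Ring.AlmostCommutativeRing using (fromCommutativeRing; _-Raw-AlmostCommutative⟶_)
open import Data.Integer as ℤ using (ℤ; -[1+_]; _⊖_) renaming (+_ to pos)
import Data.Integer.Properties as ℤP
open import Data.Maybe using (Maybe; just; nothing)
open import Data.Nat as ℕ using (ℕ; zero; suc; z≤n; s≤s; _∸_)
import Data.Nat.Properties as ℕP
open import Relation.Nullary using (¬_; ¬?; Dec; yes; no)
open import Relation.Binary.PropositionalEquality as ≡ using (_≡_; _≢_)

-- The matching respects values only; nothing linear is known about it, so coefficients must be read
-- off from single values. The condition on μ₁ and μ₂ acts through definiteness: it makes ν = -α₂/α₁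
-- a non-square of F. Hence leading terms in the plane of the first two basis vectors never cancel,
-- u² - νv² takes every value, and the third minimum must have the other parity. If (x , 1) and (y ,
-- c) have equal values, then X² - Y² = G(c) with X = a₁₁x + τ and Y = a₁₁y + τ'(c), where G depends
-- on c alone. Two members of a family at one point (η , c) satisfy (x₁ - x₂)(X₁ + X₂) = (y₁ -
-- y₂)(Y₁ + Y₂). For η ≠ 0 degrees force y₁ - y₂ = ρ(x₁ - x₂) with ρ = a/η, and a third member
-- forces ρ² = 1, the case of equal coefficients. The symmetry (y , c) ↦ (-y , -c) doubles the
-- points: 2q of them with q - 1 slopes put three at one point. For a₂₃ this symmetry is lost in
-- general, and the second coordinate of the family is chosen so that two members suffice. The term
-- wtᵏ⁻¹ serves to avoid η = 0.

module RingSolver {c ℓ} (R : CommutativeRing c ℓ) where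
  open CommutativeRing R
  open import Algebra.Properties.Ring ring using (-0#≈0#; -‿involutive; -‿distribˡ-*; -‿distribʳ-*)
  open import Algebra.Properties.AbelianGroup +-abelianGroup using (⁻¹-∙-comm)
  open import Algebra.Properties.Semiring.Mult.TCOptimised semiring using (_×_; ×-homo-+; ×1-homo-*)
  open import Relation.Binary.Reasoning.Setoid setoid

  -- Integer coefficients let the solver compare constants by computation, which elements of an
  -- abstract ring do not allow.
  ⟦_⟧ℤ : ℤ → Carrier
  ⟦ pos n ⟧ℤ      = n × 1#
  ⟦ -[1+ n ] ⟧ℤ = - (suc n × 1#)

  private
    cancel : ∀ x y → x ≈ (y + x) - y
    cancel x y = begin
      x            ≈⟨ +-identityʳ x ⟨
      x + 0#       ≈⟨ +-congˡ (-‿inverseʳ y) ⟨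
      x + (y - y)  ≈⟨ +-assoc x y (- y) ⟨
      (x + y) - y  ≈⟨ +-congʳ (+-comm x y) ⟩
      (y + x) - y  ∎

    neg-homo : ∀ i → ⟦ ℤ.- i ⟧ℤ ≈ - ⟦ i ⟧ℤ
    neg-homo (pos zero)  = sym -0#≈0#
    neg-homo (pos (suc n)) = refl
    neg-homo -[1+ n ]  = sym (-‿involutive _)

    ⊖-homo : ∀ m n → ⟦ m ⊖ n ⟧ℤ ≈ (m × 1#) - (n × 1#)
    ⊖-homo zero    zero    = sym (-‿inverseʳ _)
    ⊖-homo zero    (suc n) = sym (+-identityˡ _)
    ⊖-homo (suc m) zero    = sym (trans (+-congˡ -0#≈0#) (+-identityʳ _))
    ⊖-homo (suc m) (suc n) = begin
      ⟦ suc m ⊖ suc n ⟧ℤ                       ≡⟨ ≡.cong ⟦_⟧ℤ (ℤP.[1+m]⊖[1+n]≡m⊖n m n) ⟩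
      ⟦ m ⊖ n ⟧ℤ                               ≈⟨ ⊖-homo m n ⟩
      (m × 1#) - (n × 1#)                      ≈⟨ cancel _ 1# ⟩
      (1# + ((m × 1#) - (n × 1#))) - 1#        ≈⟨ +-congʳ (+-assoc _ _ _) ⟨
      ((1# + (m × 1#)) - (n × 1#)) - 1#        ≈⟨ +-assoc _ _ _ ⟩
      (1# + (m × 1#)) + (- (n × 1#) - 1#)      ≈⟨ +-cong (×-homo-+ 1# 1 m) (trans (sym (⁻¹-∙-comm _ _)) (+-comm _ _)) ⟨
      (suc m × 1#) - (1# + (n × 1#))           ≈⟨ +-congˡ (-‿cong (×-homo-+ 1# 1 n)) ⟨
      (suc m × 1#) - (suc n × 1#)              ∎

    +-homo : ∀ i j → ⟦ i ℤ.+ j ⟧ℤ ≈ ⟦ i ⟧ℤ + ⟦ j ⟧ℤ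
    +-homo (pos m)    (pos n)    = ×-homo-+ 1# m n
    +-homo (pos m)    -[1+ n ] = ⊖-homo m (suc n)
    +-homo -[1+ m ] (pos n)    = trans (⊖-homo n (suc m)) (+-comm _ _)
    +-homo -[1+ m ] -[1+ n ] = begin
      - (suc (suc (m ℕ.+ n)) × 1#)        ≡⟨ ≡.cong (λ k → - (k × 1#)) (≡.sym (ℕP.+-suc (suc m) n)) ⟩
      - ((suc m ℕ.+ suc n) × 1#)          ≈⟨ -‿cong (×-homo-+ 1# (suc m) (suc n)) ⟩
      - ((suc m × 1#) + (suc n × 1#))     ≈⟨ sym (⁻¹-∙-comm _ _) ⟩
      - (suc m × 1#) - (suc n × 1#)       ∎

    *-homo⁺ : ∀ m j → ⟦ pos m ℤ.* j ⟧ℤ ≈ (m × 1#) * ⟦ j ⟧ℤ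
    *-homo⁺ m (pos n) = trans (reflexive (≡.cong ⟦_⟧ℤ (≡.sym (ℤP.pos-* m n)))) (×1-homo-* m n)
    *-homo⁺ m -[1+ n ] = begin
      ⟦ pos m ℤ.* -[1+ n ] ⟧ℤ            ≡⟨ ≡.cong ⟦_⟧ℤ (≡.sym (ℤP.neg-distribʳ-* (pos m) (pos (suc n)))) ⟩
      ⟦ ℤ.- (pos m ℤ.* pos (suc n)) ⟧ℤ       ≈⟨ neg-homo (pos m ℤ.* pos (suc n)) ⟩
      - ⟦ pos m ℤ.* pos (suc n) ⟧ℤ           ≈⟨ -‿cong (*-homo⁺ m (pos (suc n))) ⟩
      - ((m × 1#) * (suc n × 1#))      ≈⟨ -‿distribʳ-* _ _ ⟩
      (m × 1#) * - (suc n × 1#)        ∎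

    *-homo : ∀ i j → ⟦ i ℤ.* j ⟧ℤ ≈ ⟦ i ⟧ℤ * ⟦ j ⟧ℤ
    *-homo (pos m) j = *-homo⁺ m j
    *-homo -[1+ m ] j = begin
      ⟦ -[1+ m ] ℤ.* j ⟧ℤ            ≡⟨ ≡.cong ⟦_⟧ℤ (≡.sym (ℤP.neg-distribˡ-* (pos (suc m)) j)) ⟩
      ⟦ ℤ.- (pos (suc m) ℤ.* j) ⟧ℤ       ≈⟨ neg-homo (pos (suc m) ℤ.* j) ⟩
      - ⟦ pos (suc m) ℤ.* j ⟧ℤ           ≈⟨ -‿cong (*-homo⁺ (suc m) j) ⟩
      - ((suc m × 1#) * ⟦ j ⟧ℤ)      ≈⟨ -‿distribˡ-* _ _ ⟩
      - (suc m × 1#) * ⟦ j ⟧ℤ        ∎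

    rawℤ : RawRing _ _
    rawℤ = CommutativeRing.rawRing ℤP.+-*-commutativeRing

    hom : rawℤ -Raw-AlmostCommutative⟶ fromCommutativeRing R
    hom = record
      { ⟦_⟧ = ⟦_⟧ℤ ; +-homo = +-homo ; *-homo = *-homo ; -‿homo = neg-homo
      ; 0-homo = refl ; 1-homo = refl }

    dec : ∀ i j → Maybe (⟦ i ⟧ℤ ≈ ⟦ j ⟧ℤ)
    dec i j with i ℤ.≟ j
    ... | yes e = just (reflexive (≡.cong ⟦_⟧ℤ e))
    ... | no _  = nothing

  open Algebra.Solver.Ring rawℤ (fromCommutativeRing R) hom dec public
    using (solve; _:=_; _:+_; _:*_; _:-_; :-_; con; Polynomial)

open import Algebra.Structures using (IsCommutativeRing)
import Algebra.Properties.CommutativeMonoid.Sum ℕP.+-0-commutativeMonoid as ℕSum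
open import Data.Empty using (⊥; ⊥-elim)
open import Data.Fin as Fin using (Fin; zero; suc; toℕ; fromℕ<; punchOut; combine; remQuot; finToFun; funToFin)
open import Data.Fin.Permutation using (Permutation; permutation)
import Data.Fin.Properties as FinP
open import Data.List using ([]; _∷_; map; length; tabulate)
import Data.Nat.DivMod as ℕD
import Data.Nat.Solver as NS
open NS.+-*-Solver using () renaming (solve to nsolve; _:+_ to _:⊕_; _:=_ to _:≡_; con to ncon)
open import Data.Product using (Σ; _×_; _,_; proj₁; proj₂; ∃; ∃₂)
open import Data.Sum using (_⊎_; inj₁; inj₂)
open import Function using (_∘_; Inverse; case_of_)
open import Relation.Binary.Definitions using (tri<; tri≈; tri>)
open import Relation.Binary.PropositionalEquality using (refl; sym; trans; cong; cong₂; subst)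
open import Relation.Nullary.Decidable using (decidable-stable; map′; _×-dec_; _⊎-dec_)
open import Relation.Unary using (Decidable)

module _ (𝔽 : FiniteField) where

  open FiniteField 𝔽
  open Over 𝔽

  -- Arithmetic in the finite field

  fieldRing : CommutativeRing 0ℓ 0ℓ
  fieldRing = record { isCommutativeRing = isCommutativeRing }

  module 𝔽R = CommutativeRing fieldRing
  module 𝔽S = RingSolver fieldRing

  x*y≡0⇒y≡0 : ∀ {x y} → x ≢ 0# → x * y ≡ 0# → y ≡ 0#
  x*y≡0⇒y≡0 {x} {y} x≢0 e = begin
    y                  ≡⟨ 𝔽R.*-identityˡ y ⟨
    1# * y             ≡⟨ cong (_* y) (inverseʳ x x≢0) ⟨
    x * x ⁻¹ * y       ≡⟨ 𝔽S.solve 3 (λ x i y → x 𝔽S.:* i 𝔽S.:* y 𝔽S.:= i 𝔽S.:* (x 𝔽S.:* y)) refl x (x ⁻¹) y ⟩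
    x ⁻¹ * (x * y)     ≡⟨ cong (x ⁻¹ *_) e ⟩
    x ⁻¹ * 0#          ≡⟨ 𝔽R.zeroʳ _ ⟩
    0#                 ∎
    where open ≡.≡-Reasoning

  *-nonzero : ∀ {x y} → x ≢ 0# → y ≢ 0# → x * y ≢ 0#
  *-nonzero x≢0 y≢0 e = y≢0 (x*y≡0⇒y≡0 x≢0 e)

  opaque
    x*y≡0⇒x≡0⊎y≡0 : ∀ x y → x * y ≡ 0# → x ≡ 0# ⊎ y ≡ 0#
    x*y≡0⇒x≡0⊎y≡0 x y e with x ≟ 0#
    ... | yes p = inj₁ p
    ... | no p  = inj₂ (x*y≡0⇒y≡0 p e)

  x-y≡0⇒x≡y : ∀ {x y} → x + - y ≡ 0# → x ≡ y
  x-y≡0⇒x≡y {x} {y} e = begin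
    x              ≡⟨ 𝔽S.solve 2 (λ x y → x 𝔽S.:= (x 𝔽S.:+ 𝔽S.:- y) 𝔽S.:+ y) refl x y ⟩
    (x + - y) + y  ≡⟨ cong (_+ y) e ⟩
    0# + y         ≡⟨ 𝔽R.+-identityˡ y ⟩
    y              ∎
    where open ≡.≡-Reasoning

  x≡y⇒x-y≡0 : ∀ {x y} → x ≡ y → x + - y ≡ 0#
  x≡y⇒x-y≡0 refl = 𝔽R.-‿inverseʳ _

  *-cancelˡ : ∀ {a x y} → a ≢ 0# → a * x ≡ a * y → x ≡ y
  *-cancelˡ {a} {x} {y} a≢0 e = x-y≡0⇒x≡y (x*y≡0⇒y≡0 a≢0
    (trans (𝔽S.solve 3 (λ a x y → a 𝔽S.:* (x 𝔽S.:+ 𝔽S.:- y) 𝔽S.:= a 𝔽S.:* x 𝔽S.:+ 𝔽S.:- (a 𝔽S.:* y)) refl a x y)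
           (x≡y⇒x-y≡0 e)))

  ⁻¹-nonzero : ∀ {x} → x ≢ 0# → x ⁻¹ ≢ 0#
  ⁻¹-nonzero {x} x≢0 e = 0≢1 (trans (sym (𝔽R.zeroʳ x)) (trans (cong (x *_) (sym e)) (inverseʳ x x≢0)))

  x²≡y²⇒x≡±y : ∀ {x y} → x * x ≡ y * y → x ≡ y ⊎ x ≡ - y
  x²≡y²⇒x≡±y {x} {y} e = case x*y≡0⇒x≡0⊎y≡0 (x + - y) (x + y) (trans (difference x y) (x≡y⇒x-y≡0 e)) of λ
    { (inj₁ p) → inj₁ (x-y≡0⇒x≡y p)
    ; (inj₂ p) → inj₂ (x-y≡0⇒x≡y (trans (cong (x +_) (-‿involutive y)) p)) }
    where
    open import Algebra.Properties.Ring 𝔽R.ring using (-‿involutive)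
    open 𝔽S
    difference : ∀ x y → (x + - y) * (x + y) ≡ x * x + - (y * y)
    difference = solve 2 (λ x y → (x :+ :- y) :* (x :+ y) := x :* x :+ :- (y :* y)) refl

  -- Convolution of coefficient sequences

  Seq : Set
  Seq = ℕ → F

  conv : Seq → Seq → Seq
  conv f g zero    = f 0 * g 0
  conv f g (suc n) = f 0 * g (suc n) + conv (f ∘ suc) g n

  -- The n-th term sees only indices up to n. The square root of a power series needs this truncated
  -- form, since its approximations agree only so far.
  conv-cong≤ : ∀ {f f' g g'} n → (∀ i → i ℕ.≤ n → f i ≡ f' i) → (∀ i → i ℕ.≤ n → g i ≡ g' i) →
               conv f g n ≡ conv f' g' n
  conv-cong≤ zero    p q = cong₂ _*_ (p 0 z≤n) (q 0 z≤n)
  conv-cong≤ (suc n) p q = cong₂ _+_ (cong₂ _*_ (p 0 z≤n) (q (suc n) ℕP.≤-refl))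
    (conv-cong≤ n (λ i i≤n → p (suc i) (s≤s i≤n)) (λ i i≤n → q i (ℕP.m≤n⇒m≤1+n i≤n)))

  conv-cong : ∀ {f f' g g'} → (∀ i → f i ≡ f' i) → (∀ i → g i ≡ g' i) → ∀ n → conv f g n ≡ conv f' g' n
  conv-cong p q n = conv-cong≤ n (λ i _ → p i) (λ i _ → q i)

  conv-+ : ∀ f f' g n → conv (λ i → f i + f' i) g n ≡ conv f g n + conv f' g n
  conv-+ f f' g zero    = 𝔽R.distribʳ _ _ _
  conv-+ f f' g (suc n) = trans (cong ((f 0 + f' 0) * g (suc n) +_) (conv-+ (f ∘ suc) (f' ∘ suc) g n))
    (𝔽S.solve 5 (λ a b c d e → (a :+ b) :* c :+ (d :+ e) := (a :* c :+ d) :+ (b :* c :+ e)) refl (f 0) (f' 0) (g (suc n)) _ _)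
    where open 𝔽S

  conv-scale : ∀ a f g n → conv (λ i → a * f i) g n ≡ a * conv f g n
  conv-scale a f g zero    = 𝔽R.*-assoc _ _ _
  conv-scale a f g (suc n) = trans (cong (a * f 0 * g (suc n) +_) (conv-scale a (f ∘ suc) g n))
    (𝔽S.solve 4 (λ a b c d → a :* b :* c :+ a :* d := a :* (b :* c :+ d)) refl a (f 0) (g (suc n)) _)
    where open 𝔽S

  conv-sucʳ : ∀ f g n → conv f g (suc n) ≡ conv f (g ∘ suc) n + f (suc n) * g 0
  conv-sucʳ f g zero    = refl
  conv-sucʳ f g (suc n) = trans (cong (f 0 * g (suc (suc n)) +_) (conv-sucʳ (f ∘ suc) g n))
    (sym (𝔽R.+-assoc _ _ _))

  conv-comm : ∀ f g n → conv f g n ≡ conv g f n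
  conv-comm f g zero    = 𝔽R.*-comm _ _
  conv-comm f g (suc n) = trans (conv-sucʳ f g n) (trans (𝔽R.+-comm _ _)
    (cong₂ _+_ (𝔽R.*-comm _ _) (conv-comm f (g ∘ suc) n)))

  conv-assoc : ∀ f g h n → conv (conv f g) h n ≡ conv f (conv g h) n
  conv-assoc f g h zero    = 𝔽R.*-assoc _ _ _
  conv-assoc f g h (suc n) = begin
    f 0 * g 0 * h (suc n) + conv (λ i → f 0 * g (suc i) + conv (f ∘ suc) g i) h n
      ≡⟨ cong (f 0 * g 0 * h (suc n) +_) (trans (conv-+ (λ i → f 0 * g (suc i)) (conv (f ∘ suc) g) h n)
           (cong₂ _+_ (conv-scale (f 0) (g ∘ suc) h n) (conv-assoc (f ∘ suc) g h n))) ⟩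
    f 0 * g 0 * h (suc n) + (f 0 * conv (g ∘ suc) h n + conv (f ∘ suc) (conv g h) n)
      ≡⟨ 𝔽S.solve 5 (λ a b c d e → a :* b :* c :+ (a :* d :+ e) := a :* (b :* c :+ d) :+ e) refl (f 0) (g 0) (h (suc n)) _ _ ⟩
    f 0 * (g 0 * h (suc n) + conv (g ∘ suc) h n) + conv (f ∘ suc) (conv g h) n ∎
    where open ≡.≡-Reasoning
          open 𝔽S

  conv-0ˡ : ∀ f g n → (∀ i → i ℕ.≤ n → f i ≡ 0#) → conv f g n ≡ 0#
  conv-0ˡ f g zero    p = trans (cong (_* g 0) (p 0 z≤n)) (𝔽R.zeroˡ _)
  conv-0ˡ f g (suc n) p = trans (cong₂ _+_ (trans (cong (_* g (suc n)) (p 0 z≤n)) (𝔽R.zeroˡ _))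
    (conv-0ˡ (f ∘ suc) g n (λ i i≤n → p (suc i) (s≤s i≤n)))) (𝔽R.+-identityˡ _)

  conv-zero : ∀ f g n → (∀ i j → i ℕ.+ j ≡ n → f i * g j ≡ 0#) → conv f g n ≡ 0#
  conv-zero f g zero    p = p 0 0 refl
  conv-zero f g (suc n) p = trans (cong₂ _+_ (p 0 (suc n) refl)
    (conv-zero (f ∘ suc) g n (λ i j e → p (suc i) j (cong suc e)))) (𝔽R.+-identityˡ _)

  conv-single : ∀ f g k l → (∀ i j → i ℕ.+ j ≡ k ℕ.+ l → i ≢ k → f i * g j ≡ 0#) → conv f g (k ℕ.+ l) ≡ f k * g l
  conv-single f g zero zero    p = refl
  conv-single f g zero (suc l) p = trans (cong (f 0 * g (suc l) +_)
    (conv-zero (f ∘ suc) g l (λ i j e → p (suc i) j (cong suc e) (λ ())))) (𝔽R.+-identityʳ _)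
  conv-single f g (suc k) l p = trans (cong₂ _+_ (p 0 (suc (k ℕ.+ l)) refl (λ ()))
    (conv-single (f ∘ suc) g k l (λ i j e i≢k → p (suc i) j (cong suc e) (i≢k ∘ ℕP.suc-injective)))) (𝔽R.+-identityˡ _)

  -- The polynomial ring

  infix 4 _≋_
  -- A record around `_≈P_`: a bare function type would unfold and leave p and r to be guessed by
  -- unification.
  record _≋_ (p r : Poly) : Set where
    constructor mk≋
    field at : ∀ n → coeff p n ≡ coeff r n
  open _≋_ public

  coeff-+P : ∀ p r n → coeff (p +P r) n ≡ coeff p n + coeff r n
  coeff-+P []      r       n       = sym (𝔽R.+-identityˡ _)
  coeff-+P (a ∷ p) []      n       = sym (𝔽R.+-identityʳ _)
  coeff-+P (a ∷ p) (b ∷ r) zero    = refl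
  coeff-+P (a ∷ p) (b ∷ r) (suc n) = coeff-+P p r n

  coeff-scale : ∀ a r n → coeff (map (a *_) r) n ≡ a * coeff r n
  coeff-scale a []      n       = sym (𝔽R.zeroʳ a)
  coeff-scale a (b ∷ r) zero    = refl
  coeff-scale a (b ∷ r) (suc n) = coeff-scale a r n

  -0≡0 : - 0# ≡ 0#
  -0≡0 = trans (sym (𝔽R.+-identityˡ _)) (𝔽R.-‿inverseʳ 0#)

  coeff-neg : ∀ r n → coeff (-P r) n ≡ - coeff r n
  coeff-neg []      n       = sym -0≡0
  coeff-neg (b ∷ r) zero    = refl
  coeff-neg (b ∷ r) (suc n) = coeff-neg r n

  coeff-*P : ∀ p r n → coeff (p *P r) n ≡ conv (coeff p) (coeff r) n
  coeff-*P []      r n       = sym (conv-0ˡ (λ _ → 0#) (coeff r) n (λ _ _ → refl))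
  coeff-*P (a ∷ p) r zero    = trans (coeff-+P (map (a *_) r) _ 0) (trans (𝔽R.+-identityʳ _) (coeff-scale a r 0))
  coeff-*P (a ∷ p) r (suc n) = trans (coeff-+P (map (a *_) r) (0# ∷ (p *P r)) (suc n))
    (cong₂ _+_ (coeff-scale a r (suc n)) (coeff-*P p r n))

  conv-1ˡ : ∀ g n → conv (coeff 1P) g n ≡ g n
  conv-1ˡ g zero    = 𝔽R.*-identityˡ _
  conv-1ˡ g (suc n) = trans (cong₂ _+_ (𝔽R.*-identityˡ _) (conv-0ˡ (coeff []) g n (λ _ _ → refl))) (𝔽R.+-identityʳ _)

  poly-laws : IsCommutativeRing _≋_ _+P_ _*P_ -P_ 0P 1P
  poly-laws = record
      { isRing = record
        { +-isAbelianGroup = record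
          { isGroup = record
            { isMonoid = record
              { isSemigroup = record
                { isMagma = record
                  { isEquivalence = record
                    { refl = mk≋ λ _ → refl ; sym = λ e → mk≋ λ n → sym (at e n)
                    ; trans = λ e f → mk≋ λ n → trans (at e n) (at f n) }
                  ; ∙-cong = λ {p} {p'} {r} {r'} e f → mk≋ λ n →
                      trans (coeff-+P p r n) (trans (cong₂ _+_ (at e n) (at f n)) (sym (coeff-+P p' r' n))) }
                ; assoc = λ p r s → mk≋ λ n → trans (coeff-+P (p +P r) s n) (trans (cong (_+ coeff s n) (coeff-+P p r n))
                    (trans (𝔽R.+-assoc _ _ _) (sym (trans (coeff-+P p (r +P s) n) (cong (coeff p n +_) (coeff-+P r s n)))))) }
              ; identity = (λ p → mk≋ λ _ → refl) , (λ p → mk≋ λ n → trans (coeff-+P p [] n) (𝔽R.+-identityʳ _)) }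
            ; inverse = (λ p → mk≋ λ n → trans (coeff-+P (-P p) p n) (trans (cong (_+ coeff p n) (coeff-neg p n)) (𝔽R.-‿inverseˡ _)))
                      , (λ p → mk≋ λ n → trans (coeff-+P p (-P p) n) (trans (cong (coeff p n +_) (coeff-neg p n)) (𝔽R.-‿inverseʳ _)))
            ; ⁻¹-cong = λ {p} {r} e → mk≋ λ n → trans (coeff-neg p n) (trans (cong -_ (at e n)) (sym (coeff-neg r n))) }
          ; comm = λ p r → mk≋ λ n → trans (coeff-+P p r n) (trans (𝔽R.+-comm _ _) (sym (coeff-+P r p n))) }
        ; *-cong = *-cong'
        ; *-assoc = λ p r s → mk≋ λ n → trans (coeff-*P (p *P r) s n)
            (trans (conv-cong (coeff-*P p r) (λ _ → refl) n) (trans (conv-assoc (coeff p) (coeff r) (coeff s) n)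
            (sym (trans (coeff-*P p (r *P s) n) (conv-cong (λ _ → refl) (coeff-*P r s) n)))))
        ; *-identity = (λ p → mk≋ λ n → trans (coeff-*P 1P p n) (conv-1ˡ (coeff p) n))
                     , (λ p → mk≋ λ n → trans (coeff-*P p 1P n) (trans (conv-comm (coeff p) (coeff 1P) n) (conv-1ˡ (coeff p) n)))
        ; distrib = (λ p r s → mk≋ λ n → trans (at (*-comm' p (r +P s)) n) (trans (dist p r s n)
                       (sym (trans (coeff-+P (p *P r) (p *P s) n) (cong₂ _+_ (at (*-comm' p r) n) (at (*-comm' p s) n))))))
                  , (λ p r s → mk≋ λ n → trans (dist p r s n) (sym (coeff-+P (r *P p) (s *P p) n))) }
      ; *-comm = *-comm' }
    where
      *-cong' : ∀ {p p' r r'} → p ≋ p' → r ≋ r' → p *P r ≋ p' *P r'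
      *-cong' {p} {p'} {r} {r'} e f = mk≋ λ n → trans (coeff-*P p r n) (trans (conv-cong (at e) (at f) n) (sym (coeff-*P p' r' n)))
      *-comm' : ∀ p r → p *P r ≋ r *P p
      *-comm' p r = mk≋ λ n → trans (coeff-*P p r n) (trans (conv-comm (coeff p) (coeff r) n) (sym (coeff-*P r p n)))
      dist : ∀ p r s n → coeff ((r +P s) *P p) n ≡ coeff (r *P p) n + coeff (s *P p) n
      dist p r s n = trans (coeff-*P (r +P s) p n) (trans (conv-cong (coeff-+P r s) (λ _ → refl) n)
        (trans (conv-+ (coeff r) (coeff s) (coeff p) n) (cong₂ _+_ (sym (coeff-*P r p n)) (sym (coeff-*P s p n)))))

  -- The ring operations are sealed, so that unification does not unfold them.
  infixl 6 _⊞_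
  infixl 7 _⊠_
  infix 8 ⊟_

  opaque
    _⊞_ _⊠_ : Poly → Poly → Poly
    _⊞_ = _+P_
    _⊠_ = _*P_

    ⊟_ : Poly → Poly
    ⊟_ = -P_

  opaque
    unfolding _⊞_

    ⊞-def : ∀ p r → p ⊞ r ≡ p +P r
    ⊞-def p r = refl

    ⊠-def : ∀ p r → p ⊠ r ≡ p *P r
    ⊠-def p r = refl

    poly-isCommutativeRing : IsCommutativeRing _≋_ _⊞_ _⊠_ ⊟_ 0P 1P
    poly-isCommutativeRing = poly-laws

    coeff-⊞ : ∀ p r n → coeff (p ⊞ r) n ≡ coeff p n + coeff r n
    coeff-⊞ = coeff-+P

    coeff-⊠ : ∀ p r n → coeff (p ⊠ r) n ≡ conv (coeff p) (coeff r) n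
    coeff-⊠ = coeff-*P

    coeff-⊟ : ∀ p n → coeff (⊟ p) n ≡ - coeff p n
    coeff-⊟ = coeff-neg

  polyRing : CommutativeRing 0ℓ 0ℓ
  polyRing = record { isCommutativeRing = poly-isCommutativeRing }

  module PR = CommutativeRing polyRing
  module PS = RingSolver polyRing

  coeff-- : ∀ p r n → coeff (p ⊞ (⊟ r)) n ≡ coeff p n + - coeff r n
  coeff-- p r n = trans (coeff-⊞ p (⊟ r) n) (cong (coeff p n +_) (coeff-⊟ r n))

  p-r≋0⇒p≋r : ∀ {p r} → p ⊞ (⊟ r) ≋ 0P → p ≋ r
  p-r≋0⇒p≋r {p} {r} e = mk≋ λ n → x-y≡0⇒x≡y (trans (sym (coeff-- p r n)) (at e n))

  p≋r⇒p-r≋0 : ∀ {p r} → p ≋ r → p ⊞ (⊟ r) ≋ 0P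
  p≋r⇒p-r≋0 {p} {r} e = mk≋ λ n → trans (coeff-- p r n) (x≡y⇒x-y≡0 (at e n))

  -- Constants, monomials and degree bounds

  constP : F → Poly
  constP a = a ∷ []

  monoP : F → ℕ → Poly
  monoP a zero    = a ∷ []
  monoP a (suc n) = 0# ∷ monoP a n

  -- The bound deg p < n. Being strict, it covers the zero polynomial without a separate degree -∞.
  record Bd (n : ℕ) (p : Poly) : Set where
    constructor bd
    field bz : ∀ e → n ℕ.≤ e → coeff p e ≡ 0#
  open Bd public

  Bd-resp : ∀ {n p r} → p ≋ r → Bd n p → Bd n r
  Bd-resp e b = bd λ k n≤k → trans (sym (at e k)) (bz b k n≤k)

  Bd-mono : ∀ {m n p} → m ℕ.≤ n → Bd m p → Bd n p
  Bd-mono m≤n b = bd λ e n≤e → bz b e (ℕP.≤-trans m≤n n≤e)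

  Bd-+ : ∀ {n} p r → Bd n p → Bd n r → Bd n (p ⊞ r)
  Bd-+ p r bp br = bd λ e n≤e → trans (coeff-⊞ p r e) (trans (cong₂ _+_ (bz bp e n≤e) (bz br e n≤e)) (𝔽R.+-identityˡ _))

  Bd-neg : ∀ {n} p → Bd n p → Bd n (⊟ p)
  Bd-neg p b = bd λ e n≤e → trans (coeff-⊟ p e) (trans (cong -_ (bz b e n≤e)) -0≡0)

  Bd-- : ∀ {n} p r → Bd n p → Bd n r → Bd n (p ⊞ (⊟ r))
  Bd-- p r bp br = Bd-+ p (⊟ r) bp (Bd-neg r br)

  Bd-0 : ∀ {n} → Bd n 0P
  Bd-0 = bd λ _ _ → refl

  Bd-length : ∀ p → Bd (length p) p
  Bd-length []      = bd λ _ _ → refl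
  Bd-length (a ∷ p) = bd λ { (suc e) (s≤s l) → bz (Bd-length p) e l }

  Bd-const : ∀ a → Bd 1 (constP a)
  Bd-const a = bd λ { (suc e) _ → refl }

  Bd0⇒≋0 : ∀ {p} → Bd 0 p → p ≋ 0P
  Bd0⇒≋0 b = mk≋ λ n → bz b n z≤n

  Bd1⇒const : ∀ {p} → Bd 1 p → p ≋ constP (coeff p 0)
  Bd1⇒const b = mk≋ λ { zero → refl ; (suc n) → bz b (suc n) (s≤s z≤n) }

  Bd-suc : ∀ {n p} → Bd (suc n) p → coeff p n ≡ 0# → Bd n p
  Bd-suc {n} {p} b z = bd go
    where
    go : ∀ e → n ℕ.≤ e → coeff p e ≡ 0#
    go e n≤e with ℕP.m≤n⇒m<n∨m≡n n≤e
    ... | inj₁ n<e = bz b e n<e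
    ... | inj₂ refl = z

  -- Degrees below a and b add up to at most a + b - 2, hence the `suc`.
  Bd-* : ∀ {a b n} p r → Bd a p → Bd b r → a ℕ.+ b ℕ.≤ suc n → Bd n (p ⊠ r)
  Bd-* {a} {b} {n} p r bp br le = bd λ e n≤e → trans (coeff-⊠ p r e) (conv-zero _ _ e (go e n≤e))
    where
    go : ∀ e → n ℕ.≤ e → ∀ i j → i ℕ.+ j ≡ e → coeff p i * coeff r j ≡ 0#
    go e n≤e i j eq with a ℕ.≤? i | b ℕ.≤? j
    ... | yes q | _     = trans (cong (_* coeff r j) (bz bp i q)) (𝔽R.zeroˡ _)
    ... | no _  | yes q = trans (cong (coeff p i *_) (bz br j q)) (𝔽R.zeroʳ _)
    ... | no q  | no q' = ⊥-elim (ℕP.<-irrefl refl (ℕP.≤-<-trans n≤e (subst (ℕ._< n) eq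
          (ℕP.≤-pred (ℕP.≤-trans (ℕP.≤-reflexive (sym (cong suc (ℕP.+-suc i j)))) (ℕP.≤-trans (ℕP.+-mono-≤ (ℕP.≰⇒> q) (ℕP.≰⇒> q')) le))))))

  coeff-*-top : ∀ {a b} p r → Bd (suc a) p → Bd (suc b) r → coeff (p ⊠ r) (a ℕ.+ b) ≡ coeff p a * coeff r b
  coeff-*-top {a} {b} p r bp br = trans (coeff-⊠ p r (a ℕ.+ b)) (conv-single _ _ a b go)
    where
    go : ∀ i j → i ℕ.+ j ≡ a ℕ.+ b → i ≢ a → coeff p i * coeff r j ≡ 0#
    go i j eq i≢a with suc a ℕ.≤? i | suc b ℕ.≤? j
    ... | yes q | _     = trans (cong (_* coeff r j) (bz bp i q)) (𝔽R.zeroˡ _)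
    ... | no _  | yes q = trans (cong (coeff p i *_) (bz br j q)) (𝔽R.zeroʳ _)
    ... | no q  | no q' = ⊥-elim (ℕP.<-irrefl eq (ℕP.+-mono-<-≤ (ℕP.≤∧≢⇒< (ℕP.≤-pred (ℕP.≰⇒> q)) i≢a) (ℕP.≤-pred (ℕP.≰⇒> q'))))

  coeff-const* : ∀ a p n → coeff (constP a ⊠ p) n ≡ a * coeff p n
  coeff-const* a p n = trans (cong (λ z → coeff z n) (⊠-def (constP a) p)) (trans (coeff-+P (map (a *_) p) (0# ∷ []) n)
    (trans (cong (coeff (map (a *_) p) n +_) (z n)) (trans (𝔽R.+-identityʳ _) (coeff-scale a p n))))
    where z : ∀ n → coeff (0# ∷ []) n ≡ 0#
          z zero = refl
          z (suc n) = refl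

  Deg= : ℕ → Poly → Set
  Deg= n p = Bd (suc n) p × coeff p n ≢ 0#

  opaque
    -- A list may end in zeros, so the search runs down from its length to the last nonzero
    -- coefficient.
    degree : ∀ p → p ≋ 0P ⊎ ∃ λ n → Deg= n p
    degree p = go (length p) (Bd-length p)
      where
      go : ∀ n → Bd n p → p ≋ 0P ⊎ ∃ λ n → Deg= n p
      go zero    b = inj₁ (Bd0⇒≋0 b)
      go (suc n) b with coeff p n ≟ 0#
      ... | yes z = go n (Bd-suc b z)
      ... | no ne = inj₂ (n , b , ne)

  opaque
    _≋?_ : ∀ p r → Dec (p ≋ r)
    p ≋? r with degree (p ⊞ (⊟ r))
    ... | inj₁ z = yes (p-r≋0⇒p≋r z)
    ... | inj₂ (n , _ , ne) = no λ e → ne (trans (coeff-- p r n) (x≡y⇒x-y≡0 (at e n)))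

  Deg=⇒≉0 : ∀ {n p} → Deg= n p → ¬ (p ≋ 0P)
  Deg=⇒≉0 (_ , ne) z = ne (at z _)

  Deg=-* : ∀ {a b} p r → Deg= a p → Deg= b r → Deg= (a ℕ.+ b) (p ⊠ r)
  Deg=-* {a} {b} p r (bp , np) (br , nr) =
    Bd-* p r bp br (ℕP.≤-reflexive (cong suc (ℕP.+-suc a b))) ,
    λ e → *-nonzero np nr (trans (sym (coeff-*-top p r bp br)) e)

  Deg=-unique : ∀ {a b p} → Deg= a p → Deg= b p → a ≡ b
  Deg=-unique {a} {b} (ba , na) (bb , nb) with ℕP.<-cmp a b
  ... | tri< l _ _ = ⊥-elim (nb (bz ba _ l))
  ... | tri≈ _ e _ = e
  ... | tri> _ _ l = ⊥-elim (na (bz bb _ l))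

  Deg=-resp : ∀ {n p r} → p ≋ r → Deg= n p → Deg= n r
  Deg=-resp e (b , ne) = Bd-resp e b , λ z → ne (trans (at e _) z)

  ⊠-nonzero : ∀ {p r} → ¬ (p ≋ 0P) → ¬ (r ≋ 0P) → ¬ (p ⊠ r ≋ 0P)
  ⊠-nonzero {p} {r} np nr z with degree p | degree r
  ... | inj₁ e | _ = np e
  ... | inj₂ _ | inj₁ e = nr e
  ... | inj₂ (_ , d) | inj₂ (_ , d') = Deg=⇒≉0 (Deg=-* p r d d') z

  ⊠-cancelˡ : ∀ {a p r} → ¬ (a ≋ 0P) → a ⊠ p ≋ a ⊠ r → p ≋ r
  ⊠-cancelˡ {a} {p} {r} na e with (p ⊞ (⊟ r)) ≋? 0P
  ... | yes z = p-r≋0⇒p≋r z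
  ... | no nz = ⊥-elim (⊠-nonzero na nz (PR.trans
    (PS.solve 3 (λ a p r → a PS.:* (p PS.:+ PS.:- r) PS.:= a PS.:* p PS.:+ PS.:- (a PS.:* r)) PR.refl a p r) (p≋r⇒p-r≋0 e)))

  module ℤS = RingSolver ℤP.+-*-commutativeRing

  -- The ring of Laurent series

  extend : Seq → ℤ → F
  extend f (pos k)    = f k
  extend f -[1+ _ ] = 0#

  extend-cong : ∀ {f g} → (∀ i → f i ≡ g i) → ∀ n → extend f n ≡ extend g n
  extend-cong e (pos k)    = e k
  extend-cong e -[1+ _ ] = refl

  coeffL≡extend : ∀ x n → coeffL x n ≡ extend (Laurent.c x) (top x ℤ.- n)
  coeffL≡extend x n with top x ℤ.- n
  ... | pos k      = refl
  ... | -[1+ _ ] = refl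

  shift : ℕ → Seq → Seq
  shift zero    f i       = f i
  shift (suc a) f zero    = 0#
  shift (suc a) f (suc i) = shift a f i

  extend-⊖ : ∀ f i a → extend f (i ⊖ a) ≡ shift a f i
  extend-⊖ f i       zero    = cong (extend f) (ℤP.⊖-≥ {i} {0} z≤n)
  extend-⊖ f zero    (suc a) = refl
  extend-⊖ f (suc i) (suc a) = trans (cong (extend f) (ℤP.[1+m]⊖[1+n]≡m⊖n i a)) (extend-⊖ f i a)

  conv-shiftˡ : ∀ a f g n → conv (shift a f) g n ≡ shift a (conv f g) n
  conv-shiftˡ zero    f g n       = refl
  conv-shiftˡ (suc a) f g zero    = 𝔽R.zeroˡ _
  conv-shiftˡ (suc a) f g (suc n) = trans (cong (_+ conv (shift a f) g n) (𝔽R.zeroˡ _))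
    (trans (𝔽R.+-identityˡ _) (conv-shiftˡ a f g n))

  shift-cong : ∀ a {f g : Seq} → (∀ i → f i ≡ g i) → ∀ i → shift a f i ≡ shift a g i
  shift-cong zero    e i       = e i
  shift-cong (suc a) e zero    = refl
  shift-cong (suc a) e (suc i) = shift-cong a e i

  shift-+ : ∀ a b f i → shift a (shift b f) i ≡ shift (a ℕ.+ b) f i
  shift-+ zero    b f i       = refl
  shift-+ (suc a) b f zero    = refl
  shift-+ (suc a) b f (suc i) = shift-+ a b f i

  conv-shift : ∀ a b f g n → conv (shift a f) (shift b g) n ≡ shift (a ℕ.+ b) (conv f g) n
  conv-shift a b f g n = trans (conv-shiftˡ a f (shift b g) n) (trans (shift-cong a
    (λ i → trans (conv-comm f (shift b g) i) (trans (conv-shiftˡ b g f i) (shift-cong b (conv-comm g f) i))) n)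
    (shift-+ a b (conv f g) n))

  sumUpTo-suc : ∀ n f → sumUpTo (suc n) f ≡ f 0 + sumUpTo n (f ∘ suc)
  sumUpTo-suc zero    f = refl
  sumUpTo-suc (suc n) f = trans (cong (_+ f (suc (suc n))) (sumUpTo-suc n f)) (𝔽R.+-assoc _ _ _)

  sumUpTo-conv : ∀ n f g → sumUpTo n (λ i → f i * g (n ∸ i)) ≡ conv f g n
  sumUpTo-conv zero    f g = refl
  sumUpTo-conv (suc n) f g = trans (sumUpTo-suc n (λ i → f i * g (suc n ∸ i))) (cong (λ z → f 0 * g (suc n) + z) (sumUpTo-conv n (f ∘ suc) g))

  coeffL-shift : ∀ x a i → coeffL x (top x ℤ.+ pos a ℤ.- pos i) ≡ shift a (Laurent.c x) i
  coeffL-shift x a i = trans (coeffL≡extend x _) (trans (cong (extend (Laurent.c x))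
    (trans (ℤS.solve 3 (λ t a i → t ℤS.:- (t ℤS.:+ a ℤS.:- i) ℤS.:= i ℤS.:- a) refl (top x) (pos a) (pos i)) (ℤP.m-n≡m⊖n i a)))
    (extend-⊖ (Laurent.c x) i a))

  ≤⇒+ : ∀ {i j} → i ℤ.≤ j → ∃ λ a → j ≡ i ℤ.+ pos a
  ≤⇒+ {i} {j} le with j ℤ.- i in eq
  ... | pos a = a , trans (ℤS.solve 2 (λ i j → j ℤS.:= i ℤS.:+ (j ℤS.:- i)) refl i j) (cong (λ z → i ℤ.+ z) eq)
  ... | -[1+ a ] = ⊥-elim (h (subst (pos 0 ℤ.≤_) eq (ℤP.i≤j⇒0≤j-i le)))
    where h : ¬ (pos 0 ℤ.≤ -[1+ a ])
          h ()

  -- The coefficients of x listed from t^T downwards. Equal series may carry different `top`s, so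
  -- they are compared from a common T.
  seqFrom : ℤ → Laurent → Seq
  seqFrom T x i = coeffL x (T ℤ.- pos i)

  coeffL-> : ∀ x n k → top x ℤ.- n ≡ -[1+ k ] → coeffL x n ≡ 0#
  coeffL-> x n k e = trans (coeffL≡extend x n) (cong (extend (Laurent.c x)) e)

  neg-mono : ∀ {t T n k} → t ℤ.≤ T → T ℤ.- n ≡ -[1+ k ] → ∃ λ k' → t ℤ.- n ≡ -[1+ k' ]
  neg-mono {t} {T} {n} {k} le e with t ℤ.- n in eq
  ... | -[1+ k' ] = k' , refl
  ... | pos j = ⊥-elim (h (≡.subst₂ ℤ._≤_ eq e (ℤP.+-monoˡ-≤ (ℤ.- n) le)))
    where h : ¬ (pos j ℤ.≤ -[1+ k ])
          h ()

  coeffL-+L : ∀ x y n → coeffL (x +L y) n ≡ coeffL x n + coeffL y n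
  coeffL-+L x y n with (top x ℤ.⊔ top y) ℤ.- n in eq
  ... | pos k = cong (λ m → coeffL x m + coeffL y m) (trans (cong (λ z → T ℤ.- z) (sym eq))
            (ℤS.solve 2 (λ t n → t ℤS.:- (t ℤS.:- n) ℤS.:= n) refl T n))
    where T = top x ℤ.⊔ top y
  ... | -[1+ k ] with neg-mono (ℤP.i≤i⊔j (top x) (top y)) eq | neg-mono (ℤP.i≤j⊔i (top x) (top y)) eq
  ...   | k₁ , e₁ | k₂ , e₂ = sym (trans (cong₂ _+_ (coeffL-> x n k₁ e₁) (coeffL-> y n k₂ e₂)) (𝔽R.+-identityˡ _))

  -- Raising a top prepends zeros, and such shifts pass through convolution; hence a product may be
  -- expanded from any larger tops X and Y. Congruence of the product rests on this.
  coeffL-*L : ∀ {X Y} x y n → top x ℤ.≤ X → top y ℤ.≤ Y →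
              coeffL (x *L y) n ≡ extend (conv (seqFrom X x) (seqFrom Y y)) ((X ℤ.+ Y) ℤ.- n)
  coeffL-*L {X} {Y} x y n lx ly with (X ℤ.+ Y) ℤ.- n in eq
  ... | -[1+ k ] with neg-mono (ℤP.+-mono-≤ lx ly) eq
  ...   | k' , e = coeffL-> (x *L y) n k' e
  coeffL-*L {X} {Y} x y n lx ly | pos k with ≤⇒+ lx | ≤⇒+ ly
  ... | a , refl | b , refl = begin
    coeffL (x *L y) n
      ≡⟨ cong (coeffL (x *L y)) (trans (ℤS.solve 5 (λ t a u b n → n ℤS.:= t ℤS.:+ u ℤS.:+ (a ℤS.:+ b) ℤS.:- (t ℤS.:+ a ℤS.:+ (u ℤS.:+ b) ℤS.:- n)) refl (top x) (pos a) (top y) (pos b) n)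
           (cong (λ z → top x ℤ.+ top y ℤ.+ pos (a ℕ.+ b) ℤ.- z) eq)) ⟩
    coeffL (x *L y) (top x ℤ.+ top y ℤ.+ pos (a ℕ.+ b) ℤ.- pos k)
      ≡⟨ coeffL-shift (x *L y) (a ℕ.+ b) k ⟩
    shift (a ℕ.+ b) (λ n → sumUpTo n (λ i → Laurent.c x i * Laurent.c y (n ∸ i))) k
      ≡⟨ shift-cong (a ℕ.+ b) (λ n → sumUpTo-conv n (Laurent.c x) (Laurent.c y)) k ⟩
    shift (a ℕ.+ b) (conv (Laurent.c x) (Laurent.c y)) k
      ≡⟨ conv-shift a b (Laurent.c x) (Laurent.c y) k ⟨
    conv (shift a (Laurent.c x)) (shift b (Laurent.c y)) k
      ≡⟨ conv-cong (coeffL-shift x a) (coeffL-shift y b) k ⟨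
    conv (seqFrom (top x ℤ.+ pos a) x) (seqFrom (top y ℤ.+ pos b) y) k ∎
    where open ≡.≡-Reasoning

  infix 4 _≋L_
  record _≋L_ (x y : Laurent) : Set where
    constructor mkL
    field atL : ∀ n → coeffL x n ≡ coeffL y n
  open _≋L_ public

  -L_ : Laurent → Laurent
  -L x = record { top = top x ; c = λ i → - Laurent.c x i }

  1L : Laurent
  1L = record { top = pos 0 ; c = coeff 1P }

  coeffL-neg : ∀ x n → coeffL (-L x) n ≡ - coeffL x n
  coeffL-neg x n with top x ℤ.- n
  ... | pos k      = refl
  ... | -[1+ _ ] = sym -0≡0

  coeffL-0 : ∀ n → coeffL 0L n ≡ 0#
  coeffL-0 n with pos 0 ℤ.- n
  ... | pos k      = refl
  ... | -[1+ _ ] = refl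

  seqFrom-top : ∀ x i → seqFrom (top x) x i ≡ Laurent.c x i
  seqFrom-top x i = trans (cong (λ t → coeffL x (t ℤ.- pos i)) (sym (ℤP.+-identityʳ (top x)))) (coeffL-shift x 0 i)

  seqFrom-*L : ∀ {X Y} x y → top x ℤ.≤ X → top y ℤ.≤ Y → ∀ k → seqFrom (X ℤ.+ Y) (x *L y) k ≡ conv (seqFrom X x) (seqFrom Y y) k
  seqFrom-*L {X} {Y} x y lx ly k = trans (coeffL-*L x y _ lx ly) (cong (extend (conv (seqFrom X x) (seqFrom Y y)))
    (ℤS.solve 2 (λ t k → t ℤS.:- (t ℤS.:- k) ℤS.:= k) refl (X ℤ.+ Y) (pos k)))

  laurent-laws : IsCommutativeRing _≋L_ _+L_ _*L_ -L_ 0L 1L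
  laurent-laws = record
      { isRing = record
        { +-isAbelianGroup = record
          { isGroup = record
            { isMonoid = record
              { isSemigroup = record
                { isMagma = record
                  { isEquivalence = record
                    { refl = mkL λ _ → refl ; sym = λ e → mkL λ n → sym (atL e n)
                    ; trans = λ e f → mkL λ n → trans (atL e n) (atL f n) }
                  ; ∙-cong = λ {p} {p'} {r} {r'} e f → mkL λ n →
                      trans (coeffL-+L p r n) (trans (cong₂ _+_ (atL e n) (atL f n)) (sym (coeffL-+L p' r' n))) }
                ; assoc = λ p r s → mkL λ n → trans (coeffL-+L (p +L r) s n) (trans (cong (_+ coeffL s n) (coeffL-+L p r n))
                    (trans (𝔽R.+-assoc _ _ _) (sym (trans (coeffL-+L p (r +L s) n) (cong (λ z → coeffL p n + z) (coeffL-+L r s n)))))) }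
              ; identity = (λ p → mkL λ n → trans (coeffL-+L 0L p n) (trans (cong (_+ coeffL p n) (coeffL-0 n)) (𝔽R.+-identityˡ _)))
                         , (λ p → mkL λ n → trans (coeffL-+L p 0L n) (trans (cong (λ z → coeffL p n + z) (coeffL-0 n)) (𝔽R.+-identityʳ _))) }
            ; inverse = (λ p → mkL λ n → trans (coeffL-+L (-L p) p n) (trans (cong (_+ coeffL p n) (coeffL-neg p n)) (trans (𝔽R.-‿inverseˡ _) (sym (coeffL-0 n)))))
                      , (λ p → mkL λ n → trans (coeffL-+L p (-L p) n) (trans (cong (λ z → coeffL p n + z) (coeffL-neg p n)) (trans (𝔽R.-‿inverseʳ _) (sym (coeffL-0 n)))))
            ; ⁻¹-cong = λ {p} {r} e → mkL λ n → trans (coeffL-neg p n) (trans (cong -_ (atL e n)) (sym (coeffL-neg r n))) }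
          ; comm = λ p r → mkL λ n → trans (coeffL-+L p r n) (trans (𝔽R.+-comm _ _) (sym (coeffL-+L r p n))) }
        ; *-cong = *-cong'
        ; *-assoc = *-assoc'
        ; *-identity = idˡ , (λ p → tr (*-comm' p 1L) (idˡ p))
        ; distrib = (λ p r s → mkL λ n → trans (atL (*-comm' p (r +L s)) n) (trans (dist p r s n)
                       (sym (trans (coeffL-+L (p *L r) (p *L s) n) (cong₂ _+_ (atL (*-comm' p r) n) (atL (*-comm' p s) n))))))
                  , (λ p r s → mkL λ n → trans (dist p r s n) (sym (coeffL-+L (r *L p) (s *L p) n))) }
      ; *-comm = *-comm' }
    where
      tr : ∀ {x y z} → x ≋L y → y ≋L z → x ≋L z
      tr e f = mkL λ n → trans (atL e n) (atL f n)
      *-cong' : ∀ {p p' r r'} → p ≋L p' → r ≋L r' → p *L r ≋L p' *L r'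
      *-cong' {p} {p'} {r} {r'} e f = mkL λ n →
        trans (coeffL-*L p r n (ℤP.i≤i⊔j (top p) (top p')) (ℤP.i≤i⊔j (top r) (top r')))
        (trans (extend-cong (conv-cong (λ i → atL e _) (λ i → atL f _)) (top p ℤ.⊔ top p' ℤ.+ (top r ℤ.⊔ top r') ℤ.- n))
        (sym (coeffL-*L p' r' n (ℤP.i≤j⊔i (top p) (top p')) (ℤP.i≤j⊔i (top r) (top r')))))
      *-comm' : ∀ p r → p *L r ≋L r *L p
      *-comm' p r = mkL λ n → trans (coeffL-*L p r n ℤP.≤-refl ℤP.≤-refl)
        (trans (extend-cong (conv-comm (seqFrom (top p) p) (seqFrom (top r) r)) (top p ℤ.+ top r ℤ.- n))
        (trans (cong (λ t → extend (conv (seqFrom (top r) r) (seqFrom (top p) p)) (t ℤ.- n)) (ℤP.+-comm (top p) (top r)))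
        (sym (coeffL-*L r p n ℤP.≤-refl ℤP.≤-refl))))
      *-assoc' : ∀ p r s → (p *L r) *L s ≋L p *L (r *L s)
      *-assoc' p r s = mkL λ n → trans (coeffL-*L (p *L r) s n ℤP.≤-refl ℤP.≤-refl)
        (trans (extend-cong (λ k → trans (conv-cong (seqFrom-*L p r ℤP.≤-refl ℤP.≤-refl) (λ _ → refl) k)
          (trans (conv-assoc (seqFrom (top p) p) (seqFrom (top r) r) (seqFrom (top s) s) k)
            (conv-cong (λ _ → refl) (λ i → sym (seqFrom-*L r s ℤP.≤-refl ℤP.≤-refl i)) k))) (top p ℤ.+ top r ℤ.+ top s ℤ.- n))
        (trans (cong (λ t → extend (conv (seqFrom (top p) p) (seqFrom (top r ℤ.+ top s) (r *L s))) (t ℤ.- n)) (ℤP.+-assoc (top p) (top r) (top s)))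
        (sym (coeffL-*L p (r *L s) n ℤP.≤-refl ℤP.≤-refl))))
      idˡ : ∀ p → 1L *L p ≋L p
      idˡ p = mkL λ n → trans (coeffL-*L 1L p n ℤP.≤-refl ℤP.≤-refl)
        (trans (extend-cong (λ k → trans (conv-cong (seqFrom-top 1L) (seqFrom-top p) k) (conv-1ˡ (Laurent.c p) k)) (pos 0 ℤ.+ top p ℤ.- n))
        (trans (cong (λ t → extend (Laurent.c p) (t ℤ.- n)) (ℤP.+-identityˡ (top p))) (sym (coeffL≡extend p n))))
      dist : ∀ p r s n → coeffL ((r +L s) *L p) n ≡ coeffL (r *L p) n + coeffL (s *L p) n
      dist p r s n = trans (coeffL-*L (r +L s) p n ℤP.≤-refl ℤP.≤-refl)
        (trans (extend-cong (λ k → trans (conv-cong (λ i → coeffL-+L r s (T ℤ.- pos i)) (λ _ → refl) k) (conv-+ (seqFrom T r) (seqFrom T s) (seqFrom (top p) p) k)) (T ℤ.+ top p ℤ.- n))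
        (trans (ext+ (T ℤ.+ top p ℤ.- n))
        (sym (cong₂ _+_ (coeffL-*L r p n (ℤP.i≤i⊔j (top r) (top s)) ℤP.≤-refl) (coeffL-*L s p n (ℤP.i≤j⊔i (top r) (top s)) ℤP.≤-refl)))))
        where
        T = top r ℤ.⊔ top s
        ext+ : ∀ m → extend (λ k → conv (seqFrom T r) (seqFrom (top p) p) k + conv (seqFrom T s) (seqFrom (top p) p) k) m
                   ≡ extend (conv (seqFrom T r) (seqFrom (top p) p)) m + extend (conv (seqFrom T s) (seqFrom (top p) p)) m
        ext+ (pos k)    = refl
        ext+ -[1+ k ] = sym (𝔽R.+-identityˡ 0#)

  infixl 6 _⊕_
  infixl 7 _⊗_
  infix 8 ⊝_

  opaque
    _⊕_ _⊗_ : Laurent → Laurent → Laurent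
    _⊕_ = _+L_
    _⊗_ = _*L_

    ⊝_ : Laurent → Laurent
    ⊝_ = -L_

  opaque
    unfolding _⊕_

    ⊕-def : ∀ x y → x ⊕ y ≡ x +L y
    ⊕-def x y = refl

    ⊗-def : ∀ x y → x ⊗ y ≡ x *L y
    ⊗-def x y = refl

    ⊝-def : ∀ x → ⊝ x ≡ -L x
    ⊝-def x = refl

    laurent-isCommutativeRing : IsCommutativeRing _≋L_ _⊕_ _⊗_ ⊝_ 0L 1L
    laurent-isCommutativeRing = laurent-laws

  laurentRing : CommutativeRing 0ℓ 0ℓ
  laurentRing = record { isCommutativeRing = laurent-isCommutativeRing }

  module LR = CommutativeRing laurentRing
  module LS = RingSolver laurentRing

  coeffL-⊕ : ∀ x y n → coeffL (x ⊕ y) n ≡ coeffL x n + coeffL y n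
  coeffL-⊕ x y n = trans (cong (λ z → coeffL z n) (⊕-def x y)) (coeffL-+L x y n)

  coeffL-⊝ : ∀ x n → coeffL (⊝ x) n ≡ - coeffL x n
  coeffL-⊝ x n = trans (cong (λ z → coeffL z n) (⊝-def x)) (coeffL-neg x n)

  coeffL-⊗ : ∀ {X Y} x y n → top x ℤ.≤ X → top y ℤ.≤ Y →
             coeffL (x ⊗ y) n ≡ extend (conv (seqFrom X x) (seqFrom Y y)) ((X ℤ.+ Y) ℤ.- n)
  coeffL-⊗ x y n lx ly = trans (cong (λ z → coeffL z n) (⊗-def x y)) (coeffL-*L x y n lx ly)

  -- Polynomials as Laurent series

  coeffL-polyL : ∀ p n → coeffL (polyL p) n ≡ coeffℤ p n
  coeffL-polyL p n with pos (length p) ℤ.- n in eq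
  ... | pos k = cong (coeffℤ p) (trans (cong (λ z → pos (length p) ℤ.- z) (sym eq))
            (ℤS.solve 2 (λ t n → t ℤS.:- (t ℤS.:- n) ℤS.:= n) refl (pos (length p)) n))
  coeffL-polyL p -[1+ m ] | -[1+ k ] = refl
  coeffL-polyL p (pos m)  | -[1+ k ] = sym (bz (Bd-length p) m (ℤP.drop‿+≤+ (ℤP.<⇒≤ (h (pos (length p)) (pos m) eq))))
    where
    h : ∀ x y → x ℤ.- y ≡ -[1+ k ] → x ℤ.< y
    h x y e = ≡.subst₂ ℤ._<_ (ℤS.solve 2 (λ x y → (x ℤS.:- y) ℤS.:+ y ℤS.:= x) refl x y) (ℤP.+-identityˡ y)
                (ℤP.+-monoˡ-< y (subst (ℤ._< pos 0) (sym e) ℤ.-<+))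

  polyL-cong : ∀ {p r} → p ≋ r → polyL p ≋L polyL r
  polyL-cong {p} {r} e = mkL λ n → trans (coeffL-polyL p n) (trans (h n) (sym (coeffL-polyL r n)))
    where h : ∀ n → coeffℤ p n ≡ coeffℤ r n
          h (pos k)  = at e k
          h -[1+ k ] = refl

  polyL-injective : ∀ {p r} → polyL p ≋L polyL r → p ≋ r
  polyL-injective {p} {r} e = mk≋ λ n → trans (sym (coeffL-polyL p (pos n))) (trans (atL e (pos n)) (coeffL-polyL r (pos n)))

  polyL-+P : ∀ p r → polyL (p +P r) ≋L polyL p ⊕ polyL r
  polyL-+P p r = mkL λ n → trans (coeffL-polyL (p +P r) n) (trans (h n) (sym (trans (coeffL-⊕ (polyL p) (polyL r) n)
      (cong₂ _+_ (coeffL-polyL p n) (coeffL-polyL r n)))))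
    where h : ∀ n → coeffℤ (p +P r) n ≡ coeffℤ p n + coeffℤ r n
          h (pos k)  = coeff-+P p r k
          h -[1+ k ] = sym (𝔽R.+-identityˡ _)

  constL : F → Laurent
  constL a = record { top = pos 0 ; c = coeff (constP a) }

  tL : Laurent
  tL = record { top = pos 1 ; c = coeff 1P }

  conv-constˡ : ∀ a g n → conv (coeff (constP a)) g n ≡ a * g n
  conv-constˡ a g zero    = refl
  conv-constˡ a g (suc n) = trans (cong (λ z → a * g (suc n) + z) (conv-0ˡ (coeff []) g n (λ _ _ → refl))) (𝔽R.+-identityʳ _)

  coeffL-const* : ∀ a y n → coeffL (constL a ⊗ y) n ≡ a * coeffL y n
  coeffL-const* a y n = trans (coeffL-⊗ (constL a) y n ℤP.≤-refl ℤP.≤-refl)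
    (trans (extend-cong (λ k → trans (conv-cong (seqFrom-top (constL a)) (seqFrom-top y) k) (conv-constˡ a (Laurent.c y) k)) (pos 0 ℤ.+ top y ℤ.- n))
    (trans (cong (λ t → extend (λ i → a * Laurent.c y i) (t ℤ.- n)) (ℤP.+-identityˡ (top y)))
    (trans (ext* (top y ℤ.- n)) (cong (a *_) (sym (coeffL≡extend y n))))))
    where
    ext* : ∀ m → extend (λ i → a * Laurent.c y i) m ≡ a * extend (Laurent.c y) m
    ext* (pos k)  = refl
    ext* -[1+ k ] = sym (𝔽R.zeroʳ a)

  coeffL-t* : ∀ y n → coeffL (tL ⊗ y) n ≡ coeffL y (n ℤ.- pos 1)
  coeffL-t* y n = trans (coeffL-⊗ tL y n ℤP.≤-refl ℤP.≤-refl)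
    (trans (extend-cong (λ k → trans (conv-cong (seqFrom-top tL) (seqFrom-top y) k) (conv-1ˡ (Laurent.c y) k)) (pos 1 ℤ.+ top y ℤ.- n))
    (trans (cong (extend (Laurent.c y)) (ℤS.solve 2 (λ t n → ℤS.con (pos 1) ℤS.:+ t ℤS.:- n ℤS.:= t ℤS.:- (n ℤS.:- ℤS.con (pos 1))) refl (top y) n))
    (sym (coeffL≡extend y (n ℤ.- pos 1)))))

  -- Horner's step. It reduces multiplicativity of `polyL` to multiplication by constants and by t.
  polyL-∷ : ∀ a p → polyL (a ∷ p) ≋L constL a ⊕ tL ⊗ polyL p
  polyL-∷ a p = mkL λ n → trans (coeffL-polyL (a ∷ p) n) (trans (h n)
    (sym (trans (coeffL-⊕ (constL a) (tL ⊗ polyL p) n) (cong₂ _+_ (coeffL≡extend (constL a) n)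
      (trans (coeffL-t* (polyL p) n) (coeffL-polyL p (n ℤ.- pos 1)))))))
    where
    h : ∀ n → coeffℤ (a ∷ p) n ≡ extend (coeff (constP a)) (pos 0 ℤ.- n) + coeffℤ p (n ℤ.- pos 1)
    h (pos zero)    = sym (𝔽R.+-identityʳ a)
    h (pos (suc k)) = trans (cong (coeff p) refl) (sym (𝔽R.+-identityˡ _))
    h -[1+ k ]      = sym (𝔽R.+-identityˡ 0#)

  polyL-scale : ∀ a r → polyL (map (a *_) r) ≋L constL a ⊗ polyL r
  polyL-scale a r = mkL λ n → trans (coeffL-polyL (map (a *_) r) n) (trans (h n)
    (sym (trans (coeffL-const* a (polyL r) n) (cong (a *_) (coeffL-polyL r n)))))
    where h : ∀ n → coeffℤ (map (a *_) r) n ≡ a * coeffℤ r n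
          h (pos k)  = coeff-scale a r k
          h -[1+ k ] = sym (𝔽R.zeroʳ a)

  polyL-0 : polyL 0P ≋L 0L
  polyL-0 = mkL λ n → trans (coeffL-polyL [] n) (trans (h n) (sym (coeffL-0 n)))
    where h : ∀ n → coeffℤ [] n ≡ 0#
          h (pos k)  = refl
          h -[1+ k ] = refl

  constL-0 : constL 0# ≋L 0L
  constL-0 = mkL λ n → trans (coeffL≡extend (constL 0#) n) (trans (h (pos 0 ℤ.- n)) (sym (coeffL-0 n)))
    where h : ∀ n → extend (coeff (constP 0#)) n ≡ 0#
          h (pos zero)    = refl
          h (pos (suc k)) = refl
          h -[1+ k ]      = refl

  polyL-1 : polyL 1P ≋L 1L
  polyL-1 = LR.trans (polyL-∷ 1# []) (LR.trans (LR.+-congˡ (LR.trans (LR.*-congˡ {tL} polyL-0) (LR.zeroʳ tL))) (LR.+-identityʳ 1L))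

  polyL-*P : ∀ p r → polyL (p *P r) ≋L polyL p ⊗ polyL r
  polyL-*P []      r = LR.trans polyL-0 (LR.sym (LR.trans (LR.*-congʳ polyL-0) (LR.zeroˡ _)))
  polyL-*P (a ∷ p) r = begin
    polyL (map (a *_) r +P (0# ∷ (p *P r)))                      ≈⟨ polyL-+P _ _ ⟩
    polyL (map (a *_) r) ⊕ polyL (0# ∷ (p *P r))                ≈⟨ LR.+-cong (polyL-scale a r) (polyL-∷ 0# (p *P r)) ⟩
    (constL a ⊗ R) ⊕ (constL 0# ⊕ (tL ⊗ polyL (p *P r)))         ≈⟨ LR.+-congˡ (LR.+-cong constL-0 (LR.*-congˡ (polyL-*P p r))) ⟩
    (constL a ⊗ R) ⊕ (0L ⊕ (tL ⊗ (polyL p ⊗ R)))                ≈⟨ LS.solve 4 (λ a r t p → a LS.:* r LS.:+ (LS.con (pos 0) LS.:+ t LS.:* (p LS.:* r)) LS.:= (a LS.:+ t LS.:* p) LS.:* r)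
                                                                      LR.refl (constL a) R tL (polyL p) ⟩
    (constL a ⊕ (tL ⊗ polyL p)) ⊗ R                             ≈⟨ LR.*-congʳ (polyL-∷ a p) ⟨
    polyL (a ∷ p) ⊗ R                                           ∎
    where
    open import Relation.Binary.Reasoning.Setoid LR.setoid
    R = polyL r

  polyL-⊞ : ∀ p r → polyL (p ⊞ r) ≋L polyL p ⊕ polyL r
  polyL-⊞ p r = LR.trans (LR.reflexive (cong polyL (⊞-def p r))) (polyL-+P p r)

  polyL-⊠ : ∀ p r → polyL (p ⊠ r) ≋L polyL p ⊗ polyL r
  polyL-⊠ p r = LR.trans (LR.reflexive (cong polyL (⊠-def p r))) (polyL-*P p r)

  polyL-⊟ : ∀ p → polyL (⊟ p) ≋L ⊝ polyL p
  polyL-⊟ p = mkL λ n → trans (coeffL-polyL (⊟ p) n) (trans (h n) (sym (trans (coeffL-⊝ (polyL p) n) (cong -_ (coeffL-polyL p n)))))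
    where h : ∀ n → coeffℤ (⊟ p) n ≡ - coeffℤ p n
          h (pos k)  = coeff-⊟ p k
          h -[1+ k ] = sym -0≡0

  -- Inverses and square roots in K_∞

  degP-spec : ∀ p → (degP p ≡ nothing × p ≋ 0P) ⊎ ∃ λ n → degP p ≡ just n × Deg= n p
  degP-spec []      = inj₁ (refl , PR.refl)
  degP-spec (a ∷ p) with degP p | degP-spec p
  ... | .nothing  | inj₁ (refl , z) with a ≟ 0#
  ...   | yes e = inj₁ (refl , mk≋ λ { zero → e ; (suc n) → at z n })
  ...   | no ne = inj₂ (0 , refl , (bd λ { (suc n) _ → at z n }) , ne)
  degP-spec (a ∷ p) | .(just n) | inj₂ (n , refl , b , ne) = inj₂ (suc n , refl , (bd λ { (suc e) (s≤s l) → bz b e l }) , ne)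

  -- `polyL` starts at t^(length), above the leading term. Starting at t^m with m the degree puts
  -- the leading coefficient at index 0, where the recursion of `invPolyL` has it.
  truncL : ℕ → Poly → Laurent
  truncL m d = record { top = pos m ; c = λ j → coeffℤ d (pos m ℤ.- pos j) }

  polyL-truncL : ∀ {m d} → Bd (suc m) d → polyL d ≋L truncL m d
  polyL-truncL {m} {d} b = mkL λ n → trans (coeffL-polyL d n) (trans (h n) (sym (coeffL≡extend (truncL m d) n)))
    where
    h : ∀ n → coeffℤ d n ≡ extend (λ j → coeffℤ d (pos m ℤ.- pos j)) (pos m ℤ.- n)
    h n with pos m ℤ.- n in eq
    ... | pos k = cong (coeffℤ d) (sym (trans (cong (λ z → pos m ℤ.- z) (sym eq))
            (ℤS.solve 2 (λ t n → t ℤS.:- (t ℤS.:- n) ℤS.:= n) refl (pos m) n)))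
    h -[1+ j ] | -[1+ k ] = refl
    h (pos j)  | -[1+ k ] = bz b j (ℕP.≰⇒> λ le → f (trans (sym (trans (ℤP.m-n≡m⊖n m j) (ℤP.⊖-≥ le))) eq))
      where f : ¬ (pos (m ∸ j) ≡ -[1+ k ])
            f ()

  ⊗-from-conv : ∀ x y z → top x ℤ.+ top y ≡ top z → (∀ n → conv (Laurent.c x) (Laurent.c y) n ≡ Laurent.c z n) → x ⊗ y ≋L z
  ⊗-from-conv x y z e h = mkL λ n → trans (coeffL-⊗ x y n ℤP.≤-refl ℤP.≤-refl)
    (trans (extend-cong (λ k → trans (conv-cong (seqFrom-top x) (seqFrom-top y) k) (h k)) (top x ℤ.+ top y ℤ.- n))
    (trans (cong (λ t → extend (Laurent.c z) (t ℤ.- n)) e) (sym (coeffL≡extend z n))))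

  private
    -- E stands for the local `dot` of `invPolyL` applied to the reversed list of coefficients,
    -- known only through its two recursion equations; these are the equations of a convolution with
    -- a shifted a.
    dot-conv : (a b : Seq) (E : ℕ → ℕ → F) → (∀ k → E k 0 ≡ a (suc k) * b 0 + 0#) →
               (∀ k n → E k (suc n) ≡ a (suc k) * b (suc n) + E (suc k) n) →
               ∀ n k → E k n ≡ conv (λ i → a (suc (k ℕ.+ i))) b n
    dot-conv a b E E0 E+ zero    k = trans (E0 k) (trans (𝔽R.+-identityʳ _) (cong (λ z → a (suc z) * b 0) (sym (ℕP.+-identityʳ k))))
    dot-conv a b E E0 E+ (suc n) k = trans (E+ k n) (cong₂ _+_ (cong (λ z → a (suc z) * b (suc n)) (sym (ℕP.+-identityʳ k)))
      (trans (dot-conv a b E E0 E+ n (suc k)) (conv-cong (λ i → cong (λ z → a (suc z)) (sym (ℕP.+-suc k i))) (λ _ → refl) n)))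

    -- invPolyL's local functions have no name outside Defs.  Abstracting the
    -- literal 0 in the goal exposes `dot k (bsRev n)' with k a variable, and
    -- unification then fills in the body of dotRev.
    mutual
      dotRev : Poly → ℕ → ℕ → ℕ → F
      dotRev d m k n = _

      inverse-suc : ∀ d m → degP d ≡ just m → ∀ n z → z ≡ 0 →
                    Laurent.c (invPolyL d) (suc n) ≡ - (coeff d m ⁻¹ * dotRev d m z n)
      inverse-suc d m e n z z≡0 with degP d
      inverse-suc d m refl n z z≡0 | .(just m) with 0 | z≡0
      ... | k | refl = refl

    dotRev-0 : ∀ d m → degP d ≡ just m → ∀ k →
               dotRev d m k 0 ≡ coeffℤ d (pos m ℤ.- pos (suc k)) * Laurent.c (invPolyL d) 0 + 0#
    dotRev-0 d m e k with degP d
    dotRev-0 d m refl k | .(just m) = refl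

    dotRev-suc : ∀ d m → degP d ≡ just m → ∀ k n → dotRev d m k (suc n) ≡
                 coeffℤ d (pos m ℤ.- pos (suc k)) * Laurent.c (invPolyL d) (suc n) + dotRev d m (suc k) n
    dotRev-suc d m e k n with degP d
    dotRev-suc d m refl k n | .(just m) = refl

    inverse-0 : ∀ d m → degP d ≡ just m → top (invPolyL d) ≡ ℤ.- pos m × Laurent.c (invPolyL d) 0 ≡ coeff d m ⁻¹
    inverse-0 d m e with degP d
    inverse-0 d m refl | .(just m) = refl , refl

    truncL-inverse : ∀ d m → degP d ≡ just m → Deg= m d → truncL m d ⊗ invPolyL d ≋L 1L
    truncL-inverse d m e (_ , lc≢0) = ⊗-from-conv (truncL m d) (invPolyL d) 1L
      (trans (cong (λ z → pos m ℤ.+ z) (proj₁ (inverse-0 d m e))) (ℤP.+-inverseʳ (pos m))) go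
      where
      lc = coeff d m
      a b : Seq
      a = Laurent.c (truncL m d)
      b = Laurent.c (invPolyL d)
      a0 : a 0 ≡ lc
      a0 = cong (coeffℤ d) (ℤP.+-identityʳ (pos m))
      go : ∀ n → conv a b n ≡ coeff 1P n
      go zero    = trans (cong₂ _*_ a0 (proj₂ (inverse-0 d m e))) (inverseʳ lc lc≢0)
      go (suc n) = begin
        a 0 * b (suc n) + C           ≡⟨ cong₂ (λ x y → x * y + C) a0 (trans (inverse-suc d m e n 0 refl)
                                           (cong (λ z → - (lc ⁻¹ * z)) (dot-conv a b (dotRev d m) (dotRev-0 d m e) (dotRev-suc d m e) n 0))) ⟩
        lc * (- (lc ⁻¹ * C)) + C      ≡⟨ 𝔽S.solve 3 (λ l i d → l 𝔽S.:* (𝔽S.:- (i 𝔽S.:* d)) 𝔽S.:+ d 𝔽S.:= 𝔽S.:- ((l 𝔽S.:* i) 𝔽S.:* d) 𝔽S.:+ d) refl lc (lc ⁻¹) C ⟩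
        - ((lc * lc ⁻¹) * C) + C      ≡⟨ cong (λ z → - (z * C) + C) (inverseʳ lc lc≢0) ⟩
        - (1# * C) + C                ≡⟨ 𝔽S.solve 1 (λ d → 𝔽S.:- (𝔽S.con (pos 1) 𝔽S.:* d) 𝔽S.:+ d 𝔽S.:= 𝔽S.con (pos 0)) refl C ⟩
        0#                            ∎
        where open ≡.≡-Reasoning
              C = conv (a ∘ suc) b n

  polyL-inverse : ∀ {d} → ¬ (d ≋ 0P) → polyL d ⊗ invPolyL d ≋L 1L
  polyL-inverse {d} nz with degP-spec d
  ... | inj₁ (_ , z) = ⊥-elim (nz z)
  ... | inj₂ (m , e , dg) = LR.trans (LR.*-congʳ (polyL-truncL (proj₁ dg))) (truncL-inverse d m e dg)

  -- Square roots of power series, by successive approximation.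

  module _ (2≢0 : 1# + 1# ≢ 0#) (f : Seq) (s : F) (s≢0 : s ≢ 0#) (s² : s * s ≡ f 0) where

    private
      two-s : F
      two-s = (1# + 1#) * s

      δ : ℕ → F → Seq
      δ zero    e zero    = e
      δ zero    e (suc i) = 0#
      δ (suc k) e zero    = 0#
      δ (suc k) e (suc i) = δ k e i

      δ-diag : ∀ k e → δ k e k ≡ e
      δ-diag zero    e = refl
      δ-diag (suc k) e = δ-diag k e

      δ-off : ∀ k e i → i ≢ k → δ k e i ≡ 0#
      δ-off zero    e zero    ne = ⊥-elim (ne refl)
      δ-off zero    e (suc i) ne = refl
      δ-off (suc k) e zero    ne = refl
      δ-off (suc k) e (suc i) ne = δ-off k e i (ne ∘ cong suc)

      -- G n is the root up to index n. The correction e at index n + 1 solves 2se = f (n + 1) - (G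
      -- n)² (n + 1), which needs 2 and s invertible.
      G : ℕ → Seq
      err : ℕ → F
      G zero      = δ 0 s
      G (suc n) i = G n i + δ (suc n) (err n) i
      err n = (f (suc n) + - conv (G n) (G n) (suc n)) * two-s ⁻¹

      G-0 : ∀ n → G n 0 ≡ s
      G-0 zero    = refl
      G-0 (suc n) = trans (𝔽R.+-identityʳ _) (G-0 n)

      G-stable : ∀ m i → i ℕ.≤ m → G m i ≡ G i i
      G-stable zero    zero    z≤n = refl
      G-stable (suc m) i       le with ℕP.m≤n⇒m<n∨m≡n le
      ... | inj₂ refl = refl
      ... | inj₁ (s≤s le') = trans (cong (λ z → G m i + z) (δ-off (suc m) (err m) i λ e → ℕP.<-irrefl e (s≤s le')))
                               (trans (𝔽R.+-identityʳ _) (G-stable m i le'))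

      conv-δ : ∀ k e g l → conv (δ k e) g (k ℕ.+ l) ≡ e * g l
      conv-δ k e g l = trans (conv-single (δ k e) g k l (λ i j _ ne → trans (cong (_* g j) (δ-off k e i ne)) (𝔽R.zeroˡ _)))
        (cong (_* g l) (δ-diag k e))

      -- At index n + 1 the correction meets only the constant term s of the other factor. It
      -- therefore contributes 2s `err n`, and its own square does not reach this index.
      conv-step : ∀ n → conv (G (suc n)) (G (suc n)) (suc n) ≡ f (suc n)
      conv-step n = begin
        conv (G (suc n)) (G (suc n)) (suc n)
          ≡⟨ conv-+ (G n) D (G (suc n)) (suc n) ⟩
        conv (G n) (G (suc n)) (suc n) + conv D (G (suc n)) (suc n)
          ≡⟨ cong₂ _+_ (trans (conv-comm (G n) (G (suc n)) (suc n)) (conv-+ (G n) D (G n) (suc n)))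
               (h (G (suc n)) (suc n) refl) ⟩
        (conv (G n) (G n) (suc n) + conv D (G n) (suc n)) + err n * G (suc n) 0
          ≡⟨ cong₂ (λ x y → (conv (G n) (G n) (suc n) + x) + err n * y) (h (G n) (suc n) refl) (G-0 (suc n)) ⟩
        (conv (G n) (G n) (suc n) + err n * G n 0) + err n * s
          ≡⟨ cong (λ y → (conv (G n) (G n) (suc n) + err n * y) + err n * s) (G-0 n) ⟩
        (conv (G n) (G n) (suc n) + err n * s) + err n * s
          ≡⟨ 𝔽S.solve 4 (λ c a t s → (c 𝔽S.:+ a 𝔽S.:* t 𝔽S.:* s) 𝔽S.:+ a 𝔽S.:* t 𝔽S.:* s
                𝔽S.:= c 𝔽S.:+ a 𝔽S.:* (((𝔽S.con (pos 1) 𝔽S.:+ 𝔽S.con (pos 1)) 𝔽S.:* s) 𝔽S.:* t)) refl C (f (suc n) + - C) (two-s ⁻¹) s ⟩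
        C + (f (suc n) + - C) * (two-s * two-s ⁻¹)
          ≡⟨ cong (λ z → C + (f (suc n) + - C) * z) (inverseʳ two-s (*-nonzero 2≢0 s≢0)) ⟩
        C + (f (suc n) + - C) * 1#
          ≡⟨ 𝔽S.solve 2 (λ c f → c 𝔽S.:+ (f 𝔽S.:+ 𝔽S.:- c) 𝔽S.:* 𝔽S.con (pos 1) 𝔽S.:= f) refl C (f (suc n)) ⟩
        f (suc n) ∎
        where
        open ≡.≡-Reasoning
        C = conv (G n) (G n) (suc n)
        D : Seq
        D i = δ (suc n) (err n) i
        h : ∀ g m → m ≡ suc n → conv D g m ≡ err n * g 0
        h g m refl = trans (cong (conv D g) (sym (ℕP.+-identityʳ (suc n)))) (conv-δ (suc n) (err n) g 0)

    power-series-sqrt : Σ Seq λ g → ∀ n → conv g g n ≡ f n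
    power-series-sqrt = (λ n → G n n) , go
      where
      go : ∀ n → conv (λ n → G n n) (λ n → G n n) n ≡ f n
      go zero    = s²
      go (suc n) = trans (conv-cong≤ (suc n) (λ i l → sym (G-stable (suc n) i l)) (λ i l → sym (G-stable (suc n) i l))) (conv-step n)

  sqrtL : 1# + 1# ≢ 0# → ∀ {e} d s → Bd (suc (e ℕ.+ e)) d → s ≢ 0# → s * s ≡ coeff d (e ℕ.+ e) →
          Σ Laurent λ w → w ⊗ w ≋L polyL d
  sqrtL 2≢0 {e} d s b s≢0 s² with power-series-sqrt 2≢0 (Laurent.c (truncL (e ℕ.+ e) d)) s s≢0
                                  (trans s² (cong (coeffℤ d) (sym (ℤP.+-identityʳ (pos (e ℕ.+ e))))))
  ... | g , h = w , LR.trans (⊗-from-conv w w (truncL (e ℕ.+ e) d) refl h) (LR.sym (polyL-truncL b))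
    where w : Laurent
          w = record { top = pos e ; c = g }

  -- Counting in finite sets

  opaque
    Fin-injective⇒surjective : ∀ {n} (f : Fin n → Fin n) → (∀ i j → f i ≡ f j → i ≡ j) → ∀ y → ∃ λ x → f x ≡ y
    Fin-injective⇒surjective {suc n} f inj y with FinP.any? (λ x → f x FinP.≟ y)
    ... | yes p = p
    ... | no np with FinP.pigeonhole (ℕP.n<1+n n) (λ i → punchOut {i = y} {j = f i} (λ e → np (i , sym e)))
    ... | i , j , i<j , e = ⊥-elim (ℕP.<-irrefl (cong toℕ (inj i j (FinP.punchOut-injective (λ e → np (i , sym e)) (λ e → np (j , sym e)) e))) i<j)

  Collide₃ : ∀ {A B : Set} → (A → B) → Set
  Collide₃ f = ∃ λ i → ∃ λ j → ∃ λ k → i ≢ j × i ≢ k × j ≢ k × f i ≡ f j × f i ≡ f k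

  opaque
    -- Each element is flagged if an earlier one has the same value. The ordinary principle gives i
    -- < j with equal value and equal flag; the flag of j is up, so that of i is up too, and an
    -- element before i is the third.
    pigeonhole₃ : ∀ {m n} → m ℕ.* 2 ℕ.< n → (f : Fin n → Fin m) →
                  Collide₃ f
    pigeonhole₃ {m} {n} lt f = case (FinP.pigeonhole lt (λ i → combine (f i) (flag i (old? i))))
      where
      Old : Fin n → Set
      Old i = ∃ λ l → l Fin.< i × f l ≡ f i
      old? : ∀ i → Dec (Old i)
      old? i = FinP.any? λ l → (l FinP.<? i) ×-dec (f l FinP.≟ f i)
      flag : ∀ i → Dec (Old i) → Fin 2
      flag i (yes _) = suc zero
      flag i (no _)  = zero
      case : (∃₂ λ i j → i Fin.< j × combine (f i) (flag i (old? i)) ≡ combine (f j) (flag j (old? j))) → Collide₃ f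
      case (i , j , i<j , e) with old? i | old? j | FinP.combine-injectiveˡ (f i) (flag i (old? i)) (f j) (flag j (old? j)) e
                                | FinP.combine-injectiveʳ (f i) (flag i (old? i)) (f j) (flag j (old? j)) e
      ... | _ | no nj | fe | _ = ⊥-elim (nj (i , i<j , fe))
      ... | no _ | yes _ | _ | ()
      ... | yes (l , l<i , le) | yes _ | fe | _ = l , i , j , (λ e → ℕP.<-irrefl (cong toℕ e) l<i) ,
            (λ e → ℕP.<-irrefl (cong toℕ e) (ℕP.<-trans l<i i<j)) , (λ e → ℕP.<-irrefl (cong toℕ e) i<j) , le , trans le fe

  opaque
    -- Exactly one member of each orbit satisfies i < τ i, and permuting by τ does not change the
    -- number of such i.
    free-involution⇒even : ∀ {n} (τ : Fin n → Fin n) → (∀ i → τ (τ i) ≡ i) → (∀ i → τ i ≢ i) → ∃ λ k → n ≡ k ℕ.+ k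
    free-involution⇒even {n} τ inv free = ℕSum.sum below , (begin
      n                                                          ≡⟨ ones n ⟨
      ℕSum.sum {n} (λ _ → 1)                                     ≡⟨ ℕSum.sum-cong-≗ {n} split ⟨
      ℕSum.sum (λ i → below i ℕ.+ below (τ i))                   ≡⟨ ℕSum.∑-distrib-+ below (below ∘ τ) ⟩
      ℕSum.sum below ℕ.+ ℕSum.sum (below ∘ τ)                    ≡⟨ cong (ℕSum.sum below ℕ.+_) (ℕSum.sum-permute below π) ⟨
      ℕSum.sum below ℕ.+ ℕSum.sum below                          ∎)
      where
      open ≡.≡-Reasoning
      π : Permutation n n
      π = permutation τ τ inv inv
      below : Fin n → ℕ
      below i with i FinP.<? τ i
      ... | yes _ = 1
      ... | no _  = 0
      ones : ∀ n → ℕSum.sum {n} (λ _ → 1) ≡ n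
      ones zero    = refl
      ones (suc n) = cong suc (ones n)
      split : ∀ i → below i ℕ.+ below (τ i) ≡ 1
      split i with i FinP.<? τ i | τ i FinP.<? τ (τ i)
      ... | yes p | yes q = ⊥-elim (ℕP.<-asym p (subst (λ z → τ i Fin.< z) (inv i) q))
      ... | yes p | no _  = refl
      ... | no _  | yes _ = refl
      ... | no p  | no q with FinP.<-cmp i (τ i)
      ...   | tri< l _ _ = ⊥-elim (p l)
      ...   | tri≈ _ e _ = ⊥-elim (free i (sym e))
      ...   | tri> _ _ l = ⊥-elim (q (subst (λ z → τ i Fin.< z) (sym (inv i)) l))

  idx : F → Fin size
  idx = Inverse.to enumeration

  elt : Fin size → F
  elt = Inverse.from enumeration

  elt-idx : ∀ x → elt (idx x) ≡ x
  elt-idx x = Inverse.strictlyInverseʳ enumeration x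

  idx-elt : ∀ i → idx (elt i) ≡ i
  idx-elt i = Inverse.strictlyInverseˡ enumeration i

  idx-injective : ∀ {x y} → idx x ≡ idx y → x ≡ y
  idx-injective {x} {y} e = trans (sym (elt-idx x)) (trans (cong elt e) (elt-idx y))

  opaque
    anyF? : ∀ {P : F → Set} → Decidable P → Dec (∃ P)
    anyF? {P} P? = map′ (λ { (i , p) → elt i , p }) (λ { (x , p) → idx x , subst P (sym (elt-idx x)) p }) (FinP.any? (λ i → P? (elt i)))

  opaque
    F-injective⇒surjective : (f : F → F) → (∀ x y → f x ≡ f y → x ≡ y) → ∀ y → ∃ λ x → f x ≡ y
    F-injective⇒surjective f inj y with Fin-injective⇒surjective (idx ∘ f ∘ elt)
        (λ i j e → trans (sym (idx-elt i)) (trans (cong idx (inj _ _ (idx-injective e))) (idx-elt j))) (idx y)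
    ... | i , e = elt i , idx-injective e

  -- If 1 + 1 = 0, then x ↦ x + 1 is an involution of F without fixed points, and q is even.
  odd⇒2≢0 : OddOrder → 1# + 1# ≢ 0#
  odd⇒2≢0 odd e = case free-involution⇒even (λ i → idx (elt i + 1#))
      (λ i → trans (cong idx (trans (cong (_+ 1#) (elt-idx (elt i + 1#))) (trans (𝔽R.+-assoc _ _ _) (trans (cong (elt i +_) e) (𝔽R.+-identityʳ _))))) (idx-elt i))
      (λ i p → 0≢1 (sym (trans (𝔽S.solve 2 (λ x o → o 𝔽S.:= (x 𝔽S.:+ o) 𝔽S.:- x) refl (elt i) 1#)
         (x≡y⇒x-y≡0 (idx-injective (trans p (sym (idx-elt i))))))))
    of λ { (k , se) → absurd (trans (sym (trans (cong (ℕ._% 2) se) (trans (cong (ℕ._% 2) (trans (cong (k ℕ.+_) (sym (ℕP.+-identityʳ k))) (ℕP.*-comm 2 k))) (ℕD.m*n%n≡0 k 2)))) odd) }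
    where absurd : ¬ (0 ≡ 1)
          absurd ()

  -- Squares and the norm form

  module _ (2≢0 : 1# + 1# ≢ 0#) where

    x≡-x⇒x≡0 : ∀ {x} → x ≡ - x → x ≡ 0#
    x≡-x⇒x≡0 {x} e = x*y≡0⇒y≡0 2≢0 (trans (𝔽S.solve 1 (λ x → (𝔽S.con (pos 1) 𝔽S.:+ 𝔽S.con (pos 1)) 𝔽S.:* x 𝔽S.:= x 𝔽S.:- 𝔽S.:- x) refl x) (x≡y⇒x-y≡0 e))

    NonSquare : F → Set
    NonSquare ν = ∀ s → s * s ≢ ν

    opaque
      nonSquare⇒anisotropic : ∀ {ν x y} → NonSquare ν → x * x ≡ ν * (y * y) → x ≡ 0# × y ≡ 0#
      nonSquare⇒anisotropic {ν} {x} {y} ns e with y ≟ 0#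
      ... | yes refl with x*y≡0⇒x≡0⊎y≡0 x x (trans e (trans (cong (ν *_) (𝔽R.zeroˡ _)) (𝔽R.zeroʳ _)))
      ...   | inj₁ z = z , refl
      ...   | inj₂ z = z , refl
      nonSquare⇒anisotropic {ν} {x} {y} ns e | no y≢0 = ⊥-elim (ns (x * y ⁻¹) (begin
        (x * y ⁻¹) * (x * y ⁻¹)           ≡⟨ 𝔽S.solve 2 (λ x i → (x 𝔽S.:* i) 𝔽S.:* (x 𝔽S.:* i) 𝔽S.:= (x 𝔽S.:* x) 𝔽S.:* (i 𝔽S.:* i)) refl x (y ⁻¹) ⟩
        (x * x) * (y ⁻¹ * y ⁻¹)           ≡⟨ cong (_* (y ⁻¹ * y ⁻¹)) e ⟩
        (ν * (y * y)) * (y ⁻¹ * y ⁻¹)     ≡⟨ 𝔽S.solve 3 (λ n y i → (n 𝔽S.:* (y 𝔽S.:* y)) 𝔽S.:* (i 𝔽S.:* i) 𝔽S.:= n 𝔽S.:* ((y 𝔽S.:* i) 𝔽S.:* (y 𝔽S.:* i))) refl ν y (y ⁻¹) ⟩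
        ν * ((y * y ⁻¹) * (y * y ⁻¹))     ≡⟨ cong (λ z → ν * (z * z)) (inverseʳ y y≢0) ⟩
        ν * (1# * 1#)                     ≡⟨ 𝔽S.solve 1 (λ n → n 𝔽S.:* (𝔽S.con (pos 1) 𝔽S.:* 𝔽S.con (pos 1)) 𝔽S.:= n) refl ν ⟩
        ν                                 ∎))
        where open ≡.≡-Reasoning

    -- x ↦ x² on one half of F and x ↦ νx² on the other half is injective, hence onto.
    opaque
      square-or-ν-square : ∀ {ν} → NonSquare ν → ∀ e → ∃ λ s → s * s ≡ e ⊎ ν * (s * s) ≡ e
      square-or-ν-square {ν} ns e = pick (F-injective⇒surjective (λ x → h x (half? x)) (λ x y → h-injective x y (half? x) (half? y)) e)
        where
        half? : ∀ x → Dec (idx x Fin.< idx (- x))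
        half? x = idx x FinP.<? idx (- x)
        h : ∀ x → Dec (idx x Fin.< idx (- x)) → F
        h x (yes _) = x * x
        h x (no _)  = ν * (x * x)
        opp : ∀ {x y} → x ≡ - y → - x ≡ y
        opp {x} {y} refl = 𝔽S.solve 1 (λ y → 𝔽S.:- (𝔽S.:- y) 𝔽S.:= y) refl y
        ν≢0 : ν ≢ 0#
        ν≢0 z = ns 0# (trans (𝔽R.zeroˡ _) (sym z))
        h-injective : ∀ x y (p : Dec (idx x Fin.< idx (- x))) (q : Dec (idx y Fin.< idx (- y))) → h x p ≡ h y q → x ≡ y
        h-injective x y (yes p) (yes q) e = case x²≡y²⇒x≡±y e of λ
          { (inj₁ r) → r
          ; (inj₂ r) → ⊥-elim (ℕP.<-asym p (≡.subst₂ (λ a b → idx a Fin.< idx b) (sym (opp r)) (sym r) q)) }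
        h-injective x y (no p) (no q) e = case x²≡y²⇒x≡±y (*-cancelˡ ν≢0 e) of λ
          { (inj₁ r) → r
          ; (inj₂ r) → case FinP.<-cmp (idx x) (idx (- x)) of λ
            { (tri< l _ _) → ⊥-elim (p l)
            ; (tri≈ _ i _) → trans (x≡-x⇒x≡0 (idx-injective i)) (sym (trans (sym (opp r)) (trans (sym (idx-injective i)) (x≡-x⇒x≡0 (idx-injective i)))))
            ; (tri> _ _ l) → ⊥-elim (q (≡.subst₂ (λ a b → idx a Fin.< idx b) (opp r) r l)) } }
        h-injective x y (yes _) (no _) e = case nonSquare⇒anisotropic ns e of λ { (z , z') → trans z (sym z') }
        h-injective x y (no _) (yes _) e = case nonSquare⇒anisotropic ns (sym e) of λ { (z , z') → trans z' (sym z) }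
        pick : (∃ λ x → h x (half? x) ≡ e) → ∃ λ s → s * s ≡ e ⊎ ν * (s * s) ≡ e
        pick (x , p) with half? x
        ... | yes _ = x , inj₁ p
        ... | no _  = x , inj₂ p

    -- If every u² - ν were a square, all multiples of -ν would be, among them ν.
    opaque
      norm-nonsquare : ∀ {ν} → NonSquare ν → ∃ λ u → ∃ λ r → r ≢ 0# × u * u + - ν ≡ ν * (r * r)
      norm-nonsquare {ν} ns with anyF? (λ u → anyF? (λ r → (u * u + - ν) ≟ (ν * (r * r))))
      ... | yes (u , r , e) = u , r , (λ { refl → ns u (x-y≡0⇒x≡y (trans e (trans (cong (ν *_) (𝔽R.zeroˡ _)) (𝔽R.zeroʳ _)))) }) , e
      ... | no none = ⊥-elim (contra (FinP.pigeonhole (ℕP.n<1+n size) (λ i → idx (mult (toℕ i)))))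
        where
        mult : ℕ → F
        mult zero    = 0#
        mult (suc n) = mult n + - ν
        isSquare : ∀ n → ∃ λ u → u * u ≡ mult n
        isSquare zero = 0# , 𝔽R.zeroˡ _
        isSquare (suc n) with isSquare n
        ... | u , e with square-or-ν-square ns (mult n + - ν)
        ...   | s , inj₁ p = s , p
        ...   | s , inj₂ p = ⊥-elim (none (u , s , trans (cong (_+ - ν) e) (sym p)))
        mult-+ : ∀ i k → mult (i ℕ.+ k) ≡ mult i + mult k
        mult-+ zero    k = sym (𝔽R.+-identityˡ _)
        mult-+ (suc i) k = trans (cong (_+ - ν) (mult-+ i k))
          (𝔽S.solve 3 (λ a b c → a 𝔽S.:+ b 𝔽S.:+ c 𝔽S.:= a 𝔽S.:+ c 𝔽S.:+ b) refl (mult i) (mult k) (- ν))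
        contra : ¬ (∃₂ λ (i j : Fin (suc size)) → i Fin.< j × idx (mult (toℕ i)) ≡ idx (mult (toℕ j)))
        contra (i , j , i<j , e) with ℕP.m<n⇒m<1+n i<j | ℕP.m≤n⇒∃[o]m+o≡n i<j
        -- Two equal multiples leave (k + 1)(-ν) = 0, so the square k(-ν) equals ν.
        ... | _ | k , p = ns (proj₁ (isSquare k)) (trans (proj₂ (isSquare k)) (x-y≡0⇒x≡y k≡0))
          where
          k≡0 : mult (suc k) ≡ 0#
          k≡0 = trans (𝔽S.solve 2 (λ a b → b 𝔽S.:= (a 𝔽S.:+ b) 𝔽S.:- a) refl (mult (toℕ i)) (mult (suc k)))
            (x≡y⇒x-y≡0 (trans (sym (mult-+ (toℕ i) (suc k))) (trans (cong mult (trans (ℕP.+-suc (toℕ i) k) p)) (sym (idx-injective e)))))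

    opaque
      -- Squares are values at v = 0. For νs², one value u² - ν = νr² with r ≠ 0 is scaled by
      -- (s/r)².
      norm-surjective : ∀ {ν} → NonSquare ν → ∀ e → ∃ λ u → ∃ λ v → u * u + - (ν * (v * v)) ≡ e
      norm-surjective {ν} ns e with square-or-ν-square ns e
      ... | s , inj₁ p = s , 0# , trans (𝔽S.solve 2 (λ s n → s 𝔽S.:* s 𝔽S.:- n 𝔽S.:* (𝔽S.con (pos 0) 𝔽S.:* 𝔽S.con (pos 0)) 𝔽S.:= s 𝔽S.:* s) refl s ν) p
      ... | s , inj₂ p with norm-nonsquare ns
      ...   | u , r , r≢0 , e' = u * t , t , (begin
        (u * t) * (u * t) + - (ν * (t * t))    ≡⟨ 𝔽S.solve 3 (λ u t n → (u 𝔽S.:* t) 𝔽S.:* (u 𝔽S.:* t) 𝔽S.:- n 𝔽S.:* (t 𝔽S.:* t) 𝔽S.:= (u 𝔽S.:* u 𝔽S.:- n) 𝔽S.:* (t 𝔽S.:* t)) refl u t ν ⟩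
        (u * u + - ν) * (t * t)                ≡⟨ cong (_* (t * t)) e' ⟩
        (ν * (r * r)) * (t * t)                ≡⟨ 𝔽S.solve 4 (λ n r i s → (n 𝔽S.:* (r 𝔽S.:* r)) 𝔽S.:* ((s 𝔽S.:* i) 𝔽S.:* (s 𝔽S.:* i)) 𝔽S.:= n 𝔽S.:* ((r 𝔽S.:* i) 𝔽S.:* s 𝔽S.:* ((r 𝔽S.:* i) 𝔽S.:* s))) refl ν r (r ⁻¹) s ⟩
        ν * ((r * r ⁻¹) * s * ((r * r ⁻¹) * s)) ≡⟨ cong (λ z → ν * (z * s * (z * s))) (inverseʳ r r≢0) ⟩
        ν * (1# * s * (1# * s))                ≡⟨ cong (λ z → ν * (z * z)) (𝔽R.*-identityˡ s) ⟩
        ν * (s * s)                            ≡⟨ p ⟩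
        e                                      ∎)
        where open ≡.≡-Reasoning
              t : F
              t = s * r ⁻¹

  -- W d N p says that 2 deg p + d ≤ N.

  record W (d N : ℕ) (p : Poly) : Set where
    constructor mkW
    field wz : ∀ e → N ℕ.< e ℕ.+ e ℕ.+ d → coeff p e ≡ 0#
  open W public

  W-weaken : ∀ {d N p} → W (suc d) N p → W d N p
  W-weaken w = mkW λ e l → wz w e (ℕP.<-≤-trans l (ℕP.+-monoʳ-≤ (e ℕ.+ e) (ℕP.n≤1+n _)))

  W-pred : ∀ {d N p} → W (suc d) (suc N) p → W d N p
  W-pred {d} {N} w = mkW λ e l → wz w e (subst (suc N ℕ.<_) (sym (ℕP.+-suc (e ℕ.+ e) d)) (s≤s l))

  W-suc : ∀ {d N p} → W d N p → W (suc d) (suc N) p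
  W-suc {d} {N} w = mkW λ e l → wz w e (ℕP.≤-pred (subst (suc N ℕ.<_) (ℕP.+-suc (e ℕ.+ e) d) l))

  W-* : ∀ {a b N M} p r → W a N p → W b M r → W (a ℕ.+ b) (N ℕ.+ M) (p ⊠ r)
  W-* {a} {b} {N} {M} p r w v = mkW λ e l → trans (coeff-⊠ p r e) (conv-zero _ _ e (go e l))
    where
    open NS.+-*-Solver
    go : ∀ e → N ℕ.+ M ℕ.< e ℕ.+ e ℕ.+ (a ℕ.+ b) → ∀ i j → i ℕ.+ j ≡ e → coeff p i * coeff r j ≡ 0#
    go .(i ℕ.+ j) l i j refl with N ℕ.<? i ℕ.+ i ℕ.+ a | M ℕ.<? j ℕ.+ j ℕ.+ b
    ... | yes q | _     = trans (cong (_* coeff r j) (wz w i q)) (𝔽R.zeroˡ _)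
    ... | no _  | yes q = trans (cong (coeff p i *_) (wz v j q)) (𝔽R.zeroʳ _)
    ... | no q  | no q' = ⊥-elim (ℕP.<⇒≱ l (subst (ℕ._≤ N ℕ.+ M)
          (solve 4 (λ i j a b → (i :+ i :+ a) :+ (j :+ j :+ b) := i :+ j :+ (i :+ j) :+ (a :+ b)) refl i j a b)
          (ℕP.+-mono-≤ (ℕP.≮⇒≥ q) (ℕP.≮⇒≥ q'))))

  Bd⇒W : ∀ {n p} c d → Bd n p → n ℕ.+ n ℕ.+ c ℕ.≤ suc (suc d) → W c d p
  Bd⇒W {n} c d b le = mkW λ e l → bz b e (ℕP.≮⇒≥ λ e<n → ℕP.<⇒≱ l (ℕP.≤-pred (ℕP.≤-pred
    (ℕP.≤-trans (ℕP.≤-trans (ℕP.≤-reflexive (eq e)) (ℕP.+-monoˡ-≤ c (ℕP.+-mono-≤ e<n e<n))) le))))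
    where
    eq : ∀ e → suc (suc (e ℕ.+ e ℕ.+ c)) ≡ suc e ℕ.+ suc e ℕ.+ c
    eq e = NS.+-*-Solver.solve 2 (λ e c → con 2 :+ (e :+ e :+ c) := (con 1 :+ e) :+ (con 1 :+ e) :+ c) refl e c
      where open NS.+-*-Solver

  W⇒Bd : ∀ {c d n p} → W c d p → d ℕ.< n ℕ.+ n ℕ.+ c → Bd n p
  W⇒Bd {c} w l = bd λ e n≤e → wz w e (ℕP.<-≤-trans l (ℕP.+-monoˡ-≤ c (ℕP.+-mono-≤ n≤e n≤e)))

  W-length : ∀ d p N → length p ℕ.+ length p ℕ.+ d ℕ.≤ N → W (suc d) N p
  W-length d p N le = Bd⇒W (suc d) N (Bd-length p) (ℕP.≤-trans (ℕP.≤-reflexive (ℕP.+-suc _ d)) (s≤s (ℕP.m≤n⇒m≤1+n le)))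

  half? : ∀ d N → (∃ λ e → N ≡ e ℕ.+ e ℕ.+ d) ⊎ (∀ e → N ≢ e ℕ.+ e ℕ.+ d)
  half? d N with d ℕ.≤? N
  ... | no n = inj₂ λ e q → n (ℕP.≤-trans (ℕP.m≤n+m d (e ℕ.+ e)) (ℕP.≤-reflexive (sym q)))
  ... | yes p with ℕP.m≤n⇒∃[o]m+o≡n p
  ...   | o , refl = go o
    where
    parity : ∀ o → (∃ λ e → o ≡ e ℕ.+ e) ⊎ (∃ λ e → o ≡ suc (e ℕ.+ e))
    parity zero = inj₁ (0 , refl)
    parity (suc o) with parity o
    ... | inj₁ (e , refl) = inj₂ (e , refl)
    ... | inj₂ (e , refl) = inj₁ (suc e , cong suc (sym (ℕP.+-suc e e)))
    e+e≢1+f+f : ∀ e f → e ℕ.+ e ≢ suc (f ℕ.+ f)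
    e+e≢1+f+f (suc e) zero    q with trans (sym (ℕP.+-suc e e)) (ℕP.suc-injective q)
    ... | ()
    e+e≢1+f+f (suc e) (suc f) q = e+e≢1+f+f e f (ℕP.suc-injective (ℕP.suc-injective (trans (cong suc (sym (ℕP.+-suc e e))) (trans q (cong (λ z → suc (suc z)) (ℕP.+-suc f f))))))
    go : ∀ o → (∃ λ e → d ℕ.+ o ≡ e ℕ.+ e ℕ.+ d) ⊎ (∀ e → d ℕ.+ o ≢ e ℕ.+ e ℕ.+ d)
    go o with parity o
    ... | inj₁ (e , refl) = inj₁ (e , ℕP.+-comm d _)
    ... | inj₂ (e , refl) = inj₂ λ f q → e+e≢1+f+f f e (sym (ℕP.+-cancelˡ-≡ d _ _ (trans q (ℕP.+-comm _ d))))

  W-drop : ∀ {d N p} → W d N p → (∀ e → N ≡ e ℕ.+ e ℕ.+ d → coeff p e ≡ 0#) → W (suc d) N p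
  W-drop {d} {N} {p} w z = mkW λ e l → go e (ℕP.m≤n⇒m<n∨m≡n (ℕP.≤-pred (subst (N ℕ.<_) (ℕP.+-suc (e ℕ.+ e) d) l)))
    where go : ∀ e → N ℕ.< e ℕ.+ e ℕ.+ d ⊎ N ≡ e ℕ.+ e ℕ.+ d → coeff p e ≡ 0#
          go e (inj₁ l) = wz w e l
          go e (inj₂ q) = z e q

  W-half⇒Bd : ∀ {d e p} → W d (e ℕ.+ e ℕ.+ d) p → Bd (suc e) p
  W-half⇒Bd {d} {e} w = W⇒Bd w (s≤s (ℕP.+-monoˡ-≤ d (ℕP.+-monoʳ-≤ e (ℕP.n≤1+n e))))

  diag-< : ∀ {d N} m x → Bd (suc d) m → W (suc d) N x → Bd N (m ⊠ (x ⊠ x))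
  diag-< {d} {N} m x bm wx = W⇒Bd (W-* m (x ⊠ x) (Bd⇒W 0 (d ℕ.+ d) bm le) (W-* x x wx wx)) l
    where
    open NS.+-*-Solver
    le : suc d ℕ.+ suc d ℕ.+ 0 ℕ.≤ suc (suc (d ℕ.+ d))
    le = ℕP.≤-reflexive (solve 1 (λ d → (con 1 :+ d) :+ (con 1 :+ d) :+ con 0 := con 2 :+ (d :+ d)) refl d)
    l : d ℕ.+ d ℕ.+ (N ℕ.+ N) ℕ.< N ℕ.+ N ℕ.+ (0 ℕ.+ (suc d ℕ.+ suc d))
    l = subst (d ℕ.+ d ℕ.+ (N ℕ.+ N) ℕ.<_) (solve 2 (λ d N → con 2 :+ (d :+ d :+ (N :+ N)) := N :+ N :+ (con 0 :+ ((con 1 :+ d) :+ (con 1 :+ d)))) refl d N)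
          (ℕP.m≤n⇒m≤1+n ℕP.≤-refl)

  diag-≤ : ∀ {d N} m x → Bd (suc d) m → W d N x → Bd (suc N) (m ⊠ (x ⊠ x))
  diag-≤ m x bm wx = diag-< m x bm (W-suc wx)

  -- N = 2e + d holds for at most one e; h is the coefficient of x at e, and 0 if there is no e.
  -- When h = 0 the bound on x becomes strict.
  diag-coeff : ∀ {d N} m x → Bd (suc d) m → W d N x →
               ∃ λ h → coeff (m ⊠ (x ⊠ x)) N ≡ coeff m d * (h * h)
                     × (h ≡ 0# → W (suc d) N x) × (h ≢ 0# → ∃ λ e → N ≡ e ℕ.+ e ℕ.+ d)
  diag-coeff {d} {N} m x bm wx with half? d N
  ... | inj₂ n = 0# , trans (bz (diag-< m x bm wx') N ℕP.≤-refl) (sym (trans (cong (coeff m d *_) (𝔽R.zeroˡ _)) (𝔽R.zeroʳ _)))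
               , (λ _ → wx') , (λ ne → ⊥-elim (ne refl))
    where wx' = W-drop wx (λ e q → ⊥-elim (n e q))
  ... | inj₁ (e , refl) = coeff x e
      , trans (cong (coeff (m ⊠ (x ⊠ x))) (ℕP.+-comm (e ℕ.+ e) d))
          (trans (coeff-*-top m (x ⊠ x) bm (Bd-* x x bx bx (ℕP.≤-reflexive (cong suc (ℕP.+-suc e e))))) (cong (coeff m d *_) (coeff-*-top x x bx bx)))
      , (λ z → W-drop wx λ e' q → trans (cong (coeff x) (half-inj e' q)) z) , (λ _ → e , refl)
    where
    bx = W-half⇒Bd {d} {e} wx
    half-inj : ∀ e' → e ℕ.+ e ℕ.+ d ≡ e' ℕ.+ e' ℕ.+ d → e' ≡ e
    half-inj e' q with ℕP.<-cmp e' e | ℕP.+-cancelʳ-≡ d (e ℕ.+ e) (e' ℕ.+ e') q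
    ... | tri< l _ _ | r = ⊥-elim (ℕP.<-irrefl (sym r) (ℕP.+-mono-< l l))
    ... | tri≈ _ r _ | _ = r
    ... | tri> _ _ l | r = ⊥-elim (ℕP.<-irrefl r (ℕP.+-mono-< l l))

  -- 2 deg m < d + d' because deg m < d ≤ d'. Adding 2 deg x + d ≤ N and 2 deg y + d' ≤ N bounds
  -- twice the degree of the product strictly by 2N.
  cross-< : ∀ {d d' N} m x y → d ℕ.≤ d' → Bd d m → W d N x → W d' N y → Bd N (m ⊠ (x ⊠ y))
  cross-< {d} {d'} {N} m x y d≤d' bm wx wy = W⇒Bd (W-* m (x ⊠ y) wm (W-* x y wx wy)) l
    where
    open NS.+-*-Solver
    wm : W 1 (d ℕ.+ d') m
    wm = mkW λ e l → bz bm e (ℕP.≮⇒≥ λ e<d → ℕP.<⇒≱ l (ℕP.≤-trans (ℕP.≤-reflexive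
           (solve 1 (λ e → e :+ e :+ con 1 := con 1 :+ e :+ e) refl e))
           (ℕP.+-mono-≤ e<d (ℕP.≤-trans (ℕP.<⇒≤ e<d) d≤d'))))
    l : d ℕ.+ d' ℕ.+ (N ℕ.+ N) ℕ.< N ℕ.+ N ℕ.+ (1 ℕ.+ (d ℕ.+ d'))
    l = ℕP.≤-reflexive (solve 3 (λ d e N → con 1 :+ (d :+ e :+ (N :+ N)) := N :+ N :+ (con 1 :+ (d :+ e))) refl d d' N)

  linear-< : ∀ {d N} m x → Bd d m → W d N x → Bd N (m ⊠ x)
  linear-< {d} {N} m x bm wx = bd λ e N≤e → trans (coeff-⊠ m x e) (conv-zero _ _ e (go e N≤e))
    where
    go : ∀ e → N ℕ.≤ e → ∀ i j → i ℕ.+ j ≡ e → coeff m i * coeff x j ≡ 0#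
    go .(i ℕ.+ j) N≤e i j refl with d ℕ.≤? i
    ... | yes q = trans (cong (_* coeff x j) (bz bm i q)) (𝔽R.zeroˡ _)
    ... | no q  = trans (cong (coeff m i *_) (wz wx j (ℕP.≤-<-trans N≤e (ℕP.<-≤-trans (ℕP.+-monoˡ-< j (ℕP.≰⇒> q))
                    (ℕP.≤-trans (ℕP.≤-reflexive (ℕP.+-comm d j)) (ℕP.+-monoˡ-≤ d (ℕP.m≤m+n j j))))))) (𝔽R.zeroʳ _)

  -- Ternary forms

  record Form : Set where
    field a₁₁ a₁₂ a₁₃ a₂₂ a₂₃ a₃₃ : Poly

  qb : Form → Poly → Poly → Poly
  qb M x y = (a₁₁ ⊠ (x ⊠ x) ⊞ a₂₂ ⊠ (y ⊠ y)) ⊞ (a₁₂ ⊠ (x ⊠ y) ⊞ a₁₂ ⊠ (x ⊠ y))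
    where open Form M

  -- The form on the plane z = 1 without its constant a₃₃. Off-diagonal terms occur twice because
  -- the coefficients are entries of the Gram matrix.
  qa : Form → Poly → Poly → Poly
  qa M x y = qb M x y ⊞ ((a₁₃ ⊠ x ⊞ a₂₃ ⊠ y) ⊞ (a₁₃ ⊠ x ⊞ a₂₃ ⊠ y))
    where open Form M

  qt : Form → Poly → Poly → Poly → Poly
  qt M x y z = (qb M x y ⊞ a₃₃ ⊠ (z ⊠ z)) ⊞ ((a₁₃ ⊠ (x ⊠ z) ⊞ a₂₃ ⊠ (y ⊠ z)) ⊞ (a₁₃ ⊠ (x ⊠ z) ⊞ a₂₃ ⊠ (y ⊠ z)))
    where open Form M

  Aniso : F → F → Set
  Aniso α β = ∀ u v → α * (u * u) + β * (v * v) ≡ 0# → u ≡ 0# × v ≡ 0#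

  -- What remains of reducedness and definiteness after clearing denominators. `aniso`, `α₃≢0` and
  -- the two parity fields exclude cancellation between the leading diagonal terms of a value.
  record ReducedForm (M : Form) (d₁ d₂ d₃ : ℕ) : Set where
    open Form M
    field
      b₁₁ : Bd (suc d₁) a₁₁
      b₂₂ : Bd (suc d₂) a₂₂
      b₃₃ : Bd (suc d₃) a₃₃
      b₁₂ : Bd d₁ a₁₂
      b₁₃ : Bd d₁ a₁₃
      b₂₃ : Bd d₂ a₂₃
      d₁<d₂ : d₁ ℕ.< d₂
      d₂<d₃ : d₂ ℕ.< d₃
      aniso : Aniso (coeff a₁₁ d₁) (coeff a₂₂ d₂)
      α₃≢0  : coeff a₃₃ d₃ ≢ 0#
      par₁  : ∀ e f → e ℕ.+ e ℕ.+ d₁ ≢ f ℕ.+ f ℕ.+ d₃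
      par₂  : ∀ e f → e ℕ.+ e ℕ.+ d₂ ≢ f ℕ.+ f ℕ.+ d₃

  module Levels {M d₁ d₂ d₃} (R : ReducedForm M d₁ d₂ d₃) where
    open Form M
    open ReducedForm R

    Level₂< : ℕ → Poly → Poly → Set
    Level₂< N x y = W (suc d₁) N x × W (suc d₂) N y

    -- The strict bounds 2 deg x + d₁ < N and so on: each diagonal term of the value has degree
    -- below N.
    Level< : ℕ → Poly → Poly → Poly → Set
    Level< N x y z = W (suc d₁) N x × W (suc d₂) N y × W (suc d₃) N z

    qb-cross : ∀ {N x y} → W d₁ N x → W d₂ N y → Bd N (a₁₂ ⊠ (x ⊠ y) ⊞ a₁₂ ⊠ (x ⊠ y))
    qb-cross {x = x} {y} wx wy = Bd-+ _ _ cr cr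
      where cr = cross-< a₁₂ x y (ℕP.<⇒≤ d₁<d₂) b₁₂ wx wy

    qa-linear : ∀ {N x y} → W d₁ N x → W d₂ N y → Bd N ((a₁₃ ⊠ x ⊞ a₂₃ ⊠ y) ⊞ (a₁₃ ⊠ x ⊞ a₂₃ ⊠ y))
    qa-linear {x = x} {y} wx wy = Bd-+ _ _ cr cr
      where cr = Bd-+ _ _ (linear-< a₁₃ x b₁₃ wx) (linear-< a₂₃ y b₂₃ wy)

    qt-cross : ∀ {N x y z} → W d₁ N x → W d₂ N y → W d₃ N z →
               Bd N ((a₁₃ ⊠ (x ⊠ z) ⊞ a₂₃ ⊠ (y ⊠ z)) ⊞ (a₁₃ ⊠ (x ⊠ z) ⊞ a₂₃ ⊠ (y ⊠ z)))
    qt-cross {x = x} {y} {z} wx wy wz = Bd-+ _ _ cr cr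
      where cr = Bd-+ _ _ (cross-< a₁₃ x z (ℕP.<⇒≤ (ℕP.<-trans d₁<d₂ d₂<d₃)) b₁₃ wx wz) (cross-< a₂₃ y z (ℕP.<⇒≤ d₂<d₃) b₂₃ wy wz)

    qb-bound : ∀ {N x y} → Level₂< N x y → Bd N (qb M x y)
    qb-bound {x = x} {y} (wx , wy) = Bd-+ _ _ (Bd-+ _ _ (diag-< a₁₁ x b₁₁ wx) (diag-< a₂₂ y b₂₂ wy)) (qb-cross (W-weaken wx) (W-weaken wy))

    qa-bound : ∀ {N x y} → Level₂< N x y → Bd N (qa M x y)
    qa-bound l@(wx , wy) = Bd-+ _ _ (qb-bound l) (qa-linear (W-weaken wx) (W-weaken wy))

    private
      drop0 : ∀ p r {N} → Bd N r → coeff (p ⊞ r) N ≡ coeff p N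
      drop0 p r {N} b = trans (coeff-⊞ p r N) (trans (cong (λ z → coeff p N + z) (bz b N ℕP.≤-refl)) (𝔽R.+-identityʳ _))

      qb-coeff : ∀ {N x y a b} → W d₁ N x → W d₂ N y → coeff (a₁₁ ⊠ (x ⊠ x)) N ≡ a → coeff (a₂₂ ⊠ (y ⊠ y)) N ≡ b →
                 coeff (qb M x y) N ≡ a + b
      qb-coeff {N} {x} {y} wx wy e₁ e₂ = trans (drop0 (a₁₁ ⊠ (x ⊠ x) ⊞ a₂₂ ⊠ (y ⊠ y)) _ (qb-cross wx wy))
        (trans (coeff-⊞ (a₁₁ ⊠ (x ⊠ x)) (a₂₂ ⊠ (y ⊠ y)) N) (cong₂ _+_ e₁ e₂))

    qa-step : ∀ {N x y} → Level₂< (suc N) x y → coeff (qa M x y) N ≡ 0# → Level₂< N x y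
    qa-step {N} {x} {y} (wx , wy) z with diag-coeff a₁₁ x b₁₁ (W-pred wx) | diag-coeff a₂₂ y b₂₂ (W-pred wy)
    ... | h₁ , e₁ , f₁ , _ | h₂ , e₂ , f₂ , _ = f₁ (proj₁ hh) , f₂ (proj₂ hh)
      where
      hh = aniso h₁ h₂ (trans (sym (trans (drop0 (qb M x y) _ (qa-linear (W-pred wx) (W-pred wy)))
             (qb-coeff (W-pred wx) (W-pred wy) e₁ e₂))) z)

    -- The coefficient of the value at N is α₁h₁² + α₂h₂² + α₃h₃². By parity h₃ cannot be nonzero
    -- together with h₁ or h₂, and the first two terms are anisotropic; so all three h vanish and
    -- every bound drops by one.
    qt-step : ∀ {N x y z} → Level< (suc N) x y z → coeff (qt M x y z) N ≡ 0# → Level< N x y z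
    qt-step {N} {x} {y} {z} (wx , wy , wz) c≡0
      with diag-coeff a₁₁ x b₁₁ (W-pred wx) | diag-coeff a₂₂ y b₂₂ (W-pred wy) | diag-coeff a₃₃ z b₃₃ (W-pred wz)
    ... | h₁ , e₁ , f₁ , g₁ | h₂ , e₂ , f₂ , g₂ | h₃ , e₃ , f₃ , g₃ = case (h₃ ≟ 0#) (h₁ ≟ 0#) (h₂ ≟ 0#)
      where
      A B C : F
      A = coeff a₁₁ d₁ * (h₁ * h₁)
      B = coeff a₂₂ d₂ * (h₂ * h₂)
      C = coeff a₃₃ d₃ * (h₃ * h₃)
      sum0 : (A + B) + C ≡ 0#
      sum0 = trans (sym (trans (drop0 (qb M x y ⊞ a₃₃ ⊠ (z ⊠ z)) _ (qt-cross (W-pred wx) (W-pred wy) (W-pred wz)))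
        (trans (coeff-⊞ (qb M x y) (a₃₃ ⊠ (z ⊠ z)) N) (cong₂ _+_ (qb-coeff (W-pred wx) (W-pred wy) e₁ e₂) e₃)))) c≡0
      a*0 : ∀ a {h} → h ≡ 0# → a * (h * h) ≡ 0#
      a*0 a refl = trans (cong (a *_) (𝔽R.zeroˡ _)) (𝔽R.zeroʳ _)
      case : Dec (h₃ ≡ 0#) → Dec (h₁ ≡ 0#) → Dec (h₂ ≡ 0#) → Level< N x y z
      case (yes z₃) _ _ = f₁ (proj₁ hh) , f₂ (proj₂ hh) , f₃ z₃
        where hh = aniso h₁ h₂ (trans (sym (trans (cong (A + B +_) (a*0 _ z₃)) (𝔽R.+-identityʳ _))) sum0)
      case (no n₃) (no n₁) _ with g₃ n₃ | g₁ n₁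
      ... | f , p | e , r = ⊥-elim (par₁ e f (trans (sym r) p))
      case (no n₃) (yes _) (no n₂) with g₃ n₃ | g₂ n₂
      ... | f , p | e , r = ⊥-elim (par₂ e f (trans (sym r) p))
      case (no n₃) (yes z₁) (yes z₂) = ⊥-elim (*-nonzero α₃≢0 (*-nonzero n₃ n₃)
        (trans (sym (trans (cong (_+ C) (trans (cong₂ _+_ (a*0 _ z₁) (a*0 _ z₂)) (𝔽R.+-identityˡ _))) (𝔽R.+-identityˡ _))) sum0))

    -- The lengths of the coordinate lists supply some starting level. As long as the coefficients
    -- of the value vanish, the level drops by one at a time, down to N.
    descend : (P : ℕ → Set) (c : ℕ → F) → (∀ N → P (suc N) → c N ≡ 0# → P N) →
              ∀ N → (∀ e → N ℕ.≤ e → c e ≡ 0#) → ∀ k → P (k ℕ.+ N) → P N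
    descend P c step N b zero    p = p
    descend P c step N b (suc k) p = descend P c step N b k (step (k ℕ.+ N) p (b (k ℕ.+ N) (ℕP.m≤n+m N k)))

    qa-level : ∀ {N x y} → Bd N (qa M x y) → Level₂< N x y
    qa-level {N} {x} {y} b = descend (λ N → Level₂< N x y) (coeff (qa M x y)) (λ N → qa-step) N (bz b) (X ℕ.+ Y)
      ( W-length d₁ x _ (ℕP.≤-trans (ℕP.m≤m+n X Y) (ℕP.m≤m+n _ N))
      , W-length d₂ y _ (ℕP.≤-trans (ℕP.m≤n+m Y X) (ℕP.m≤m+n _ N)))
      where X = length x ℕ.+ length x ℕ.+ d₁
            Y = length y ℕ.+ length y ℕ.+ d₂

    qt-level : ∀ {N x y z} → Bd N (qt M x y z) → Level< N x y z
    qt-level {N} {x} {y} {z} b = descend (λ N → Level< N x y z) (coeff (qt M x y z)) (λ N → qt-step) N (bz b) (X ℕ.+ Y ℕ.+ Z)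
      ( W-length d₁ x _ (ℕP.≤-trans (ℕP.≤-trans (ℕP.m≤m+n X Y) (ℕP.m≤m+n _ Z)) (ℕP.m≤m+n _ N))
      , W-length d₂ y _ (ℕP.≤-trans (ℕP.≤-trans (ℕP.m≤n+m Y X) (ℕP.m≤m+n _ Z)) (ℕP.m≤m+n _ N))
      , W-length d₃ z _ (ℕP.≤-trans (ℕP.m≤n+m Z (X ℕ.+ Y)) (ℕP.m≤m+n _ N)))
      where X = length x ℕ.+ length x ℕ.+ d₁
            Y = length y ℕ.+ length y ℕ.+ d₂
            Z = length z ℕ.+ length z ℕ.+ d₃

  -- Bilinear forms over a commutative ring

  module Bilinear (R : CommutativeRing 0ℓ 0ℓ) where
    open CommutativeRing R hiding (zero; refl; sym; trans) renaming (Carrier to C; _+_ to _⟨+⟩_; _*_ to _⟨*⟩_)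
    open CommutativeRing R using () renaming (refl to ≈refl; sym to ≈sym; trans to ≈trans)
    open RingSolver R
    open import Relation.Binary.Reasoning.Setoid setoid

    infixl 6 _+ᵣ_
    infixl 7 _*ᵣ_
    _+ᵣ_ _*ᵣ_ : C → C → C
    _+ᵣ_ = _⟨+⟩_
    _*ᵣ_ = _⟨*⟩_

    S : (Fin 3 → C) → C
    S = Σ3 _⟨+⟩_

    S-cong : ∀ {f g} → (∀ i → f i ≈ g i) → S f ≈ S g
    S-cong e = +-cong (e zero) (+-cong (e (suc zero)) (e (suc (suc zero))))

    S-+ : ∀ f g → S (λ i → f i +ᵣ g i) ≈ S f +ᵣ S g
    S-+ f g = solve 6 (λ a b c d e h → (a :+ b) :+ ((c :+ d) :+ (e :+ h)) := (a :+ (c :+ e)) :+ (b :+ (d :+ h))) ≈refl (f zero) (g zero) (f (suc zero)) (g (suc zero)) (f (suc (suc zero))) (g (suc (suc zero)))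

    S-* : ∀ k f → S (λ i → k *ᵣ f i) ≈ k *ᵣ S f
    S-* k f = solve 4 (λ k a b c → k :* a :+ (k :* b :+ k :* c) := k :* (a :+ (b :+ c))) ≈refl k (f zero) (f (suc zero)) (f (suc (suc zero)))

    bf : (Fin 3 → Fin 3 → C) → (Fin 3 → C) → (Fin 3 → C) → C
    bf N u v = S λ i → S λ j → N i j *ᵣ (u i *ᵣ v j)

    bf-cong : ∀ {N N' u u' v v'} → (∀ i j → N i j ≈ N' i j) → (∀ i → u i ≈ u' i) → (∀ i → v i ≈ v' i) → bf N u v ≈ bf N' u' v'
    bf-cong e f g = S-cong λ i → S-cong λ j → *-cong (e i j) (*-cong (f i) (g j))

    bf-+ˡ : ∀ N u u' v → bf N (λ i → u i +ᵣ u' i) v ≈ bf N u v +ᵣ bf N u' v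
    bf-+ˡ N u u' v = ≈trans (S-cong λ i → ≈trans (S-cong λ j →
        solve 4 (λ n a b v → n :* ((a :+ b) :* v) := n :* (a :* v) :+ n :* (b :* v)) ≈refl (N i j) (u i) (u' i) (v j))
        (S-+ (λ j → N i j *ᵣ (u i *ᵣ v j)) (λ j → N i j *ᵣ (u' i *ᵣ v j))))
      (S-+ (λ i → S λ j → N i j *ᵣ (u i *ᵣ v j)) (λ i → S λ j → N i j *ᵣ (u' i *ᵣ v j)))

    bf-*ˡ : ∀ N k u v → bf N (λ i → k *ᵣ u i) v ≈ k *ᵣ bf N u v
    bf-*ˡ N k u v = ≈trans (S-cong λ i → ≈trans (S-cong λ j →
        solve 4 (λ n k a v → n :* ((k :* a) :* v) := k :* (n :* (a :* v))) ≈refl (N i j) k (u i) (v j))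
        (S-* k (λ j → N i j *ᵣ (u i *ᵣ v j))))
      (S-* k (λ i → S λ j → N i j *ᵣ (u i *ᵣ v j)))

    bf-scale : ∀ k N u v → bf (λ i j → k *ᵣ N i j) u v ≈ k *ᵣ bf N u v
    bf-scale k N u v = ≈trans (S-cong λ i → ≈trans (S-cong λ j → *-assoc k (N i j) (u i *ᵣ v j))
        (S-* k (λ j → N i j *ᵣ (u i *ᵣ v j))))
      (S-* k (λ i → S λ j → N i j *ᵣ (u i *ᵣ v j)))

    bf-flip : ∀ N u v → bf N u v ≈ bf (λ i j → N j i) v u
    bf-flip N u v = ≈trans (S-cong λ i → S-cong λ j → *-congˡ {N i j} (*-comm (u i) (v j)))
      (solve 9 (λ a b c d e f g h k → (a :+ (b :+ c)) :+ ((d :+ (e :+ f)) :+ (g :+ (h :+ k))) := (a :+ (d :+ g)) :+ ((b :+ (e :+ h)) :+ (c :+ (f :+ k)))) ≈refl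
        (t zero zero) (t zero (suc zero)) (t zero (suc (suc zero))) (t (suc zero) zero) (t (suc zero) (suc zero)) (t (suc zero) (suc (suc zero)))
        (t (suc (suc zero)) zero) (t (suc (suc zero)) (suc zero)) (t (suc (suc zero)) (suc (suc zero))))
      where t : Fin 3 → Fin 3 → C
            t i j = N i j *ᵣ (v j *ᵣ u i)

    app : (Fin 3 → Fin 3 → C) → (Fin 3 → C) → Fin 3 → C
    app P x i = S λ a → P i a *ᵣ x a

    bf-appˡ : ∀ N P x v → bf N (app P x) v ≈ S λ a → x a *ᵣ bf N (λ i → P i a) v
    bf-appˡ N P x v = ≈trans
      (bf-cong {N} {N} {app P x} {λ i → t zero i +ᵣ (t (suc zero) i +ᵣ t (suc (suc zero)) i)} {v} {v} (λ _ _ → ≈refl)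
        (λ i → +-cong (*-comm _ _) (+-cong (*-comm _ _) (*-comm _ _))) (λ _ → ≈refl))
      (≈trans (bf-+ˡ N (t zero) (λ i → t (suc zero) i +ᵣ t (suc (suc zero)) i) v) (+-cong (bf-*ˡ N (x zero) (λ i → P i zero) v)
      (≈trans (bf-+ˡ N (t (suc zero)) (t (suc (suc zero))) v)
        (+-cong (bf-*ˡ N (x (suc zero)) (λ i → P i (suc zero)) v) (bf-*ˡ N (x (suc (suc zero))) (λ i → P i (suc (suc zero))) v)))))
      where t : Fin 3 → Fin 3 → C
            t a i = x a *ᵣ P i a

    bf-appʳ : ∀ N P u x → bf N u (app P x) ≈ S λ b → x b *ᵣ bf N u (λ i → P i b)
    bf-appʳ N P u x = ≈trans (bf-flip N u (app P x)) (≈trans (bf-appˡ (λ i j → N j i) P x u) (S-cong λ b → *-congˡ {x b} (bf-flip (λ i j → N j i) (λ i → P i b) u)))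

    bf-congr : ∀ N P x y → bf N (app P x) (app P y) ≈ bf (λ a b → bf N (λ i → P i a) (λ i → P i b)) x y
    bf-congr N P x y = ≈trans (bf-appˡ N P x (app P y)) (S-cong λ a → ≈trans (*-congˡ {x a} (bf-appʳ N P (λ i → P i a) y))
      (≈trans (≈sym (S-* (x a) (λ b → y b *ᵣ bf N (λ i → P i a) (λ i → P i b))))
        (S-cong λ b → solve 3 (λ x y m → x :* (y :* m) := m :* (x :* y)) ≈refl (x a) (y b) (bf N (λ i → P i a) (λ i → P i b)))))

    bf-comb : ∀ N s t u u' v → bf N (λ i → s *ᵣ u i +ᵣ t *ᵣ u' i) v ≈ s *ᵣ bf N u v +ᵣ t *ᵣ bf N u' v
    bf-comb N s t u u' v = ≈trans (bf-+ˡ N (λ i → s *ᵣ u i) (λ i → t *ᵣ u' i) v) (+-cong (bf-*ˡ N s u v) (bf-*ˡ N t u' v))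

    bf-quad : ∀ N s t u u' → (∀ i j → N i j ≈ N j i) →
              bf N (λ i → s *ᵣ u i +ᵣ t *ᵣ u' i) (λ i → s *ᵣ u i +ᵣ t *ᵣ u' i)
              ≈ (s *ᵣ s *ᵣ bf N u u +ᵣ t *ᵣ t *ᵣ bf N u' u') +ᵣ (s *ᵣ t *ᵣ bf N u u' +ᵣ s *ᵣ t *ᵣ bf N u u')
    bf-quad N s t u u' symN = begin
      bf N w w                                                ≈⟨ bf-comb N s t u u' w ⟩
      s *ᵣ bf N u w +ᵣ t *ᵣ bf N u' w                         ≈⟨ +-cong (*-congˡ (right u)) (*-congˡ (right u')) ⟩
      s *ᵣ (s *ᵣ bf N u u +ᵣ t *ᵣ bf N u u') +ᵣ t *ᵣ (s *ᵣ bf N u' u +ᵣ t *ᵣ bf N u' u')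
                                                              ≈⟨ +-congˡ (*-congˡ (+-congʳ (*-congˡ (flip u' u)))) ⟩
      s *ᵣ (s *ᵣ bf N u u +ᵣ t *ᵣ bf N u u') +ᵣ t *ᵣ (s *ᵣ bf N u u' +ᵣ t *ᵣ bf N u' u')
        ≈⟨ solve 5 (λ s t a b c → s :* (s :* a :+ t :* b) :+ t :* (s :* b :+ t :* c) := (s :* s :* a :+ t :* t :* c) :+ (s :* t :* b :+ s :* t :* b)) ≈refl s t (bf N u u) (bf N u u') (bf N u' u') ⟩
      (s *ᵣ s *ᵣ bf N u u +ᵣ t *ᵣ t *ᵣ bf N u' u') +ᵣ (s *ᵣ t *ᵣ bf N u u' +ᵣ s *ᵣ t *ᵣ bf N u u') ∎
      where
      w : Fin 3 → C
      w i = s *ᵣ u i +ᵣ t *ᵣ u' i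
      flip : ∀ u v → bf N u v ≈ bf N v u
      flip u v = ≈trans (bf-flip N u v) (bf-cong {λ i j → N j i} {N} {v} {v} {u} {u} (λ i j → symN j i) (λ _ → ≈refl) (λ _ → ≈refl))
      right : ∀ v → bf N v w ≈ s *ᵣ bf N v u +ᵣ t *ᵣ bf N v u'
      right v = ≈trans (flip v w) (≈trans (bf-comb N s t u u' v) (+-cong (*-congˡ (flip u v)) (*-congˡ (flip u' v))))

  module PB = Bilinear polyRing
  module LB = Bilinear laurentRing

  -- Clearing denominators

  -- The polynomial p is K x. Fractions cleared by the same K are compared through their p.
  record Clears (K : Poly) (x : Frac) (p : Poly) : Set where
    constructor clears
    field
      den≉0  : ¬ (den x ≋ 0P)
      cross  : num x ⊠ K ≋ p ⊠ den x
  open Clears public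

  opaque
    unfolding _⊞_

    ≈K⇒cross : ∀ {x y} → x ≈K y → num x ⊠ den y ≋ num y ⊠ den x
    ≈K⇒cross e = mk≋ e

    cross⇒≈K : ∀ {x y} → num x ⊠ den y ≋ num y ⊠ den x → x ≈K y
    cross⇒≈K e = at e

    clears-+K : ∀ {K x y p} → ¬ (den x ⊠ den y ≋ 0P) →
                (num x ⊠ den y ⊞ num y ⊠ den x) ⊠ K ≋ p ⊠ (den x ⊠ den y) → Clears K (x +K y) p
    clears-+K = clears

    clears-*K : ∀ {K x u p} → ¬ (den x ⊠ 1P ≋ 0P) → (num x ⊠ u) ⊠ K ≋ p ⊠ (den x ⊠ 1P) → Clears K (x *K fromPoly u) p
    clears-*K = clears

  module _ (K : Poly) where

    Clears-+ : ∀ {x y p r} → Clears K x p → Clears K y r → Clears K (x +K y) (p ⊞ r)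
    Clears-+ {x} {y} {p} {r} (clears dx ex) (clears dy ey) = clears-+K {K} {x} {y} (⊠-nonzero dx dy) (begin
      (num x ⊠ den y ⊞ num y ⊠ den x) ⊠ K
        ≈⟨ PS.solve 5 (λ nx dx ny dy k → (nx PS.:* dy PS.:+ ny PS.:* dx) PS.:* k PS.:= (nx PS.:* k) PS.:* dy PS.:+ (ny PS.:* k) PS.:* dx) PR.refl (num x) (den x) (num y) (den y) K ⟩
      (num x ⊠ K) ⊠ den y ⊞ (num y ⊠ K) ⊠ den x
        ≈⟨ PR.+-cong (PR.*-congʳ ex) (PR.*-congʳ ey) ⟩
      (p ⊠ den x) ⊠ den y ⊞ (r ⊠ den y) ⊠ den x
        ≈⟨ PS.solve 4 (λ p r a b → (p PS.:* a) PS.:* b PS.:+ (r PS.:* b) PS.:* a PS.:= (p PS.:+ r) PS.:* (a PS.:* b)) PR.refl p r (den x) (den y) ⟩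
      (p ⊞ r) ⊠ (den x ⊠ den y) ∎)
      where open import Relation.Binary.Reasoning.Setoid PR.setoid

    1P≉0 : ¬ (1P ≋ 0P)
    1P≉0 e = 0≢1 (sym (at e 0))

    Clears-* : ∀ {x p} u → Clears K x p → Clears K (x *K fromPoly u) (p ⊠ u)
    Clears-* {x} {p} u (clears dx ex) = clears-*K {K} {x} {u} (⊠-nonzero dx 1P≉0)
      (PR.trans (PS.solve 3 (λ n u k → n PS.:* u PS.:* k PS.:= (n PS.:* k) PS.:* u) PR.refl (num x) u K)
      (PR.trans (PR.*-congʳ ex) (PR.trans (PS.solve 3 (λ p d u → p PS.:* d PS.:* u PS.:= (p PS.:* u) PS.:* d) PR.refl p (den x) u)
        (PR.*-congˡ (PR.sym (PR.*-identityʳ (den x)))))))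

    Clears-bil : ∀ L N → (∀ i j → Clears K (gram L i j) (N i j)) → ∀ u v → Clears K (bil L u v) (PB.bf N u v)
    Clears-bil L N cl u v = Clears-+ (row zero) (Clears-+ (row (suc zero)) (row (suc (suc zero))))
      where
      t : ∀ i j → Clears K (gram L i j *K fromPoly (u i *P v j)) (N i j ⊠ (u i ⊠ v j))
      t i j = subst (λ z → Clears K (gram L i j *K fromPoly z) (N i j ⊠ (u i ⊠ v j))) (⊠-def (u i) (v j)) (Clears-* (u i ⊠ v j) (cl i j))
      row : ∀ i → Clears K (Σ3 _+K_ λ j → gram L i j *K fromPoly (u i *P v j)) (PB.S λ j → N i j ⊠ (u i ⊠ v j))
      row i = Clears-+ (t i zero) (Clears-+ (t i (suc zero)) (t i (suc (suc zero))))

    ≈K⇒≋ : ∀ {x y p r} → ¬ (K ≋ 0P) → Clears K x p → Clears K y r → x ≈K y → p ≋ r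
    ≈K⇒≋ {x} {y} {p} {r} K≉0 (clears dx ex) (clears dy ey) e = ⊠-cancelˡ (⊠-nonzero dx dy) (begin
      (den x ⊠ den y) ⊠ p     ≈⟨ PS.solve 3 (λ a b p → (a PS.:* b) PS.:* p PS.:= (p PS.:* a) PS.:* b) PR.refl (den x) (den y) p ⟩
      (p ⊠ den x) ⊠ den y     ≈⟨ PR.*-congʳ (PR.sym ex) ⟩
      (num x ⊠ K) ⊠ den y     ≈⟨ PS.solve 3 (λ n k d → (n PS.:* k) PS.:* d PS.:= (n PS.:* d) PS.:* k) PR.refl (num x) K (den y) ⟩
      (num x ⊠ den y) ⊠ K     ≈⟨ PR.*-congʳ (≈K⇒cross {x} {y} e) ⟩
      (num y ⊠ den x) ⊠ K     ≈⟨ PS.solve 3 (λ n k d → (n PS.:* d) PS.:* k PS.:= (n PS.:* k) PS.:* d) PR.refl (num y) K (den x) ⟩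
      (num y ⊠ K) ⊠ den x     ≈⟨ PR.*-congʳ ey ⟩
      (r ⊠ den y) ⊠ den x     ≈⟨ PS.solve 3 (λ a b p → (p PS.:* b) PS.:* a PS.:= (a PS.:* b) PS.:* p) PR.refl (den x) (den y) r ⟩
      (den x ⊠ den y) ⊠ r     ∎)
      where open import Relation.Binary.Reasoning.Setoid PR.setoid

    ≋⇒≈K : ∀ {x y p r} → ¬ (K ≋ 0P) → Clears K x p → Clears K y r → p ≋ r → x ≈K y
    ≋⇒≈K {x} {y} {p} {r} K≉0 (clears dx ex) (clears dy ey) e = cross⇒≈K {x} {y} (⊠-cancelˡ K≉0 (begin
      K ⊠ (num x ⊠ den y)     ≈⟨ PS.solve 3 (λ n k d → k PS.:* (n PS.:* d) PS.:= (n PS.:* k) PS.:* d) PR.refl (num x) K (den y) ⟩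
      (num x ⊠ K) ⊠ den y     ≈⟨ PR.*-congʳ ex ⟩
      (p ⊠ den x) ⊠ den y     ≈⟨ PR.*-congʳ (PR.*-congʳ e) ⟩
      (r ⊠ den x) ⊠ den y     ≈⟨ PS.solve 3 (λ a b p → (p PS.:* a) PS.:* b PS.:= (p PS.:* b) PS.:* a) PR.refl (den x) (den y) r ⟩
      (r ⊠ den y) ⊠ den x     ≈⟨ PR.*-congʳ (PR.sym ey) ⟩
      (num y ⊠ K) ⊠ den x     ≈⟨ PS.solve 3 (λ n k d → (n PS.:* k) PS.:* d PS.:= k PS.:* (n PS.:* d)) PR.refl (num y) K (den x) ⟩
      K ⊠ (num y ⊠ den x)     ∎))
      where open import Relation.Binary.Reasoning.Setoid PR.setoid

    Clears-/ : ¬ (K ≋ 0P) → ∀ p → Clears K (p / K) p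
    Clears-/ K≉0 p = clears K≉0 PR.refl

  -- The properties in question pass to multiples, so finitely many nonzero witnesses can be
  -- replaced by their product. Nested use covers all entries of both Gram matrices.
  common-multiple : ∀ {n} (Φ : Fin n → Poly → Set) → (∀ i p r → Φ i p → Φ i (p ⊠ r)) → (∀ i p r → p ≋ r → Φ i p → Φ i r) →
                    (∀ i → ∃ λ p → ¬ (p ≋ 0P) × Φ i p) → ∃ λ p → ¬ (p ≋ 0P) × (∀ i → Φ i p)
  common-multiple {zero} Φ m r f = 1P , (λ e → 0≢1 (sym (at e 0))) , λ ()
  common-multiple {suc n} Φ m r f with f zero | common-multiple (Φ ∘ suc) (m ∘ suc) (r ∘ suc) (f ∘ suc)
  ... | p , np , fp | p' , np' , fp' = p ⊠ p' , ⊠-nonzero np np' ,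
    λ { zero → m zero p p' fp ; (suc i) → r (suc i) (p' ⊠ p) (p ⊠ p') (PR.*-comm p' p) (m (suc i) p' p (fp' i)) }

  Clearable : Frac → Poly → Set
  Clearable x K = ∃ λ p → Clears K x p

  Clearable-* : ∀ x K D → Clearable x K → Clearable x (K ⊠ D)
  Clearable-* x K D (p , clears d e) = p ⊠ D , clears d (PR.trans (PR.sym (PR.*-assoc (num x) K D)) (PR.trans (PR.*-congʳ e)
    (PS.solve 3 (λ p d k → p PS.:* d PS.:* k PS.:= p PS.:* k PS.:* d) PR.refl p (den x) D)))

  Clearable-resp : ∀ x K D → K ≋ D → Clearable x K → Clearable x D
  Clearable-resp x K D e (p , clears d f) = p , clears d (PR.trans (PR.*-congˡ (PR.sym e)) f)

  -- One K serves both lattices, so that a common value p/K corresponds to the same polynomial p on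
  -- either side.
  common-denominator : ∀ L L' → ∃ λ K → ¬ (K ≋ 0P) × (∀ i j → Clearable (gram L i j) K) × (∀ i j → Clearable (gram L' i j) K)
  common-denominator L L' with common-multiple {2} Φ
      (λ { zero p r f i j → Clearable-* (gram L i j) p r (f i j) ; (suc zero) p r f i j → Clearable-* (gram L' i j) p r (f i j) })
      (λ { zero p r e f i j → Clearable-resp (gram L i j) p r e (f i j) ; (suc zero) p r e f i j → Clearable-resp (gram L' i j) p r e (f i j) })
      (λ { zero → matrix L ; (suc zero) → matrix L' })
    where
    Φ : Fin 2 → Poly → Set
    Φ zero       K = ∀ i j → Clearable (gram L i j) K
    Φ (suc zero) K = ∀ i j → Clearable (gram L' i j) K
    entry : ∀ (L : TernaryLattice) i j → ∃ λ K → ¬ (K ≋ 0P) × Clearable (gram L i j) K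
    entry L i j = den (gram L i j) , (λ e → valid L i j (at e)) , num (gram L i j) , clears (λ e → valid L i j (at e)) PR.refl
    matrix : ∀ (L : TernaryLattice) → ∃ λ K → ¬ (K ≋ 0P) × (∀ i j → Clearable (gram L i j) K)
    matrix L = common-multiple (λ i K → ∀ j → Clearable (gram L i j) K) (λ i p r f j → Clearable-* (gram L i j) p r (f j)) (λ i p r e f j → Clearable-resp (gram L i j) p r e (f j))
      λ i → common-multiple (λ j K → Clearable (gram L i j) K) (λ j p r → Clearable-* (gram L i j) p r) (λ j p r → Clearable-resp (gram L i j) p r) (entry L i)
  ... | K , nz , f = K , nz , f zero , f (suc zero)

  -- Clearing adds n = deg K to all degrees, which turns the integer minima into natural numbers.
  degK-just : ∀ {K x p n μ} → Deg= n K → Clears K x p → degK x ≡ just μ → ∃ λ m → Deg= m p × pos m ≡ μ ℤ.+ pos n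
  degK-just {K} {x} {p} {n} {μ} dK (clears dx ex) e with degP (num x) | degP-spec (num x) | degP (den x) | degP-spec (den x)
  degK-just dK (clears dx ex) () | _ | inj₁ (refl , _) | _ | _
  ... | _ | inj₂ _ | _ | inj₁ (refl , z) = ⊥-elim (dx z)
  degK-just {K} {x} {p} {n} {μ} dK (clears dx ex) refl | .(just a) | inj₂ (a , refl , da) | .(just b) | inj₂ (b , refl , db)
    with degree p
  ... | inj₁ z = ⊥-elim (⊠-nonzero (Deg=⇒≉0 da) (Deg=⇒≉0 dK) (PR.trans ex (PR.trans (PR.*-congʳ z) (PR.zeroˡ (den x)))))
  ... | inj₂ (m , dm) = m , dm , eq
    where
    s : a ℕ.+ n ≡ m ℕ.+ b
    s = Deg=-unique (Deg=-resp ex (Deg=-* (num x) K da dK)) (Deg=-* p (den x) dm db)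
    eq : pos m ≡ pos a ℤ.- pos b ℤ.+ pos n
    eq = ≡.trans (ℤS.solve 2 (λ m b → m ℤS.:= (m ℤS.:+ b) ℤS.:- b) refl (pos m) (pos b))
         (≡.trans (cong (λ z → z ℤ.- pos b) (cong pos (sym s)))
           (ℤS.solve 3 (λ a n b → (a ℤS.:+ n) ℤS.:- b ℤS.:= a ℤS.:- b ℤS.:+ n) refl (pos a) (pos n) (pos b)))

  degK-nothing : ∀ x → ¬ (den x ≋ 0P) → degK x ≡ nothing → num x ≋ 0P
  degK-nothing x dx e with degP (num x) | degP-spec (num x) | degP (den x) | degP-spec (den x)
  ... | _ | inj₁ (_ , z) | _ | _ = z
  ... | _ | inj₂ _ | _ | inj₁ (_ , z) = ⊥-elim (dx z)
  degK-nothing x dx () | .(just a) | inj₂ (a , refl , _) | .(just b) | inj₂ (b , refl , _)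

  degK-< : ∀ {K x p n m μ} → Deg= n K → Clears K x p → pos m ≡ μ ℤ.+ pos n → degK x <D just μ → Bd m p
  degK-< {K} {x} {p} {n} {m} {μ} dK cl em lt with degree p
  ... | inj₁ z = Bd-resp (PR.sym z) Bd-0
  ... | inj₂ (k , dk) with degK x in eq
  ...   | nothing = ⊥-elim (⊠-nonzero (Deg=⇒≉0 dk) (den≉0 cl) (PR.trans (PR.sym (cross cl))
                      (PR.trans (PR.*-congʳ (degK-nothing x (den≉0 cl) eq)) (PR.zeroˡ K))))
  ...   | just μ' with degK-just dK cl eq
  ...     | k' , dk' , e = Bd-mono (ℤP.drop‿+<+ (≡.subst₂ ℤ._<_ (sym (trans (cong pos (Deg=-unique dk dk')) e)) (sym em) (ℤP.+-monoˡ-< (pos n) lt))) (proj₁ dk)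

  -- Matrices and their inverses

  pattern i₀ = zero
  pattern i₁ = suc zero
  pattern i₂ = suc (suc zero)

  module Matrices (R : CommutativeRing 0ℓ 0ℓ) where
    open CommutativeRing R using (_≈_; +-cong; *-cong; *-congʳ; *-congˡ; +-assoc)
      renaming (Carrier to C; 0# to 0R; 1# to 1R; _+_ to _⟨+⟩_; _*_ to _⟨*⟩_; refl to ≈refl; sym to ≈sym; trans to ≈trans)
    open RingSolver R
    open Bilinear R

    app-cong : ∀ {A B x y} → (∀ i j → A i j ≈ B i j) → (∀ i → x i ≈ y i) → ∀ i → app A x i ≈ app B y i
    app-cong e f i = S-cong λ j → *-cong (e i j) (f j)

    app-app : ∀ A B x i → app A (app B x) i ≈ app (λ i j → S λ k → A i k ⟨*⟩ B k j) x i
    app-app A B x i = solve 15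
      (λ a b c x y z p q r s t u v w k →
          a :* (p :* x :+ (q :* y :+ r :* z)) :+ (b :* (s :* x :+ (t :* y :+ u :* z)) :+ c :* (v :* x :+ (w :* y :+ k :* z)))
       := (a :* p :+ (b :* s :+ c :* v)) :* x :+ ((a :* q :+ (b :* t :+ c :* w)) :* y :+ (a :* r :+ (b :* u :+ c :* k)) :* z)) ≈refl
      (A i i₀) (A i i₁) (A i i₂) (x i₀) (x i₁) (x i₂) (B i₀ i₀) (B i₀ i₁) (B i₀ i₂) (B i₁ i₀) (B i₁ i₁) (B i₁ i₂) (B i₂ i₀) (B i₂ i₁) (B i₂ i₂)

    record IsIdentity (J : Fin 3 → Fin 3 → C) : Set where
      field
        diag : ∀ i → J i i ≈ 1R
        off  : ∀ i j → i ≢ j → J i j ≈ 0R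

    app-identity : ∀ J → IsIdentity J → ∀ x i → app J x i ≈ x i
    app-identity J id x i = ≈trans (go i) (+-0 i)
      where
      open IsIdentity id
      δ : Fin 3 → Fin 3 → C
      δ i₀ i₀ = 1R
      δ i₀ (suc _) = 0R
      δ i₁ i₁ = 1R
      δ i₁ i₀ = 0R
      δ i₁ i₂ = 0R
      δ i₂ i₂ = 1R
      δ i₂ i₀ = 0R
      δ i₂ i₁ = 0R
      J≈δ : ∀ i j → J i j ≈ δ i j
      J≈δ i₀ i₀ = diag i₀
      J≈δ i₀ i₁ = off i₀ i₁ λ ()
      J≈δ i₀ i₂ = off i₀ i₂ λ ()
      J≈δ i₁ i₀ = off i₁ i₀ λ ()
      J≈δ i₁ i₁ = diag i₁
      J≈δ i₁ i₂ = off i₁ i₂ λ ()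
      J≈δ i₂ i₀ = off i₂ i₀ λ ()
      J≈δ i₂ i₁ = off i₂ i₁ λ ()
      J≈δ i₂ i₂ = diag i₂
      go : ∀ i → app J x i ≈ app δ x i
      go = app-cong {J} {δ} {x} {x} J≈δ (λ _ → ≈refl)
      +-0 : ∀ i → app δ x i ≈ x i
      +-0 i₀ = solve 3 (λ a b c → con (pos 1) :* a :+ (con (pos 0) :* b :+ con (pos 0) :* c) := a) ≈refl (x i₀) (x i₁) (x i₂)
      +-0 i₁ = solve 3 (λ a b c → con (pos 0) :* a :+ (con (pos 1) :* b :+ con (pos 0) :* c) := b) ≈refl (x i₀) (x i₁) (x i₂)
      +-0 i₂ = solve 3 (λ a b c → con (pos 0) :* a :+ (con (pos 0) :* b :+ con (pos 1) :* c) := c) ≈refl (x i₀) (x i₁) (x i₂)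

    app-inverse : ∀ A B → IsIdentity (λ i j → S λ k → A i k ⟨*⟩ B k j) → ∀ x i → app A (app B x) i ≈ x i
    app-inverse A B id x i = ≈trans (app-app A B x i) (app-identity _ id x i)

  module PM = Matrices polyRing
  module LM = Matrices laurentRing

  I3-identity : PM.IsIdentity I3
  I3-identity = record { diag = λ { i₀ → PR.refl ; i₁ → PR.refl ; i₂ → PR.refl } ; off = off' }
    where
    off' : ∀ i j → i ≢ j → I3 i j ≋ 0P
    off' i₀ i₀ n = ⊥-elim (n refl)
    off' i₀ i₁ _ = PR.refl
    off' i₀ i₂ _ = PR.refl
    off' i₁ i₀ _ = PR.refl
    off' i₁ i₁ n = ⊥-elim (n refl)
    off' i₁ i₂ _ = PR.refl
    off' i₂ i₀ _ = PR.refl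
    off' i₂ i₁ _ = PR.refl
    off' i₂ i₂ n = ⊥-elim (n refl)

  IsIdentity-resp : ∀ {A B} → (∀ i j → A i j ≋ B i j) → PM.IsIdentity A → PM.IsIdentity B
  IsIdentity-resp e id = record { diag = λ i → PR.trans (PR.sym (e i i)) (PM.IsIdentity.diag id i)
                                ; off = λ i j n → PR.trans (PR.sym (e i j)) (PM.IsIdentity.off id i j n) }

  opaque
    unfolding _⊞_

    ·v-def : ∀ P x i → (P ·v x) i ≡ PB.app P x i
    ·v-def P x i = refl

    ·M-identity : ∀ A B → (A ·M B) ≈M I3 → PM.IsIdentity (λ i j → PB.S λ k → A i k ⊠ B k j)
    ·M-identity A B e = IsIdentity-resp (λ i j → mk≋ λ n → sym (e i j n)) I3-identity

    identity-·M : ∀ A B → PM.IsIdentity (λ i j → PB.S λ k → A i k ⊠ B k j) → (A ·M B) ≈M I3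
    identity-·M A B id i j n with i FinP.≟ j
    ... | yes refl = at (PM.IsIdentity.diag id i) n
    ... | no ne = at (PM.IsIdentity.off id i j ne) n

  -- Values over K_∞ after clearing denominators

  opaque
    unfolding _⊕_

    Q∞-def : ∀ L X → Q∞ L X ≡ LB.bf (λ i j → fracL (gram L i j)) X X
    Q∞-def L X = refl

    fracL-def : ∀ x → fracL x ≡ polyL (num x) ⊗ invPolyL (den x)
    fracL-def x = refl

  fracL-clears : ∀ {K x p} → ¬ (K ≋ 0P) → Clears K x p → fracL x ≋L invPolyL K ⊗ polyL p
  fracL-clears {K} {x} {p} K≉0 (clears dx ex) = begin
    fracL x                                ≡⟨ fracL-def x ⟩
    n ⊗ di                                 ≈⟨ LR.*-identityʳ _ ⟨
    n ⊗ di ⊗ 1L                            ≈⟨ LR.*-congˡ (polyL-inverse K≉0) ⟨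
    n ⊗ di ⊗ (k ⊗ ki)                      ≈⟨ LS.solve 4 (λ n di k ki → n LS.:* di LS.:* (k LS.:* ki) LS.:= (n LS.:* k) LS.:* (di LS.:* ki)) LR.refl n di k ki ⟩
    (n ⊗ k) ⊗ (di ⊗ ki)                    ≈⟨ LR.*-congʳ (LR.trans (LR.sym (polyL-⊠ (num x) K)) (LR.trans (polyL-cong ex) (polyL-⊠ p (den x)))) ⟩
    (polyL p ⊗ d) ⊗ (di ⊗ ki)              ≈⟨ LS.solve 4 (λ p d di ki → (p LS.:* d) LS.:* (di LS.:* ki) LS.:= (d LS.:* di) LS.:* (ki LS.:* p)) LR.refl (polyL p) d di ki ⟩
    (d ⊗ di) ⊗ (ki ⊗ polyL p)              ≈⟨ LR.*-congʳ (polyL-inverse dx) ⟩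
    1L ⊗ (ki ⊗ polyL p)                    ≈⟨ LR.*-identityˡ _ ⟩
    ki ⊗ polyL p                           ∎
    where
    open import Relation.Binary.Reasoning.Setoid LR.setoid
    n = polyL (num x)
    d = polyL (den x)
    di = invPolyL (den x)
    k = polyL K
    ki = invPolyL K

  polyL-S : ∀ f → polyL (PB.S f) ≋L LB.S (polyL ∘ f)
  polyL-S f = LR.trans (polyL-⊞ (f i₀) (f i₁ ⊞ f i₂)) (LR.+-congˡ (polyL-⊞ (f i₁) (f i₂)))

  polyL-bf : ∀ N u v → polyL (PB.bf N u v) ≋L LB.bf (λ i j → polyL (N i j)) (polyL ∘ u) (polyL ∘ v)
  polyL-bf N u v = LR.trans (polyL-S (λ i → PB.S λ j → N i j ⊠ (u i ⊠ v j))) (LB.S-cong λ i →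
    LR.trans (polyL-S (λ j → N i j ⊠ (u i ⊠ v j))) (LB.S-cong λ j →
    LR.trans (polyL-⊠ (N i j) (u i ⊠ v j)) (LR.*-congˡ (polyL-⊠ (u i) (v j)))))

  -- The cleared Gram matrix of a lattice in the basis P

  module Cleared (K : Poly) (K≉0 : ¬ (K ≋ 0P)) (L : TernaryLattice) (P P⁻ : Mat3 Poly)
                 (PP⁻ : (P ·M P⁻) ≈M I3) (P⁻P : (P⁻ ·M P) ≈M I3)
                 (clearable : ∀ i j → Clearable (gram L i j) K) where

    N : Fin 3 → Fin 3 → Poly
    N i j = proj₁ (clearable i j)

    opaque
      M : Fin 3 → Fin 3 → Poly
      M a b = PB.bf N (col P a) (col P b)

      M-def : ∀ a b → M a b ≡ PB.bf N (col P a) (col P b)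
      M-def a b = refl

    N-cl : ∀ i j → Clears K (gram L i j) (N i j)
    N-cl i j = proj₂ (clearable i j)

    N-sym : ∀ i j → N i j ≋ N j i
    N-sym i j = ≈K⇒≋ K K≉0 (N-cl i j) (N-cl j i) (symmetric L i j)

    M-sym : ∀ a b → M a b ≋ M b a
    M-sym a b = PR.trans (PR.reflexive (M-def a b)) (PR.trans (PB.bf-flip N (col P a) (col P b))
      (PR.trans (PB.bf-cong {λ i j → N j i} {N} {col P b} {col P b} {col P a} {col P a} (λ i j → N-sym j i) (λ _ → PR.refl) (λ _ → PR.refl))
        (PR.reflexive (sym (M-def b a)))))

    M-cl : ∀ a b → Clears K (gramOf L P a b) (M a b)
    M-cl a b = subst (Clears K (gramOf L P a b)) (sym (M-def a b)) (Clears-bil K L N N-cl (col P a) (col P b))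

    form : Form
    form = record { a₁₁ = M i₀ i₀ ; a₁₂ = M i₀ i₁ ; a₁₃ = M i₀ i₂ ; a₂₂ = M i₁ i₁ ; a₂₃ = M i₁ i₂ ; a₃₃ = M i₂ i₂ }

    qt-bf : ∀ x → PB.bf M x x ≋ qt form (x i₀) (x i₁) (x i₂)
    qt-bf x = PR.trans (PB.bf-cong {M} {M'} {x} {x} {x} {x} e (λ _ → PR.refl) (λ _ → PR.refl))
      (solve 9 (λ a b c d e f x y z →
        (a :* (x :* x) :+ (b :* (x :* y) :+ c :* (x :* z))) :+ ((b :* (y :* x) :+ (d :* (y :* y) :+ e :* (y :* z))) :+ (c :* (z :* x) :+ (e :* (z :* y) :+ f :* (z :* z))))
        := (((a :* (x :* x) :+ d :* (y :* y)) :+ (b :* (x :* y) :+ b :* (x :* y))) :+ f :* (z :* z)) :+ ((c :* (x :* z) :+ e :* (y :* z)) :+ (c :* (x :* z) :+ e :* (y :* z))))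
        PR.refl (M i₀ i₀) (M i₀ i₁) (M i₀ i₂) (M i₁ i₁) (M i₁ i₂) (M i₂ i₂) (x i₀) (x i₁) (x i₂))
      where
      open PS
      M' : Fin 3 → Fin 3 → Poly
      M' i₀ j  = M i₀ j
      M' i₁ i₀ = M i₀ i₁
      M' i₁ (suc j) = M i₁ (suc j)
      M' i₂ i₀ = M i₀ i₂
      M' i₂ i₁ = M i₁ i₂
      M' i₂ i₂ = M i₂ i₂
      e : ∀ i j → M i j ≋ M' i j
      e i₀ j  = PR.refl
      e i₁ i₀ = M-sym i₁ i₀
      e i₁ (suc j) = PR.refl
      e i₂ i₀ = M-sym i₂ i₀
      e i₂ i₁ = M-sym i₂ i₁
      e i₂ i₂ = PR.refl

    N-P : ∀ x → PB.bf N (P ·v x) (P ·v x) ≋ qt form (x i₀) (x i₁) (x i₂)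
    N-P x = PR.trans (PB.bf-cong {N} {N} {P ·v x} {PB.app P x} {P ·v x} {PB.app P x} (λ _ _ → PR.refl) (λ i → PR.reflexive (·v-def P x i)) (λ i → PR.reflexive (·v-def P x i)))
      (PR.trans (PB.bf-congr N P x x) (PR.trans (PB.bf-cong {λ a b → PB.bf N (col P a) (col P b)} {M} {x} {x} {x} {x}
        (λ a b → PR.reflexive (sym (M-def a b))) (λ _ → PR.refl) (λ _ → PR.refl)) (qt-bf x)))

    Q-cl : ∀ v → Clears K (Q L v) (PB.bf N v v)
    Q-cl v = Clears-bil K L N N-cl v v

    P⁻-P : ∀ x i → (P⁻ ·v (P ·v x)) i ≋ x i
    P⁻-P x i = PR.trans (PR.reflexive (·v-def P⁻ (P ·v x) i)) (PR.trans (PM.app-cong {P⁻} {P⁻} {P ·v x} {PB.app P x} (λ _ _ → PR.refl) (λ j → PR.reflexive (·v-def P x j)) i)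
      (PM.app-inverse P⁻ P (·M-identity P⁻ P P⁻P) x i))

    P-P⁻ : ∀ x i → (P ·v (P⁻ ·v x)) i ≋ x i
    P-P⁻ x i = PR.trans (PR.reflexive (·v-def P (P⁻ ·v x) i)) (PR.trans (PM.app-cong {P} {P} {P⁻ ·v x} {PB.app P⁻ x} (λ _ _ → PR.refl) (λ j → PR.reflexive (·v-def P⁻ x j)) i)
      (PM.app-inverse P P⁻ (·M-identity P P⁻ PP⁻) x i))

    Mʟ : Fin 3 → Fin 3 → Laurent
    Mʟ a b = polyL (M a b)

    Mʟ-sym : ∀ a b → Mʟ a b ≋L Mʟ b a
    Mʟ-sym a b = polyL-cong (M-sym a b)

    Pʟ P⁻ʟ Nʟ : Fin 3 → Fin 3 → Laurent
    Pʟ i j = polyL (P i j)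
    P⁻ʟ i j = polyL (P⁻ i j)
    Nʟ i j = polyL (N i j)

    P⁻Pʟ : LM.IsIdentity (λ i j → LB.S λ k → P⁻ʟ i k ⊗ Pʟ k j)
    P⁻Pʟ = record { diag = λ i → LR.trans (LR.sym (h i i)) (LR.trans (polyL-cong (diag i)) polyL-1)
                  ; off = λ i j n → LR.trans (LR.sym (h i j)) (LR.trans (polyL-cong (off i j n)) polyL-0) }
      where
      open PM.IsIdentity (·M-identity P⁻ P P⁻P)
      h : ∀ i j → polyL (PB.S λ k → P⁻ i k ⊠ P k j) ≋L LB.S λ k → P⁻ʟ i k ⊗ Pʟ k j
      h i j = LR.trans (polyL-S λ k → P⁻ i k ⊠ P k j) (LB.S-cong λ k → polyL-⊠ (P⁻ i k) (P k j))

    Q∞-P : ∀ x → Q∞ L (LB.app Pʟ x) ≋L invPolyL K ⊗ LB.bf Mʟ x x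
    Q∞-P x = begin
      Q∞ L X                                            ≡⟨ Q∞-def L X ⟩
      LB.bf (λ i j → fracL (gram L i j)) X X            ≈⟨ LB.bf-cong {λ i j → fracL (gram L i j)} {λ i j → invPolyL K ⊗ Nʟ i j} {X} {X} {X} {X} (λ i j → fracL-clears K≉0 (N-cl i j)) (λ _ → LR.refl) (λ _ → LR.refl) ⟩
      LB.bf (λ i j → invPolyL K ⊗ Nʟ i j) X X           ≈⟨ LB.bf-scale (invPolyL K) Nʟ X X ⟩
      invPolyL K ⊗ LB.bf Nʟ X X                         ≈⟨ LR.*-congˡ (LR.trans (LB.bf-congr Nʟ Pʟ x x)
                                                            (LB.bf-cong {λ a b → LB.bf Nʟ (λ i → Pʟ i a) (λ i → Pʟ i b)} {Mʟ} {x} {x} {x} {x} (λ a b → LR.trans (LR.sym (polyL-bf N (col P a) (col P b))) (LR.reflexive (cong polyL (sym (M-def a b))))) (λ _ → LR.refl) (λ _ → LR.refl))) ⟩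
      invPolyL K ⊗ LB.bf Mʟ x x                         ∎
      where
      open import Relation.Binary.Reasoning.Setoid LR.setoid
      X = LB.app Pʟ x

    -- P⁻ recovers x from P x, so a nonzero x gives a nonzero vector of L over K_∞. `Definite` is
    -- stated by negations and yields only the double negation, which suffices for contradictions.
    anisotropic : Definite L → ∀ x → LB.bf Mʟ x x ≋L 0L → ¬ ¬ (∀ i → x i ≋L 0L)
    anisotropic def x e nz = def (LB.app Pʟ x)
      (λ z → nz λ i → LR.trans (LR.sym (LM.app-inverse P⁻ʟ Pʟ P⁻Pʟ x i)) (LR.trans
          (LM.app-cong {P⁻ʟ} {P⁻ʟ} {LB.app Pʟ x} {λ _ → 0L} (λ _ _ → LR.refl) (λ j → mkL (z j)) i)
          (LS.solve 3 (λ a b c → a LS.:* LS.con (pos 0) LS.:+ (b LS.:* LS.con (pos 0) LS.:+ c LS.:* LS.con (pos 0)) LS.:= LS.con (pos 0)) LR.refl (P⁻ʟ i i₀) (P⁻ʟ i i₁) (P⁻ʟ i i₂))))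
      (atL (LR.trans (Q∞-P x) (LR.trans (LR.*-congˡ e) (LR.zeroʳ _))))

    -- If B² - q(y)q(z) is a square w², then q(z) y + (w - B) z is isotropic.
    discriminant-nonsquare : 1# + 1# ≢ 0# → Definite L → ∀ (y z : Vec3 Poly) e s →
      (∃ λ i → z i ≋ 0P × ¬ (PB.bf M z z ⊠ y i ≋ 0P)) →
      Bd (suc (e ℕ.+ e)) (PB.bf M y z ⊠ PB.bf M y z ⊞ ⊟ (PB.bf M y y ⊠ PB.bf M z z)) →
      s ≢ 0# → s * s ≡ coeff (PB.bf M y z ⊠ PB.bf M y z ⊞ ⊟ (PB.bf M y y ⊠ PB.bf M z z)) (e ℕ.+ e) → ⊥
    discriminant-nonsquare 2≢0 def y z e s (i , zi , yi) b s≢0 s² with sqrtL 2≢0 {e} _ s b s≢0 s²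
    -- At a coordinate where z vanishes the isotropic vector equals q(z) times that of y, which is
    -- nonzero by hypothesis.
    ... | w , ww = anisotropic def x iso λ x≋0 → yi (polyL-injective (LR.trans (polyL-⊠ Z (y i)) (LR.trans
           (LR.trans (LR.sym (LR.+-identityʳ _)) (LR.+-congˡ (LR.sym (LR.trans (LR.*-congˡ (LR.trans (polyL-cong zi) polyL-0)) (LR.zeroʳ _)))))
           (LR.trans (x≋0 i) (LR.sym polyL-0)))))
      where
      Y Z B : Poly
      Y = PB.bf M y y
      Z = PB.bf M z z
      B = PB.bf M y z
      x : Vec3 Laurent
      x i = polyL Z ⊗ polyL (y i) ⊕ (w ⊕ ⊝ polyL B) ⊗ polyL (z i)
      ww' : w ⊗ w ≋L polyL B ⊗ polyL B ⊕ ⊝ (polyL Y ⊗ polyL Z)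
      ww' = LR.trans ww (LR.trans (polyL-⊞ (B ⊠ B) (⊟ (Y ⊠ Z))) (LR.+-cong (polyL-⊠ B B) (LR.trans (polyL-⊟ (Y ⊠ Z)) (LR.-‿cong (polyL-⊠ Y Z)))))
      iso : LB.bf Mʟ x x ≋L 0L
      iso = begin
        LB.bf Mʟ x x
          ≈⟨ LB.bf-quad Mʟ (polyL Z) (w ⊕ ⊝ polyL B) (polyL ∘ y) (polyL ∘ z) Mʟ-sym ⟩
        (polyL Z ⊗ polyL Z ⊗ LB.bf Mʟ (polyL ∘ y) (polyL ∘ y) ⊕ (w ⊕ ⊝ polyL B) ⊗ (w ⊕ ⊝ polyL B) ⊗ LB.bf Mʟ (polyL ∘ z) (polyL ∘ z))
          ⊕ (polyL Z ⊗ (w ⊕ ⊝ polyL B) ⊗ LB.bf Mʟ (polyL ∘ y) (polyL ∘ z) ⊕ polyL Z ⊗ (w ⊕ ⊝ polyL B) ⊗ LB.bf Mʟ (polyL ∘ y) (polyL ∘ z))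
          ≈⟨ LR.+-cong (LR.+-cong (LR.*-congˡ (polyL-bf M y y)) (LR.*-congˡ (polyL-bf M z z))) (LR.+-cong (LR.*-congˡ (polyL-bf M y z)) (LR.*-congˡ (polyL-bf M y z))) ⟨
        (polyL Z ⊗ polyL Z ⊗ polyL Y ⊕ (w ⊕ ⊝ polyL B) ⊗ (w ⊕ ⊝ polyL B) ⊗ polyL Z)
          ⊕ (polyL Z ⊗ (w ⊕ ⊝ polyL B) ⊗ polyL B ⊕ polyL Z ⊗ (w ⊕ ⊝ polyL B) ⊗ polyL B)
          ≈⟨ LS.solve 4 (λ y z b w → (z LS.:* z LS.:* y LS.:+ (w LS.:- b) LS.:* (w LS.:- b) LS.:* z) LS.:+ (z LS.:* (w LS.:- b) LS.:* b LS.:+ z LS.:* (w LS.:- b) LS.:* b)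
               LS.:= z LS.:* (w LS.:* w LS.:- (b LS.:* b LS.:- y LS.:* z))) LR.refl (polyL Y) (polyL Z) (polyL B) w ⟩
        polyL Z ⊗ (w ⊗ w ⊕ ⊝ (polyL B ⊗ polyL B ⊕ ⊝ (polyL Y ⊗ polyL Z)))
          ≈⟨ LR.*-congˡ (LR.trans (LR.+-congʳ ww') (LR.-‿inverseʳ _)) ⟩
        polyL Z ⊗ 0L
          ≈⟨ LR.zeroʳ _ ⟩
        0L ∎
        where open import Relation.Binary.Reasoning.Setoid LR.setoid

  -- Test vectors and binary forms over F

  vec : Poly → Poly → Poly → Vec3 Poly
  vec a b d i₀ = a
  vec a b d i₁ = b
  vec a b d i₂ = d

  coeff-monoP : ∀ a n → coeff (monoP a n) n ≡ a
  coeff-monoP a zero    = refl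
  coeff-monoP a (suc n) = coeff-monoP a n

  Bd-monoP : ∀ a n → Bd (suc n) (monoP a n)
  Bd-monoP a zero    = bd λ { (suc e) _ → refl }
  Bd-monoP a (suc n) = bd λ { (suc e) (s≤s l) → bz (Bd-monoP a n) e l }

  a*0²≡0 : ∀ a {x} → x ≡ 0# → a * (x * x) ≡ 0#
  a*0²≡0 a {x} e = trans (cong (λ z → a * (z * z)) e) (trans (cong (a *_) (𝔽R.zeroˡ 0#)) (𝔽R.zeroʳ a))

  aniso⇒α≢0 : ∀ {α β} → Aniso α β → α ≢ 0#
  aniso⇒α≢0 {α} {β} an e = 0≢1 (sym (proj₁ (an 1# 0#
    (trans (cong₂ _+_ (trans (cong (_* (1# * 1#)) e) (𝔽R.zeroˡ _)) (a*0²≡0 β refl)) (𝔽R.+-identityˡ 0#)))))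

  aniso⇒β≢0 : ∀ {α β} → Aniso α β → β ≢ 0#
  aniso⇒β≢0 {α} {β} an e = 0≢1 (sym (proj₂ (an 0# 1#
    (trans (cong₂ _+_ (a*0²≡0 α refl) (trans (cong (_* (1# * 1#)) e) (𝔽R.zeroˡ _))) (𝔽R.+-identityˡ 0#)))))

  a*a⁻¹*b : ∀ {a} b → a ≢ 0# → a * (b * a ⁻¹) ≡ b
  a*a⁻¹*b {a} b a≢0 = trans (𝔽S.solve 3 (λ a b i → a 𝔽S.:* (b 𝔽S.:* i) 𝔽S.:= b 𝔽S.:* (a 𝔽S.:* i)) refl a b (a ⁻¹))
    (trans (cong (b *_) (inverseʳ a a≢0)) (𝔽R.*-identityʳ b))

  module _ {α β ρ : F} (αρ : α * ρ ≡ - β) where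

    private
      move : ∀ a b u v → a * u + b * v ≡ a * u + - (- b * v)
      move = 𝔽S.solve 4 (λ a b u v → a 𝔽S.:* u 𝔽S.:+ b 𝔽S.:* v 𝔽S.:= a 𝔽S.:* u 𝔽S.:- (𝔽S.:- b) 𝔽S.:* v) refl
      factor : ∀ a r u v → a * u + - (a * r * v) ≡ a * (u + - (r * v))
      factor = 𝔽S.solve 4 (λ a r u v → a 𝔽S.:* u 𝔽S.:- a 𝔽S.:* r 𝔽S.:* v 𝔽S.:= a 𝔽S.:* (u 𝔽S.:- r 𝔽S.:* v)) refl

    diagonal-as-norm : ∀ u v → α * u + β * v ≡ α * (u + - (ρ * v))
    diagonal-as-norm u v = trans (move α β u v) (trans (cong (λ z → α * u + - (z * v)) (sym αρ)) (factor α ρ u v))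

  module _ (2≢0 : 1# + 1# ≢ 0#) {α β : F} (an : Aniso α β) where

    -- With ρ = -β/α, the form αu² + βv² is α times the norm u² - ρv²; the ν and κ of the conics are
    -- ratios of this kind.
    ratio : F
    ratio = - (β * α ⁻¹)

    α*ratio : α * ratio ≡ - β
    α*ratio = trans (sym (-‿distribʳ-* α (β * α ⁻¹))) (cong -_ (a*a⁻¹*b β (aniso⇒α≢0 an)))
      where open import Algebra.Properties.Ring 𝔽R.ring using (-‿distribʳ-*)

    aniso⇒nonSquare : NonSquare 2≢0 ratio
    aniso⇒nonSquare s e = 0≢1 (sym (proj₂ (an s 1# (trans (diagonal-as-norm α*ratio (s * s) (1# * 1#))
      (trans (cong (α *_) (x≡y⇒x-y≡0 (trans e (sym (trans (cong (ratio *_) (𝔽R.*-identityˡ 1#)) (𝔽R.*-identityʳ ratio)))))) (𝔽R.zeroʳ α))))))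

    aniso-represents : ∀ γ → ∃ λ u → ∃ λ v → α * (u * u) + β * (v * v) ≡ γ
    aniso-represents γ = case norm-surjective 2≢0 aniso⇒nonSquare (γ * α ⁻¹) of λ
      { (u , v , e) → u , v , trans (diagonal-as-norm α*ratio (u * u) (v * v)) (trans (cong (α *_) e) (a*a⁻¹*b γ (aniso⇒α≢0 an))) }

  module _ (M : Fin 3 → Fin 3 → Poly) where
    open PS

    private
      expand : Poly → Poly → Poly → Poly → Poly → Poly → Poly
      expand a b d x y z = (M i₀ i₀ ⊠ (a ⊠ x) ⊞ (M i₀ i₁ ⊠ (a ⊠ y) ⊞ M i₀ i₂ ⊠ (a ⊠ z))) ⊞ ((M i₁ i₀ ⊠ (b ⊠ x) ⊞ (M i₁ i₁ ⊠ (b ⊠ y) ⊞ M i₁ i₂ ⊠ (b ⊠ z)))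
            ⊞ (M i₂ i₀ ⊠ (d ⊠ x) ⊞ (M i₂ i₁ ⊠ (d ⊠ y) ⊞ M i₂ i₂ ⊠ (d ⊠ z))))

      o z : ∀ {n} → Polynomial n
      o = con (pos 1)
      z = con (pos 0)

      ex : ∀ {n} → (a b c d e f g h k u v w x y t : Polynomial n) → Polynomial n
      ex a b c d e f g h k u v w x y t = (a :* (u :* x) :+ (b :* (u :* y) :+ c :* (u :* t))) :+ ((d :* (v :* x) :+ (e :* (v :* y) :+ f :* (v :* t)))
            :+ (g :* (w :* x) :+ (h :* (w :* y) :+ k :* (w :* t))))

    bf-e₂e₁ : PB.bf M (vec 0P 1P 0P) (vec 1P 0P 0P) ≋ M i₁ i₀
    bf-e₂e₁ = solve 9 (λ a b c d e f g h k → ex a b c d e f g h k z o z o z z := d) PR.refl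
      (M i₀ i₀) (M i₀ i₁) (M i₀ i₂) (M i₁ i₀) (M i₁ i₁) (M i₁ i₂) (M i₂ i₀) (M i₂ i₁) (M i₂ i₂)

    bf-e₁e₁ : PB.bf M (vec 1P 0P 0P) (vec 1P 0P 0P) ≋ M i₀ i₀
    bf-e₁e₁ = solve 9 (λ a b c d e f g h k → ex a b c d e f g h k o z z o z z := a) PR.refl
      (M i₀ i₀) (M i₀ i₁) (M i₀ i₂) (M i₁ i₀) (M i₁ i₁) (M i₁ i₂) (M i₂ i₀) (M i₂ i₁) (M i₂ i₂)

    bf-e₂e₂ : PB.bf M (vec 0P 1P 0P) (vec 0P 1P 0P) ≋ M i₁ i₁
    bf-e₂e₂ = solve 9 (λ a b c d e f g h k → ex a b c d e f g h k z o z z o z := e) PR.refl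
      (M i₀ i₀) (M i₀ i₁) (M i₀ i₂) (M i₁ i₀) (M i₁ i₁) (M i₁ i₂) (M i₂ i₀) (M i₂ i₁) (M i₂ i₂)

    bf-e₃e₃ : PB.bf M (vec 0P 0P 1P) (vec 0P 0P 1P) ≋ M i₂ i₂
    bf-e₃e₃ = solve 9 (λ a b c d e f g h k → ex a b c d e f g h k z z o z z o := k) PR.refl
      (M i₀ i₀) (M i₀ i₁) (M i₀ i₂) (M i₁ i₀) (M i₁ i₁) (M i₁ i₂) (M i₂ i₀) (M i₂ i₁) (M i₂ i₂)

    bf-e₁₂e₃ : ∀ x y → PB.bf M (vec x y 0P) (vec 0P 0P 1P) ≋ M i₀ i₂ ⊠ x ⊞ M i₁ i₂ ⊠ y
    bf-e₁₂e₃ x y = solve 11 (λ a b c d e f g h k x y → ex a b c d e f g h k x y z z z o := c :* x :+ f :* y) PR.refl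
      (M i₀ i₀) (M i₀ i₁) (M i₀ i₂) (M i₁ i₀) (M i₁ i₁) (M i₁ i₂) (M i₂ i₀) (M i₂ i₁) (M i₂ i₂) x y

  qt-plane : ∀ F x y → qt F x y 0P ≋ qb F x y
  qt-plane F x y = PS.solve 8 (λ a b c d e f x y →
       (((a :* (x :* x) :+ d :* (y :* y)) :+ (b :* (x :* y) :+ b :* (x :* y))) :+ f :* (con (pos 0) :* con (pos 0)))
         :+ ((c :* (x :* con (pos 0)) :+ e :* (y :* con (pos 0))) :+ (c :* (x :* con (pos 0)) :+ e :* (y :* con (pos 0))))
       := (a :* (x :* x) :+ d :* (y :* y)) :+ (b :* (x :* y) :+ b :* (x :* y))) PR.refl a₁₁ a₁₂ a₁₃ a₂₂ a₂₃ a₃₃ x y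
    where open Form F
          open PS

  -- Definite lattices have anisotropic leading coefficients

  module Leading (2≢0 : 1# + 1# ≢ 0#) (K : Poly) (K≉0 : ¬ (K ≋ 0P)) (L : TernaryLattice) (P P⁻ : Mat3 Poly)
                 (PP⁻ : (P ·M P⁻) ≈M I3) (P⁻P : (P⁻ ·M P) ≈M I3)
                 (clearable : ∀ i j → Clearable (gram L i j) K) (definite : Definite L) where

    open Cleared K K≉0 L P P⁻ PP⁻ P⁻P clearable public
    open Form form public

    module _ {d₁ d₂ k} (D₁ : Deg= d₁ a₁₁) (D₂ : Deg= d₂ a₂₂) (b₁₂ : Bd d₁ a₁₂) (par : d₂ ≡ k ℕ.+ k ℕ.+ d₁) (d₁<d₂ : d₁ ℕ.< d₂) where

      private
        e₁ e₂ : Vec3 Poly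
        e₁ = vec 1P 0P 0P
        e₂ = vec 0P 1P 0P

        M₂₁ : PB.bf M e₂ e₁ ≋ a₁₂
        M₂₁ = PR.trans (bf-e₂e₁ M) (M-sym i₁ i₀)
        M₁₁ : PB.bf M e₁ e₁ ≋ a₁₁
        M₁₁ = bf-e₁e₁ M
        M₂₂ : PB.bf M e₂ e₂ ≋ a₂₂
        M₂₂ = bf-e₂e₂ M

        α₁ α₂ : F
        α₁ = coeff a₁₁ d₁
        α₂ = coeff a₂₂ d₂

        δ δ' : Poly
        δ = PB.bf M e₂ e₁ ⊠ PB.bf M e₂ e₁ ⊞ ⊟ (PB.bf M e₂ e₂ ⊠ PB.bf M e₁ e₁)
        δ' = a₁₂ ⊠ a₁₂ ⊞ ⊟ (a₂₂ ⊠ a₁₁)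
        δ≋δ' : δ ≋ δ'
        δ≋δ' = PR.+-cong (PR.*-cong M₂₁ M₂₁) (PR.-‿cong (PR.*-cong M₂₂ M₁₁))

        e : ℕ
        e = k ℕ.+ d₁
        ee : e ℕ.+ e ≡ d₂ ℕ.+ d₁
        ee = trans (nsolve 2 (λ k d → (k :⊕ d) :⊕ (k :⊕ d) :≡ (k :⊕ k :⊕ d) :⊕ d) refl k d₁) (cong (ℕ._+ d₁) (sym par))

        b² : Bd (d₂ ℕ.+ d₁) (a₁₂ ⊠ a₁₂)
        b² = Bd-* a₁₂ a₁₂ b₁₂ b₁₂ (ℕP.m≤n⇒m≤1+n (ℕP.+-monoˡ-≤ d₁ (ℕP.<⇒≤ d₁<d₂)))

        δ-Bd : Bd (suc (e ℕ.+ e)) δ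
        δ-Bd = Bd-resp (PR.sym δ≋δ') (subst (λ n → Bd (suc n) δ') (sym ee)
          (Bd-- (a₁₂ ⊠ a₁₂) (a₂₂ ⊠ a₁₁) (Bd-mono (ℕP.n≤1+n _) b²) (Bd-* a₂₂ a₁₁ (proj₁ D₂) (proj₁ D₁) (ℕP.≤-reflexive (cong suc (ℕP.+-suc d₂ d₁))))))

        δ-coeff : coeff δ (e ℕ.+ e) ≡ - (α₂ * α₁)
        δ-coeff = trans (at δ≋δ' (e ℕ.+ e)) (trans (cong (coeff δ') ee) (trans (coeff-- (a₁₂ ⊠ a₁₂) (a₂₂ ⊠ a₁₁) (d₂ ℕ.+ d₁))
          (trans (cong₂ (λ x y → x + - y) (bz b² _ ℕP.≤-refl) (coeff-*-top a₂₂ a₁₁ (proj₁ D₂) (proj₁ D₁))) (𝔽R.+-identityˡ _))))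

      -- d₁ + d₂ is even, and a₁₂² - a₁₁a₂₂ has leading coefficient -α₁α₂. A zero (u , v) with v ≠ 0
      -- makes this the square of α₁u/v, so the plane of the first two basis vectors would be
      -- isotropic over K_∞.
      leading-aniso : Aniso α₁ α₂
      leading-aniso u v eq = case v ≟ 0# of λ
        { (yes v≡0) → case x*y≡0⇒x≡0⊎y≡0 u u (x*y≡0⇒y≡0 (proj₂ D₁) (trans
            (trans (sym (𝔽R.+-identityʳ _)) (cong (α₁ * (u * u) +_) (sym (a*0²≡0 α₂ v≡0)))) eq)) of λ
            { (inj₁ z) → z , v≡0 ; (inj₂ z) → z , v≡0 }
        ; (no v≢0) → ⊥-elim (impossible v≢0) }
        where
        s : F
        s = α₁ * (u * v ⁻¹)
        square : ∀ a b u v i → (a * (u * i)) * (a * (u * i)) ≡ a * (a * (u * u) + b * (v * v)) * (i * i) + - (b * a * ((v * i) * (v * i)))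
        square = 𝔽S.solve 5 (λ a b u v i → (a 𝔽S.:* (u 𝔽S.:* i)) 𝔽S.:* (a 𝔽S.:* (u 𝔽S.:* i))
                    𝔽S.:= a 𝔽S.:* (a 𝔽S.:* (u 𝔽S.:* u) 𝔽S.:+ b 𝔽S.:* (v 𝔽S.:* v)) 𝔽S.:* (i 𝔽S.:* i) 𝔽S.:- b 𝔽S.:* a 𝔽S.:* ((v 𝔽S.:* i) 𝔽S.:* (v 𝔽S.:* i))) refl
        simplify : ∀ a b i → a * 0# * i + - (b * a * (1# * 1#)) ≡ - (b * a)
        simplify = 𝔽S.solve 3 (λ a b i → a 𝔽S.:* 𝔽S.con (pos 0) 𝔽S.:* i 𝔽S.:- b 𝔽S.:* a 𝔽S.:* (𝔽S.con (pos 1) 𝔽S.:* 𝔽S.con (pos 1)) 𝔽S.:= 𝔽S.:- (b 𝔽S.:* a)) refl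
        module _ (v≢0 : v ≢ 0#) where
          s² : s * s ≡ - (α₂ * α₁)
          s² = trans (square α₁ α₂ u v (v ⁻¹)) (trans
                 (cong₂ (λ x y → α₁ * x * (v ⁻¹ * v ⁻¹) + - (α₂ * α₁ * (y * y))) eq (inverseʳ v v≢0)) (simplify α₁ α₂ (v ⁻¹ * v ⁻¹)))
          u≢0 : u ≢ 0#
          u≢0 u≡0 = *-nonzero (proj₂ D₂) (*-nonzero v≢0 v≢0) (trans
            (trans (sym (𝔽R.+-identityˡ _)) (cong (_+ α₂ * (v * v)) (sym (a*0²≡0 α₁ u≡0)))) eq)
          s≢0 : s ≢ 0#
          s≢0 = *-nonzero (proj₂ D₁) (*-nonzero u≢0 (⁻¹-nonzero v≢0))
          impossible : ⊥
          impossible = discriminant-nonsquare 2≢0 definite e₂ e₁ e s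
            (i₁ , PR.refl , λ z → Deg=⇒≉0 D₁ (PR.trans (PR.sym M₁₁) (PR.trans (PR.sym (PR.*-identityʳ _)) z))) δ-Bd s≢0 (trans s² (sym δ-coeff))

      -- Were d₃ ≡ d₁ (mod 2), c₁tⁱv₁ + c₂tʲv₂ with α₁c₁² + α₂c₂² = -α₃ and v₃ would span an isotropic plane.
      module _ {d₃} (D₃ : Deg= d₃ a₃₃) (b₁₃ : Bd d₁ a₁₃) (b₂₃ : Bd d₂ a₂₃) (d₂<d₃ : d₂ ℕ.< d₃) where

        no-parity : ∀ i j → d₃ ≡ i ℕ.+ i ℕ.+ d₁ → d₃ ≡ j ℕ.+ j ℕ.+ d₂ → ⊥
        no-parity i j p r = case aniso-represents 2≢0 leading-aniso (- coeff a₃₃ d₃) of λ { (c₁ , c₂ , ce) → isotropic-plane i j p r c₁ c₂ ce }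
          where
          isotropic-plane : ∀ i j → d₃ ≡ i ℕ.+ i ℕ.+ d₁ → d₃ ≡ j ℕ.+ j ℕ.+ d₂ → ∀ c₁ c₂ →
                            coeff a₁₁ d₁ * (c₁ * c₁) + coeff a₂₂ d₂ * (c₂ * c₂) ≡ - coeff a₃₃ d₃ → ⊥
          isotropic-plane i j p r c₁ c₂ ce = discriminant-nonsquare 2≢0 definite y e₃ d₃ α₃ nz δ₃-Bd (proj₂ D₃) (sym δ₃-coeff)
            where
            α₃ : F
            α₃ = coeff a₃₃ d₃
            y₁ y₂ : Poly
            y₁ = monoP c₁ i
            y₂ = monoP c₂ j
            y e₃ : Vec3 Poly
            y = vec y₁ y₂ 0P
            e₃ = vec 0P 0P 1P
            w₁ : W d₁ d₃ y₁
            w₁ = Bd⇒W d₁ d₃ (Bd-monoP c₁ i) (ℕP.≤-reflexive (trans (nsolve 2 (λ i d → (ncon 1 :⊕ i) :⊕ (ncon 1 :⊕ i) :⊕ d :≡ ncon 2 :⊕ (i :⊕ i :⊕ d)) refl i d₁) (cong (λ z → suc (suc z)) (sym p))))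
            w₂ : W d₂ d₃ y₂
            w₂ = Bd⇒W d₂ d₃ (Bd-monoP c₂ j) (ℕP.≤-reflexive (trans (nsolve 2 (λ i d → (ncon 1 :⊕ i) :⊕ (ncon 1 :⊕ i) :⊕ d :≡ ncon 2 :⊕ (i :⊕ i :⊕ d)) refl j d₂) (cong (λ z → suc (suc z)) (sym r))))
            Y B Z : Poly
            Y = qb form y₁ y₂
            B = a₁₃ ⊠ y₁ ⊞ a₂₃ ⊠ y₂
            YY : PB.bf M y y ≋ Y
            YY = PR.trans (qt-bf y) (qt-plane form y₁ y₂)
            ZZ : PB.bf M e₃ e₃ ≋ a₃₃
            ZZ = bf-e₃e₃ M
            Z = a₃₃
            BB : PB.bf M y e₃ ≋ B
            BB = bf-e₁₂e₃ M y₁ y₂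
            δ₃ δ₃' : Poly
            δ₃ = PB.bf M y e₃ ⊠ PB.bf M y e₃ ⊞ ⊟ (PB.bf M y y ⊠ PB.bf M e₃ e₃)
            δ₃' = B ⊠ B ⊞ ⊟ (Y ⊠ Z)
            δ₃≋ : δ₃ ≋ δ₃'
            δ₃≋ = PR.+-cong (PR.*-cong BB BB) (PR.-‿cong (PR.*-cong YY ZZ))
            bB : Bd d₃ B
            bB = Bd-+ _ _ (linear-< a₁₃ y₁ b₁₃ w₁) (linear-< a₂₃ y₂ b₂₃ w₂)
            bB² : Bd (d₃ ℕ.+ d₃) (B ⊠ B)
            bB² = Bd-* B B bB bB (ℕP.n≤1+n _)
            crossᵇ : Bd d₃ (a₁₂ ⊠ (y₁ ⊠ y₂) ⊞ a₁₂ ⊠ (y₁ ⊠ y₂))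
            crossᵇ = Bd-+ _ _ cr cr
              where cr = cross-< a₁₂ y₁ y₂ (ℕP.<⇒≤ d₁<d₂) b₁₂ w₁ w₂
            bY : Bd (suc d₃) Y
            bY = Bd-+ _ _ (Bd-+ _ _ (diag-≤ a₁₁ y₁ (proj₁ D₁) w₁) (diag-≤ a₂₂ y₂ (proj₁ D₂) w₂)) (Bd-mono (ℕP.n≤1+n _) crossᵇ)
            diagTop : ∀ {d} m c i → Bd (suc d) m → d₃ ≡ i ℕ.+ i ℕ.+ d → coeff (m ⊠ (monoP c i ⊠ monoP c i)) d₃ ≡ coeff m d * (c * c)
            diagTop {d} m c i b q = trans (cong (coeff (m ⊠ (monoP c i ⊠ monoP c i))) (trans q (ℕP.+-comm (i ℕ.+ i) d)))
              (trans (coeff-*-top m _ b (Bd-* (monoP c i) (monoP c i) (Bd-monoP c i) (Bd-monoP c i) (ℕP.≤-reflexive (cong suc (ℕP.+-suc i i)))))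
              (cong (coeff m d *_) (trans (coeff-*-top (monoP c i) (monoP c i) (Bd-monoP c i) (Bd-monoP c i)) (cong₂ _*_ (coeff-monoP c i) (coeff-monoP c i)))))
            Y-coeff : coeff Y d₃ ≡ - α₃
            Y-coeff = trans (coeff-⊞ (a₁₁ ⊠ (y₁ ⊠ y₁) ⊞ a₂₂ ⊠ (y₂ ⊠ y₂)) _ d₃) (trans (cong₂ _+_ (trans (coeff-⊞ (a₁₁ ⊠ (y₁ ⊠ y₁)) _ d₃)
              (cong₂ _+_ (diagTop a₁₁ c₁ i (proj₁ D₁) p) (diagTop a₂₂ c₂ j (proj₁ D₂) r))) (bz crossᵇ d₃ ℕP.≤-refl)) (trans (𝔽R.+-identityʳ _) ce))
            δ₃-Bd : Bd (suc (d₃ ℕ.+ d₃)) δ₃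
            δ₃-Bd = Bd-resp (PR.sym δ₃≋) (Bd-- (B ⊠ B) (Y ⊠ Z) (Bd-mono (ℕP.n≤1+n _) bB²) (Bd-* Y Z bY (proj₁ D₃) (ℕP.≤-reflexive (cong suc (ℕP.+-suc d₃ d₃)))))
            δ₃-coeff : coeff δ₃ (d₃ ℕ.+ d₃) ≡ α₃ * α₃
            δ₃-coeff = trans (at δ₃≋ (d₃ ℕ.+ d₃)) (trans (coeff-- (B ⊠ B) (Y ⊠ Z) (d₃ ℕ.+ d₃)) (trans
              (cong₂ (λ x y → x + - y) (bz bB² _ ℕP.≤-refl) (trans (coeff-*-top Y Z bY (proj₁ D₃)) (cong (_* α₃) Y-coeff)))
              (𝔽S.solve 1 (λ a → 𝔽S.con (pos 0) 𝔽S.:- (𝔽S.:- a 𝔽S.:* a) 𝔽S.:= a 𝔽S.:* a) refl α₃)))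
            mono-nz : ∀ {c i} → c ≢ 0# → ¬ (PB.bf M e₃ e₃ ⊠ monoP c i ≋ 0P)
            mono-nz {c} {i} c≢0 z = ⊠-nonzero {a₃₃} {monoP c i} (Deg=⇒≉0 D₃) (λ z' → c≢0 (trans (sym (coeff-monoP c i)) (at z' i)))
              (PR.trans (PR.*-congʳ (PR.sym ZZ)) z)
            nz : ∃ λ i → e₃ i ≋ 0P × ¬ (PB.bf M e₃ e₃ ⊠ y i ≋ 0P)
            nz with c₁ ≟ 0# | c₂ ≟ 0#
            ... | no n | _ = i₀ , PR.refl , mono-nz n
            ... | yes _ | no n = i₁ , PR.refl , mono-nz n
            -- c₁ = c₂ = 0 would represent -α₃ by zero.
            ... | yes z₁ | yes z₂ = ⊥-elim (proj₂ D₃ (trans (sym (-‿involutive α₃)) (trans (cong -_ (trans (sym ce)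
                (trans (cong₂ _+_ (a*0²≡0 α₁ z₁) (a*0²≡0 α₂ z₂)) (𝔽R.+-identityˡ 0#)))) -0≡0)))
              where open import Algebra.Properties.Ring 𝔽R.ring using (-‿involutive)

        reduced : ReducedForm form d₁ d₂ d₃
        reduced = record { b₁₁ = proj₁ D₁ ; b₂₂ = proj₁ D₂ ; b₃₃ = proj₁ D₃ ; b₁₂ = b₁₂ ; b₁₃ = b₁₃ ; b₂₃ = b₂₃
          ; d₁<d₂ = d₁<d₂ ; d₂<d₃ = d₂<d₃ ; aniso = leading-aniso ; α₃≢0 = proj₂ D₃ ; par₁ = par₁ ; par₂ = par₂ }
          where
          -- `no-parity` also asks for j with d₃ = 2j + d₂. Since d₂ < d₃, i is at least k, and j =
          -- i - k.
          never : ∀ i → d₃ ≢ i ℕ.+ i ℕ.+ d₁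
          never i p with k ℕ.≤? i
          ... | no n = ℕP.<⇒≱ d₂<d₃ (ℕP.≤-trans (ℕP.≤-reflexive p) (ℕP.≤-trans (ℕP.+-monoˡ-≤ d₁ (ℕP.+-mono-≤ k≥i k≥i)) (ℕP.≤-reflexive (sym par))))
            where k≥i = ℕP.<⇒≤ (ℕP.≰⇒> n)
          ... | yes q with ℕP.m≤n⇒∃[o]m+o≡n q
          ...   | j , refl = no-parity (k ℕ.+ j) j p (trans p (trans (nsolve 3 (λ k j d → (k :⊕ j) :⊕ (k :⊕ j) :⊕ d :≡ j :⊕ j :⊕ (k :⊕ k :⊕ d)) refl k j d₁) (cong (j ℕ.+ j ℕ.+_) (sym par))))
          par₁ : ∀ e f → e ℕ.+ e ℕ.+ d₁ ≢ f ℕ.+ f ℕ.+ d₃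
          par₁ e f q with f ℕ.≤? e
          ... | no n = ℕP.<-irrefl q (ℕP.+-mono-≤-< (ℕP.+-mono-≤ f≥e f≥e) (ℕP.<-trans d₁<d₂ d₂<d₃))
            where f≥e = ℕP.<⇒≤ (ℕP.≰⇒> n)
          ... | yes l with ℕP.m≤n⇒∃[o]m+o≡n l
          ...   | g , refl = never g (ℕP.+-cancelˡ-≡ (f ℕ.+ f) _ _ (trans (sym q) (nsolve 3 (λ f g d → (f :⊕ g) :⊕ (f :⊕ g) :⊕ d :≡ (f :⊕ f) :⊕ (g :⊕ g :⊕ d)) refl f g d₁)))
          par₂ : ∀ e f → e ℕ.+ e ℕ.+ d₂ ≢ f ℕ.+ f ℕ.+ d₃
          par₂ e f q = par₁ (e ℕ.+ k) f (trans (trans (nsolve 3 (λ e k d → (e :⊕ k) :⊕ (e :⊕ k) :⊕ d :≡ e :⊕ e :⊕ (k :⊕ k :⊕ d)) refl e k d₁) (cong (e ℕ.+ e ℕ.+_) (sym par))) q)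

  record LatticeData (K : Poly) (K≉0 : ¬ (K ≋ 0P)) (L : TernaryLattice) (clearable : ∀ i j → Clearable (gram L i j) K) : Set where
    field
      P P⁻ : Mat3 Poly
      PP⁻  : (P ·M P⁻) ≈M I3
      P⁻P  : (P⁻ ·M P) ≈M I3
      d₁ d₂ d₃ k : ℕ
      d₂≡  : d₂ ≡ k ℕ.+ k ℕ.+ d₁
    open Cleared K K≉0 L P P⁻ PP⁻ P⁻P clearable public
    field
      reduced : ReducedForm form d₁ d₂ d₃

  latticeData : 1# + 1# ≢ 0# → ∀ {K} (K≉0 : ¬ (K ≋ 0P)) L (cl : ∀ i j → Clearable (gram L i j) K) →
                Definite L → MinimaCondition L → LatticeData K K≉0 L cl
  latticeData 2≢0 {K} K≉0 L cl def (μ₁ , μ₂ , μ₃ , (P , ((P⁻ , PP⁻ , P⁻P) , _ , off) , m₁ , m₂ , m₃) , μ₁<μ₂ , μ₂<μ₃ , par)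
    with degree K
  ... | inj₁ z = ⊥-elim (K≉0 z)
  ... | inj₂ (n , dK) = record
    { P = P ; P⁻ = P⁻ ; PP⁻ = PP⁻ ; P⁻P = P⁻P ; d₁ = d₁ ; d₂ = d₂ ; d₃ = d₃ ; k = k ; d₂≡ = d₂≡
    ; reduced = reduced {k = k} (proj₁ (proj₂ r₁)) (proj₁ (proj₂ r₂)) b₁₂ d₂≡ d₁<d₂ (proj₁ (proj₂ r₃)) b₁₃ b₂₃ d₂<d₃ }
    where
    open Leading 2≢0 K K≉0 L P P⁻ PP⁻ P⁻P cl def
    r₁ = degK-just dK (M-cl i₀ i₀) m₁
    r₂ = degK-just dK (M-cl i₁ i₁) m₂
    r₃ = degK-just dK (M-cl i₂ i₂) m₃
    d₁ d₂ d₃ : ℕ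
    d₁ = proj₁ r₁
    d₂ = proj₁ r₂
    d₃ = proj₁ r₃
    lt : ∀ {a b μ μ'} → pos a ≡ μ ℤ.+ pos n → pos b ≡ μ' ℤ.+ pos n → μ ℤ.< μ' → a ℕ.< b
    lt e f l = ℤP.drop‿+<+ (≡.subst₂ ℤ._<_ (sym e) (sym f) (ℤP.+-monoˡ-< (pos n) l))
    d₁<d₂ = lt (proj₂ (proj₂ r₁)) (proj₂ (proj₂ r₂)) μ₁<μ₂
    d₂<d₃ = lt (proj₂ (proj₂ r₂)) (proj₂ (proj₂ r₃)) μ₂<μ₃
    b₁₂ = degK-< dK (M-cl i₀ i₁) (proj₂ (proj₂ r₁)) (subst (degK (gramOf L P i₀ i₁) <D_) m₁ (off i₀ i₁ (s≤s z≤n)))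
    b₁₃ = degK-< dK (M-cl i₀ i₂) (proj₂ (proj₂ r₁)) (subst (degK (gramOf L P i₀ i₂) <D_) m₁ (off i₀ i₂ (s≤s z≤n)))
    b₂₃ = degK-< dK (M-cl i₁ i₂) (proj₂ (proj₂ r₂)) (subst (degK (gramOf L P i₁ i₂) <D_) m₂ (off i₁ i₂ (s≤s (s≤s z≤n))))
    -- Clearing shifts every minimum by deg K, so the difference whose parity is given survives.
    difference : ℤ.∣ μ₂ ℤ.- μ₁ ∣ ≡ d₂ ℕ.∸ d₁
    difference = cong ℤ.∣_∣ (begin
      μ₂ ℤ.- μ₁                          ≡⟨ ℤS.solve 3 (λ a b n → b ℤS.:- a ℤS.:= (b ℤS.:+ n) ℤS.:- (a ℤS.:+ n)) refl μ₁ μ₂ (pos n) ⟩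
      (μ₂ ℤ.+ pos n) ℤ.- (μ₁ ℤ.+ pos n)  ≡⟨ cong₂ ℤ._-_ (proj₂ (proj₂ r₂)) (proj₂ (proj₂ r₁)) ⟨
      pos d₂ ℤ.- pos d₁                  ≡⟨ ℤP.m-n≡m⊖n d₂ d₁ ⟩
      d₂ ℤ.⊖ d₁                          ≡⟨ ℤP.⊖-≥ (ℕP.<⇒≤ d₁<d₂) ⟩
      pos (d₂ ℕ.∸ d₁)                    ∎)
      where open ≡.≡-Reasoning
    k+k≡k*2 : ∀ k → k ℕ.+ k ≡ k ℕ.* 2
    k+k≡k*2 k = trans (cong (λ z → k ℕ.+ z) (sym (ℕP.+-identityʳ k))) (ℕP.*-comm 2 k)
    k : ℕ
    k = ℤ.∣ μ₂ ℤ.- μ₁ ∣ ℕ./ 2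
    d₂≡ : d₂ ≡ k ℕ.+ k ℕ.+ d₁
    d₂≡ = sym (trans (cong (ℕ._+ d₁) (trans (k+k≡k*2 k) (trans (cong (ℕ._+ k ℕ.* 2) (sym par))
      (trans (sym (ℕD.m≡m%n+[m/n]*n ℤ.∣ μ₂ ℤ.- μ₁ ∣ 2)) difference)))) (ℕP.m∸n+n≡m (ℕP.<⇒≤ d₁<d₂)))

  -- Counting vectors

  infix 4 _≋ᵥ_
  _≋ᵥ_ : Vec3 Poly → Vec3 Poly → Set
  u ≋ᵥ v = ∀ i → u i ≋ v i

  coeff-tabulate : ∀ {n} (f : Fin n → F) (j : Fin n) → coeff (tabulate f) (toℕ j) ≡ f j
  coeff-tabulate f zero    = refl
  coeff-tabulate f (suc j) = coeff-tabulate (f ∘ suc) j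

  Bd-tabulate : ∀ {n} (f : Fin n → F) → Bd n (tabulate f)
  Bd-tabulate {zero}  f = Bd-0
  Bd-tabulate {suc n} f = bd λ { (suc e) (s≤s l) → bz (Bd-tabulate (f ∘ suc)) e l }

  Bd-ext : ∀ {n p r} → Bd n p → Bd n r → (∀ (j : Fin n) → coeff p (toℕ j) ≡ coeff r (toℕ j)) → p ≋ r
  Bd-ext {n} {p} {r} b b' e = mk≋ go
    where
    go : ∀ k → coeff p k ≡ coeff r k
    go k with k ℕ.<? n
    ... | yes l = subst (λ z → coeff p z ≡ coeff r z) (FinP.toℕ-fromℕ< l) (e (fromℕ< l))
    ... | no l  = trans (bz b k (ℕP.≮⇒≥ l)) (sym (bz b' k (ℕP.≮⇒≥ l)))

  -- The 3n base-q digits of a number are the coefficients of a vector with entries of degree below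
  -- n.
  vectorOf : ∀ n → Fin (size ℕ.^ (3 ℕ.* n)) → Vec3 Poly
  vectorOf n k i = tabulate {n = n} λ j → elt (finToFun {size} {3 ℕ.* n} k (combine i j))

  funToFin-cong : ∀ {m n} (f g : Fin m → Fin n) → (∀ i → f i ≡ g i) → funToFin f ≡ funToFin g
  funToFin-cong {zero}  f g e = refl
  funToFin-cong {suc m} f g e = cong₂ combine (e zero) (funToFin-cong (f ∘ suc) (g ∘ suc) (e ∘ suc))

  vectorOf-injective : ∀ n k l → vectorOf n k ≋ᵥ vectorOf n l → k ≡ l
  vectorOf-injective n k l e = trans (sym (FinP.funToFin-finToFin {3 ℕ.* n} {size} k)) (trans (funToFin-cong (finToFun {size} {3 ℕ.* n} k) (finToFun {size} {3 ℕ.* n} l) same) (FinP.funToFin-finToFin {3 ℕ.* n} {size} l))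
    where
    K L : Fin (3 ℕ.* n) → Fin size
    K = finToFun {size} {3 ℕ.* n} k
    L = finToFun {size} {3 ℕ.* n} l
    same-digit : ∀ i j → K (combine i j) ≡ L (combine i j)
    same-digit i j = trans (sym (idx-elt _)) (trans (cong idx (trans (sym (coeff-tabulate (λ j → elt (K (combine i j))) j))
      (trans (at (e i) (toℕ j)) (coeff-tabulate (λ j → elt (L (combine i j))) j)))) (idx-elt _))
    same : ∀ m → K m ≡ L m
    same m = subst (λ z → K z ≡ L z) (FinP.combine-remQuot {3} n m) (same-digit (proj₁ (remQuot {3} n m)) (proj₂ (remQuot {3} n m)))

  vectorOf-complete : ∀ n v → (∀ i → Bd n (v i)) → ∃ λ k → v ≋ᵥ vectorOf n k
  vectorOf-complete n v b = funToFin f , λ i → Bd-ext (b i) (Bd-tabulate {n} _) λ j →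
      sym (trans (coeff-tabulate (λ j → elt (finToFun {size} {3 ℕ.* n} (funToFin f) (combine i j))) j)
        (trans (cong elt (trans (FinP.finToFun-funToFin f (combine i j)) (cong g (FinP.remQuot-combine i j)))) (elt-idx _)))
    where
    g : Fin 3 × Fin n → Fin size
    g (i , j) = idx (coeff (v i) (toℕ j))
    f : Fin (3 ℕ.* n) → Fin size
    f c = g (remQuot {3} n c)

  enumerate : ∀ {N} {P : Fin N → Set} → Decidable P →
    ∃ λ m → Σ (Fin m → Fin N) λ e → (∀ j → P (e j)) × (∀ i j → e i ≡ e j → i ≡ j) × (∀ k → P k → ∃ λ j → k ≡ e j)
  enumerate {zero} P? = 0 , (λ ()) , (λ ()) , (λ ()) , λ ()
  enumerate {suc N} {P} P? with enumerate {N} {P ∘ suc} (P? ∘ suc) | P? zero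
  ... | m , e , h , inj , surj | yes p = suc m , e' , h' , inj' , surj'
    where
    e' : Fin (suc m) → Fin (suc N)
    e' zero    = zero
    e' (suc j) = suc (e j)
    h' : ∀ j → P (e' j)
    h' zero    = p
    h' (suc j) = h j
    inj' : ∀ i j → e' i ≡ e' j → i ≡ j
    inj' zero    zero    _ = refl
    inj' (suc i) (suc j) q = cong suc (inj i j (FinP.suc-injective q))
    surj' : ∀ k → P k → ∃ λ j → k ≡ e' j
    surj' zero    _ = zero , refl
    surj' (suc k) q = suc (proj₁ (surj k q)) , cong suc (proj₂ (surj k q))
  ... | m , e , h , inj , surj | no np = m , suc ∘ e , h , (λ i j q → inj i j (FinP.suc-injective q)) , surj'
    where
    surj' : ∀ k → P k → ∃ λ j → k ≡ suc (e j)
    surj' zero    q = ⊥-elim (np q)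
    surj' (suc k) q = proj₁ (surj k q) , cong suc (proj₂ (surj k q))

  -- What makes a set of vectors countable by enumeration: a common degree bound, decidability, and
  -- invariance under equality of polynomials.
  record Bounded (P : Vec3 Poly → Set) : Set where
    field
      bound   : ℕ
      bounded : ∀ {v} → P v → ∀ i → Bd bound (v i)
      dec     : Decidable P
      resp    : ∀ {u v} → u ≋ᵥ v → P u → P v

  opaque
    hasCount : ∀ {P} → Bounded P → ∃ (HasCount P)
    hasCount {P} B with enumerate (λ k → Bounded.dec B (vectorOf (Bounded.bound B) k))
    ... | m , e , h , inj , surj = m , vectorOf bound ∘ e , h
        , (λ k l q → inj k l (vectorOf-injective bound _ _ (λ i → mk≋ (q i))))
        , λ v p → let (k , vk) = vectorOf-complete bound v (bounded p) ; (j , ek) = surj k (resp vk p) in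
            j , λ i → at (subst (λ z → v i ≋ vectorOf bound z i) ek (vk i))
      where open Bounded B

    self-map-onto : ∀ {P} → Bounded P → (T : Vec3 Poly → Vec3 Poly) → (∀ {v} → P v → P (T v)) →
                    (∀ {u v} → P u → P v → T u ≋ᵥ T v → u ≋ᵥ v) → ∀ {v} → P v → ∃ λ u → P u × T u ≋ᵥ v
    self-map-onto {P} B T closed inj {v} pv = case hasCount B of λ { (m , vs , h , i , surj) → go m vs h i surj }
      where
      go : ∀ m (vs : Fin m → Vec3 Poly) → (∀ k → P (vs k)) → (∀ k l → vs k ≈V vs l → k ≡ l) →
           (∀ v → P v → ∃ λ k → v ≈V vs k) → ∃ λ u → P u × T u ≋ᵥ v
      go m vs h i surj = vs l , h l , λ c → PR.trans (mk≋ (proj₂ (surj (T (vs l)) (closed (h l))) c))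
          (PR.trans (PR.reflexive (cong (λ z → vs z c) (proj₂ onto))) (PR.sym (mk≋ (proj₂ (surj v pv) c))))
        where
        π : Fin m → Fin m
        π k = proj₁ (surj (T (vs k)) (closed (h k)))
        π-injective : ∀ k l → π k ≡ π l → k ≡ l
        π-injective k l e = i k l (λ c → at (inj (h k) (h l) (λ c → PR.trans (mk≋ (proj₂ (surj (T (vs k)) (closed (h k))) c))
          (PR.trans (PR.reflexive (cong (λ z → vs z c) e)) (PR.sym (mk≋ (proj₂ (surj (T (vs l)) (closed (h l))) c))))) c))
        onto : ∃ λ l → π l ≡ proj₁ (surj v pv)
        onto = Fin-injective⇒surjective π π-injective (proj₁ (surj v pv))
        l : Fin m
        l = proj₁ onto

  HasCount-map : ∀ {A B : Vec3 Poly → Set} (f g : Vec3 Poly → Vec3 Poly) →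
    (∀ {u v} → u ≋ᵥ v → f u ≋ᵥ f v) → (∀ {u v} → u ≋ᵥ v → g u ≋ᵥ g v) →
    (∀ u → g (f u) ≋ᵥ u) → (∀ u → f (g u) ≋ᵥ u) → (∀ {u} → A u → B (f u)) → (∀ {u} → B u → A (g u)) →
    ∀ {n} → HasCount A n → HasCount B n
  HasCount-map f g f-cong g-cong gf fg ab ba (vs , h , inj , surj) = f ∘ vs , ab ∘ h
    , (λ k l e → inj k l (λ c → at (PR.trans (PR.sym (gf (vs k) c)) (PR.trans (g-cong (λ c → mk≋ (e c)) c) (gf (vs l) c)))))
    , λ v bv → let (k , e) = surj (g v) (ba bv) in k , λ c → at (PR.trans (PR.sym (fg v c)) (f-cong (λ c → mk≋ (e c)) c))

  -- From equal counts to value-preserving injections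

  strip : F → Poly → Poly
  strip a [] with a ≟ 0#
  ... | yes _ = []
  ... | no _  = a ∷ []
  strip a (b ∷ p) = a ∷ b ∷ p

  -- Without trailing zeros, equal polynomials become identical lists; so the normal form of a value
  -- can index its fibre.
  norm : Poly → Poly
  norm []      = []
  norm (a ∷ p) = strip a (norm p)

  strip-coeff : ∀ a p n → coeff (strip a p) n ≡ coeff (a ∷ p) n
  strip-coeff a [] n with a ≟ 0#
  strip-coeff a [] zero    | yes e = sym e
  strip-coeff a [] (suc n) | yes e = refl
  strip-coeff a [] n       | no _  = refl
  strip-coeff a (b ∷ p) n = refl

  norm-≋ : ∀ p → norm p ≋ p
  norm-≋ []      = PR.refl
  norm-≋ (a ∷ p) = mk≋ λ { zero → strip-coeff a (norm p) zero ; (suc n) → trans (strip-coeff a (norm p) (suc n)) (at (norm-≋ p) n) }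

  strip-0 : ∀ {a} → a ≡ 0# → strip a [] ≡ []
  strip-0 {a} e with a ≟ 0#
  ... | yes _ = refl
  ... | no n = ⊥-elim (n e)

  norm-0 : ∀ p → p ≋ 0P → norm p ≡ []
  norm-0 []      e = refl
  norm-0 (a ∷ p) e = trans (cong (strip a) (norm-0 p (mk≋ λ n → at e (suc n)))) (strip-0 (at e 0))

  norm-cong : ∀ {p r} → p ≋ r → norm p ≡ norm r
  norm-cong {[]}    {r}     e = sym (norm-0 r (PR.sym e))
  norm-cong {a ∷ p} {[]}    e = norm-0 (a ∷ p) e
  norm-cong {a ∷ p} {b ∷ r} e = cong₂ strip (at e 0) (norm-cong {p} {r} (mk≋ λ n → at e (suc n)))

  -- Counts carry no linear structure: only injectivity and the values are kept.
  record Emb (q q' : Vec3 Poly → Poly) : Set where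
    field
      to        : Vec3 Poly → Vec3 Poly
      to-cong   : ∀ {u v} → u ≋ᵥ v → to u ≋ᵥ to v
      injective : ∀ {u v} → to u ≋ᵥ to v → u ≋ᵥ v
      value     : ∀ v → q' (to v) ≋ q v

  opaque
    -- Over each value both fibres have the same size, and the i-th vector of one goes to the i-th
    -- of the other. The value is normalised, so that equal values select the same pair of
    -- enumerations.
    counts⇒Emb : ∀ {q q'} → (∀ {u v} → u ≋ᵥ v → q u ≋ q v) → (∀ {u v} → u ≋ᵥ v → q' u ≋ q' v) → (∀ p → ∃ (HasCount (λ v → q v ≋ p))) →
                 (∀ p n → HasCount (λ v → q v ≋ p) n → HasCount (λ v → q' v ≋ p) n) → Emb q q'
    counts⇒Emb {q} {q'} q-cong q'-cong count transfer = record { to = λ v → to (norm (q v)) v ; to-cong = λ {u} {v} → to-cong u v ; injective = λ {u} {v} → inj u v ; value = λ v → PR.trans (value v) (norm-≋ (q v)) }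
      where
      C : ∀ p → HasCount (λ v → q v ≋ p) (proj₁ (count p))
      C p = proj₂ (count p)
      C' : ∀ p → HasCount (λ v → q' v ≋ p) (proj₁ (count p))
      C' p = transfer p _ (C p)
      index : ∀ p v → q v ≋ p → Fin (proj₁ (count p))
      index p v e = proj₁ (proj₂ (proj₂ (proj₂ (C p))) v e)
      index-spec : ∀ p v e → v ≈V proj₁ (C p) (index p v e)
      index-spec p v e = proj₂ (proj₂ (proj₂ (proj₂ (C p))) v e)
      at-value : ∀ p v → Dec (q v ≋ p) → Vec3 Poly
      at-value p v (yes e) = proj₁ (C' p) (index p v e)
      -- A default that never matters: `to` is applied with p the normal form of q v.
      at-value p v (no _)  = v
      to : Poly → Vec3 Poly → Vec3 Poly
      to p v = at-value p v (q v ≋? p)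
      at-value-value : ∀ p v (d : Dec (q v ≋ p)) → q v ≋ p → q' (at-value p v d) ≋ p
      at-value-value p v (yes e) _ = proj₁ (proj₂ (C' p)) (index p v e)
      at-value-value p v (no n)  e = ⊥-elim (n e)
      value : ∀ v → q' (to (norm (q v)) v) ≋ norm (q v)
      value v = at-value-value (norm (q v)) v (q v ≋? norm (q v)) (PR.sym (norm-≋ (q v)))
      at-value-inj : ∀ p u v (d : Dec (q u ≋ p)) (d' : Dec (q v ≋ p)) → q u ≋ p → q v ≋ p → at-value p u d ≋ᵥ at-value p v d' → u ≋ᵥ v
      at-value-inj p u v (no n) _ e _ _ = ⊥-elim (n e)
      at-value-inj p u v _ (no n) _ e _ = ⊥-elim (n e)
      at-value-inj p u v (yes e) (yes e') _ _ h c = PR.trans (mk≋ (index-spec p u e c))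
        (PR.trans (PR.reflexive (cong (λ z → proj₁ (C p) z c) (proj₁ (proj₂ (proj₂ (C' p))) _ _ (λ c → at (h c))))) (PR.sym (mk≋ (index-spec p v e' c))))
      inj : ∀ u v → to (norm (q u)) u ≋ᵥ to (norm (q v)) v → u ≋ᵥ v
      inj u v h = at-value-inj (norm (q v)) u v (q u ≋? norm (q v)) (q v ≋? norm (q v)) (PR.trans quv (PR.sym (norm-≋ (q v)))) (PR.sym (norm-≋ (q v)))
        (subst (λ z → to z u ≋ᵥ to (norm (q v)) v) (norm-cong quv) h)
        where
        quv : q u ≋ q v
        quv = PR.trans (PR.sym (PR.trans (value u) (norm-≋ (q u)))) (PR.trans (q'-cong {to (norm (q u)) u} {to (norm (q v)) v} h) (PR.trans (value v) (norm-≋ (q v))))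
      at-value-cong : ∀ p u v (d : Dec (q u ≋ p)) (d' : Dec (q v ≋ p)) → q u ≋ p → q v ≋ p → u ≋ᵥ v → at-value p u d ≋ᵥ at-value p v d'
      at-value-cong p u v (no n) _ e _ _ = ⊥-elim (n e)
      at-value-cong p u v _ (no n) _ e _ = ⊥-elim (n e)
      at-value-cong p u v (yes e) (yes e') _ _ h c = PR.reflexive (cong (λ z → proj₁ (C' p) z c) (proj₁ (proj₂ (proj₂ (C p))) (index p u e) (index p v e')
        (λ c n → trans (sym (index-spec p u e c n)) (trans (at (h c) n) (index-spec p v e' c n)))))
      to-cong : ∀ u v → u ≋ᵥ v → to (norm (q u)) u ≋ᵥ to (norm (q v)) v
      to-cong u v h = subst (λ z → to z u ≋ᵥ to (norm (q v)) v) (sym (norm-cong (q-cong h)))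
        (at-value-cong (norm (q v)) u v (q u ≋? norm (q v)) (q v ≋? norm (q v)) (PR.trans (q-cong h) (PR.sym (norm-≋ (q v)))) (PR.sym (norm-≋ (q v))) h)

  -- Constant polynomials and division by two

  constP-0 : constP 0# ≋ 0P
  constP-0 = mk≋ λ { zero → refl ; (suc n) → refl }

  constP-+ : ∀ a b → constP (a + b) ≋ constP a ⊞ constP b
  constP-+ a b = mk≋ λ n → sym (trans (coeff-⊞ (constP a) (constP b) n) (go n))
    where go : ∀ n → coeff (constP a) n + coeff (constP b) n ≡ coeff (constP (a + b)) n
          go zero    = refl
          go (suc n) = 𝔽R.+-identityˡ 0#

  constP-neg : ∀ a → constP (- a) ≋ ⊟ constP a
  constP-neg a = mk≋ λ n → sym (trans (coeff-⊟ (constP a) n) (go n))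
    where go : ∀ n → - coeff (constP a) n ≡ coeff (constP (- a)) n
          go zero    = refl
          go (suc n) = -0≡0

  constP-* : ∀ a b → constP (a * b) ≋ constP a ⊠ constP b
  constP-* a b = mk≋ λ n → sym (trans (coeff-const* a (constP b) n) (go n))
    where go : ∀ n → a * coeff (constP b) n ≡ coeff (constP (a * b)) n
          go zero    = refl
          go (suc n) = 𝔽R.zeroʳ a

  constP-cong : ∀ {a b} → a ≡ b → constP a ≋ constP b
  constP-cong refl = PR.refl

  constP-injective : ∀ {a b} → constP a ≋ constP b → a ≡ b
  constP-injective e = at e 0

  constP≉0 : ∀ {a} → a ≢ 0# → ¬ (constP a ≋ 0P)
  constP≉0 n e = n (at e 0)

  coeff-⊠-const : ∀ p a n → coeff (p ⊠ constP a) n ≡ coeff p n * a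
  coeff-⊠-const p a n = trans (at (PR.*-comm p (constP a)) n) (trans (coeff-const* a p n) (𝔽R.*-comm _ _))

  module Halving (2≢0 : 1# + 1# ≢ 0#) where

    p+p≋0⇒p≋0 : ∀ {p} → p ⊞ p ≋ 0P → p ≋ 0P
    p+p≋0⇒p≋0 {p} e = mk≋ λ n → x*y≡0⇒y≡0 2≢0 (trans (trans (𝔽R.distribʳ _ _ _) (cong₂ _+_ (𝔽R.*-identityˡ _) (𝔽R.*-identityˡ _)))
      (trans (sym (coeff-⊞ p p n)) (at e n)))

    p+p≋r+r⇒p≋r : ∀ {p r} → p ⊞ p ≋ r ⊞ r → p ≋ r
    p+p≋r+r⇒p≋r {p} {r} e = p-r≋0⇒p≋r (p+p≋0⇒p≋0 (PR.trans
      (PS.solve 2 (λ p r → (p PS.:- r) PS.:+ (p PS.:- r) PS.:= (p PS.:+ p) PS.:- (r PS.:+ r)) PR.refl p r) (p≋r⇒p-r≋0 e)))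

  opaque
    -- The 2q values lie among q - 1 nonzero elements, and 2(q - 1) < 2q.
    avoid-zero⇒collide₃ : (f : Fin (size ℕ.* 2) → F) → (∀ i → f i ≢ 0#) → Collide₃ f
    avoid-zero⇒collide₃ f nz = case go size (idx 0#) (idx ∘ f) (λ i e → nz i (idx-injective (sym e))) of λ
      { (i , j , k , ij , ik , jk , e , e') → i , j , k , ij , ik , jk , idx-injective e , idx-injective e' }
      where
      go : ∀ n (z : Fin n) (g : Fin (n ℕ.* 2) → Fin n) → (∀ i → z ≢ g i) → Collide₃ g
      go (suc n) z g ne = case pigeonhole₃ (ℕP.m≤n⇒m≤1+n ℕP.≤-refl) (λ i → punchOut (ne i)) of λ
        { (i , j , k , ij , ik , jk , e , e') → i , j , k , ij , ik , jk , FinP.punchOut-injective (ne i) (ne j) e , FinP.punchOut-injective (ne i) (ne k) e' }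

  -- The families x = atᵏ + wtᵏ⁻¹ + b (b ∈ F), and the points (η , c) of the conic
  -- η² - ν c² = w₀² at which the vectors matched with them lie.

  module Core (2≢0 : 1# + 1# ≢ 0#) (m : Poly) (d : ℕ) (Dm : Deg= d m) (k' : ℕ) (τ : Poly) (bτ : Bd d τ)
              (τ' : F → Poly) (bτ' : ∀ c → Bd d (τ' c)) (G : F → Poly) (ν : F) (nonSquare : NonSquare 2≢0 ν)
              (κ a w₀ : F) (a≢0 : a ≢ 0#) (w₀≢0 : w₀ ≢ 0#) (aw : a * a + - κ ≡ w₀ * w₀) where

    open Halving 2≢0

    private
      k : ℕ
      k = suc k'

    X : Poly → Poly
    X x = m ⊠ x ⊞ τ

    Y : F → Poly → Poly
    Y c y = m ⊠ y ⊞ τ' c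

    -- Holds when (x , 1), or (x , b) with a fixed b, and (y , c) have equal values. `eqn` is that
    -- equality multiplied by m after completing the square; `conic` compares the coefficients at
    -- the top degree, divided by that of m.
    record Match (x y : Poly) (c : F) : Set where
      field
        bdy   : Bd (suc k) y
        c≢0   : c ≢ 0#
        eqn   : X x ⊠ X x ⊞ ⊟ (Y c y ⊠ Y c y) ≋ G c
        conic : coeff y k * coeff y k + - (ν * (c * c)) ≡ coeff x k * coeff x k + - κ
    open Match

    module _ {x₁ x₂ y₁ y₂ c} (M₁ : Match x₁ y₁ c) (M₂ : Match x₂ y₂ c)
             (bx₁ : Bd (suc k) x₁) (bx₂ : Bd (suc k) x₂) (ax₁ : coeff x₁ k ≡ a) (ax₂ : coeff x₂ k ≡ a) where

      -- Both matches have the same c, so X₁² - X₂² = Y₁² - Y₂². Each side is divisible by m, since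
      -- X₁ - X₂ = m(x₁ - x₂) and likewise for Y.
      cancelled : (x₁ ⊞ ⊟ x₂) ⊠ (X x₁ ⊞ X x₂) ≋ (y₁ ⊞ ⊟ y₂) ⊠ (Y c y₁ ⊞ Y c y₂)
      cancelled = ⊠-cancelˡ (Deg=⇒≉0 Dm) (begin
        m ⊠ ((x₁ ⊞ ⊟ x₂) ⊠ (X x₁ ⊞ X x₂))   ≈⟨ factor m x₁ x₂ τ ⟩
        X x₁ ⊠ X x₁ ⊞ ⊟ (X x₂ ⊠ X x₂)       ≈⟨ swap (PR.trans (eqn M₁) (PR.sym (eqn M₂))) ⟩
        Y c y₁ ⊠ Y c y₁ ⊞ ⊟ (Y c y₂ ⊠ Y c y₂) ≈⟨ factor m y₁ y₂ (τ' c) ⟨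
        m ⊠ ((y₁ ⊞ ⊟ y₂) ⊠ (Y c y₁ ⊞ Y c y₂)) ∎)
        where
        open import Relation.Binary.Reasoning.Setoid PR.setoid
        factor : ∀ m x y t → m ⊠ ((x ⊞ ⊟ y) ⊠ ((m ⊠ x ⊞ t) ⊞ (m ⊠ y ⊞ t))) ≋ (m ⊠ x ⊞ t) ⊠ (m ⊠ x ⊞ t) ⊞ ⊟ ((m ⊠ y ⊞ t) ⊠ (m ⊠ y ⊞ t))
        factor = PS.solve 4 (λ m x y t → m PS.:* ((x PS.:- y) PS.:* ((m PS.:* x PS.:+ t) PS.:+ (m PS.:* y PS.:+ t))) PS.:= (m PS.:* x PS.:+ t) PS.:* (m PS.:* x PS.:+ t) PS.:- (m PS.:* y PS.:+ t) PS.:* (m PS.:* y PS.:+ t)) PR.refl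
        swap : ∀ {p q r s} → p ⊞ ⊟ q ≋ r ⊞ ⊟ s → p ⊞ ⊟ r ≋ q ⊞ ⊟ s
        swap {p} {q} {r} {s} e = PR.trans (PS.solve 3 (λ p q r → p PS.:- r PS.:= (p PS.:- q) PS.:+ (q PS.:- r)) PR.refl p q r)
          (PR.trans (PR.+-congʳ e) (PS.solve 3 (λ r s q → (r PS.:- s) PS.:+ (q PS.:- r) PS.:= q PS.:- s) PR.refl r s q))

      private
        bX : ∀ {x} → Bd (suc k) x → Bd (suc (d ℕ.+ k)) (X x)
        bX {x} b = Bd-+ _ _ (Bd-* m x (proj₁ Dm) b (ℕP.≤-reflexive (cong suc (ℕP.+-suc d k)))) (Bd-mono (ℕP.≤-trans (ℕP.m≤m+n d k) (ℕP.n≤1+n _)) bτ)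
        bY : ∀ {y} → Bd (suc k) y → Bd (suc (d ℕ.+ k)) (Y c y)
        bY {y} b = Bd-+ _ _ (Bd-* m y (proj₁ Dm) b (ℕP.≤-reflexive (cong suc (ℕP.+-suc d k)))) (Bd-mono (ℕP.≤-trans (ℕP.m≤m+n d k) (ℕP.n≤1+n _)) (bτ' c))
        top-coeff : ∀ x t → Bd (suc k) x → Bd d t → coeff (m ⊠ x ⊞ t) (d ℕ.+ k) ≡ coeff m d * coeff x k
        top-coeff x t b bt = trans (coeff-⊞ (m ⊠ x) t (d ℕ.+ k)) (trans (cong₂ _+_ (coeff-*-top m x (proj₁ Dm) b) (bz bt _ (ℕP.m≤m+n d k))) (𝔽R.+-identityʳ _))

        XX : Poly
        XX = X x₁ ⊞ X x₂
        YY : Poly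
        YY = Y c y₁ ⊞ Y c y₂
        double : ∀ u v → u * v + u * v ≡ (1# + 1#) * (u * v)
        double = 𝔽S.solve 2 (λ u v → u 𝔽S.:* v 𝔽S.:+ u 𝔽S.:* v 𝔽S.:= (𝔽S.con (pos 1) 𝔽S.:+ 𝔽S.con (pos 1)) 𝔽S.:* (u 𝔽S.:* v)) refl
        XX-coeff : coeff XX (d ℕ.+ k) ≡ (1# + 1#) * (coeff m d * a)
        XX-coeff = trans (coeff-⊞ (X x₁) (X x₂) _) (trans (cong₂ _+_
          (trans (top-coeff x₁ τ bx₁ bτ) (cong (coeff m d *_) ax₁)) (trans (top-coeff x₂ τ bx₂ bτ) (cong (coeff m d *_) ax₂))) (double _ _))
        XX-deg : Deg= (d ℕ.+ k) XX
        XX-deg = Bd-+ _ _ (bX bx₁) (bX bx₂) , λ e → *-nonzero 2≢0 (*-nonzero (proj₂ Dm) a≢0) (trans (sym XX-coeff) e)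

      -- At η = 0 two matched vectors cannot differ in degree exactly k - 1.
      origin-unique : Deg= k' (x₁ ⊞ ⊟ x₂) → coeff y₁ k ≡ 0# → coeff y₂ k ≡ 0# → ⊥
      origin-unique dx z₁ z₂ = proj₂ (Deg=-* _ _ dx XX-deg) (trans (at cancelled _) (bz
        (Bd-* (y₁ ⊞ ⊟ y₂) YY (Bd-- y₁ y₂ by₁ by₂) (Bd-+ _ _ (bY' by₁) (bY' by₂)) (ℕP.≤-reflexive refl)) _ ℕP.≤-refl))
        where
        by₁ : Bd k y₁
        by₁ = Bd-suc (bdy M₁) z₁
        by₂ : Bd k y₂
        by₂ = Bd-suc (bdy M₂) z₂
        bY' : ∀ {y} → Bd k y → Bd (d ℕ.+ k) (Y c y)
        bY' {y} b = Bd-+ _ _ (Bd-* m y (proj₁ Dm) b ℕP.≤-refl) (Bd-mono (ℕP.m≤m+n d k) (bτ' c))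

      module Pair {β η ρ} (β≢0 : β ≢ 0#) (η≢0 : η ≢ 0#) (aρ : a ≡ ρ * η) (dx : x₁ ⊞ ⊟ x₂ ≋ constP β) (e₁ : coeff y₁ k ≡ η) (e₂ : coeff y₂ k ≡ η) where
        private
          YY-coeff : coeff YY (d ℕ.+ k) ≡ (1# + 1#) * (coeff m d * η)
          YY-coeff = trans (coeff-⊞ (Y c y₁) (Y c y₂) _) (trans (cong₂ _+_
            (trans (top-coeff y₁ (τ' c) (bdy M₁) (bτ' c)) (cong (coeff m d *_) e₁)) (trans (top-coeff y₂ (τ' c) (bdy M₂) (bτ' c)) (cong (coeff m d *_) e₂))) (double _ _))
          YY-deg : Deg= (d ℕ.+ k) YY
          YY-deg = Bd-+ _ _ (bY (bdy M₁)) (bY (bdy M₂)) , λ e → *-nonzero 2≢0 (*-nonzero (proj₂ Dm) η≢0) (trans (sym YY-coeff) e)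
          βXX : constP β ⊠ XX ≋ (y₁ ⊞ ⊟ y₂) ⊠ YY
          βXX = PR.trans (PR.*-congʳ (PR.sym dx)) cancelled
          -- X₁ + X₂ and Y₁ + Y₂ both have degree d + k, so y₁ - y₂ is constant like x₁ - x₂. Their
          -- leading coefficients are proportional to a and η, which makes ρ = a/η the ratio of the
          -- two constants.
          dy : Bd 1 (y₁ ⊞ ⊟ y₂)
          dy = case degree (y₁ ⊞ ⊟ y₂) of λ
            { (inj₁ z) → Bd-resp (PR.sym z) Bd-0
            ; (inj₂ (e , D)) → case e ℕ.≟ 0 of λ
              { (yes refl) → proj₁ D
              ; (no e≢0) → ⊥-elim (proj₂ (Deg=-* _ _ D YY-deg) (trans (sym (at βXX _)) (bz
                   (Bd-* (constP β) XX (Bd-const β) (proj₁ XX-deg) (ℕP.≤-reflexive refl)) _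
                     (ℕP.+-monoˡ-≤ (d ℕ.+ k) (ℕP.n≢0⇒n>0 e≢0))))) } }
          γ : F
          γ = coeff (y₁ ⊞ ⊟ y₂) 0
          dyγ : y₁ ⊞ ⊟ y₂ ≋ constP γ
          dyγ = Bd1⇒const dy
          βργ : β * ρ ≡ γ
          βργ = *-cancelˡ (*-nonzero 2≢0 (*-nonzero (proj₂ Dm) η≢0)) (begin
            (1# + 1#) * (coeff m d * η) * (β * ρ)     ≡⟨ 𝔽S.solve 5 (λ t u h b r → t 𝔽S.:* (u 𝔽S.:* h) 𝔽S.:* (b 𝔽S.:* r) 𝔽S.:= b 𝔽S.:* (t 𝔽S.:* (u 𝔽S.:* (r 𝔽S.:* h)))) refl (1# + 1#) (coeff m d) η β ρ ⟩
            β * ((1# + 1#) * (coeff m d * (ρ * η)))   ≡⟨ cong (λ z → β * ((1# + 1#) * (coeff m d * z))) aρ ⟨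
            β * ((1# + 1#) * (coeff m d * a))         ≡⟨ cong (β *_) XX-coeff ⟨
            β * coeff XX (d ℕ.+ k)                    ≡⟨ coeff-const* β XX (d ℕ.+ k) ⟨
            coeff (constP β ⊠ XX) (d ℕ.+ k)           ≡⟨ at (PR.trans βXX (PR.*-congʳ dyγ)) (d ℕ.+ k) ⟩
            coeff (constP γ ⊠ YY) (d ℕ.+ k)           ≡⟨ coeff-const* γ YY (d ℕ.+ k) ⟩
            γ * coeff YY (d ℕ.+ k)                    ≡⟨ cong (γ *_) YY-coeff ⟩
            γ * ((1# + 1#) * (coeff m d * η))         ≡⟨ 𝔽R.*-comm _ _ ⟩
            (1# + 1#) * (coeff m d * η) * γ           ∎)
            where open ≡.≡-Reasoning

        sum-relation : X x₁ ⊞ X x₂ ≋ constP ρ ⊠ (Y c y₁ ⊞ Y c y₂)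
        sum-relation = ⊠-cancelˡ (constP≉0 β≢0) (PR.trans βXX (PR.trans (PR.*-congʳ (PR.trans dyγ
          (PR.trans (constP-cong (sym βργ)) (constP-* β ρ)))) (PR.*-assoc _ _ _)))

        difference-relation : Y c y₁ ⊞ ⊟ Y c y₂ ≋ constP ρ ⊠ (X x₁ ⊞ ⊟ X x₂)
        difference-relation = PR.trans (linear m y₁ y₂ (τ' c)) (PR.trans (PR.*-congˡ (PR.trans dyγ (PR.trans (constP-cong (sym βργ)) (constP-* β ρ))))
          (PR.trans (shuffle m (constP β) (constP ρ)) (PR.*-congˡ (PR.sym (PR.trans (linear m x₁ x₂ τ) (PR.*-congˡ dx))))))
          where
          linear : ∀ m x y t → (m ⊠ x ⊞ t) ⊞ ⊟ (m ⊠ y ⊞ t) ≋ m ⊠ (x ⊞ ⊟ y)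
          linear = PS.solve 4 (λ m x y t → (m PS.:* x PS.:+ t) PS.:- (m PS.:* y PS.:+ t) PS.:= m PS.:* (x PS.:- y)) PR.refl
          shuffle : ∀ m b r → m ⊠ (b ⊠ r) ≋ r ⊠ (m ⊠ b)
          shuffle = PS.solve 3 (λ m b r → m PS.:* (b PS.:* r) PS.:= r PS.:* (m PS.:* b)) PR.refl

        -- The sum relation reads mZ = 2(ρτ' - τ). The right side has degree below that of m, so
        -- both sides vanish.
        remainder : τ ≋ constP ρ ⊠ τ' c
        remainder = PR.sym (p+p≋r+r⇒p≋r (p-r≋0⇒p≋r (PR.trans (PR.sym quotient) (PR.trans (PR.*-congˡ Z≋0) (PR.zeroʳ m)))))
          where
          Z T : Poly
          Z = (x₁ ⊞ x₂) ⊞ ⊟ (constP ρ ⊠ (y₁ ⊞ y₂))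
          T = (constP ρ ⊠ τ' c ⊞ constP ρ ⊠ τ' c) ⊞ ⊟ (τ ⊞ τ)
          quotient : m ⊠ Z ≋ T
          quotient = PR.trans (PS.solve 8 (λ m x₁ x₂ t r y₁ y₂ s →
              m PS.:* ((x₁ PS.:+ x₂) PS.:- r PS.:* (y₁ PS.:+ y₂))
              PS.:= ((m PS.:* x₁ PS.:+ t) PS.:+ (m PS.:* x₂ PS.:+ t) PS.:- r PS.:* ((m PS.:* y₁ PS.:+ s) PS.:+ (m PS.:* y₂ PS.:+ s))) PS.:+ ((r PS.:* s PS.:+ r PS.:* s) PS.:- (t PS.:+ t)))
              PR.refl m x₁ x₂ τ (constP ρ) y₁ y₂ (τ' c))
            (PR.trans (PR.+-congʳ (p≋r⇒p-r≋0 sum-relation)) (PR.+-identityˡ T))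
          bT : Bd d T
          bT = Bd-- _ _ (Bd-+ _ _ r r) (Bd-+ _ _ bτ bτ)
            where r = Bd-* (constP ρ) (τ' c) (Bd-const ρ) (bτ' c) ℕP.≤-refl
          Z≋0 : Z ≋ 0P
          Z≋0 = case degree Z of λ
            { (inj₁ z) → z
            ; (inj₂ (e , D)) → ⊥-elim (proj₂ (Deg=-* m Z Dm D) (trans (at quotient _) (bz bT _ (ℕP.m≤m+n d e)))) }

        -- For ρ² = 1 the difference relation can be inverted; added to the sum relation it gives X₁
        -- = ρY₁, hence X₁² = Y₁².
        unit-ratio⇒success : ρ * ρ ≡ 1# → G c ≋ 0P
        unit-ratio⇒success ρ² = PR.trans (PR.sym (eqn M₁)) (p≋r⇒p-r≋0 (PR.trans (PR.*-cong X≋ X≋)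
            (PR.trans (PS.solve 2 (λ r y → (r PS.:* y) PS.:* (r PS.:* y) PS.:= (r PS.:* r) PS.:* (y PS.:* y)) PR.refl (constP ρ) (Y c y₁))
            (PR.trans (PR.*-congʳ ρρ) (PR.*-identityˡ _)))))
          where
          ρρ : constP ρ ⊠ constP ρ ≋ 1P
          ρρ = PR.trans (PR.sym (constP-* ρ ρ)) (constP-cong ρ²)
          back : X x₁ ⊞ ⊟ X x₂ ≋ constP ρ ⊠ (Y c y₁ ⊞ ⊟ Y c y₂)
          back = PR.sym (PR.trans (PR.*-congˡ difference-relation) (PR.trans (PR.sym (PR.*-assoc _ _ _)) (PR.trans (PR.*-congʳ ρρ) (PR.*-identityˡ _))))
          X≋ : X x₁ ≋ constP ρ ⊠ Y c y₁
          X≋ = p+p≋r+r⇒p≋r (PR.trans (PS.solve 2 (λ p q → p PS.:+ p PS.:= (p PS.:+ q) PS.:+ (p PS.:- q)) PR.refl (X x₁) (X x₂))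
            (PR.trans (PR.+-cong sum-relation back) (PS.solve 3 (λ r p q → r PS.:* (p PS.:+ q) PS.:+ r PS.:* (p PS.:- q) PS.:= r PS.:* p PS.:+ r PS.:* p) PR.refl (constP ρ) (Y c y₁) (Y c y₂))))

    -- the slope of a point of the conic, seen from (w₀ , 0)

    slope : F → F → F
    slope η c = (η + - w₀) * c ⁻¹

    module _ {η c} (c≢0 : c ≢ 0#) (on : η * η + - (ν * (c * c)) ≡ w₀ * w₀) where

      slope-* : slope η c * c ≡ η + - w₀
      slope-* = trans (𝔽S.solve 3 (λ e i c → e 𝔽S.:* i 𝔽S.:* c 𝔽S.:= e 𝔽S.:* (c 𝔽S.:* i)) refl (η + - w₀) (c ⁻¹) c)
        (trans (cong ((η + - w₀) *_) (inverseʳ c c≢0)) (𝔽R.*-identityʳ _))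

      -- Put η = w₀ + sc into the conic and cancel c: a line through (w₀ , 0) meets the conic in one
      -- further point.
      slope-equation : (slope η c * slope η c + - ν) * c ≡ - ((w₀ + w₀) * slope η c)
      slope-equation = *-cancelˡ c≢0 (x-y≡0⇒x≡y (trans (expand s c ν w₀) (trans (cong₂ _+_ (cong (λ z → (z + w₀) * (z + w₀) + - (ν * (c * c))) slope-*) refl)
          (trans (cong (_+ - (w₀ * w₀)) (trans (cong (λ z → z * z + - (ν * (c * c))) (𝔽S.solve 2 (λ e w → (e 𝔽S.:- w) 𝔽S.:+ w 𝔽S.:= e) refl η w₀)) on)) (𝔽R.-‿inverseʳ _)))))
        where
        s : F
        s = slope η c
        expand : ∀ s c n w → c * ((s * s + - n) * c) + - (c * - ((w + w) * s)) ≡ ((s * c + w) * (s * c + w) + - (n * (c * c))) + - (w * w)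
        expand = 𝔽S.solve 4 (λ s c n w → c 𝔽S.:* ((s 𝔽S.:* s 𝔽S.:- n) 𝔽S.:* c) 𝔽S.:- c 𝔽S.:* 𝔽S.:- ((w 𝔽S.:+ w) 𝔽S.:* s)
                   𝔽S.:= ((s 𝔽S.:* c 𝔽S.:+ w) 𝔽S.:* (s 𝔽S.:* c 𝔽S.:+ w) 𝔽S.:- n 𝔽S.:* (c 𝔽S.:* c)) 𝔽S.:- w 𝔽S.:* w) refl

      slope≢0 : slope η c ≢ 0#
      slope≢0 e = *-nonzero {(- ν)} (λ z → nonSquare 0# (trans (𝔽R.zeroˡ _) (sym (trans (sym (neg-neg ν)) (trans (cong -_ z) -0≡0))))) c≢0
        (trans (cong (_* c) (trans (sym (𝔽R.+-identityˡ _)) (cong (_+ - ν) (sym (trans (cong₂ _*_ e e) (𝔽R.zeroˡ _))))))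
          (trans slope-equation (trans (cong -_ (trans (cong ((w₀ + w₀) *_) e) (𝔽R.zeroʳ _))) -0≡0)))
        where
        neg-neg : ∀ x → - (- x) ≡ x
        neg-neg = 𝔽S.solve 1 (λ x → 𝔽S.:- (𝔽S.:- x) 𝔽S.:= x) refl

    -- s² - ν ≠ 0 because ν is not a square, so the slope equation determines c, and then η.
    slope-injective : ∀ {η c η' c'} → c ≢ 0# → c' ≢ 0# → η * η + - (ν * (c * c)) ≡ w₀ * w₀ → η' * η' + - (ν * (c' * c')) ≡ w₀ * w₀ →
                      slope η c ≡ slope η' c' → η ≡ η' × c ≡ c'
    slope-injective {η} {c} {η'} {c'} n n' on on' e = ηη , cc
      where
      s : F
      s = slope η c
      q≢0 : s * s + - ν ≢ 0#
      q≢0 z = nonSquare s (x-y≡0⇒x≡y z)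
      cc : c ≡ c'
      cc = *-cancelˡ q≢0 (trans (slope-equation n on) (trans (cong (λ z → - ((w₀ + w₀) * z)) e) (sym (trans (cong (λ z → (z * z + - ν) * c') e) (slope-equation n' on')))))
      ηη : η ≡ η'
      ηη = x-y≡0⇒x≡y (trans (𝔽S.solve 3 (λ a b w → a 𝔽S.:- b 𝔽S.:= (a 𝔽S.:- w) 𝔽S.:- (b 𝔽S.:- w)) refl η η' w₀)
        (x≡y⇒x-y≡0 (trans (sym (slope-* n on)) (trans (cong₂ _*_ e cc) (slope-* n' on')))))

    xs : F → F → Poly
    xs w b = monoP a k ⊞ (monoP w k' ⊞ constP b)

    xs-bd : ∀ w b → Bd (suc k) (xs w b)
    xs-bd w b = Bd-+ _ _ (Bd-monoP a k) (Bd-+ _ _ (Bd-mono (ℕP.n≤1+n _) (Bd-monoP w k')) (Bd-mono (s≤s z≤n) (Bd-const b)))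

    xs-coeff : ∀ w b → coeff (xs w b) k ≡ a
    xs-coeff w b = trans (coeff-⊞ (monoP a k) _ k) (trans (cong₂ _+_ (coeff-monoP a k) (trans (coeff-⊞ (monoP w k') (constP b) k)
      (trans (cong (_+ 0#) (bz (Bd-monoP w k') k ℕP.≤-refl)) (𝔽R.+-identityʳ 0#)))) (𝔽R.+-identityʳ a))

    xs-b : ∀ w b b' → xs w b ⊞ ⊟ xs w b' ≋ constP (b + - b')
    xs-b w b b' = PR.trans (PS.solve 4 (λ a w b b' → (a PS.:+ (w PS.:+ b)) PS.:- (a PS.:+ (w PS.:+ b')) PS.:= b PS.:- b') PR.refl (monoP a k) (monoP w k') (constP b) (constP b'))
      (PR.trans (PR.+-congˡ (PR.sym (constP-neg b'))) (PR.sym (constP-+ b (- b'))))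

    -- For k' = 0 the term w would merge with b; `Good` sets that case apart.
    xs-w : ∀ w w' b b' → k' ≢ 0 → w ≢ w' → Deg= k' (xs w b ⊞ ⊟ xs w' b')
    xs-w w w' b b' k'≢0 w≢w' = Deg=-resp (PR.sym (PS.solve 5 (λ a w b w' b' → (a PS.:+ (w PS.:+ b)) PS.:- (a PS.:+ (w' PS.:+ b')) PS.:= (w PS.:- w') PS.:+ (b PS.:- b')) PR.refl (monoP a k) (monoP w k') (constP b) (monoP w' k') (constP b')))
      ( Bd-+ _ _ (Bd-- _ _ (Bd-monoP w k') (Bd-monoP w' k')) (Bd-mono (s≤s z≤n) (Bd-- _ _ (Bd-const b) (Bd-const b')))
      , λ e → w≢w' (x-y≡0⇒x≡y (trans (sym (trans (coeff-⊞ (monoP w k' ⊞ ⊟ monoP w' k') _ k') (trans (cong₂ _+_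
          (trans (coeff-- (monoP w k') (monoP w' k') k') (cong₂ (λ x y → x + - y) (coeff-monoP w k') (coeff-monoP w' k')))
          (bz (Bd-- _ _ (Bd-const b) (Bd-const b')) k' (ℕP.n≢0⇒n>0 k'≢0))) (𝔽R.+-identityʳ _)))) e)) )

    module Contradiction
      (match : ∀ x → Bd (suc k) x → ∃ λ y → ∃ λ c → Match x y c)
      (failure : ∀ c ρ → c ≢ 0# → ρ * ρ ≡ 1# → G c ≋ 0P → τ ≋ constP ρ ⊠ τ' c → ⊥) where

      yᵐ : F → F → Poly
      yᵐ w b = proj₁ (match (xs w b) (xs-bd w b))

      cᵐ : F → F → F
      cᵐ w b = proj₁ (proj₂ (match (xs w b) (xs-bd w b)))

      isMatch : ∀ w b → Match (xs w b) (yᵐ w b) (cᵐ w b)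
      isMatch w b = proj₂ (proj₂ (match (xs w b) (xs-bd w b)))

      ηᵐ : F → F → F
      ηᵐ w b = coeff (yᵐ w b) k

      on-conic : ∀ {w b y c} → Match (xs w b) y c → coeff y k * coeff y k + - (ν * (c * c)) ≡ w₀ * w₀
      on-conic {w} {b} M = trans (conic M) (trans (cong (λ z → z * z + - κ) (xs-coeff w b)) aw)

      origin-clash : ∀ {w b y c w' b' y' c'} → Match (xs w b) y c → Match (xs w' b') y' c' → c ≡ c' →
                     Deg= k' (xs w b ⊞ ⊟ xs w' b') → coeff y k ≡ 0# → coeff y' k ≡ 0# → ⊥
      origin-clash {w} {b} {w' = w'} {b'} M M' refl = origin-unique M M' (xs-bd w b) (xs-bd w' b') (xs-coeff w b) (xs-coeff w' b')

      a≡a/η*η : ∀ {η} → η ≢ 0# → a ≡ (a * η ⁻¹) * η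
      a≡a/η*η {η} n = sym (trans (𝔽R.*-assoc a (η ⁻¹) η) (trans (cong (a *_) (trans (𝔽R.*-comm _ _) (inverseʳ η n))) (𝔽R.*-identityʳ a)))

      b-b'≢0 : ∀ {b b' : F} → b ≢ b' → b + - b' ≢ 0#
      b-b'≢0 n e = n (x-y≡0⇒x≡y e)

      two-matches : ∀ {w b b' y y' c c' η} → Match (xs w b) y c → Match (xs w b') y' c' → c ≡ c' → b ≢ b' → η ≢ 0# →
                    coeff y k ≡ η → coeff y' k ≡ η →
                    τ ≋ constP (a * η ⁻¹) ⊠ τ' c × ((a * η ⁻¹) * (a * η ⁻¹) ≢ 1#)
                    × (X (xs w b) ⊞ X (xs w b') ≋ constP (a * η ⁻¹) ⊠ (Y c y ⊞ Y c y'))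
                    × (Y c y ⊞ ⊟ Y c y' ≋ constP (a * η ⁻¹) ⊠ (X (xs w b) ⊞ ⊟ X (xs w b')))
      two-matches {w} {b} {b'} {c = c} M M' refl b≢b' η≢0 e e' = remainder , (λ ρ² → failure c _ (c≢0 M) ρ² (unit-ratio⇒success ρ²) remainder) , sum-relation , difference-relation
        where open Pair M M' (xs-bd w b) (xs-bd w b') (xs-coeff w b) (xs-coeff w b') (b-b'≢0 b≢b') η≢0 (a≡a/η*η η≢0) (xs-b w b b') e e'

      -- Two sum relations sharing x₁ give X₂ - X₃ = ρ(Y₂ - Y₃), while the difference relation gives
      -- Y₂ - Y₃ = ρ(X₂ - X₃). Hence ρ² = 1, which `two-matches` excludes.
      three-matches : ∀ {w b₁ b₂ b₃ y₁ y₂ y₃ c₁ c₂ c₃ η} → Match (xs w b₁) y₁ c₁ → Match (xs w b₂) y₂ c₂ → Match (xs w b₃) y₃ c₃ →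
                      c₁ ≡ c₂ → c₁ ≡ c₃ → b₁ ≢ b₂ → b₁ ≢ b₃ → b₂ ≢ b₃ → η ≢ 0# →
                      coeff y₁ k ≡ η → coeff y₂ k ≡ η → coeff y₃ k ≡ η → ⊥
      three-matches {w} {b₁} {b₂} {b₃} {y₁} {y₂} {y₃} {c₁} {η = η} M₁ M₂ M₃ refl refl n₁₂ n₁₃ n₂₃ η≢0 e₁ e₂ e₃ = go
        (two-matches M₁ M₂ refl n₁₂ η≢0 e₁ e₂) (two-matches M₁ M₃ refl n₁₃ η≢0 e₁ e₃) (two-matches M₂ M₃ refl n₂₃ η≢0 e₂ e₃)
        where
        ρ : F
        ρ = a * η ⁻¹
        r X₁ X₂ X₃ Y₁ Y₂ Y₃ : Poly
        r = constP ρ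
        X₁ = X (xs w b₁)
        X₂ = X (xs w b₂)
        X₃ = X (xs w b₃)
        Y₁ = Y c₁ y₁
        Y₂ = Y c₁ y₂
        Y₃ = Y c₁ y₃
        D≉0 : ¬ (X₂ ⊞ ⊟ X₃ ≋ 0P)
        D≉0 z = ⊠-nonzero (Deg=⇒≉0 Dm) (constP≉0 (b-b'≢0 n₂₃)) (PR.trans (PR.*-congˡ (PR.sym (xs-b w b₂ b₃)))
          (PR.trans (PS.solve 4 (λ m x y t → m PS.:* (x PS.:- y) PS.:= (m PS.:* x PS.:+ t) PS.:- (m PS.:* y PS.:+ t)) PR.refl m (xs w b₂) (xs w b₃) τ) z))
        go : _ × _ × (X₁ ⊞ X₂ ≋ r ⊠ (Y₁ ⊞ Y₂)) × _ → _ × _ × (X₁ ⊞ X₃ ≋ r ⊠ (Y₁ ⊞ Y₃)) × _ →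
             (τ ≋ r ⊠ τ' c₁) × (ρ * ρ ≢ 1#) × (X₂ ⊞ X₃ ≋ r ⊠ (Y₂ ⊞ Y₃)) × (Y₂ ⊞ ⊟ Y₃ ≋ r ⊠ (X₂ ⊞ ⊟ X₃)) → ⊥
        go (_ , _ , s₁₂ , _) (_ , _ , s₁₃ , _) (_ , ρ²≢1 , _ , d₂₃) = ρ²≢1 (sym (constP-injective (⊠-cancelʳ D≉0 (PR.trans (PR.*-identityˡ _) (begin
          X₂ ⊞ ⊟ X₃                           ≈⟨ PS.solve 3 (λ x y z → y PS.:- z PS.:= (x PS.:+ y) PS.:- (x PS.:+ z)) PR.refl X₁ X₂ X₃ ⟩
          (X₁ ⊞ X₂) ⊞ ⊟ (X₁ ⊞ X₃)             ≈⟨ PR.+-cong s₁₂ (PR.-‿cong s₁₃) ⟩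
          r ⊠ (Y₁ ⊞ Y₂) ⊞ ⊟ (r ⊠ (Y₁ ⊞ Y₃))   ≈⟨ PS.solve 4 (λ r x y z → r PS.:* (x PS.:+ y) PS.:- r PS.:* (x PS.:+ z) PS.:= r PS.:* (y PS.:- z)) PR.refl r Y₁ Y₂ Y₃ ⟩
          r ⊠ (Y₂ ⊞ ⊟ Y₃)                     ≈⟨ PR.*-congˡ d₂₃ ⟩
          r ⊠ (r ⊠ (X₂ ⊞ ⊟ X₃))               ≈⟨ PR.trans (PR.sym (PR.*-assoc r r _)) (PR.*-congʳ (PR.sym (constP-* ρ ρ))) ⟩
          constP (ρ * ρ) ⊠ (X₂ ⊞ ⊟ X₃)        ∎)))))
          where
          open import Relation.Binary.Reasoning.Setoid PR.setoid
          ⊠-cancelʳ : ∀ {x y z} → ¬ (z ≋ 0P) → x ⊠ z ≋ y ⊠ z → x ≋ y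
          ⊠-cancelʳ nz e = ⊠-cancelˡ nz (PR.trans (PR.*-comm _ _) (PR.trans e (PR.*-comm _ _)))

      Good : F → Set
      Good w = (∀ b → ηᵐ w b ≢ 0#) ⊎ k' ≡ 0

      opaque
        -- At η = 0 the conic fixes c up to sign. If the families w = 0, 1, -1 all met η = 0, two of
        -- them would do so with the same c; their members differ in degree exactly k - 1, against
        -- `origin-unique`.
        good-family : ∃ Good
        good-family = case k' ℕ.≟ 0 of λ { (yes e) → 0# , inj₂ e ; (no n) → search n }
          where
          Bad : F → Set
          Bad w = ∃ λ b → ηᵐ w b ≡ 0#
          bad? : ∀ w → Dec (Bad w)
          bad? w = anyF? (λ b → ηᵐ w b ≟ 0#)
          good : ∀ {w} → ¬ Bad w → ∃ Good
          good {w} n = w , inj₁ (λ b e → n (b , e))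
          module _ (k'≢0 : k' ≢ 0) where
            c² : ∀ {w w'} (B : Bad w) (B' : Bad w') → cᵐ w (proj₁ B) * cᵐ w (proj₁ B) ≡ cᵐ w' (proj₁ B') * cᵐ w' (proj₁ B')
            c² {w} {w'} (b , e) (b' , e') = *-cancelˡ {ν} (λ z → nonSquare 0# (trans (𝔽R.zeroˡ _) (sym z)))
              (neg-injective (trans (sym (at0 e (on-conic (isMatch w b)))) (at0 e' (on-conic (isMatch w' b')))))
              where
              at0 : ∀ {η v} → η ≡ 0# → η * η + - v ≡ w₀ * w₀ → w₀ * w₀ ≡ - v
              at0 {v = v} z q = trans (sym q) (trans (cong (_+ - v) (trans (cong₂ _*_ z z) (𝔽R.zeroˡ _))) (𝔽R.+-identityˡ _))
              neg-injective : ∀ {x y} → - x ≡ - y → x ≡ y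
              neg-injective {x} {y} e = trans (sym (-‿involutive x)) (trans (cong -_ e) (-‿involutive y))
                where open import Algebra.Properties.Ring 𝔽R.ring using (-‿involutive)
            clash : ∀ {w w'} (B : Bad w) (B' : Bad w') → w ≢ w' → cᵐ w (proj₁ B) ≡ cᵐ w' (proj₁ B') → ⊥
            clash {w} {w'} (b , e) (b' , e') n q = origin-clash (isMatch w b) (isMatch w' b') q (xs-w w w' b b' k'≢0 n) e e'
            opposite : ∀ {w w'} (B : Bad w) (B' : Bad w') → w ≢ w' → cᵐ w (proj₁ B) ≡ - cᵐ w' (proj₁ B')
            opposite B B' n = case x²≡y²⇒x≡±y (c² B B') of λ { (inj₁ q) → ⊥-elim (clash B B' n q) ; (inj₂ q) → q }
            all-bad : Bad 0# → Bad 1# → Bad (- 1#) → ⊥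
            all-bad B₀ B₁ B₂ = clash B₁ B₂ (λ e → 0≢1 (sym (x≡-x⇒x≡0 2≢0 e))) (neg-inj (trans (sym (opposite B₀ B₁ 0≢1)) (opposite B₀ B₂ 0≢-1)))
              where
              open import Algebra.Properties.Ring 𝔽R.ring using (-‿involutive)
              neg-inj : ∀ {x y} → - x ≡ - y → x ≡ y
              neg-inj {x} {y} e = trans (sym (-‿involutive x)) (trans (cong -_ e) (-‿involutive y))
              0≢-1 : 0# ≢ - 1#
              0≢-1 e = 0≢1 (trans (sym -0≡0) (trans (cong -_ e) (-‿involutive 1#)))
            search : ∃ Good
            search = case bad? 0# of λ { (no n) → good n ; (yes B₀) →
                     case bad? 1# of λ { (no n) → good n ; (yes B₁) →
                     case bad? (- 1#) of λ { (no n) → good n ; (yes B₂) → ⊥-elim (all-bad B₀ B₁ B₂) } } }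

      -- For k = 1 the members of one family already differ in degree k - 1 = 0, so `origin-unique`
      -- applies inside the family.
      same-origin : k' ≡ 0 → ∀ {w b b' y y' c c'} → Match (xs w b) y c → Match (xs w b') y' c' → c ≡ c' → b ≢ b' →
                    coeff y k ≡ 0# → coeff y' k ≡ 0# → ⊥
      same-origin k'≡0 {w} {b} {b'} M M' q n = origin-clash M M' q
        (Deg=-resp (PR.sym (xs-b w b b')) (subst (λ z → Deg= z (constP (b + - b'))) (sym k'≡0) (Bd-const _ , b-b'≢0 n)))

      -- If no two members share a point, b ↦ slope is injective on the finite set F, hence onto;
      -- but no slope is 0.
      one-fold : (∀ c η ρ → c ≢ 0# → η * η + - (ν * (c * c)) ≡ w₀ * w₀ → a ≡ ρ * η → τ ≋ constP ρ ⊠ τ' c → ρ * ρ ≡ 1#) → ⊥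
      one-fold no-extra = case good-family of λ { (w , g) → go w g }
        where
        go : ∀ w → Good w → ⊥
        go w g = case F-injective⇒surjective f f-injective 0# of λ { (b , e) → slope≢0 (c≢0 (isMatch w b)) (on-conic (isMatch w b)) e }
          where
          f : F → F
          f b = slope (ηᵐ w b) (cᵐ w b)
          distinct : ∀ b b' → b ≢ b' → ηᵐ w b ≡ ηᵐ w b' → cᵐ w b ≡ cᵐ w b' → ⊥
          distinct b b' n eη ec = case ηᵐ w b ≟ 0# of λ
            { (yes z) → case g of λ { (inj₁ h) → h b z ; (inj₂ e) → same-origin e (isMatch w b) (isMatch w b') ec n z (trans (sym eη) z) }
            ; (no nz) → case two-matches (isMatch w b) (isMatch w b') ec n nz refl (sym eη) of λ
                { (rem , ρ²≢1 , _) → ρ²≢1 (no-extra _ _ _ (c≢0 (isMatch w b)) (on-conic (isMatch w b)) (a≡a/η*η nz) rem) } }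
          f-injective : ∀ b b' → f b ≡ f b' → b ≡ b'
          f-injective b b' e = case b ≟ b' of λ
            { (yes p) → p
            ; (no n) → case slope-injective (c≢0 (isMatch w b)) (c≢0 (isMatch w b')) (on-conic (isMatch w b)) (on-conic (isMatch w b')) e of λ
                { (eη , ec) → ⊥-elim (distinct b b' n eη ec) } }

      module _ (ε : F) (ε² : ε * ε ≡ 1#) (τ'-ε : ∀ c → τ' (ε * c) ≋ ⊟ τ' c) (G-ε : ∀ c → G (ε * c) ≋ G c) where

        -- The hypotheses on ε make Y change sign under (y , c) ↦ (-y , εc), so its square and G are
        -- unchanged.
        flip-match : ∀ {x y c} → Match x y c → Match x (⊟ y) (ε * c)
        flip-match {x} {y} {c} M = record
          { bdy = Bd-neg y (bdy M)
          ; c≢0 = *-nonzero (λ e → 0≢1 (sym (trans (sym ε²) (trans (cong (_* ε) e) (𝔽R.zeroˡ _))))) (c≢0 M)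
          ; eqn = PR.trans (PR.+-congˡ (PR.-‿cong (PR.trans (PR.*-cong Y≋ Y≋)
              (PS.solve 1 (λ y → (PS.:- y) PS.:* (PS.:- y) PS.:= y PS.:* y) PR.refl (Y c y))))) (PR.trans (eqn M) (PR.sym (G-ε c)))
          ; conic = trans (cong₂ (λ u v → u + - (ν * v)) (trans (cong₂ _*_ (coeff-⊟ y k) (coeff-⊟ y k)) (neg² (coeff y k)))
              (trans (εc² ε c) (trans (cong (_* (c * c)) ε²) (𝔽R.*-identityˡ _)))) (conic M) }
          where
          Y≋ : Y (ε * c) (⊟ y) ≋ ⊟ Y c y
          Y≋ = PR.trans (PR.+-congˡ (τ'-ε c)) (PS.solve 3 (λ m y t → m PS.:* (PS.:- y) PS.:- t PS.:= PS.:- (m PS.:* y PS.:+ t)) PR.refl m y (τ' c))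
          neg² : ∀ u → (- u) * (- u) ≡ u * u
          neg² = 𝔽S.solve 1 (λ u → (𝔽S.:- u) 𝔽S.:* (𝔽S.:- u) 𝔽S.:= u 𝔽S.:* u) refl
          εc² : ∀ e c → (e * c) * (e * c) ≡ (e * e) * (c * c)
          εc² = 𝔽S.solve 2 (λ e c → (e 𝔽S.:* c) 𝔽S.:* (e 𝔽S.:* c) 𝔽S.:= (e 𝔽S.:* e) 𝔽S.:* (c 𝔽S.:* c)) refl

        -- Each b contributes the points of (y , c) and (-y , εc), 2q in all with q - 1 slopes, so
        -- three coincide. If η ≠ 0 they come from three different b, and `three-matches` applies.
        two-fold : ⊥
        two-fold = case good-family of λ { (w , g) → go w g }
          where
          go : ∀ w → Good w → ⊥
          go w g = contradiction (avoid-zero⇒collide₃ f f≢0)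
            where
            yˢ : Fin size × Fin 2 → Poly
            yˢ (b , zero)  = yᵐ w (elt b)
            yˢ (b , suc _) = ⊟ yᵐ w (elt b)
            cˢ : Fin size × Fin 2 → F
            cˢ (b , zero)  = cᵐ w (elt b)
            cˢ (b , suc _) = ε * cᵐ w (elt b)
            Mˢ : ∀ p → Match (xs w (elt (proj₁ p))) (yˢ p) (cˢ p)
            Mˢ (b , zero)  = isMatch w (elt b)
            Mˢ (b , suc _) = flip-match (isMatch w (elt b))
            ηˢ : Fin size × Fin 2 → F
            ηˢ p = coeff (yˢ p) k
            pt : Fin (size ℕ.* 2) → Fin size × Fin 2
            pt = remQuot {size} 2
            pt-injective : ∀ i j → pt i ≡ pt j → i ≡ j
            pt-injective i j e = trans (sym (FinP.combine-remQuot {size} 2 i)) (trans (cong (λ p → combine (proj₁ p) (proj₂ p)) e) (FinP.combine-remQuot {size} 2 j))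
            f : Fin (size ℕ.* 2) → F
            f i = slope (ηˢ (pt i)) (cˢ (pt i))
            f≢0 : ∀ i → f i ≢ 0#
            f≢0 i = slope≢0 (c≢0 (Mˢ (pt i))) (on-conic (Mˢ (pt i)))
            same-point : ∀ i j → f i ≡ f j → ηˢ (pt i) ≡ ηˢ (pt j) × cˢ (pt i) ≡ cˢ (pt j)
            same-point i j = slope-injective (c≢0 (Mˢ (pt i))) (c≢0 (Mˢ (pt j))) (on-conic (Mˢ (pt i))) (on-conic (Mˢ (pt j)))
            -- The two points of one b have opposite η, which can agree only at 0.
            η-zero : ∀ p q → p ≢ q → proj₁ p ≡ proj₁ q → ηˢ p ≡ ηˢ q → ηˢ p ≡ 0#
            η-zero (b , zero)     (.b , zero)     n refl e = ⊥-elim (n refl)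
            η-zero (b , zero)     (.b , suc _)    n refl e = x≡-x⇒x≡0 2≢0 (trans e (coeff-⊟ (yᵐ w (elt b)) k))
            η-zero (b , suc _)    (.b , zero)     n refl e = trans e (x≡-x⇒x≡0 2≢0 (trans (sym e) (coeff-⊟ (yᵐ w (elt b)) k)))
            η-zero (b , suc zero) (.b , suc zero) n refl e = ⊥-elim (n refl)
            elt-injective : ∀ {i j} → elt i ≡ elt j → i ≡ j
            elt-injective {i} {j} e = trans (sym (idx-elt i)) (trans (cong idx e) (idx-elt j))
            -- For k' = 0 the common point may have η = 0. Two of the three then carry the same
            -- sign, hence different b, and `same-origin` applies.
            two-agree : ∀ (s t u : Fin 2) → s ≡ t ⊎ s ≡ u ⊎ t ≡ u
            two-agree zero       zero       _          = inj₁ refl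
            two-agree (suc zero) (suc zero) _          = inj₁ refl
            two-agree zero       (suc zero) zero       = inj₂ (inj₁ refl)
            two-agree zero       (suc zero) (suc zero) = inj₂ (inj₂ refl)
            two-agree (suc zero) zero       zero       = inj₂ (inj₂ refl)
            two-agree (suc zero) zero       (suc zero) = inj₂ (inj₁ refl)
            η-nonzero : (∀ b → ηᵐ w b ≢ 0#) → ∀ p → ηˢ p ≢ 0#
            η-nonzero h (b , zero)  e = h (elt b) e
            η-nonzero h (b , suc _) e = h (elt b) (trans (sym (-‿involutive _)) (trans (cong -_ (trans (sym (coeff-⊟ (yᵐ w (elt b)) k)) e)) -0≡0))
              where open import Algebra.Properties.Ring 𝔽R.ring using (-‿involutive)
            module _ (i j l : Fin (size ℕ.* 2)) (ij : i ≢ j) (il : i ≢ l) (jl : j ≢ l)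
                     (eη : ηˢ (pt i) ≡ ηˢ (pt j)) (eη' : ηˢ (pt i) ≡ ηˢ (pt l)) (ec : cˢ (pt i) ≡ cˢ (pt j)) (ec' : cˢ (pt i) ≡ cˢ (pt l)) where
              ≢-pt : ∀ {i j} → i ≢ j → pt i ≢ pt j
              ≢-pt n e = n (pt-injective _ _ e)
              nonzero-case : ηˢ (pt i) ≢ 0# → ⊥
              nonzero-case nz = three-matches (Mˢ (pt i)) (Mˢ (pt j)) (Mˢ (pt l)) ec ec'
                (λ e → nz (η-zero (pt i) (pt j) (≢-pt ij) (elt-injective e) eη))
                (λ e → nz (η-zero (pt i) (pt l) (≢-pt il) (elt-injective e) eη'))
                (λ e → nz (trans eη (η-zero (pt j) (pt l) (≢-pt jl) (elt-injective e) (trans (sym eη) eη')))) nz refl (sym eη) (sym eη')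
              same-sign : ∀ {i j} → i ≢ j → proj₂ (pt i) ≡ proj₂ (pt j) → elt (proj₁ (pt i)) ≢ elt (proj₁ (pt j))
              same-sign n e e' = ≢-pt n (cong₂ _,_ (elt-injective e') e)
              zero-case : ηˢ (pt i) ≡ 0# → ⊥
              zero-case z = case g of λ
                { (inj₁ h) → η-nonzero h (pt i) z
                ; (inj₂ k0) → case two-agree (proj₂ (pt i)) (proj₂ (pt j)) (proj₂ (pt l)) of λ
                  { (inj₁ e) → same-origin k0 (Mˢ (pt i)) (Mˢ (pt j)) ec (same-sign ij e) z (trans (sym eη) z)
                  ; (inj₂ (inj₁ e)) → same-origin k0 (Mˢ (pt i)) (Mˢ (pt l)) ec' (same-sign il e) z (trans (sym eη') z)
                  ; (inj₂ (inj₂ e)) → same-origin k0 (Mˢ (pt j)) (Mˢ (pt l)) (trans (sym ec) ec') (same-sign jl e) (trans (sym eη) z) (trans (sym eη') z) } }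
              impossible : ⊥
              impossible = case ηˢ (pt i) ≟ 0# of λ { (yes z) → zero-case z ; (no nz) → nonzero-case nz }
            contradiction : Collide₃ f → ⊥
            contradiction (i , j , l , ij , il , jl , e , e') = impossible i j l ij il jl (proj₁ (same-point i j e)) (proj₁ (same-point i l e')) (proj₂ (same-point i j e)) (proj₂ (same-point i l e'))

  -- Values of ternary forms

  open Form

  qv : Form → Vec3 Poly → Poly
  qv M v = qt M (v i₀) (v i₁) (v i₂)

  qb-cong : ∀ M {x x' y y'} → x ≋ x' → y ≋ y' → qb M x y ≋ qb M x' y'
  qb-cong M e f = PR.+-cong (PR.+-cong (PR.*-congˡ (PR.*-cong e e)) (PR.*-congˡ (PR.*-cong f f))) (PR.+-cong (PR.*-congˡ (PR.*-cong e f)) (PR.*-congˡ (PR.*-cong e f)))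

  qa-cong : ∀ M {x x' y y'} → x ≋ x' → y ≋ y' → qa M x y ≋ qa M x' y'
  qa-cong M e f = PR.+-cong (qb-cong M e f) (PR.+-cong l l)
    where l = PR.+-cong (PR.*-congˡ e) (PR.*-congˡ f)

  qt-cong : ∀ M {x x' y y' z z'} → x ≋ x' → y ≋ y' → z ≋ z' → qt M x y z ≋ qt M x' y' z'
  qt-cong M e f g = PR.+-cong (PR.+-cong (qb-cong M e f) (PR.*-congˡ (PR.*-cong g g))) (PR.+-cong l l)
    where l = PR.+-cong (PR.*-congˡ (PR.*-cong e g)) (PR.*-congˡ (PR.*-cong f g))

  qv-cong : ∀ M {u v} → u ≋ᵥ v → qv M u ≋ qv M v
  qv-cong M e = qt-cong M (e i₀) (e i₁) (e i₂)

  module _ (M : Form) where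
    open PS

    private
      o z : ∀ {n} → Polynomial n
      o = con (pos 1)
      z = con (pos 0)
      QB : ∀ {n} → (a b d x y : Polynomial n) → Polynomial n
      QB a b d x y = (a :* (x :* x) :+ d :* (y :* y)) :+ (b :* (x :* y) :+ b :* (x :* y))
      QA : ∀ {n} → (a b c d e x y : Polynomial n) → Polynomial n
      QA a b c d e x y = QB a b d x y :+ ((c :* x :+ e :* y) :+ (c :* x :+ e :* y))

    qb-x0 : ∀ x → qb M x 0P ≋ a₁₁ M ⊠ (x ⊠ x)
    qb-x0 x = solve 4 (λ a b d x → QB a b d x z := a :* (x :* x)) PR.refl (a₁₁ M) (a₁₂ M) (a₂₂ M) x

    qb-0y : ∀ y → qb M 0P y ≋ a₂₂ M ⊠ (y ⊠ y)
    qb-0y y = solve 4 (λ a b d y → QB a b d z y := d :* (y :* y)) PR.refl (a₁₁ M) (a₁₂ M) (a₂₂ M) y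

    qa-x0 : ∀ x → qa M x 0P ≋ a₁₁ M ⊠ (x ⊠ x) ⊞ (a₁₃ M ⊠ x ⊞ a₁₃ M ⊠ x)
    qa-x0 x = solve 6 (λ a b c d e x → QA a b c d e x z := a :* (x :* x) :+ (c :* x :+ c :* x)) PR.refl (a₁₁ M) (a₁₂ M) (a₁₃ M) (a₂₂ M) (a₂₃ M) x

    qa-00 : qa M 0P 0P ≋ 0P
    qa-00 = solve 5 (λ a b c d e → QA a b c d e z z := z) PR.refl (a₁₁ M) (a₁₂ M) (a₁₃ M) (a₂₂ M) (a₂₃ M)

    qt-000 : qt M 0P 0P 0P ≋ 0P
    qt-000 = PR.trans (qt-plane M 0P 0P) (PR.trans (qb-x0 0P) (PR.trans (PR.*-congˡ (PR.zeroˡ 0P)) (PR.zeroʳ _)))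

    -- (x , y , s) is s times (s x , s y , 1), and s² = 1 leaves the value unchanged.
    qt-affine : ∀ x y s → s ⊠ s ≋ 1P → qt M x y s ≋ qa M (s ⊠ x) (s ⊠ y) ⊞ a₃₃ M
    qt-affine x y s ss = PR.trans (PR.+-congʳ (PR.+-cong
        (PR.trans (PR.sym (PR.*-identityˡ _)) (PR.trans (PR.*-congʳ (PR.sym ss))
          (solve 6 (λ a b d x y s → (s :* s) :* QB a b d x y := QB a b d (s :* x) (s :* y)) PR.refl (a₁₁ M) (a₁₂ M) (a₂₂ M) x y s)))
        (PR.trans (PR.*-congˡ ss) (PR.*-identityʳ _))))
      (solve 7 (λ q c e f x y s → (q :+ f) :+ ((c :* (x :* s) :+ e :* (y :* s)) :+ (c :* (x :* s) :+ e :* (y :* s)))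
         := (q :+ ((c :* (s :* x) :+ e :* (s :* y)) :+ (c :* (s :* x) :+ e :* (s :* y)))) :+ f) PR.refl (qb M (s ⊠ x) (s ⊠ y)) (a₁₃ M) (a₂₃ M) (a₃₃ M) x y s)

    qt-xy1 : ∀ x y → qt M x y 1P ≋ qa M x y ⊞ a₃₃ M
    qt-xy1 x y = PR.trans (qt-affine x y 1P (PR.*-identityˡ 1P)) (PR.+-congʳ (qa-cong M (PR.*-identityˡ x) (PR.*-identityˡ y)))

  qb-agree : ∀ M M' {x y} → a₁₁ M ≋ a₁₁ M' → a₁₂ M ≋ a₁₂ M' → a₂₂ M ≋ a₂₂ M' → qb M x y ≋ qb M' x y
  qb-agree M M' e f g = PR.+-cong (PR.+-cong (PR.*-congʳ e) (PR.*-congʳ g)) (PR.+-cong (PR.*-congʳ f) (PR.*-congʳ f))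

  W-zero : ∀ {d n p} → W d n p → n ℕ.< d → p ≋ 0P
  W-zero {d} w l = mk≋ λ e → wz w e (ℕP.<-≤-trans l (ℕP.m≤n+m d (e ℕ.+ e)))

  W-const : ∀ {d p} → W d d p → p ≋ constP (coeff p 0)
  W-const {d} w = Bd1⇒const (W⇒Bd w (ℕP.m≤n+m (suc d) 1))

  W⇒Bd-level : ∀ {d N x} → W (suc d) N x → Bd N x
  W⇒Bd-level {d} {N} w = W⇒Bd w (ℕP.<-≤-trans (ℕP.m<m+n N (s≤s z≤n)) (ℕP.+-monoˡ-≤ (suc d) (ℕP.m≤m+n N N)))

  fibre-bounded : ∀ {M d₁ d₂ d₃} → ReducedForm M d₁ d₂ d₃ → ∀ p → Bounded (λ v → qv M v ≋ p)
  fibre-bounded {M} {d₁} {d₂} {d₃} R p = record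
    { bound = length p
    ; bounded = λ {v} e → bounds {v} (qt-level (Bd-resp (PR.sym e) (Bd-length p)))
    ; dec = λ v → qv M v ≋? p
    ; resp = λ e f → PR.trans (PR.sym (qv-cong M e)) f }
    where
    open Levels R
    bounds : ∀ {v : Vec3 Poly} → Level< (length p) (v i₀) (v i₁) (v i₂) → ∀ i → Bd (length p) (v i)
    bounds (w , _ , _) i₀ = W⇒Bd-level w
    bounds (_ , w , _) i₁ = W⇒Bd-level w
    bounds (_ , _ , w) i₂ = W⇒Bd-level w

  opaque
    -- If Emb maps a fibre into vectors on which both forms agree, it maps the fibre onto itself.
    complement : ∀ {M M' d₁ d₂ d₃} → ReducedForm M d₁ d₂ d₃ → Emb (qv M) (qv M') →
      (Z : Vec3 Poly → Set) → Decidable Z → (∀ {u v} → u ≋ᵥ v → Z u → Z v) → (∀ y → Z y → qv M y ≋ qv M' y) →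
      ∀ x → ¬ Z x → ∃ λ y → qv M' y ≋ qv M x × ¬ Z y
    complement {M} {M'} R E Z Z? Z-resp agree x ¬Zx = case hasCount B of λ { (n , vs , h , _ , surj) → go n vs h surj }
      where
      open Emb E
      B : Bounded (λ v → qv M v ≋ qv M x)
      B = fibre-bounded R (qv M x)
      go : ∀ n (vs : Fin n → Vec3 Poly) → (∀ k → qv M (vs k) ≋ qv M x) → (∀ v → qv M v ≋ qv M x → ∃ λ k → v ≈V vs k) → ∃ λ y → qv M' y ≋ qv M x × ¬ Z y
      go n vs h surj = case FinP.any? (λ k → ¬? (Z? (to (vs k)))) of λ
        { (yes (k , ¬z)) → to (vs k) , PR.trans (value (vs k)) (h k) , ¬z
        ; (no none) → ⊥-elim (absurd none) }
        where
        absurd : ¬ (∃ λ k → ¬ Z (to (vs k))) → ⊥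
        absurd none = case self-map-onto B to closed (λ _ _ → injective) PR.refl of λ { (u , pu , e) → ¬Zx (Z-resp e (Z-to pu)) }
          where
          Z-to : ∀ {v} → qv M v ≋ qv M x → Z (to v)
          Z-to {v} e = case surj v e of λ { (k , ek) → Z-resp (to-cong (λ c → mk≋ λ n → sym (ek c n)))
            (decidable-stable (Z? (to (vs k))) (λ nz → none (k , nz))) }
          closed : ∀ {v} → qv M v ≋ qv M x → qv M (to v) ≋ qv M x
          closed {v} e = PR.trans (agree (to v) (Z-to e)) (PR.trans (value v) e)

  -- Rescaling the basis vectors by constants

  scale : F → F → F → Form → Form
  scale a b c M = record
    { a₁₁ = constP (a * a) ⊠ a₁₁ M ; a₁₂ = constP (a * b) ⊠ a₁₂ M ; a₁₃ = constP (a * c) ⊠ a₁₃ M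
    ; a₂₂ = constP (b * b) ⊠ a₂₂ M ; a₂₃ = constP (b * c) ⊠ a₂₃ M ; a₃₃ = constP (c * c) ⊠ a₃₃ M }

  scaleV : F → F → F → Vec3 Poly → Vec3 Poly
  scaleV a b c v = vec (constP a ⊠ v i₀) (constP b ⊠ v i₁) (constP c ⊠ v i₂)

  scaleV-cong : ∀ a b c {u v} → u ≋ᵥ v → scaleV a b c u ≋ᵥ scaleV a b c v
  scaleV-cong a b c e i₀ = PR.*-congˡ (e i₀)
  scaleV-cong a b c e i₁ = PR.*-congˡ (e i₁)
  scaleV-cong a b c e i₂ = PR.*-congˡ (e i₂)

  qv-scale : ∀ a b c M v → qv (scale a b c M) v ≋ qv M (scaleV a b c v)
  qv-scale a b c M v = PR.trans
    (PR.+-cong (PR.+-cong (PR.+-cong (PR.+-cong (s a a) (s b b)) (PR.+-cong (s a b) (s a b))) (s c c)) (PR.+-cong (PR.+-cong (s a c) (s b c)) (PR.+-cong (s a c) (s b c))))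
    (PS.solve 12 (λ a b c m₁₁ m₁₂ m₁₃ m₂₂ m₂₃ m₃₃ x y z →
       (((((a PS.:* a) PS.:* m₁₁) PS.:* (x PS.:* x) PS.:+ ((b PS.:* b) PS.:* m₂₂) PS.:* (y PS.:* y)) PS.:+ (((a PS.:* b) PS.:* m₁₂) PS.:* (x PS.:* y) PS.:+ ((a PS.:* b) PS.:* m₁₂) PS.:* (x PS.:* y))) PS.:+ ((c PS.:* c) PS.:* m₃₃) PS.:* (z PS.:* z))
         PS.:+ ((((a PS.:* c) PS.:* m₁₃) PS.:* (x PS.:* z) PS.:+ ((b PS.:* c) PS.:* m₂₃) PS.:* (y PS.:* z)) PS.:+ (((a PS.:* c) PS.:* m₁₃) PS.:* (x PS.:* z) PS.:+ ((b PS.:* c) PS.:* m₂₃) PS.:* (y PS.:* z)))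
       PS.:= (((m₁₁ PS.:* ((a PS.:* x) PS.:* (a PS.:* x)) PS.:+ m₂₂ PS.:* ((b PS.:* y) PS.:* (b PS.:* y))) PS.:+ (m₁₂ PS.:* ((a PS.:* x) PS.:* (b PS.:* y)) PS.:+ m₁₂ PS.:* ((a PS.:* x) PS.:* (b PS.:* y)))) PS.:+ m₃₃ PS.:* ((c PS.:* z) PS.:* (c PS.:* z)))
         PS.:+ ((m₁₃ PS.:* ((a PS.:* x) PS.:* (c PS.:* z)) PS.:+ m₂₃ PS.:* ((b PS.:* y) PS.:* (c PS.:* z))) PS.:+ (m₁₃ PS.:* ((a PS.:* x) PS.:* (c PS.:* z)) PS.:+ m₂₃ PS.:* ((b PS.:* y) PS.:* (c PS.:* z)))))
       PR.refl (constP a) (constP b) (constP c) (a₁₁ M) (a₁₂ M) (a₁₃ M) (a₂₂ M) (a₂₃ M) (a₃₃ M) (v i₀) (v i₁) (v i₂))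
    where
    s : ∀ a b {m t} → (constP (a * b) ⊠ m) ⊠ t ≋ ((constP a ⊠ constP b) ⊠ m) ⊠ t
    s a b = PR.*-congʳ (PR.*-congʳ (constP-* a b))

  constP-inverse : ∀ {a} → a ≢ 0# → ∀ p → constP a ⊠ (constP (a ⁻¹) ⊠ p) ≋ p
  constP-inverse {a} n p = PR.trans (PR.sym (PR.*-assoc _ _ _)) (PR.trans (PR.*-congʳ (PR.trans (PR.sym (constP-* a (a ⁻¹))) (constP-cong (inverseʳ a n)))) (PR.*-identityˡ p))

  module Scaling {a b c} (a≢0 : a ≢ 0#) (b≢0 : b ≢ 0#) (c≢0 : c ≢ 0#) where

    unscale : ∀ v → scaleV a b c (scaleV (a ⁻¹) (b ⁻¹) (c ⁻¹) v) ≋ᵥ v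
    unscale v i₀ = constP-inverse a≢0 (v i₀)
    unscale v i₁ = constP-inverse b≢0 (v i₁)
    unscale v i₂ = constP-inverse c≢0 (v i₂)

    scaleV-injective : ∀ {u v} → scaleV a b c u ≋ᵥ scaleV a b c v → u ≋ᵥ v
    scaleV-injective e i₀ = ⊠-cancelˡ (constP≉0 a≢0) (e i₀)
    scaleV-injective e i₁ = ⊠-cancelˡ (constP≉0 b≢0) (e i₁)
    scaleV-injective e i₂ = ⊠-cancelˡ (constP≉0 c≢0) (e i₂)

    Emb-scale-to : ∀ {q M} → Emb q (qv M) → Emb q (qv (scale a b c M))
    Emb-scale-to {q} {M} E = record
      { to = λ v → scaleV (a ⁻¹) (b ⁻¹) (c ⁻¹) (to v)
      ; to-cong = λ e → scaleV-cong (a ⁻¹) (b ⁻¹) (c ⁻¹) (to-cong e)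
      ; injective = λ {u} {v} e → injective (λ i → PR.trans (PR.sym (unscale (to u) i)) (PR.trans (scaleV-cong a b c e i) (unscale (to v) i)))
      ; value = λ v → PR.trans (qv-scale a b c M (scaleV (a ⁻¹) (b ⁻¹) (c ⁻¹) (to v))) (PR.trans (qv-cong M (unscale (to v))) (value v)) }
      where open Emb E

    Emb-scale-from : ∀ {q M} → Emb (qv M) q → Emb (qv (scale a b c M)) q
    Emb-scale-from {q} {M} E = record
      { to = λ v → to (scaleV a b c v) ; to-cong = λ e → to-cong (scaleV-cong a b c e)
      ; injective = λ e → scaleV-injective (injective e)
      ; value = λ v → PR.trans (value (scaleV a b c v)) (PR.sym (qv-scale a b c M v)) }
      where open Emb E

    reduced-scale : ∀ {M d₁ d₂ d₃} → ReducedForm M d₁ d₂ d₃ → ReducedForm (scale a b c M) d₁ d₂ d₃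
    reduced-scale {M} {d₁} {d₂} {d₃} R = record
      { b₁₁ = k b₁₁ ; b₂₂ = k b₂₂ ; b₃₃ = k b₃₃ ; b₁₂ = k b₁₂ ; b₁₃ = k b₁₃ ; b₂₃ = k b₂₃ ; d₁<d₂ = d₁<d₂ ; d₂<d₃ = d₂<d₃
      ; aniso = λ u v e → case aniso (a * u) (b * v) (trans (cong₂ _+_ (m (a₁₁ M) d₁ a u) (m (a₂₂ M) d₂ b v)) e) of λ
          { (z , z') → x*y≡0⇒y≡0 a≢0 z , x*y≡0⇒y≡0 b≢0 z' }
      ; α₃≢0 = λ e → *-nonzero (*-nonzero c≢0 c≢0) α₃≢0 (trans (sym (coeff-const* _ (a₃₃ M) d₃)) e)
      ; par₁ = par₁ ; par₂ = par₂ }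
      where
      open ReducedForm R
      k : ∀ {n x p} → Bd n p → Bd n (constP x ⊠ p)
      k {x = x} {p} bp = Bd-* (constP x) p (Bd-const x) bp ℕP.≤-refl
      m : ∀ p d a u → coeff p d * ((a * u) * (a * u)) ≡ coeff (constP (a * a) ⊠ p) d * (u * u)
      m p d a u = trans (𝔽S.solve 3 (λ p a u → p 𝔽S.:* ((a 𝔽S.:* u) 𝔽S.:* (a 𝔽S.:* u)) 𝔽S.:= ((a 𝔽S.:* a) 𝔽S.:* p) 𝔽S.:* (u 𝔽S.:* u)) refl (coeff p d) a u)
        (cong (_* (u * u)) (sym (coeff-const* (a * a) p d)))

  record Equivalent (M M' : Form) : Set where
    constructor equivalent
    field
      c₁ c₂ c₃ : F
      c₁≢0 : c₁ ≢ 0#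
      c₂≢0 : c₂ ≢ 0#
      c₃≢0 : c₃ ≢ 0#
      e₁₁ : a₁₁ M ≋ constP (c₁ * c₁) ⊠ a₁₁ M'
      e₁₂ : a₁₂ M ≋ constP (c₁ * c₂) ⊠ a₁₂ M'
      e₁₃ : a₁₃ M ≋ constP (c₁ * c₃) ⊠ a₁₃ M'
      e₂₂ : a₂₂ M ≋ constP (c₂ * c₂) ⊠ a₂₂ M'
      e₂₃ : a₂₃ M ≋ constP (c₂ * c₃) ⊠ a₂₃ M'
      e₃₃ : a₃₃ M ≋ constP (c₃ * c₃) ⊠ a₃₃ M'

  Equivalent-scale : ∀ {M M' a b c} → a ≢ 0# → b ≢ 0# → c ≢ 0# → Equivalent M (scale a b c M') → Equivalent M M'
  Equivalent-scale {M} {M'} {a} {b} {c} na nb nc (equivalent c₁ c₂ c₃ n₁ n₂ n₃ e₁₁ e₁₂ e₁₃ e₂₂ e₂₃ e₃₃) =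
    equivalent (c₁ * a) (c₂ * b) (c₃ * c) (*-nonzero n₁ na) (*-nonzero n₂ nb) (*-nonzero n₃ nc)
      (t e₁₁) (t e₁₂) (t e₁₃) (t e₂₂) (t e₂₃) (t e₃₃)
    where
    t : ∀ {p r x y u v} → p ≋ constP (x * y) ⊠ (constP (u * v) ⊠ r) → p ≋ constP ((x * u) * (y * v)) ⊠ r
    t {x = x} {y} {u} {v} e = PR.trans e (PR.trans (PR.sym (PR.*-assoc _ _ _)) (PR.*-congʳ (PR.trans (PR.sym (constP-* (x * y) (u * v)))
      (constP-cong (𝔽S.solve 4 (λ x y u v → (x 𝔽S.:* y) 𝔽S.:* (u 𝔽S.:* v) 𝔽S.:= (x 𝔽S.:* u) 𝔽S.:* (y 𝔽S.:* v)) refl x y u v)))))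

  open Form

  -- Values of degree d₂ and d₃

  suc-double : ∀ k d → suc k ℕ.+ suc k ℕ.+ d ≡ suc (suc (k ℕ.+ k ℕ.+ d))
  suc-double k d = cong (λ z → suc (z ℕ.+ d)) (ℕP.+-suc k k)

  module Top {M d₁ d₂ d₃} (R : ReducedForm M d₁ d₂ d₃) where
    open ReducedForm R
    open Levels R

    α₁≢0 : coeff (a₁₁ M) d₁ ≢ 0#
    α₁≢0 = aniso⇒α≢0 aniso

    α₂≢0 : coeff (a₂₂ M) d₂ ≢ 0#
    α₂≢0 = aniso⇒β≢0 aniso

    qb-off : ∀ {n x y} → Level₂< (suc n) x y → (∀ e → n ≢ e ℕ.+ e ℕ.+ d₁) → (∀ e → n ≢ e ℕ.+ e ℕ.+ d₂) → Bd n (qb M x y)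
    qb-off (wx , wy) no₁ no₂ = qb-bound (W-drop (W-pred wx) (λ e q → ⊥-elim (no₁ e q)) , W-drop (W-pred wy) (λ e q → ⊥-elim (no₂ e q)))

    qb-off₃ : ∀ {x y} → Level₂< (suc d₃) x y → Bd d₃ (qb M x y)
    qb-off₃ l = qb-off l (λ e q → par₁ e 0 (sym q)) (λ e q → par₂ e 0 (sym q))

    -- By parity the plane part has no term in t^(d₃), and the mixed terms have smaller degree; only
    -- the third coordinate, a constant, is visible there.
    qt-top : ∀ {x y z} → Bd (suc d₃) (qt M x y z) → ∃ λ s → z ≋ constP s × coeff (qt M x y z) d₃ ≡ coeff (a₃₃ M) d₃ * (s * s)
    qt-top {x} {y} {z} b = coeff z 0 , z≋ , trans (coeff-⊞ (qb M x y ⊞ a₃₃ M ⊠ (z ⊠ z)) _ d₃) (trans (cong₂ _+_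
        (trans (coeff-⊞ (qb M x y) (a₃₃ M ⊠ (z ⊠ z)) d₃) (trans (cong₂ _+_ (bz (qb-off₃ (proj₁ l , proj₁ (proj₂ l))) d₃ ℕP.≤-refl)
          (trans (at (PR.*-congˡ (PR.trans (PR.*-cong z≋ z≋) (PR.sym (constP-* _ _)))) d₃) (coeff-⊠-const (a₃₃ M) _ d₃))) (𝔽R.+-identityˡ _)))
        (bz (qt-cross (W-pred (proj₁ l)) (W-pred (proj₁ (proj₂ l))) (W-pred (proj₂ (proj₂ l)))) d₃ ℕP.≤-refl)) (𝔽R.+-identityʳ _))
      where
      l : Level< (suc d₃) x y z
      l = qt-level b
      z≋ : z ≋ constP (coeff z 0)
      z≋ = W-const (proj₂ (proj₂ l))

    module _ {k} (d₂≡ : d₂ ≡ k ℕ.+ k ℕ.+ d₁) {x} (v : F) (bx : Bd (suc k) x) where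

      private
        wx : W d₁ d₂ x
        wx = Bd⇒W d₁ d₂ bx (ℕP.≤-reflexive (trans (suc-double k d₁) (cong (λ z → suc (suc z)) (sym d₂≡))))
        wv : W d₂ d₂ (constP v)
        wv = Bd⇒W d₂ d₂ (Bd-const v) ℕP.≤-refl

      plane-level : Level₂< (suc d₂) x (constP v)
      plane-level = W-suc wx , W-suc wv

      -- Since d₂ = 2k + d₁, the coefficient of t^k in x and the constant v meet at t^(d₂). This sum
      -- is the source of the conic.
      qb-top : coeff (qb M x (constP v)) d₂ ≡ coeff (a₁₁ M) d₁ * (coeff x k * coeff x k) + coeff (a₂₂ M) d₂ * (v * v)
      qb-top = trans (coeff-⊞ (a₁₁ M ⊠ (x ⊠ x) ⊞ a₂₂ M ⊠ (constP v ⊠ constP v)) _ d₂)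
        (trans (cong₂ _+_ (trans (coeff-⊞ (a₁₁ M ⊠ (x ⊠ x)) _ d₂) (cong₂ _+_ first second)) (bz (qb-cross wx wv) d₂ ℕP.≤-refl)) (𝔽R.+-identityʳ _))
        where
        first : coeff (a₁₁ M ⊠ (x ⊠ x)) d₂ ≡ coeff (a₁₁ M) d₁ * (coeff x k * coeff x k)
        first = trans (cong (coeff (a₁₁ M ⊠ (x ⊠ x))) (trans d₂≡ (ℕP.+-comm (k ℕ.+ k) d₁)))
          (trans (coeff-*-top (a₁₁ M) (x ⊠ x) b₁₁ (Bd-* x x bx bx (ℕP.≤-reflexive (cong suc (ℕP.+-suc k k))))) (cong (coeff (a₁₁ M) d₁ *_) (coeff-*-top x x bx bx)))
        second : coeff (a₂₂ M ⊠ (constP v ⊠ constP v)) d₂ ≡ coeff (a₂₂ M) d₂ * (v * v)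
        second = trans (at (PR.*-congˡ (PR.sym (constP-* v v))) d₂) (coeff-⊠-const (a₂₂ M) (v * v) d₂)

      qa-top : coeff (qa M x (constP v)) d₂ ≡ coeff (a₁₁ M) d₁ * (coeff x k * coeff x k) + coeff (a₂₂ M) d₂ * (v * v)
      qa-top = trans (coeff-⊞ (qb M x (constP v)) _ d₂) (trans (cong₂ _+_ qb-top (bz (qa-linear wx wv) d₂ ℕP.≤-refl)) (𝔽R.+-identityʳ _))

    level-plane : ∀ {k x y} → d₂ ≡ k ℕ.+ k ℕ.+ d₁ → Level₂< (suc d₂) x y → Bd (suc k) x × y ≋ constP (coeff y 0)
    level-plane {k} d₂≡ (wx , wy) = W⇒Bd wx (ℕP.≤-trans (s≤s (s≤s (ℕP.≤-trans (ℕP.≤-reflexive d₂≡) (ℕP.+-monoʳ-≤ (k ℕ.+ k) (ℕP.n≤1+n d₁)))))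
      (ℕP.≤-reflexive (sym (suc-double k (suc d₁))))) , W-const wy

  -- Comparing the successive minima

  module _ {M M' d₁ d₂ d₃ d₁' d₂' d₃'} (R : ReducedForm M d₁ d₂ d₃) (R' : ReducedForm M' d₁' d₂' d₃') (E : Emb (qv M) (qv M')) where
    open Emb E

    private
      e₁ : Vec3 Poly
      e₁ = vec 1P 0P 0P

    value-e₁ : qv M' (to e₁) ≋ a₁₁ M
    value-e₁ = PR.trans (value e₁) (PR.trans (qt-plane M 1P 0P) (PR.trans (qb-x0 M 1P) (PR.trans (PR.*-congˡ (PR.*-identityˡ 1P)) (PR.*-identityʳ _))))

    level-e₁ : Levels.Level< R' (suc d₁) (to e₁ i₀) (to e₁ i₁) (to e₁ i₂)
    level-e₁ = Levels.qt-level R' (Bd-resp (PR.sym value-e₁) (ReducedForm.b₁₁ R))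

    to-e₁≉0 : to e₁ i₀ ≋ 0P → to e₁ i₁ ≋ 0P → to e₁ i₂ ≋ 0P → ⊥
    to-e₁≉0 z₀ z₁ z₂ = Top.α₁≢0 R (at (PR.trans (PR.sym value-e₁) (PR.trans (qt-cong M' z₀ z₁ z₂) (qt-000 M'))) d₁)

    -- If d₁ < d₁', the image of e₁ has all coordinates zero by its level, although its value a₁₁ is
    -- nonzero.
    first-minimum-≤ : d₁' ℕ.≤ d₁
    first-minimum-≤ = ℕP.≮⇒≥ λ l → to-e₁≉0 (W-zero (proj₁ level-e₁) (s≤s l)) (W-zero (proj₁ (proj₂ level-e₁)) (ℕP.<-trans (s≤s l) (s≤s R'.d₁<d₂)))
        (W-zero (proj₂ (proj₂ level-e₁)) (ℕP.<-trans (s≤s l) (s≤s (ℕP.<-trans R'.d₁<d₂ R'.d₂<d₃))))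
      where module R' = ReducedForm R'

  module _ {M M' d₁ d₂ d₃ d₂' d₃'} (R : ReducedForm M d₁ d₂ d₃) (R' : ReducedForm M' d₁ d₂' d₃') (E : Emb (qv M) (qv M')) where
    open Emb E
    private
      module R = ReducedForm R
      module R' = ReducedForm R'

    -- A value of degree d₁ leaves room only for a constant first coordinate, since d₂ and d₃ are
    -- larger; so e₁ goes to a constant multiple of the first basis vector.
    first-scale : ∃ λ s → s ≢ 0# × a₁₁ M ≋ constP (s * s) ⊠ a₁₁ M'
    first-scale = case level-e₁ R R' E of λ { (w₀ , w₁ , w₂) → go (W-const w₀) (W-zero w₁ (s≤s R'.d₁<d₂)) (W-zero w₂ (s≤s (ℕP.<-trans R'.d₁<d₂ R'.d₂<d₃))) }
      where
      y : Vec3 Poly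
      y = to (vec 1P 0P 0P)
      go : ∀ {s} → y i₀ ≋ constP s → y i₁ ≋ 0P → y i₂ ≋ 0P → ∃ λ s → s ≢ 0# × a₁₁ M ≋ constP (s * s) ⊠ a₁₁ M'
      go {s} z₀ z₁ z₂ = s , (λ e → to-e₁≉0 R R' E (PR.trans z₀ (PR.trans (constP-cong e) constP-0)) z₁ z₂)
        , PR.trans (PR.sym (value-e₁ R R' E)) (PR.trans (qt-cong M' z₀ z₁ z₂) (PR.trans (qt-plane M' (constP s) 0P)
          (PR.trans (qb-x0 M' (constP s)) (PR.trans (PR.*-comm _ _) (PR.*-congʳ (PR.sym (constP-* s s)))))))

    module _ (e₁₁ : a₁₁ M ≋ a₁₁ M') where

      -- The image of (x , 1 , 0) may itself lie on the first axis. Both forms agree on that axis,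
      -- so counting the fibre supplies some vector off it with the same value.
      plane-image : ∀ x → ∃ λ y → qv M' y ≋ qb M x 1P × ¬ (y i₁ ≋ 0P × y i₂ ≋ 0P)
      plane-image x = case complement R E Z (λ v → (v i₁ ≋? 0P) ×-dec (v i₂ ≋? 0P)) (λ {u} {v} → resp {u} {v}) agree (vec x 1P 0P) (λ z → constP≉0 (λ e → 0≢1 (sym e)) (proj₁ z)) of λ
          { (y , e , nz) → y , PR.trans e (qt-plane M x 1P) , nz }
        where
        Z : Vec3 Poly → Set
        Z v = v i₁ ≋ 0P × v i₂ ≋ 0P
        resp : ∀ {u v} → u ≋ᵥ v → Z u → Z v
        resp e (z , z') = PR.trans (PR.sym (e i₁)) z , PR.trans (PR.sym (e i₂)) z'
        on-axis : ∀ M y → Z y → qv M y ≋ a₁₁ M ⊠ (y i₀ ⊠ y i₀)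
        on-axis M y (z , z') = PR.trans (qt-cong M PR.refl z z') (PR.trans (qt-plane M (y i₀) 0P) (qb-x0 M (y i₀)))
        agree : ∀ y → Z y → qv M y ≋ qv M' y
        agree y z = PR.trans (on-axis M y z) (PR.trans (PR.*-congʳ e₁₁) (PR.sym (on-axis M' y z)))

      second-minimum-≤ : d₂' ℕ.≤ d₂
      second-minimum-≤ = ℕP.≮⇒≥ λ l → case plane-image 0P of λ { (y , e , nz) → case Levels.qt-level R' (Bd-resp (PR.sym (value-e₂ y e)) R.b₂₂) of λ
          { (_ , w₁ , w₂) → nz (W-zero w₁ (s≤s l) , W-zero w₂ (ℕP.<-trans (s≤s l) (s≤s R'.d₂<d₃))) } }
        where
        value-e₂ : ∀ y → qv M' y ≋ qb M 0P 1P → qv M' y ≋ a₂₂ M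
        value-e₂ y e = PR.trans e (PR.trans (qb-0y M 1P) (PR.trans (PR.*-congˡ (PR.*-identityˡ 1P)) (PR.*-identityʳ _)))

  module _ {M M' d₁ d₂ d₃ d₃'} (R : ReducedForm M d₁ d₂ d₃) (R' : ReducedForm M' d₁ d₂ d₃') (E : Emb (qv M) (qv M')) where
    open Emb E
    private
      module R = ReducedForm R
      module R' = ReducedForm R'
      e₃ : Vec3 Poly
      e₃ = vec 0P 0P 1P

    plane-match : ∀ {k} → d₂ ≡ k ℕ.+ k ℕ.+ d₁ → a₁₁ M ≋ a₁₁ M' → ∀ x → Bd (suc k) x →
                  ∃ λ y → ∃ λ s → Bd (suc k) y × s ≢ 0# × qb M' y (constP s) ≋ qb M x 1P
    plane-match {k} d₂≡ e₁₁ x bx = case plane-image R R' E e₁₁ x of λ { (y , e , nz) → go y e nz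
        (Levels.qt-level R' (Bd-resp (PR.sym e) (Levels.qb-bound R (Top.plane-level R d₂≡ 1# bx)))) }
      where
      go : ∀ y → qv M' y ≋ qb M x 1P → ¬ (y i₁ ≋ 0P × y i₂ ≋ 0P) → Levels.Level< R' (suc d₂) (y i₀) (y i₁) (y i₂) →
           ∃ λ y → ∃ λ s → Bd (suc k) y × s ≢ 0# × qb M' y (constP s) ≋ qb M x 1P
      go y e nz (w₀ , w₁ , w₂) = case Top.level-plane R' d₂≡ (w₀ , w₁) of λ { (by , y₁) →
        y i₀ , coeff (y i₁) 0 , by , (λ z → nz (PR.trans y₁ (PR.trans (constP-cong z) constP-0) , y₂))
        , PR.trans (PR.trans (PR.sym (qt-plane M' (y i₀) (constP (coeff (y i₁) 0)))) (PR.sym (qt-cong M' PR.refl y₁ y₂))) e }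
        where
        y₂ : y i₂ ≋ 0P
        y₂ = W-zero w₂ (s≤s R'.d₂<d₃)

    value-e₃ : qv M' (to e₃) ≋ a₃₃ M
    value-e₃ = PR.trans (value e₃) (PR.trans (qt-xy1 M 0P 0P) (PR.trans (PR.+-congʳ (qa-00 M)) (PR.+-identityˡ _)))

    -- Otherwise the image of e₃ lies in the plane z = 0, where parity keeps the coefficient of
    -- t^(d₃) at zero, while α₃ ≠ 0.
    third-minimum-≤ : d₃' ℕ.≤ d₃
    third-minimum-≤ = ℕP.≮⇒≥ λ l → case Levels.qt-level R' (Bd-resp (PR.sym value-e₃) R.b₃₃) of λ { (w₀ , w₁ , w₂) → absurd w₀ w₁ (W-zero w₂ (s≤s l)) }
      where
      y : Vec3 Poly
      y = to e₃
      absurd : W (suc d₁) (suc d₃) (y i₀) → W (suc d₂) (suc d₃) (y i₁) → y i₂ ≋ 0P → ⊥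
      absurd w₀ w₁ z = R.α₃≢0 (bz (Bd-resp e (Top.qb-off R' (w₀ , w₁) (λ e q → R.par₁ e 0 (sym q)) (λ e q → R.par₂ e 0 (sym q)))) d₃ ℕP.≤-refl)
        where
        e : qb M' (y i₀) (y i₁) ≋ a₃₃ M
        e = PR.trans (PR.sym (PR.trans (qt-cong M' PR.refl PR.refl z) (qt-plane M' (y i₀) (y i₁)))) value-e₃

  third-scale : ∀ {M M' d₁ d₂ d₃} → ReducedForm M d₁ d₂ d₃ → ReducedForm M' d₁ d₂ d₃ → Emb (qv M) (qv M') →
                ∃ λ s → s ≢ 0# × coeff (a₃₃ M) d₃ ≡ (s * s) * coeff (a₃₃ M') d₃
  third-scale {M} {M'} {d₃ = d₃} R R' E = case Top.qt-top R' (Bd-resp (PR.sym e) (ReducedForm.b₃₃ R)) of λ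
      { (s , _ , q) → s , (λ z → ReducedForm.α₃≢0 R (trans (sym (at e d₃)) (trans q (trans (cong (λ t → coeff (a₃₃ M') d₃ * (t * s)) z) (trans (cong (coeff (a₃₃ M') d₃ *_) (𝔽R.zeroˡ s)) (𝔽R.zeroʳ _))))))
        , trans (sym (at e d₃)) (trans q (𝔽R.*-comm _ _)) }
    where
    e : qv M' (Emb.to E (vec 0P 0P 1P)) ≋ a₃₃ M
    e = value-e₃ R R' E

  -- The polynomials m y² + 2 g y

  module _ {m g d e y} (Dm : Deg= d m) (bg : Bd d g) (Dy : Deg= e y) where

    private
      linear : Bd (d ℕ.+ (e ℕ.+ e)) (g ⊠ y ⊞ g ⊠ y)
      linear = Bd-+ _ _ b b
        where b = Bd-* g y bg (proj₁ Dy) (ℕP.≤-trans (ℕP.≤-reflexive (ℕP.+-suc d e)) (s≤s (ℕP.+-monoʳ-≤ d (ℕP.m≤m+n e e))))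

    leading-bound : Bd (suc (d ℕ.+ (e ℕ.+ e))) (m ⊠ (y ⊠ y) ⊞ (g ⊠ y ⊞ g ⊠ y))
    leading-bound = Bd-+ _ _ (proj₁ (Deg=-* m (y ⊠ y) Dm (Deg=-* y y Dy Dy))) (Bd-mono (ℕP.n≤1+n _) linear)

    leading-coeff : coeff (m ⊠ (y ⊠ y) ⊞ (g ⊠ y ⊞ g ⊠ y)) (d ℕ.+ (e ℕ.+ e)) ≡ coeff m d * (coeff y e * coeff y e)
    leading-coeff = trans (coeff-⊞ (m ⊠ (y ⊠ y)) _ _) (trans (cong₂ _+_ (trans (coeff-*-top m (y ⊠ y) (proj₁ Dm) (proj₁ (Deg=-* y y Dy Dy)))
        (cong (coeff m d *_) (coeff-*-top y y (proj₁ Dy) (proj₁ Dy)))) (bz linear _ ℕP.≤-refl)) (𝔽R.+-identityʳ _))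

    leading≢0 : coeff (m ⊠ (y ⊠ y) ⊞ (g ⊠ y ⊞ g ⊠ y)) (d ℕ.+ (e ℕ.+ e)) ≢ 0#
    leading≢0 z = *-nonzero (proj₂ Dm) (*-nonzero (proj₂ Dy) (proj₂ Dy)) (trans (sym leading-coeff) z)

  unary-0 : ∀ m g {y} → y ≋ 0P → m ⊠ (y ⊠ y) ⊞ (g ⊠ y ⊞ g ⊠ y) ≋ 0P
  unary-0 m g {y} z = PR.trans (PR.+-cong (PR.*-congˡ (PR.*-cong z z)) (PR.+-cong (PR.*-congˡ z) (PR.*-congˡ z)))
    (PS.solve 2 (λ m g → m PS.:* (PS.con (pos 0) PS.:* PS.con (pos 0)) PS.:+ (g PS.:* PS.con (pos 0) PS.:+ g PS.:* PS.con (pos 0)) PS.:= PS.con (pos 0)) PR.refl m g)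

  module _ {m g p d y} (Dm : Deg= d m) (bg : Bd d g) (bp : Bd (suc d) p) (e : m ⊠ (y ⊠ y) ⊞ (g ⊠ y ⊞ g ⊠ y) ≋ p) where
    opaque
      unary-const : y ≋ constP (coeff y 0)
      unary-const = case degree y of λ
        { (inj₁ z) → PR.trans z (PR.trans (PR.sym constP-0) (constP-cong (sym (at z 0))))
        ; (inj₂ (zero , Dy)) → Bd1⇒const (proj₁ Dy)
        ; (inj₂ (suc n , Dy)) → ⊥-elim (leading≢0 Dm bg Dy (trans (at e _) (bz bp _ (ℕP.≤-trans (ℕP.≤-reflexive (ℕP.+-comm 1 d)) (ℕP.+-monoʳ-≤ d (s≤s z≤n)))))) }

  coeff-unary : ∀ {m g d} → Bd d g → ∀ t → coeff (m ⊠ (constP t ⊠ constP t) ⊞ (g ⊠ constP t ⊞ g ⊠ constP t)) d ≡ coeff m d * (t * t)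
  coeff-unary {m} {g} {d} bg t = trans (coeff-⊞ (m ⊠ (constP t ⊠ constP t)) _ d) (trans (cong₂ _+_
    (trans (at (PR.*-congˡ (PR.sym (constP-* t t))) d) (coeff-⊠-const m (t * t) d))
    (bz (Bd-+ _ _ l l) d ℕP.≤-refl)) (𝔽R.+-identityʳ _))
    where
    l : Bd d (g ⊠ constP t)
    l = Bd-* g (constP t) bg (Bd-const t) (ℕP.≤-reflexive (ℕP.+-comm d 1))

  -- The right side has degree d, so y is a constant η, and the coefficient of t^d gives η² = 1.
  -- What is left are the linear terms.
  unary-match : 1# + 1# ≢ 0# → ∀ {m g h d y} → Deg= d m → Bd d g → Bd d h → m ⊠ (y ⊠ y) ⊞ (g ⊠ y ⊞ g ⊠ y) ≋ m ⊞ (h ⊞ h) →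
                ∃ λ η → η * η ≡ 1# × h ≋ constP η ⊠ g
  unary-match 2≢0 {m} {g} {h} {d} {y} Dm bg bh e = η , η² , p+p≋r+r⇒p≋r (begin
      h ⊞ h                                    ≈⟨ PS.solve 2 (λ m h → h PS.:+ h PS.:= (m PS.:+ (h PS.:+ h)) PS.:- m) PR.refl m h ⟩
      (m ⊞ (h ⊞ h)) ⊞ ⊟ m                      ≈⟨ PR.+-congʳ e' ⟨
      (m ⊠ (constP η ⊠ constP η) ⊞ (g ⊠ constP η ⊞ g ⊠ constP η)) ⊞ ⊟ m ≈⟨ PR.+-congʳ (PR.+-congʳ (PR.trans (PR.*-congˡ (PR.trans (PR.sym (constP-* η η)) (constP-cong η²))) (PR.*-identityʳ m))) ⟩
      (m ⊞ (g ⊠ constP η ⊞ g ⊠ constP η)) ⊞ ⊟ m ≈⟨ PS.solve 3 (λ m g t → (m PS.:+ (g PS.:* t PS.:+ g PS.:* t)) PS.:- m PS.:= t PS.:* g PS.:+ t PS.:* g) PR.refl m g (constP η) ⟩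
      constP η ⊠ g ⊞ constP η ⊠ g              ∎)
    where
    open import Relation.Binary.Reasoning.Setoid PR.setoid
    open Halving 2≢0
    b-rhs : Bd (suc d) (m ⊞ (h ⊞ h))
    b-rhs = Bd-+ _ _ (proj₁ Dm) (Bd-mono (ℕP.n≤1+n d) (Bd-+ _ _ bh bh))
    η : F
    η = coeff y 0
    yη : y ≋ constP η
    yη = unary-const Dm bg b-rhs e
    e' : m ⊠ (constP η ⊠ constP η) ⊞ (g ⊠ constP η ⊞ g ⊠ constP η) ≋ m ⊞ (h ⊞ h)
    e' = PR.trans (PR.sym (PR.+-cong (PR.*-congˡ (PR.*-cong yη yη)) (PR.+-cong (PR.*-congˡ yη) (PR.*-congˡ yη)))) e
    η² : η * η ≡ 1#
    η² = *-cancelˡ (proj₂ Dm) (trans (sym (coeff-unary bg η)) (trans (at e' d) (trans (coeff-⊞ m (h ⊞ h) d)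
      (trans (cong (coeff m d +_) (bz (Bd-+ _ _ bh bh) d ℕP.≤-refl)) (trans (𝔽R.+-identityʳ _) (sym (𝔽R.*-identityʳ _)))))))

  -- A starting point on the conic

  module _ (2≢0 : 1# + 1# ≢ 0#) where

    record ConicPoint (κ : F) : Set where
      constructor conicPoint
      field
        a w₀ : F
        a≢0  : a ≢ 0#
        w₀≢0 : w₀ ≢ 0#
        eqn  : a * a + - κ ≡ w₀ * w₀

    opaque
      -- w₀ + a = κ / z and a - w₀ = z.
      conic-start : ∀ {κ} → NonSquare 2≢0 κ → (∃ λ t → t ≢ 0# × t ≢ 1# × t ≢ - 1#) → ConicPoint κ
      -- a ≠ 0 needs z² ≠ -κ. The choice z = 1 fails only for -κ = 1; then z must differ from 1 and
      -- -1, and the additional element t serves.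
      conic-start {κ} ns (t , t≢0 , t≢1 , t≢-1) = case (1# * 1#) ≟ (- κ) of λ
        { (no n) → point 1# (λ e → 0≢1 (sym e)) n
        ; (yes e) → point t t≢0 (λ e' → case x²≡y²⇒x≡±y (trans e' (sym e)) of λ { (inj₁ q) → t≢1 q ; (inj₂ q) → t≢-1 q }) }
        where
        h : F
        h = (1# + 1#) ⁻¹
        2h : (1# + 1#) * h ≡ 1#
        2h = inverseʳ _ 2≢0
        h≢0 : h ≢ 0#
        h≢0 = ⁻¹-nonzero 2≢0
        point : ∀ z → z ≢ 0# → z * z ≢ - κ → ConicPoint κ
        point z nz n = conicPoint (h * (z + r)) (h * (r + - z)) (*-nonzero h≢0 a≢0) (*-nonzero h≢0 w≢0)
            (trans (cong (λ u → (h * (z + r)) * (h * (z + r)) + - u) (sym κ≡)) (identity h z r))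
          where
          open 𝔽S
          r : F
          r = κ * z ⁻¹
          zr : z * r ≡ κ
          zr = a*a⁻¹*b κ nz
          a≢0 : z + r ≢ 0#
          a≢0 e = n (trans (solve 2 (λ z r → z :* z := z :* (z :+ r) :- z :* r) refl z r)
            (trans (cong₂ (λ u v → u + - v) (trans (cong (z *_) e) (𝔽R.zeroʳ z)) zr) (𝔽R.+-identityˡ _)))
          w≢0 : r + - z ≢ 0#
          w≢0 e = ns z (trans (cong (z *_) (sym (x-y≡0⇒x≡y e))) zr)
          κ≡ : (((1# + 1#) * h) * ((1# + 1#) * h)) * (z * r) ≡ κ
          κ≡ = trans (cong (_* (z * r)) (trans (cong₂ _*_ 2h 2h) (𝔽R.*-identityˡ 1#))) (trans (𝔽R.*-identityˡ _) zr)
          identity : ∀ h z r → (h * (z + r)) * (h * (z + r)) + - ((((1# + 1#) * h) * ((1# + 1#) * h)) * (z * r)) ≡ (h * (r + - z)) * (h * (r + - z))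
          identity = solve 3 (λ h z r → let o = con (pos 1) in (h :* (z :+ r)) :* (h :* (z :+ r)) :- (((((o :+ o) :* h) :* ((o :+ o) :* h))) :* (z :* r)) := (h :* (r :- z)) :* (h :* (r :- z))) refl

  open Form

  -- Squares in the field with three elements

  -- Leading coefficient α up to nonzero squares. With three elements h² = 1, so nonzero p of this
  -- type all have leading coefficient α.
  SquareType : F → Poly → Set
  SquareType α p = p ≋ 0P ⊎ ∃ λ n → ∃ λ h → h ≢ 0# × Bd (suc n) p × coeff p n ≡ α * (h * h)

  SquareType-resp : ∀ {α p r} → p ≋ r → SquareType α p → SquareType α r
  SquareType-resp e (inj₁ z) = inj₁ (PR.trans (PR.sym e) z)
  SquareType-resp e (inj₂ (n , h , nz , b , q)) = inj₂ (n , h , nz , Bd-resp e b , trans (sym (at e n)) q)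

  unary-square : ∀ {m g d} → Deg= d m → Bd d g → ∀ y → SquareType (coeff m d) (m ⊠ (y ⊠ y) ⊞ (g ⊠ y ⊞ g ⊠ y))
  unary-square {m} {g} {d} Dm bg y = case degree y of λ
    { (inj₁ z) → inj₁ (unary-0 m g z)
    ; (inj₂ (e , Dy)) → inj₂ (d ℕ.+ (e ℕ.+ e) , coeff y e , proj₂ Dy , leading-bound Dm bg Dy , leading-coeff Dm bg Dy) }

  ⊟-⊟ : ∀ p r → ⊟ (p ⊞ ⊟ r) ≋ r ⊞ ⊟ p
  ⊟-⊟ = PS.solve 2 (λ p r → PS.:- (p PS.:- r) PS.:= r PS.:- p) PR.refl

  opaque
    -- -1 is not a square, so the leading coefficients of p and - p cannot both be of the form α h².
    squareType-antisym : 1# + 1# ≢ 0# → (∀ z → z ≢ 0# → z * z ≡ 1#) → ∀ {α p r} → α ≢ 0# → SquareType α (p ⊞ ⊟ r) → SquareType α (r ⊞ ⊟ p) → p ≋ r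
    squareType-antisym 2≢0 three α≢0 (inj₁ z) _ = p-r≋0⇒p≋r z
    squareType-antisym 2≢0 three α≢0 (inj₂ _) (inj₁ z) = PR.sym (p-r≋0⇒p≋r z)
    squareType-antisym 2≢0 three {α} {p} {r} α≢0 (inj₂ (n , h , nh , b , q)) (inj₂ (n' , h' , nh' , b' , q')) =
      ⊥-elim (*-nonzero α≢0 2≢0 (trans (𝔽R.distribˡ α 1# 1#) (trans (cong₂ _+_ (trans (cong (α *_) (sym (three h nh))) (sym q))
        (trans (cong (α *_) (sym (three h' nh'))) (sym (trans (cong (coeff (r ⊞ ⊟ p)) same) q'))))
        (trans (cong (coeff (p ⊞ ⊟ r) n +_) (trans (sym (at (⊟-⊟ p r) n)) (coeff-⊟ (p ⊞ ⊟ r) n))) (𝔽R.-‿inverseʳ _)))))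
      where
      same : n ≡ n'
      same = Deg=-unique {p = r ⊞ ⊟ p}
        ( Bd-resp (⊟-⊟ p r) (Bd-neg _ b)
        , λ z → *-nonzero α≢0 (*-nonzero nh nh) (trans (sym q) (trans (trans (sym (at (⊟-⊟ r p) n)) (coeff-⊟ (r ⊞ ⊟ p) n)) (trans (cong -_ z) -0≡0))))
        (b' , λ z → *-nonzero α≢0 (*-nonzero nh' nh') (trans (sym q') z))

  module _ (M : Form) {s : F} (s² : s * s ≡ 1#) where

    const² : constP s ⊠ constP s ≋ 1P
    const² = PR.trans (PR.sym (constP-* s s)) (constP-cong s²)

    qb-unary : ∀ y → qb M y (constP s) ≋ (a₁₁ M ⊠ (y ⊠ y) ⊞ ((constP s ⊠ a₁₂ M) ⊠ y ⊞ (constP s ⊠ a₁₂ M) ⊠ y)) ⊞ a₂₂ M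
    qb-unary y = PR.trans (PS.solve 5 (λ m g n y s → (m PS.:* (y PS.:* y) PS.:+ n PS.:* (s PS.:* s)) PS.:+ (g PS.:* (y PS.:* s) PS.:+ g PS.:* (y PS.:* s))
        PS.:= (m PS.:* (y PS.:* y) PS.:+ ((s PS.:* g) PS.:* y PS.:+ (s PS.:* g) PS.:* y)) PS.:+ n PS.:* (s PS.:* s)) PR.refl (a₁₁ M) (a₁₂ M) (a₂₂ M) y (constP s))
      (PR.+-congˡ (PR.trans (PR.*-congˡ const²) (PR.*-identityʳ _)))

    qa-unary : ∀ y → qa M y (constP s) ≋ (a₁₁ M ⊠ (y ⊠ y) ⊞ ((constP s ⊠ a₁₂ M ⊞ a₁₃ M) ⊠ y ⊞ (constP s ⊠ a₁₂ M ⊞ a₁₃ M) ⊠ y)) ⊞ (a₂₂ M ⊞ (constP s ⊠ a₂₃ M ⊞ constP s ⊠ a₂₃ M))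
    qa-unary y = PR.trans (PR.+-congʳ (qb-unary y)) (PS.solve 7 (λ m g n l h y s →
        ((m PS.:* (y PS.:* y) PS.:+ ((s PS.:* g) PS.:* y PS.:+ (s PS.:* g) PS.:* y)) PS.:+ n) PS.:+ ((l PS.:* y PS.:+ h PS.:* s) PS.:+ (l PS.:* y PS.:+ h PS.:* s))
        PS.:= (m PS.:* (y PS.:* y) PS.:+ ((s PS.:* g PS.:+ l) PS.:* y PS.:+ (s PS.:* g PS.:+ l) PS.:* y)) PS.:+ (n PS.:+ (s PS.:* h PS.:+ s PS.:* h)))
        PR.refl (a₁₁ M) (a₁₂ M) (a₂₂ M) (a₁₃ M) (a₂₃ M) y (constP s))

  MoreThanThree : Set
  MoreThanThree = ∃ λ t → t ≢ 0# × t ≢ 1# × t ≢ - 1#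

  moreThanThree? : Dec MoreThanThree
  moreThanThree? = anyF? λ t → ¬? (t ≟ 0#) ×-dec (¬? (t ≟ 1#) ×-dec ¬? (t ≟ (- 1#)))

  three-elements : ¬ MoreThanThree → ∀ z → z ≢ 0# → z ≡ 1# ⊎ z ≡ - 1#
  three-elements none z nz = case z ≟ 1# of λ
    { (yes e) → inj₁ e
    ; (no n) → case z ≟ (- 1#) of λ { (yes e) → inj₂ e ; (no n') → ⊥-elim (none (z , nz , n , n')) } }

  [-1]² : - 1# * - 1# ≡ 1#
  [-1]² = trans (𝔽S.solve 1 (λ u → (𝔽S.:- u) 𝔽S.:* (𝔽S.:- u) 𝔽S.:= u 𝔽S.:* u) refl 1#) (𝔽R.*-identityˡ 1#)

  three-squares : ¬ MoreThanThree → ∀ z → z ≢ 0# → z * z ≡ 1#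
  three-squares none z nz = case three-elements none z nz of λ
    { (inj₁ e) → trans (cong₂ _*_ e e) (𝔽R.*-identityˡ 1#)
    ; (inj₂ e) → trans (cong₂ _*_ e e) [-1]² }

  module Equations where
    open PS

    -- Completing the square: a₁₁ q(x , 1) = (a₁₁x + a₁₂)² + D with D the determinant of the plane.
    X² : ∀ m g n x → (m ⊠ x ⊞ g) ⊠ (m ⊠ x ⊞ g) ≋
         m ⊠ ((m ⊠ (x ⊠ x) ⊞ n ⊠ (1P ⊠ 1P)) ⊞ (g ⊠ (x ⊠ 1P) ⊞ g ⊠ (x ⊠ 1P))) ⊞ ⊟ (m ⊠ n ⊞ ⊟ (g ⊠ g))
    X² = solve 4 (λ m g n x → let o = con (pos 1) in (m :* x :+ g) :* (m :* x :+ g) :=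
         m :* ((m :* (x :* x) :+ n :* (o :* o)) :+ (g :* (x :* o) :+ g :* (x :* o))) :- (m :* n :- g :* g)) PR.refl

    Y² : ∀ m g n y s → (m ⊠ y ⊞ s ⊠ g) ⊠ (m ⊠ y ⊞ s ⊠ g) ≋
         m ⊠ ((m ⊠ (y ⊠ y) ⊞ n ⊠ (s ⊠ s)) ⊞ (g ⊠ (y ⊠ s) ⊞ g ⊠ (y ⊠ s))) ⊞ ⊟ ((s ⊠ s) ⊠ (m ⊠ n ⊞ ⊟ (g ⊠ g)))
    Y² = solve 5 (λ m g n y s → (m :* y :+ s :* g) :* (m :* y :+ s :* g) :=
         m :* ((m :* (y :* y) :+ n :* (s :* s)) :+ (g :* (y :* s) :+ g :* (y :* s))) :- ((s :* s) :* (m :* n :- g :* g))) PR.refl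

    subtract : ∀ q d e → (q ⊞ ⊟ d) ⊞ ⊟ (q ⊞ ⊟ e) ≋ e ⊞ ⊟ d
    subtract = solve 3 (λ q d e → (q :- d) :- (q :- e) := e :- d) PR.refl

  -- The coefficients a₁₂ and a₂₂

  module Binary (2≢0 : 1# + 1# ≢ 0#) {M M' d₁ d₂ d₃ d₃'} (R : ReducedForm M d₁ d₂ d₃) (R' : ReducedForm M' d₁ d₂ d₃')
                (E : Emb (qv M) (qv M')) (E' : Emb (qv M') (qv M)) {k'} (d₂≡ : d₂ ≡ suc k' ℕ.+ suc k' ℕ.+ d₁) (e₁₁ : a₁₁ M ≋ a₁₁ M') where

    Success : Set
    Success = ∃ λ s → s ≢ 0# × a₂₂ M ≋ constP (s * s) ⊠ a₂₂ M' × a₁₂ M ≋ constP s ⊠ a₁₂ M'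

    private
      module R = ReducedForm R
      module R' = ReducedForm R'
      m : Poly
      m = a₁₁ M
      Dm : Deg= d₁ m
      Dm = R.b₁₁ , Top.α₁≢0 R
      ν κ : F
      ν = ratio 2≢0 R'.aniso
      κ = ratio 2≢0 R.aniso
      D D' : Poly
      D  = m ⊠ a₂₂ M ⊞ ⊟ (a₁₂ M ⊠ a₁₂ M)
      D' = m ⊠ a₂₂ M' ⊞ ⊟ (a₁₂ M' ⊠ a₁₂ M')
      -- D and D' are the determinants of the planes; the factor s² belongs to scaling the second
      -- basis vector by s.
      G : F → Poly
      G s = constP (s * s) ⊠ D' ⊞ ⊟ D
      τ' : F → Poly
      τ' s = constP s ⊠ a₁₂ M'

    success? : Dec Success
    success? = anyF? λ s → ¬? (s ≟ 0#) ×-dec ((a₂₂ M ≋? (constP (s * s) ⊠ a₂₂ M')) ×-dec (a₁₂ M ≋? (constP s ⊠ a₁₂ M')))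

    module Large (none : ¬ Success) (point : ConicPoint 2≢0 κ) where
      open ConicPoint point
      open Core 2≢0 m d₁ Dm k' (a₁₂ M) R.b₁₂ τ' (λ s → Bd-* (constP s) (a₁₂ M') (Bd-const s) R'.b₁₂ ℕP.≤-refl) G ν (aniso⇒nonSquare 2≢0 R'.aniso) κ a w₀ a≢0 w₀≢0 eqn

      opaque
        match : ∀ x → Bd (suc (suc k')) x → ∃ λ y → ∃ λ s → Match x y s
        match x bx = case plane-match R R' E {k = suc k'} d₂≡ e₁₁ x bx of λ { (y , s , by , s≢0 , e) → y , s , record
            { bdy = by ; c≢0 = s≢0 ; eqn = equation y s e ; conic = on-conic y s by e } }
          where
          equation : ∀ y s → qb M' y (constP s) ≋ qb M x 1P → X x ⊠ X x ⊞ ⊟ (Y s y ⊠ Y s y) ≋ G s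
          equation y s e = PR.trans (PR.+-cong (Equations.X² m (a₁₂ M) (a₂₂ M) x) (PR.-‿cong (PR.trans (Equations.Y² m (a₁₂ M') (a₂₂ M') y (constP s))
              (PR.+-congʳ (PR.*-congˡ (PR.trans (PR.+-congʳ (PR.+-congʳ (PR.*-congʳ e₁₁))) e))))))
            (PR.trans (Equations.subtract (m ⊠ qb M x 1P) D ((constP s ⊠ constP s) ⊠ D')) (PR.+-congʳ (PR.*-congʳ (PR.sym (constP-* s s)))))
          on-conic : ∀ y s → Bd (suc (suc k')) y → qb M' y (constP s) ≋ qb M x 1P →
                     coeff y (suc k') * coeff y (suc k') + - (ν * (s * s)) ≡ coeff x (suc k') * coeff x (suc k') + - κ
          on-conic y s by e = trans (*-cancelˡ (Top.α₁≢0 R) (trans (cong (_* _) (at e₁₁ d₁)) (trans (sym (diagonal-as-norm (α*ratio 2≢0 R'.aniso) _ _))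
            (trans (sym (Top.qb-top R' d₂≡ s by)) (trans (at e d₂) (trans (Top.qb-top R d₂≡ 1# bx) (diagonal-as-norm (α*ratio 2≢0 R.aniso) _ _)))))))
            (cong (λ z → coeff x (suc k') * coeff x (suc k') + - z) (trans (cong (κ *_) (𝔽R.*-identityˡ 1#)) (𝔽R.*-identityʳ κ)))

      -- a₁₂ = ρs a₁₂' with (ρs)² = s², and D = s²D'. Adding a₁₂² turns the determinants into a₁₁a₂₂
      -- and s²a₁₁a₂₂', so ρs is the scalar sought.
      failure : ∀ s ρ → s ≢ 0# → ρ * ρ ≡ 1# → G s ≋ 0P → a₁₂ M ≋ constP ρ ⊠ τ' s → ⊥
      failure s ρ s≢0 ρ² G0 e = none (ρ * s , *-nonzero ρ≢0 s≢0 , ⊠-cancelˡ (Deg=⇒≉0 Dm) (begin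
          m ⊠ a₂₂ M                                      ≈⟨ PS.solve 3 (λ m n g → m PS.:* n PS.:= (m PS.:* n PS.:- g) PS.:+ g) PR.refl m (a₂₂ M) (a₁₂ M ⊠ a₁₂ M) ⟩
          D ⊞ a₁₂ M ⊠ a₁₂ M                              ≈⟨ PR.+-cong (PR.sym (p-r≋0⇒p≋r G0)) square ⟩
          constP (s * s) ⊠ D' ⊞ constP (s * s) ⊠ (a₁₂ M' ⊠ a₁₂ M') ≈⟨ PS.solve 4 (λ t m n g → t PS.:* (m PS.:* n PS.:- g) PS.:+ t PS.:* g PS.:= m PS.:* (t PS.:* n)) PR.refl (constP (s * s)) m (a₂₂ M') (a₁₂ M' ⊠ a₁₂ M') ⟩
          m ⊠ (constP (s * s) ⊠ a₂₂ M')                  ≈⟨ PR.*-congˡ (PR.*-congʳ (constP-cong (sym [ρs]²))) ⟩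
          m ⊠ (constP ((ρ * s) * (ρ * s)) ⊠ a₂₂ M')      ∎) , linear)
        where
        open import Relation.Binary.Reasoning.Setoid PR.setoid
        ρ≢0 : ρ ≢ 0#
        ρ≢0 z = 0≢1 (trans (sym (𝔽R.zeroˡ ρ)) (trans (cong (_* ρ) (sym z)) ρ²))
        [ρs]² : (ρ * s) * (ρ * s) ≡ s * s
        [ρs]² = trans (𝔽S.solve 2 (λ r s → (r 𝔽S.:* s) 𝔽S.:* (r 𝔽S.:* s) 𝔽S.:= (r 𝔽S.:* r) 𝔽S.:* (s 𝔽S.:* s)) refl ρ s) (trans (cong (_* (s * s)) ρ²) (𝔽R.*-identityˡ _))
        linear : a₁₂ M ≋ constP (ρ * s) ⊠ a₁₂ M'
        linear = PR.trans e (PR.trans (PR.sym (PR.*-assoc _ _ _)) (PR.*-congʳ (PR.sym (constP-* ρ s))))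
        square : a₁₂ M ⊠ a₁₂ M ≋ constP (s * s) ⊠ (a₁₂ M' ⊠ a₁₂ M')
        square = PR.trans (PR.*-cong linear linear) (PR.trans (PS.solve 2 (λ r g → (r PS.:* g) PS.:* (r PS.:* g) PS.:= (r PS.:* r) PS.:* (g PS.:* g)) PR.refl (constP (ρ * s)) (a₁₂ M'))
          (PR.*-congʳ (PR.trans (PR.sym (constP-* _ _)) (constP-cong [ρs]²))))

      -- ε = -1: the binary form takes the same value at (y , s) and (-y , -s).
      absurd : ⊥
      absurd = Contradiction.two-fold match failure (- 1#) [-1]²
        (λ s → PR.trans (PR.*-congʳ (PR.trans (constP-cong (neg s)) (constP-neg s))) (PS.solve 2 (λ s g → (PS.:- s) PS.:* g PS.:= PS.:- (s PS.:* g)) PR.refl (constP s) (a₁₂ M')))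
        (λ s → PR.+-congʳ (PR.*-congʳ (constP-cong (trans (cong₂ _*_ (neg s) (neg s)) (𝔽S.solve 1 (λ u → (𝔽S.:- u) 𝔽S.:* (𝔽S.:- u) 𝔽S.:= u 𝔽S.:* u) refl s)))))
        where
        neg : ∀ s → - 1# * s ≡ - s
        neg = 𝔽S.solve 1 (λ s → (𝔽S.:- 𝔽S.con (pos 1)) 𝔽S.:* s 𝔽S.:= 𝔽S.:- s) refl

    private
      cancel-summand : ∀ {p r n} → p ⊞ n ≋ r ⊞ n → p ≋ r
      cancel-summand {p} {r} {n} e = PR.trans (PS.solve 2 (λ p n → p PS.:= (p PS.:+ n) PS.:- n) PR.refl p n)
        (PR.trans (PR.+-congʳ e) (PS.solve 2 (λ p n → (p PS.:+ n) PS.:- n PS.:= p) PR.refl r n))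

      difference : ∀ {p r n} → p ⊞ r ≋ n → p ≋ n ⊞ ⊟ r
      difference {p} {r} e = PR.trans (PS.solve 2 (λ p n → p PS.:= (p PS.:+ n) PS.:- n) PR.refl p r) (PR.+-congʳ e)

    opaque
      -- Nonzero squares are 1. Matching e₂ in both directions expresses a₂₂ - a₂₂' and its negative
      -- as m y² + 2 g y, so leading coefficients force a₂₂ = a₂₂'; the vector (1 , 1) then gives
      -- a₁₂ up to sign.
      small : ¬ MoreThanThree → Success
      small few = case plane-match R R' E {k = suc k'} d₂≡ e₁₁ 0P Bd-0 of λ { (y , s , _ , s≢0 , e) →
                  case plane-match R' R E' {k = suc k'} d₂≡ (PR.sym e₁₁) 0P Bd-0 of λ { (z , t , _ , t≢0 , e') →
                  case plane-match R R' E {k = suc k'} d₂≡ e₁₁ 1P (Bd-mono (s≤s z≤n) (Bd-const 1#)) of λ { (u , v , _ , v≢0 , e'') →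
                  finish u v v≢0 e'' (squareType-antisym 2≢0 sq (Top.α₁≢0 R)
                    (SquareType-resp (value s≢0 e) (subst (λ a → SquareType a _) (sym (at e₁₁ d₁)) (unary-square Dm' (bτ' s) y)))
                    (SquareType-resp (value' t≢0 e') (unary-square Dm (bτ t) z))) } } }
        where
        sq : ∀ z → z ≢ 0# → z * z ≡ 1#
        sq = three-squares few
        Dm' : Deg= d₁ (a₁₁ M')
        Dm' = R'.b₁₁ , Top.α₁≢0 R'
        bτ' : ∀ s → Bd d₁ (constP s ⊠ a₁₂ M')
        bτ' s = Bd-* (constP s) (a₁₂ M') (Bd-const s) R'.b₁₂ ℕP.≤-refl
        bτ : ∀ s → Bd d₁ (constP s ⊠ a₁₂ M)
        bτ s = Bd-* (constP s) (a₁₂ M) (Bd-const s) R.b₁₂ ℕP.≤-refl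
        qb-01 : ∀ M → qb M 0P 1P ≋ a₂₂ M
        qb-01 M = PR.trans (qb-0y M 1P) (PR.trans (PR.*-congˡ (PR.*-identityˡ 1P)) (PR.*-identityʳ _))
        value : ∀ {y s} → s ≢ 0# → qb M' y (constP s) ≋ qb M 0P 1P → a₁₁ M' ⊠ (y ⊠ y) ⊞ ((constP s ⊠ a₁₂ M') ⊠ y ⊞ (constP s ⊠ a₁₂ M') ⊠ y) ≋ a₂₂ M ⊞ ⊟ a₂₂ M'
        value {y} {s} nz e = difference (PR.trans (PR.sym (qb-unary M' (sq s nz) y)) (PR.trans e (qb-01 M)))
        value' : ∀ {y s} → s ≢ 0# → qb M y (constP s) ≋ qb M' 0P 1P → a₁₁ M ⊠ (y ⊠ y) ⊞ ((constP s ⊠ a₁₂ M) ⊠ y ⊞ (constP s ⊠ a₁₂ M) ⊠ y) ≋ a₂₂ M' ⊞ ⊟ a₂₂ M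
        value' {y} {s} nz e = difference (PR.trans (PR.sym (qb-unary M (sq s nz) y)) (PR.trans e (qb-01 M')))
        finish : ∀ u v → v ≢ 0# → qb M' u (constP v) ≋ qb M 1P 1P → a₂₂ M ≋ a₂₂ M' → Success
        finish u v v≢0 e e₂₂ = case unary-match 2≢0 {m} {constP v ⊠ a₁₂ M'} {a₁₂ M} {y = u} Dm (bτ' v) R.b₁₂ relation of λ
            { (η , η² , e₁₂) → η * v , *-nonzero (λ z → 0≢1 (trans (sym (𝔽R.zeroˡ η)) (trans (cong (_* η) (sym z)) η²))) v≢0
            , PR.trans e₂₂ (PR.trans (PR.sym (PR.*-identityˡ _)) (PR.*-congʳ (constP-cong (sym (sq (η * v) (*-nonzero (λ z → 0≢1 (trans (sym (𝔽R.zeroˡ η)) (trans (cong (_* η) (sym z)) η²))) v≢0))))))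
            , PR.trans e₁₂ (PR.trans (PR.sym (PR.*-assoc _ _ _)) (PR.*-congʳ (PR.sym (constP-* η v)))) }
          where
          relation : m ⊠ (u ⊠ u) ⊞ ((constP v ⊠ a₁₂ M') ⊠ u ⊞ (constP v ⊠ a₁₂ M') ⊠ u) ≋ m ⊞ (a₁₂ M ⊞ a₁₂ M)
          relation = cancel-summand (PR.trans (PR.+-congʳ (PR.+-congʳ (PR.*-congʳ e₁₁))) (PR.trans (PR.sym (qb-unary M' (sq v v≢0) u)) (PR.trans e
            (PR.trans (PS.solve 3 (λ m g n → let o = PS.con (pos 1) in (m PS.:* (o PS.:* o) PS.:+ n PS.:* (o PS.:* o)) PS.:+ (g PS.:* (o PS.:* o) PS.:+ g PS.:* (o PS.:* o))
               PS.:= (m PS.:+ (g PS.:+ g)) PS.:+ n) PR.refl m (a₁₂ M) (a₂₂ M)) (PR.+-congˡ e₂₂)))))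

    binary-success : Success
    binary-success = case success? of λ
      { (yes p) → p
      ; (no none) → case moreThanThree? of λ
        { (yes t) → ⊥-elim (Large.absurd none (conic-start 2≢0 (aniso⇒nonSquare 2≢0 R.aniso) t))
        ; (no few) → small few } }

  open Form

  -- Vectors whose third coordinate has square one

  module _ {M d₁ d₂ d₃} (R : ReducedForm M d₁ d₂ d₃) where

    -- A leading coefficient α₃ at t^(d₃) forces the third coordinate to be a constant s with s² =
    -- 1. Multiplying the vector by s brings it to 1 without changing the value.
    affine-image : ∀ {v p} → qv M v ≋ p → Bd (suc d₃) p → coeff p d₃ ≡ coeff (a₃₃ M) d₃ →
                   ∃ λ s → s * s ≡ 1# × v i₂ ≋ constP s × qa M (constP s ⊠ v i₀) (constP s ⊠ v i₁) ⊞ a₃₃ M ≋ p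
    affine-image {v} {p} e b q = case Top.qt-top R (Bd-resp (PR.sym e) b) of λ { (s , vs , top≡) → go s vs top≡ }
      where
      go : ∀ s → v i₂ ≋ constP s → coeff (qv M v) d₃ ≡ coeff (a₃₃ M) d₃ * (s * s) → _
      go s vs top≡ = s , s² , vs , PR.trans (PR.sym (qt-affine M (v i₀) (v i₁) (constP s) (const² M s²))) (PR.trans (qt-cong M PR.refl PR.refl (PR.sym vs)) e)
        where
        s² : s * s ≡ 1#
        s² = *-cancelˡ (ReducedForm.α₃≢0 R) (trans (sym top≡) (trans (at e d₃) (trans q (sym (𝔽R.*-identityʳ _)))))

    affine-value : ∀ {v q} → qv M v ≋ q ⊞ a₃₃ M → Bd d₃ q →
                   ∃ λ s → s * s ≡ 1# × qa M (constP s ⊠ v i₀) (constP s ⊠ v i₁) ≋ q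
    affine-value {v} {q} e b = case affine-image {v} e (Bd-+ _ _ (Bd-mono (ℕP.n≤1+n d₃) b) (ReducedForm.b₃₃ R))
        (trans (coeff-⊞ q (a₃₃ M) d₃) (trans (cong (_+ coeff (a₃₃ M) d₃) (bz b d₃ ℕP.≤-refl)) (𝔽R.+-identityˡ _))) of λ
      { (s , s² , _ , e') → s , s² , PR.trans (PS.solve 2 (λ p n → p PS.:= (p PS.:+ n) PS.:- n) PR.refl _ (a₃₃ M))
          (PR.trans (PR.+-congʳ e') (PS.solve 2 (λ p n → (p PS.:+ n) PS.:- n PS.:= p) PR.refl q (a₃₃ M))) }

  polar-< : ∀ {d n} m p x → Bd (suc d) m → W (suc d) n p → W d n x → Bd n (m ⊠ (p ⊠ x))
  polar-< {d} {n} m p x bm wp wx = W⇒Bd (W-* m (p ⊠ x) (Bd⇒W 0 (d ℕ.+ d) bm le) (W-* p x wp wx)) l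
    where
    le : suc d ℕ.+ suc d ℕ.+ 0 ℕ.≤ suc (suc (d ℕ.+ d))
    le = ℕP.≤-reflexive (trans (ℕP.+-identityʳ _) (cong suc (ℕP.+-suc d d)))
    l : d ℕ.+ d ℕ.+ (n ℕ.+ n) ℕ.< n ℕ.+ n ℕ.+ (0 ℕ.+ (suc d ℕ.+ d))
    l = ℕP.≤-reflexive (trans (cong suc (ℕP.+-comm (d ℕ.+ d) (n ℕ.+ n))) (sym (ℕP.+-suc (n ℕ.+ n) (d ℕ.+ d))))

  Bd? : ∀ n p → Dec (Bd n p)
  Bd? n p = case degree p of λ
    { (inj₁ z) → yes (Bd-resp (PR.sym z) Bd-0)
    ; (inj₂ (e , b , nz)) → case e ℕ.<? n of λ
      { (yes l) → yes (Bd-mono l b)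
      ; (no l) → no (λ b' → nz (bz b' e (ℕP.≮⇒≥ l))) } }

  module _ (M : Form) where
    open PS

    private
      QA : ∀ {n} → (a b c d e x y : Polynomial n) → Polynomial n
      QA a b c d e x y = ((a :* (x :* x) :+ d :* (y :* y)) :+ (b :* (x :* y) :+ b :* (x :* y))) :+ ((c :* x :+ e :* y) :+ (c :* x :+ e :* y))

    qa-polar : ∀ p q x y → qa M (p ⊞ x) (q ⊞ y) ⊞ ⊟ qa M x y ≋
      qa M p q ⊞ (((a₁₁ M ⊠ (p ⊠ x) ⊞ a₂₂ M ⊠ (q ⊠ y)) ⊞ (a₁₂ M ⊠ (p ⊠ y) ⊞ a₁₂ M ⊠ (x ⊠ q))) ⊞ ((a₁₁ M ⊠ (p ⊠ x) ⊞ a₂₂ M ⊠ (q ⊠ y)) ⊞ (a₁₂ M ⊠ (p ⊠ y) ⊞ a₁₂ M ⊠ (x ⊠ q))))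
    qa-polar p q x y = solve 9 (λ a b c d e p q x y → QA a b c d e (p :+ x) (q :+ y) :- QA a b c d e x y :=
      QA a b c d e p q :+ (((a :* (p :* x) :+ d :* (q :* y)) :+ (b :* (p :* y) :+ b :* (x :* q))) :+ ((a :* (p :* x) :+ d :* (q :* y)) :+ (b :* (p :* y) :+ b :* (x :* q)))))
      PR.refl (a₁₁ M) (a₁₂ M) (a₁₃ M) (a₂₂ M) (a₂₃ M) p q x y

    qa-odd : ∀ x y → qa M (⊟ x) (⊟ y) ⊞ ⊟ qa M x y ≋ ⊟ (((a₁₃ M ⊠ x ⊞ a₂₃ M ⊠ y) ⊞ (a₁₃ M ⊠ x ⊞ a₂₃ M ⊠ y)) ⊞ ((a₁₃ M ⊠ x ⊞ a₂₃ M ⊠ y) ⊞ (a₁₃ M ⊠ x ⊞ a₂₃ M ⊠ y)))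
    qa-odd x y = solve 7 (λ a b c d e x y → QA a b c d e (:- x) (:- y) :- QA a b c d e x y :=
      :- (((c :* x :+ e :* y) :+ (c :* x :+ e :* y)) :+ ((c :* x :+ e :* y) :+ (c :* x :+ e :* y)))) PR.refl (a₁₁ M) (a₁₂ M) (a₁₃ M) (a₂₂ M) (a₂₃ M) x y

  -- The coefficients a₃₃ and a₁₃

  module Third (2≢0 : 1# + 1# ≢ 0#) {M M' d₁ d₂ d₃} (R : ReducedForm M d₁ d₂ d₃) (R' : ReducedForm M' d₁ d₂ d₃)
               (E : Emb (qv M) (qv M')) (E' : Emb (qv M') (qv M)) (e₁₁ : a₁₁ M ≋ a₁₁ M') (α₃≡ : coeff (a₃₃ M) d₃ ≡ coeff (a₃₃ M') d₃) where
    open Emb E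
    private
      module R = ReducedForm R
      module R' = ReducedForm R'

    -- If a₃₃' = q(x , 1) with x ≠ 0 and n = deg (a₃₃' - a₃₃), then v ↦ to (v + v₃ x) maps the finite set
    -- { v₃² = 1 , deg (q' v - a₃₃') < n } injectively into itself without reaching to (- x , 1).
    module Shift {x₁ x₂} (rel : qa M x₁ x₂ ⊞ a₃₃ M ≋ a₃₃ M') {n} (Dn : Deg= n (qa M x₁ x₂)) where

      D≋ : qa M x₁ x₂ ≋ a₃₃ M' ⊞ ⊟ a₃₃ M
      D≋ = PR.trans (PS.solve 2 (λ p n → p PS.:= (p PS.:+ n) PS.:- n) PR.refl (qa M x₁ x₂) (a₃₃ M)) (PR.+-congʳ rel)

      n<d₃ : n ℕ.< d₃
      n<d₃ = ℕP.≰⇒> λ d₃≤n → proj₂ Dn (bz (Bd-suc (Bd-resp (PR.sym D≋) (Bd-- _ _ R'.b₃₃ R.b₃₃))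
        (trans (at D≋ d₃) (trans (coeff-- (a₃₃ M') (a₃₃ M) d₃) (x≡y⇒x-y≡0 (sym α₃≡))))) n d₃≤n)

      w₁ : W d₁ n x₁
      w₁ = W-pred (proj₁ (Levels.qa-level R (proj₁ Dn)))

      w₂ : W d₂ n x₂
      w₂ = W-pred (proj₂ (Levels.qa-level R (proj₁ Dn)))

      S : Vec3 Poly → Set
      S v = v i₂ ⊠ v i₂ ≋ 1P × Bd n (qv M' v ⊞ ⊟ a₃₃ M')

      shear : Vec3 Poly → Vec3 Poly
      shear v = vec (v i₀ ⊞ v i₂ ⊠ x₁) (v i₁ ⊞ v i₂ ⊠ x₂) (v i₂)

      restore : ∀ p → p ≋ (p ⊞ ⊟ a₃₃ M') ⊞ a₃₃ M'
      restore p = PS.solve 2 (λ p a → p PS.:= (p PS.:- a) PS.:+ a) PR.refl p (a₃₃ M')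

      near-bound : ∀ {v} → Bd n (qv M' v ⊞ ⊟ a₃₃ M') → Bd (suc d₃) (qv M' v)
      near-bound {v} b = Bd-resp (PR.sym (restore (qv M' v))) (Bd-+ _ _ (Bd-mono (ℕP.≤-trans (ℕP.<⇒≤ n<d₃) (ℕP.n≤1+n d₃)) b) R'.b₃₃)

      -- n < d₃, so a value this close to a₃₃' has its leading coefficient at t^(d₃), and v₃² = 1
      -- comes for free.
      near⇒S : ∀ {v} → Bd n (qv M' v ⊞ ⊟ a₃₃ M') → S v
      near⇒S {v} b = (case affine-image R' {v} PR.refl (near-bound {v} b) (trans (at (restore (qv M' v)) d₃) (trans (coeff-⊞ (qv M' v ⊞ ⊟ a₃₃ M') (a₃₃ M') d₃)
          (trans (cong (_+ coeff (a₃₃ M') d₃) (bz b d₃ (ℕP.<⇒≤ n<d₃))) (𝔽R.+-identityˡ _)))) of λ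
            { (s , s² , vs , _) → PR.trans (PR.*-cong vs vs) (const² M' s²) }) , b

      level : ∀ {v} → S v → W (suc d₁) n (v i₂ ⊠ v i₀) × W (suc d₂) n (v i₂ ⊠ v i₁)
      level {v} (ss , b) = Levels.qa-level R' (Bd-resp (PR.trans (PR.+-congʳ (qt-affine M' (v i₀) (v i₁) (v i₂) ss))
        (PS.solve 2 (λ p n → (p PS.:+ n) PS.:- n PS.:= p) PR.refl _ (a₃₃ M'))) b)

      S-bounded : Bounded S
      S-bounded = record
        { bound = suc d₃
        ; bounded = λ {v} s → bounds {v} (Levels.qt-level R' (near-bound {v} (proj₂ s)))
        ; dec = λ v → ((v i₂ ⊠ v i₂) ≋? 1P) ×-dec Bd? n (qv M' v ⊞ ⊟ a₃₃ M')
        ; resp = λ e s → PR.trans (PR.sym (PR.*-cong (e i₂) (e i₂))) (proj₁ s) , Bd-resp (PR.+-congʳ (qv-cong M' e)) (proj₂ s) }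
        where
        bounds : ∀ {v : Vec3 Poly} → Levels.Level< R' (suc d₃) (v i₀) (v i₁) (v i₂) → ∀ i → Bd (suc d₃) (v i)
        bounds (w , _ , _) i₀ = W⇒Bd-level w
        bounds (_ , w , _) i₁ = W⇒Bd-level w
        bounds (_ , _ , w) i₂ = W⇒Bd-level w

      near-from : ∀ u {p q} → qv M u ≋ qa M p q ⊞ a₃₃ M → Bd n (qa M p q ⊞ ⊟ qa M x₁ x₂) → Bd n (qv M' (to u) ⊞ ⊟ a₃₃ M')
      near-from u {p} {q} e b = Bd-resp (PR.sym (PR.trans (PR.+-cong (PR.trans (value u) e) (PR.-‿cong (PR.sym rel)))
        (PS.solve 3 (λ p d a → (p PS.:+ a) PS.:- (d PS.:+ a) PS.:= p PS.:- d) PR.refl (qa M p q) (qa M x₁ x₂) (a₃₃ M)))) b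

      -- After the shear the value differs from a₃₃' by `qa` at p + x minus `qa` at x, where p =
      -- v₃(v₁ , v₂) lies strictly below level n. The polar terms pair p with x, which is at level n
      -- at most, so the degree stays below n.
      closed : ∀ {v} → S v → S (to (shear v))
      closed {v} s = near⇒S {to (shear v)} (near-from (shear v) {v i₂ ⊠ v i₀ ⊞ x₁} {v i₂ ⊠ v i₁ ⊞ x₂} (PR.trans (qt-affine M _ _ (v i₂) (proj₁ s)) (PR.+-congʳ (qa-cong M (sheared x₁) (sheared x₂))))
          (Bd-resp (PR.sym (qa-polar M (v i₂ ⊠ v i₀) (v i₂ ⊠ v i₁) x₁ x₂)) (Bd-+ _ _ (Levels.qa-bound R l) (Bd-+ _ _ cross' cross'))))
        where
        l : W (suc d₁) n (v i₂ ⊠ v i₀) × W (suc d₂) n (v i₂ ⊠ v i₁)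
        l = level {v} s
        sheared : ∀ x {u} → v i₂ ⊠ (u ⊞ v i₂ ⊠ x) ≋ v i₂ ⊠ u ⊞ x
        sheared x {u} = PR.trans (PS.solve 3 (λ t u x → t PS.:* (u PS.:+ t PS.:* x) PS.:= t PS.:* u PS.:+ (t PS.:* t) PS.:* x) PR.refl (v i₂) u x)
          (PR.+-congˡ (PR.trans (PR.*-congʳ (proj₁ s)) (PR.*-identityˡ x)))
        cross' : Bd n ((a₁₁ M ⊠ ((v i₂ ⊠ v i₀) ⊠ x₁) ⊞ a₂₂ M ⊠ ((v i₂ ⊠ v i₁) ⊠ x₂)) ⊞ (a₁₂ M ⊠ ((v i₂ ⊠ v i₀) ⊠ x₂) ⊞ a₁₂ M ⊠ (x₁ ⊠ (v i₂ ⊠ v i₁))))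
        cross' = Bd-+ _ _ (Bd-+ _ _ (polar-< _ _ _ R.b₁₁ (proj₁ l) w₁) (polar-< _ _ _ R.b₂₂ (proj₂ l) w₂))
          (Bd-+ _ _ (cross-< _ _ _ (ℕP.<⇒≤ R.d₁<d₂) R.b₁₂ (W-weaken (proj₁ l)) w₂) (cross-< _ _ _ (ℕP.<⇒≤ R.d₁<d₂) R.b₁₂ w₁ (W-weaken (proj₂ l))))

      cancelʳ : ∀ {p r s t} → p ⊞ s ≋ r ⊞ t → s ≋ t → p ≋ r
      cancelʳ {p} {r} {s} {t} e f = PR.trans (PS.solve 2 (λ p n → p PS.:= (p PS.:+ n) PS.:- n) PR.refl p s)
        (PR.trans (PR.+-cong e (PR.-‿cong f)) (PS.solve 2 (λ p n → (p PS.:+ n) PS.:- n PS.:= p) PR.refl r t))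

      shear-injective : ∀ {u v} → shear u ≋ᵥ shear v → u ≋ᵥ v
      shear-injective e i₀ = cancelʳ (e i₀) (PR.*-congʳ (e i₂))
      shear-injective e i₁ = cancelʳ (e i₁) (PR.*-congʳ (e i₂))
      shear-injective e i₂ = e i₂

      missed : Vec3 Poly
      missed = vec (⊟ x₁) (⊟ x₂) 1P

      -- A sign change of x affects only the linear terms in a₁₃ and a₂₃, which have degree below n.
      S-missed : S (to missed)
      S-missed = near⇒S {to missed} (near-from missed {⊟ x₁} {⊟ x₂} (qt-xy1 M (⊟ x₁) (⊟ x₂)) (Bd-resp (PR.sym (qa-odd M x₁ x₂)) (Bd-neg _ (Bd-+ _ _ l l))))
        where l = Levels.qa-linear R w₁ w₂

      -- A preimage of `missed` under `shear` is (-2x , 1). As an element of S it lies strictly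
      -- below level n, hence so does x; then `qa` at x could not have degree n.
      halve : ∀ {d x y t} → y ⊞ t ⊠ x ≋ ⊟ x → t ≋ 1P → W d n (t ⊠ y) → W d n x
      halve {x = x} {y} {t} e t1 w = mkW λ j l → x≡-x⇒x≡0 2≢0 (trans (solve 1 (λ u → u := (u :+ u) :- u) refl (coeff x j))
          (trans (cong (_+ - coeff x j) (twice j l)) (𝔽R.+-identityˡ _)))
        where
        open 𝔽S
        doubled : ⊟ (x ⊞ x) ≋ t ⊠ y
        doubled = PR.trans (PS.solve 1 (λ x → PS.:- (x PS.:+ x) PS.:= (PS.:- x) PS.:- x) PR.refl x)
          (PR.trans (PR.+-cong (PR.sym e) (PR.-‿cong (PR.sym (PR.trans (PR.*-congʳ t1) (PR.*-identityˡ x)))))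
          (PR.trans (PS.solve 2 (λ y u → (y PS.:+ u) PS.:- u PS.:= y) PR.refl y (t ⊠ x)) (PR.sym (PR.trans (PR.*-congʳ t1) (PR.*-identityˡ y)))))
        twice : ∀ j → n ℕ.< _ → coeff x j + coeff x j ≡ 0#
        twice j l = trans (sym (coeff-⊞ x x j)) (trans (solve 1 (λ u → u := :- (:- u)) refl _) (trans (cong -_ (trans (sym (coeff-⊟ (x ⊞ x) j)) (trans (at doubled j) (wz w j l)))) -0≡0))

      absurd : ⊥
      absurd = case self-map-onto S-bounded (λ v → to (shear v)) (λ {v} → closed {v}) (λ {u} {v} _ _ e → shear-injective {u} {v} (injective e)) S-missed of λ
        { (u , s , e) → go u s (injective e) }
        where
        go : ∀ u → S u → shear u ≋ᵥ missed → ⊥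
        go u s e = proj₂ Dn (bz (Levels.qa-bound R (halve (e i₀) (e i₂) (proj₁ (level {u} s)) , halve (e i₁) (e i₂) (proj₂ (level {u} s)))) n ℕP.≤-refl)

    opaque
      -- Some vector of M has the value a₃₃'. Its third coordinate can be taken to be 1, so a₃₃' -
      -- a₃₃ is a value of `qa`, and `Shift` excludes a nonzero one.
      third-a₃₃ : a₃₃ M ≋ a₃₃ M'
      third-a₃₃ = case affine-image R {Emb.to E' (vec 0P 0P 1P)} (value-e₃ R' R E') R'.b₃₃ (sym α₃≡) of λ
        { (s , _ , _ , rel) → case degree (qa M (constP s ⊠ Emb.to E' (vec 0P 0P 1P) i₀) (constP s ⊠ Emb.to E' (vec 0P 0P 1P) i₁)) of λ
          { (inj₁ z) → PR.trans (PR.sym (PR.trans (PR.+-congʳ z) (PR.+-identityˡ _))) rel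
          ; (inj₂ (n , Dn)) → ⊥-elim (Shift.absurd rel Dn) } }

      -- The value at (1 , 0 , 1) exceeds a₃₃ by a₁₁ + 2a₁₃, of degree d₁ < d₂. So the image,
      -- brought to third coordinate 1, has second coordinate 0, and a quadratic equation in one
      -- variable remains.
      third-a₁₃ : ∃ λ η → η * η ≡ 1# × a₁₃ M ≋ constP η ⊠ a₁₃ M'
      third-a₁₃ = case affine-value R' {to (vec 1P 0P 1P)} {a₁₁ M ⊞ (a₁₃ M ⊞ a₁₃ M)} (PR.trans (value (vec 1P 0P 1P)) (PR.trans (qt-xy1 M 1P 0P) (PR.+-cong (PR.trans (qa-x0 M 1P) unit) third-a₃₃)))
          (Bd-mono (ℕP.<-trans R.d₁<d₂ R.d₂<d₃) bound) of λ
        { (s , _ , e) → unary-match 2≢0 (R.b₁₁ , Top.α₁≢0 R) R'.b₁₃ R.b₁₃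
            (PR.trans (PR.+-congʳ (PR.*-congʳ e₁₁)) (PR.trans (PR.sym (PR.trans (qa-cong M' PR.refl (W-zero (proj₂ (Levels.qa-level R' (Bd-resp (PR.sym e) bound))) (s≤s R.d₁<d₂))) (qa-x0 M' _))) e)) }
        where
        unit : a₁₁ M ⊠ (1P ⊠ 1P) ⊞ (a₁₃ M ⊠ 1P ⊞ a₁₃ M ⊠ 1P) ≋ a₁₁ M ⊞ (a₁₃ M ⊞ a₁₃ M)
        unit = PS.solve 2 (λ m g → let o = PS.con (pos 1) in m PS.:* (o PS.:* o) PS.:+ (g PS.:* o PS.:+ g PS.:* o) PS.:= m PS.:+ (g PS.:+ g)) PR.refl (a₁₁ M) (a₁₃ M)
        bound : Bd (suc d₁) (a₁₁ M ⊞ (a₁₃ M ⊞ a₁₃ M))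
        bound = Bd-+ _ _ R.b₁₁ (Bd-mono (ℕP.n≤1+n d₁) (Bd-+ _ _ R.b₁₃ R.b₁₃))

  open Form

  -- The coefficient a₂₃

  record AgreeUpToA₂₃ (M M' : Form) : Set where
    field
      e₁₁ : a₁₁ M ≋ a₁₁ M'
      e₁₂ : a₁₂ M ≋ a₁₂ M'
      e₁₃ : a₁₃ M ≋ a₁₃ M'
      e₂₂ : a₂₂ M ≋ a₂₂ M'
      e₃₃ : a₃₃ M ≋ a₃₃ M'

  agree-sym : ∀ {M M'} → AgreeUpToA₂₃ M M' → AgreeUpToA₂₃ M' M
  agree-sym A = record { e₁₁ = PR.sym e₁₁ ; e₁₂ = PR.sym e₁₂ ; e₁₃ = PR.sym e₁₃ ; e₂₂ = PR.sym e₂₂ ; e₃₃ = PR.sym e₃₃ }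
    where open AgreeUpToA₂₃ A

  -- The forms differ only in a₂₃, so they agree where the second coordinate is 0. Counting removes
  -- those vectors, which secures s ≠ 0.
  affine-match : ∀ {M M' d₁ d₂ d₃ k} → ReducedForm M d₁ d₂ d₃ → ReducedForm M' d₁ d₂ d₃ → Emb (qv M) (qv M') → AgreeUpToA₂₃ M M' → d₂ ≡ k ℕ.+ k ℕ.+ d₁ →
                 ∀ {b} → b ≢ 0# → ∀ x → Bd (suc k) x → ∃ λ y → ∃ λ s → Bd (suc k) y × s ≢ 0# × qa M' y (constP s) ≋ qa M x (constP b)
  affine-match {M} {M'} {d₁} {d₂} {d₃} {k} R R' E A d₂≡ {b} b≢0 x bx =
    case complement R E (λ v → v i₁ ≋ 0P) (λ v → v i₁ ≋? 0P) (λ e z → PR.trans (PR.sym (e i₁)) z) agree (vec x (constP b) 1P) (constP≉0 b≢0) of λ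
      { (y , e , nz) → case affine-value R' {y} (PR.trans e (PR.trans (qt-xy1 M x (constP b)) (PR.+-congˡ e₃₃))) (Bd-mono (ReducedForm.d₂<d₃ R) bound) of λ
        { (s , s² , e') → image y s s² nz e' } }
    where
    open AgreeUpToA₂₃ A
    bound : Bd (suc d₂) (qa M x (constP b))
    bound = Levels.qa-bound R (Top.plane-level R {k} d₂≡ b bx)
    agree : ∀ y → y i₁ ≋ 0P → qv M y ≋ qv M' y
    agree y z = PR.trans (qt-cong M PR.refl z PR.refl) (PR.trans (PR.+-cong (PR.+-cong (qb-agree M M' e₁₁ e₁₂ e₂₂) (PR.*-congʳ e₃₃)) (PR.+-cong l l)) (qt-cong M' PR.refl (PR.sym z) PR.refl))
      where
      vanish : ∀ p t → p ⊠ (0P ⊠ t) ≋ 0P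
      vanish p t = PR.trans (PR.*-congˡ (PR.zeroˡ t)) (PR.zeroʳ p)
      l : a₁₃ M ⊠ (y i₀ ⊠ y i₂) ⊞ a₂₃ M ⊠ (0P ⊠ y i₂) ≋ a₁₃ M' ⊠ (y i₀ ⊠ y i₂) ⊞ a₂₃ M' ⊠ (0P ⊠ y i₂)
      l = PR.+-cong (PR.*-congʳ e₁₃) (PR.trans (vanish (a₂₃ M) (y i₂)) (PR.sym (vanish (a₂₃ M') (y i₂))))
    image : ∀ y s → s * s ≡ 1# → ¬ (y i₁ ≋ 0P) → qa M' (constP s ⊠ y i₀) (constP s ⊠ y i₁) ≋ qa M x (constP b) →
            ∃ λ y → ∃ λ s → Bd (suc k) y × s ≢ 0# × qa M' y (constP s) ≋ qa M x (constP b)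
    image y s s² nz e = case Top.level-plane R' {k} d₂≡ (Levels.qa-level R' (Bd-resp (PR.sym e) bound)) of λ
      { (by , const) → constP s ⊠ y i₀ , coeff (constP s ⊠ y i₁) 0 , by
        , (λ z → ⊠-nonzero (constP≉0 (λ s≡0 → 0≢1 (trans (sym (𝔽R.zeroˡ s)) (trans (cong (_* s) (sym s≡0)) s²)))) nz (PR.trans const (PR.trans (constP-cong z) constP-0)))
        , PR.trans (qa-cong M' PR.refl (PR.sym const)) e }

  sign : ∀ {ρ} → ρ * ρ ≡ 1# → ρ ≡ 1# ⊎ ρ ≡ - 1#
  sign e = x²≡y²⇒x≡±y (trans e (sym (𝔽R.*-identityˡ 1#)))

  square⇒nonzero : ∀ {ρ} → ρ * ρ ≡ 1# → ρ ≢ 0#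
  square⇒nonzero {ρ} e z = 0≢1 (trans (sym (𝔽R.zeroˡ ρ)) (trans (cong (_* ρ) (sym z)) e))

  twice : Poly → Poly
  twice p = p ⊞ p

  module _ (few : ¬ MoreThanThree) {M M' d₁ d₂ d₃ k} (R : ReducedForm M d₁ d₂ d₃) (R' : ReducedForm M' d₁ d₂ d₃) (E : Emb (qv M) (qv M'))
           (A : AgreeUpToA₂₃ M M') (d₂≡ : d₂ ≡ k ℕ.+ k ℕ.+ d₁) where

    private
      open AgreeUpToA₂₃ A
      h h' : Poly
      h  = twice (a₂₃ M)
      h' = twice (a₂₃ M')
      Sq : Poly → Set
      Sq = SquareType (coeff (a₁₁ M') d₁)

      signed : ∀ s → s ≢ 0# → ∀ p → constP s ⊠ p ≋ p ⊎ constP s ⊠ p ≋ ⊟ p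
      signed s nz p = case three-elements few s nz of λ
        { (inj₁ q) → inj₁ (PR.trans (PR.*-congʳ (constP-cong q)) (PR.*-identityˡ p))
        ; (inj₂ q) → inj₂ (PR.trans (PR.*-congʳ (PR.trans (constP-cong q) (constP-neg 1#))) (PS.solve 1 (λ p → (PS.:- PS.con (pos 1)) PS.:* p PS.:= PS.:- p) PR.refl p)) }

      -- At x = 0 the terms with a₂₂ cancel because b² = s² = 1. A polynomial m y² + 2 g y remains
      -- on one side, so the difference on the other is zero or has leading coefficient α₁ times a
      -- square.
      value-at-0 : ∀ {b} → b ≢ 0# → ∃ λ s → s ≢ 0# × Sq ((constP b ⊠ h) ⊞ ⊟ (constP s ⊠ h'))
      value-at-0 {b} b≢0 = case affine-match {k = k} R R' E A d₂≡ b≢0 0P Bd-0 of λ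
        { (y , s , _ , s≢0 , e) → s , s≢0 , SquareType-resp (rearrange y s (PR.trans (PR.sym (qa-unary M' (three-squares few s s≢0) y)) (PR.trans e (qa-unary M (three-squares few b b≢0) 0P))))
            (unary-square (ReducedForm.b₁₁ R' , Top.α₁≢0 R') (Bd-+ _ _ (Bd-* (constP s) (a₁₂ M') (Bd-const s) (ReducedForm.b₁₂ R') ℕP.≤-refl) (ReducedForm.b₁₃ R')) y) }
        where
        rearrange : ∀ y s {u g} → u ⊞ (a₂₂ M' ⊞ (constP s ⊠ a₂₃ M' ⊞ constP s ⊠ a₂₃ M')) ≋ (a₁₁ M ⊠ (0P ⊠ 0P) ⊞ (g ⊠ 0P ⊞ g ⊠ 0P)) ⊞ (a₂₂ M ⊞ (constP b ⊠ a₂₃ M ⊞ constP b ⊠ a₂₃ M)) →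
                    u ≋ (constP b ⊠ h) ⊞ ⊟ (constP s ⊠ h')
        rearrange y s {u} {g} e = PR.trans (PS.solve 2 (λ u t → u PS.:= (u PS.:+ t) PS.:- t) PR.refl u (a₂₂ M' ⊞ (constP s ⊠ a₂₃ M' ⊞ constP s ⊠ a₂₃ M')))
          (PR.trans (PR.+-cong e (PR.-‿cong (PR.+-congʳ (PR.sym e₂₂)))) (PS.solve 7 (λ m g n b h s h' → let z = PS.con (pos 0) in
            ((m PS.:* (z PS.:* z) PS.:+ (g PS.:* z PS.:+ g PS.:* z)) PS.:+ (n PS.:+ (b PS.:* h PS.:+ b PS.:* h))) PS.:- (n PS.:+ (s PS.:* h' PS.:+ s PS.:* h'))
            PS.:= b PS.:* (h PS.:+ h) PS.:- s PS.:* (h' PS.:+ h')) PR.refl (a₁₁ M) g (a₂₂ M) (constP b) (a₂₃ M) (constP s) (a₂₃ M')))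

    squares-plus : Sq (h ⊞ ⊟ h') ⊎ Sq (h ⊞ ⊟ (⊟ h'))
    squares-plus = case value-at-0 {1#} (λ e → 0≢1 (sym e)) of λ { (s , s≢0 , q) → case signed s s≢0 h' of λ
      { (inj₁ e) → inj₁ (SquareType-resp (PR.+-cong (PR.*-identityˡ h) (PR.-‿cong e)) q)
      ; (inj₂ e) → inj₂ (SquareType-resp (PR.+-cong (PR.*-identityˡ h) (PR.-‿cong e)) q) } }

    squares-minus : Sq (⊟ h' ⊞ ⊟ h) ⊎ Sq (h' ⊞ ⊟ h)
    squares-minus = case value-at-0 { - 1#} (square⇒nonzero [-1]²) of λ { (s , s≢0 , q) → case signed s s≢0 h' of λ
      { (inj₁ e) → inj₁ (SquareType-resp (PR.trans (PR.+-cong minus (PR.-‿cong e)) (PR.+-comm _ _)) q)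
      ; (inj₂ e) → inj₂ (SquareType-resp (PR.trans (PR.+-cong minus (PR.-‿cong e)) (PS.solve 2 (λ h h' → (PS.:- h) PS.:- (PS.:- h') PS.:= h' PS.:- h) PR.refl h h')) q) } }
      where
      minus : constP (- 1#) ⊠ h ≋ ⊟ h
      minus = PR.trans (PR.*-congʳ (constP-neg 1#)) (PS.solve 1 (λ p → (PS.:- PS.con (pos 1)) PS.:* p PS.:= PS.:- p) PR.refl h)

  module Last (2≢0 : 1# + 1# ≢ 0#) {M M' d₁ d₂ d₃} (R : ReducedForm M d₁ d₂ d₃) (R' : ReducedForm M' d₁ d₂ d₃)
              (E : Emb (qv M) (qv M')) (E' : Emb (qv M') (qv M)) {k'} (d₂≡ : d₂ ≡ suc k' ℕ.+ suc k' ℕ.+ d₁) (A : AgreeUpToA₂₃ M M') where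

    open AgreeUpToA₂₃ A
    open Halving 2≢0

    -- An opposite sign of a₂₃ can be repaired by changing the sign of the second basis vector if
    -- a₁₂ = 0, or of the third if a₁₃ = 0.
    Success : Set
    Success = a₂₃ M ≋ a₂₃ M' ⊎ (a₂₃ M' ≋ ⊟ a₂₃ M × (a₁₂ M ≋ 0P ⊎ a₁₃ M ≋ 0P))

    success? : Dec Success
    success? = (a₂₃ M ≋? a₂₃ M') ⊎-dec ((a₂₃ M' ≋? (⊟ a₂₃ M)) ×-dec ((a₁₂ M ≋? 0P) ⊎-dec (a₁₃ M ≋? 0P)))

    private
      module R = ReducedForm R
      module R' = ReducedForm R'
      m g l n : Poly
      m = a₁₁ M
      g = a₁₂ M
      l = a₁₃ M
      n = a₂₂ M
      Dm : Deg= d₁ m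
      Dm = R.b₁₁ , Top.α₁≢0 R
      ν : F
      ν = ratio 2≢0 R.aniso
      nonSquare : NonSquare 2≢0 ν
      nonSquare = aniso⇒nonSquare 2≢0 R.aniso
      γ : F → Poly
      γ s = constP s ⊠ g ⊞ l
      bγ : ∀ s → Bd d₁ (γ s)
      bγ s = Bd-+ _ _ (Bd-* (constP s) g (Bd-const s) R.b₁₂ ℕP.≤-refl) R.b₁₃
      N : Form
      N = record { a₁₁ = m ; a₁₂ = g ; a₁₃ = l ; a₂₂ = n ; a₂₃ = a₂₃ M' ; a₃₃ = a₃₃ M }
      qa-N : ∀ y s → qa N y s ≋ qa M' y s
      qa-N y s = PR.+-cong (qb-agree N M' e₁₁ e₁₂ e₂₂) (PR.+-cong t t)
        where t = PR.+-congʳ (PR.*-congʳ e₁₃)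
      -- At second coordinate s, a₁₁ times `qa` is (a₁₁x + γ s)² + H, where h takes the place of
      -- a₂₃.
      H : Poly → Poly → Poly
      H h s = m ⊠ ((s ⊠ s) ⊠ n ⊞ (s ⊠ h ⊞ s ⊠ h)) ⊞ ⊟ ((s ⊠ g ⊞ l) ⊠ (s ⊠ g ⊞ l))

    -- For s = -b the relation is b g + l = ρ(l - b g): ρ = 1 forces g = 0, and ρ = -1 forces l = 0.
    opposite-success : ∀ {b s ρ} → b ≢ 0# → s ≡ - b → ρ * ρ ≡ 1# → a₂₃ M' ≋ ⊟ a₂₃ M → γ b ≋ constP ρ ⊠ γ s → Success
    opposite-success {b} {s} {ρ} b≢0 s≡ ρ² opp e = inj₂ (opp , (case sign ρ² of λ
      { (inj₁ q) → inj₁ (⊠-cancelˡ (constP≉0 b≢0) (PR.trans (p+p≋0⇒p≋0 (PR.trans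
          (PS.solve 3 (λ b g l → b PS.:* g PS.:+ b PS.:* g PS.:= (b PS.:* g PS.:+ l) PS.:- PS.con (pos 1) PS.:* ((PS.:- b) PS.:* g PS.:+ l)) PR.refl (constP b) g l)
          (p≋r⇒p-r≋0 (e' (PR.trans (constP-cong q) PR.refl))))) (PR.sym (PR.zeroʳ _))))
      ; (inj₂ q) → inj₂ (p+p≋0⇒p≋0 (PR.trans
          (PS.solve 3 (λ b g l → l PS.:+ l PS.:= (b PS.:* g PS.:+ l) PS.:- (PS.:- PS.con (pos 1)) PS.:* ((PS.:- b) PS.:* g PS.:+ l)) PR.refl (constP b) g l)
          (p≋r⇒p-r≋0 (e' (PR.trans (constP-cong q) (constP-neg 1#)))))) }))
      where
      e' : ∀ {r} → constP ρ ≋ r → γ b ≋ r ⊠ (⊟ constP b ⊠ g ⊞ l)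
      e' q = PR.trans e (PR.*-cong q (PR.+-congʳ (PR.*-congʳ (PR.trans (constP-cong s≡) (constP-neg b)))))

    module Large (none : ¬ Success) {b} (b≢0 : b ≢ 0#) (point : ConicPoint 2≢0 (ν * (b * b))) where
      open ConicPoint point

      G : F → Poly
      G s = H (a₂₃ M') (constP s) ⊞ ⊟ H (a₂₃ M) (constP b)

      open Core 2≢0 m d₁ Dm k' (γ b) (bγ b) γ bγ G ν nonSquare (ν * (b * b)) a w₀ a≢0 w₀≢0 eqn

      opaque
        match : ∀ x → Bd (suc (suc k')) x → ∃ λ y → ∃ λ s → Match x y s
        match x bx = case affine-match {k = suc k'} R R' E A d₂≡ b≢0 x bx of λ { (y , s , by , s≢0 , e) → y , s , record
            { bdy = by ; c≢0 = s≢0 ; eqn = equation y s e ; conic = on-conic y s by e } }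
          where
          complete : ∀ m g n l h x s → (m ⊠ x ⊞ (s ⊠ g ⊞ l)) ⊠ (m ⊠ x ⊞ (s ⊠ g ⊞ l)) ≋
            m ⊠ (((m ⊠ (x ⊠ x) ⊞ n ⊠ (s ⊠ s)) ⊞ (g ⊠ (x ⊠ s) ⊞ g ⊠ (x ⊠ s))) ⊞ ((l ⊠ x ⊞ h ⊠ s) ⊞ (l ⊠ x ⊞ h ⊠ s)))
            ⊞ ⊟ (m ⊠ ((s ⊠ s) ⊠ n ⊞ (s ⊠ h ⊞ s ⊠ h)) ⊞ ⊟ ((s ⊠ g ⊞ l) ⊠ (s ⊠ g ⊞ l)))
          complete = solve 7 (λ m g n l h x s → (m :* x :+ (s :* g :+ l)) :* (m :* x :+ (s :* g :+ l)) :=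
            m :* (((m :* (x :* x) :+ n :* (s :* s)) :+ (g :* (x :* s) :+ g :* (x :* s))) :+ ((l :* x :+ h :* s) :+ (l :* x :+ h :* s)))
            :- (m :* ((s :* s) :* n :+ (s :* h :+ s :* h)) :- ((s :* g :+ l) :* (s :* g :+ l)))) PR.refl
            where open PS
          equation : ∀ y s → qa M' y (constP s) ≋ qa M x (constP b) → X x ⊠ X x ⊞ ⊟ (Y s y ⊠ Y s y) ≋ G s
          equation y s e = PR.trans (PR.+-cong (complete m g n l (a₂₃ M) x (constP b)) (PR.-‿cong (PR.trans (complete m g n l (a₂₃ M') y (constP s))
              (PR.+-congʳ (PR.*-congˡ (PR.trans (qa-N y (constP s)) e))))))
            (Equations.subtract (m ⊠ qa M x (constP b)) (H (a₂₃ M) (constP b)) (H (a₂₃ M') (constP s)))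
          on-conic : ∀ y s → Bd (suc (suc k')) y → qa M' y (constP s) ≋ qa M x (constP b) →
                     coeff y (suc k') * coeff y (suc k') + - (ν * (s * s)) ≡ coeff x (suc k') * coeff x (suc k') + - (ν * (b * b))
          on-conic y s by e = *-cancelˡ (Top.α₁≢0 R) (trans (sym (diagonal-as-norm (α*ratio 2≢0 R.aniso) _ _))
            (trans (cong₂ (λ u v → u * (coeff y (suc k') * coeff y (suc k')) + v * (s * s)) (at e₁₁ d₁) (at e₂₂ d₂))
            (trans (sym (Top.qa-top R' {k = suc k'} d₂≡ s by)) (trans (at e d₂) (trans (Top.qa-top R {k = suc k'} d₂≡ b bx) (diagonal-as-norm (α*ratio 2≢0 R.aniso) _ _))))))

      opaque
        -- ρ² = 1 removes the squares of γ from G(s) = 0, leaving s²a₂₂ + 2s a₂₃' = b²a₂₂ + 2b a₂₃.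
        -- The coefficient of t^(d₂) gives s² = b²; s = b makes the a₂₃ equal, s = -b makes them
        -- opposite.
        failure : ∀ s ρ → s ≢ 0# → ρ * ρ ≡ 1# → G s ≋ 0P → γ b ≋ constP ρ ⊠ γ s → ⊥
        failure s ρ s≢0 ρ² G0 e = none (case x²≡y²⇒x≡±y s²≡b² of λ
          { (inj₁ q) → inj₁ (PR.sym (⊠-cancelˡ (constP≉0 b≢0) (p+p≋r+r⇒p≋r (linear (constP-cong q) (PR.*-cong (constP-cong q) (constP-cong q))))))
          ; (inj₂ q) → opposite-success b≢0 q ρ² (⊠-cancelˡ (constP≉0 b≢0) (PR.trans (flip (linear (PR.trans (constP-cong q) (constP-neg b)) (negated q)))
              (PS.solve 2 (λ b h → PS.:- (b PS.:* h) PS.:= b PS.:* (PS.:- h)) PR.refl (constP b) (a₂₃ M)))) e })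
          where
          squares : γ b ⊠ γ b ≋ γ s ⊠ γ s
          squares = PR.trans (PR.*-cong e e) (PR.trans (PS.solve 2 (λ r t → (r PS.:* t) PS.:* (r PS.:* t) PS.:= (r PS.:* r) PS.:* (t PS.:* t)) PR.refl (constP ρ) (γ s))
            (PR.trans (PR.*-congʳ (const² M ρ²)) (PR.*-identityˡ _)))
          balance : (constP s ⊠ constP s) ⊠ n ⊞ (constP s ⊠ a₂₃ M' ⊞ constP s ⊠ a₂₃ M') ≋ (constP b ⊠ constP b) ⊠ n ⊞ (constP b ⊠ a₂₃ M ⊞ constP b ⊠ a₂₃ M)
          balance = ⊠-cancelˡ (Deg=⇒≉0 Dm) (PR.trans (PS.solve 2 (λ p t → p PS.:= (p PS.:- t) PS.:+ t) PR.refl _ (γ s ⊠ γ s))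
            (PR.trans (PR.+-cong (p-r≋0⇒p≋r G0) (PR.sym squares)) (PS.solve 2 (λ p t → (p PS.:- t) PS.:+ t PS.:= p) PR.refl _ (γ b ⊠ γ b))))
          side : ∀ s h → Bd d₂ h → coeff ((constP s ⊠ constP s) ⊠ n ⊞ (constP s ⊠ h ⊞ constP s ⊠ h)) d₂ ≡ (s * s) * coeff n d₂
          side s h bh = trans (coeff-⊞ ((constP s ⊠ constP s) ⊠ n) (constP s ⊠ h ⊞ constP s ⊠ h) d₂) (trans (cong₂ _+_
            (trans (at (PR.*-congʳ (PR.sym (constP-* s s))) d₂) (coeff-const* (s * s) n d₂))
            (bz (Bd-+ _ _ t t) d₂ ℕP.≤-refl)) (𝔽R.+-identityʳ _))
            where
            t : Bd d₂ (constP s ⊠ h)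
            t = Bd-* (constP s) h (Bd-const s) bh ℕP.≤-refl
          s²≡b² : s * s ≡ b * b
          s²≡b² = *-cancelˡ (Top.α₂≢0 R) (trans (𝔽R.*-comm _ _) (trans (sym (side s (a₂₃ M') R'.b₂₃)) (trans (at balance d₂) (trans (side b (a₂₃ M) R.b₂₃) (𝔽R.*-comm _ _)))))
          linear : ∀ {t} → constP s ≋ t → constP s ⊠ constP s ≋ constP b ⊠ constP b → t ⊠ a₂₃ M' ⊞ t ⊠ a₂₃ M' ≋ constP b ⊠ a₂₃ M ⊞ constP b ⊠ a₂₃ M
          linear q q² = PR.trans (PR.+-cong (PR.*-congʳ (PR.sym q)) (PR.*-congʳ (PR.sym q)))
            (PR.trans (PS.solve 2 (λ p t → t PS.:= (p PS.:+ t) PS.:- p) PR.refl ((constP s ⊠ constP s) ⊠ n) _)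
            (PR.trans (PR.+-cong balance (PR.-‿cong (PR.*-congʳ q²))) (PS.solve 2 (λ p t → (p PS.:+ t) PS.:- p PS.:= t) PR.refl ((constP b ⊠ constP b) ⊠ n) _)))
          negated : s ≡ - b → constP s ⊠ constP s ≋ constP b ⊠ constP b
          negated q = PR.trans (PR.*-cong q' q') (PS.solve 1 (λ b → (PS.:- b) PS.:* (PS.:- b) PS.:= b PS.:* b) PR.refl (constP b))
            where
            q' : constP s ≋ ⊟ constP b
            q' = PR.trans (constP-cong q) (constP-neg b)
          flip : ⊟ constP b ⊠ a₂₃ M' ⊞ ⊟ constP b ⊠ a₂₃ M' ≋ constP b ⊠ a₂₃ M ⊞ constP b ⊠ a₂₃ M → constP b ⊠ a₂₃ M' ≋ ⊟ (constP b ⊠ a₂₃ M)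
          flip q = p+p≋r+r⇒p≋r (PR.trans (PS.solve 2 (λ b h → b PS.:* h PS.:+ b PS.:* h PS.:= PS.:- ((PS.:- b) PS.:* h PS.:+ (PS.:- b) PS.:* h)) PR.refl (constP b) (a₂₃ M'))
            (PR.trans (PR.-‿cong q) (PS.solve 1 (λ t → PS.:- (t PS.:+ t) PS.:= (PS.:- t) PS.:+ (PS.:- t)) PR.refl (constP b ⊠ a₂₃ M))))

      -- γ(-s) is not -γ(s) in general, so only q points face q - 1 slopes, and already two at one
      -- point must force ρ² = 1. The second coordinate b is chosen to achieve this.
      NoExtra : Set
      NoExtra = ∀ s η ρ → s ≢ 0# → η * η + - (ν * (s * s)) ≡ w₀ * w₀ → a ≡ ρ * η → γ b ≋ constP ρ ⊠ γ s → ρ * ρ ≡ 1#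

      one-fold : NoExtra → ⊥
      one-fold = Contradiction.one-fold match failure

      -- For g = l = 0 the relation γ b = ρ γ s is empty, but then (-y , s) matches whenever (y , s)
      -- does: ε = 1.
      two-fold : g ≋ 0P → l ≋ 0P → ⊥
      two-fold g0 l0 = Contradiction.two-fold match failure 1# (𝔽R.*-identityˡ 1#) (λ s → PR.trans (γ0 (1# * s)) (PR.sym (PR.trans (PR.-‿cong (γ0 s)) ⊟0)))
          (λ s → PR.+-congʳ (PR.+-cong (PR.*-congˡ (PR.+-cong (PR.*-congʳ (PR.*-cong (id* s) (id* s))) (PR.+-cong (PR.*-congʳ (id* s)) (PR.*-congʳ (id* s))))) (PR.-‿cong (PR.*-cong (γ* s) (γ* s)))))
        where
        id* : ∀ s → constP (1# * s) ≋ constP s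
        id* s = constP-cong (𝔽R.*-identityˡ s)
        γ* : ∀ s → γ (1# * s) ≋ γ s
        γ* s = PR.+-congʳ (PR.*-congʳ (id* s))
        γ0 : ∀ s → γ s ≋ 0P
        γ0 s = PR.trans (PR.+-cong (PR.trans (PR.*-congˡ g0) (PR.zeroʳ _)) l0) (PR.+-identityˡ 0P)
        ⊟0 : ⊟ 0P ≋ 0P
        ⊟0 = PS.solve 0 (PS.:- PS.con (pos 0) PS.:= PS.con (pos 0)) PR.refl

      lone : g ≋ 0P → ¬ (l ≋ 0P) → NoExtra
      lone g0 nl s η ρ _ _ _ e = trans (cong (λ z → z * z) (sym (constP-injective {1#} {ρ} 1≋ρ))) (𝔽R.*-identityˡ 1#)
        where
        cancelˡ : ∀ {p r} → l ⊠ p ≋ l ⊠ r → p ≋ r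
        cancelˡ = ⊠-cancelˡ nl
        γ0 : ∀ s → γ s ≋ l
        γ0 s = PR.trans (PR.+-congʳ (PR.trans (PR.*-congˡ g0) (PR.zeroʳ _))) (PR.+-identityˡ l)
        1≋ρ : constP 1# ≋ constP ρ
        1≋ρ = cancelˡ (PR.trans (PR.*-identityʳ l) (PR.trans (PR.sym (γ0 b)) (PR.trans e (PR.trans (PR.*-congˡ (γ0 s)) (PR.*-comm (constP ρ) l)))))

      -- For ρ ≠ 1 the relation γ b = ρ γ s could be solved for l as a constant multiple of g.
      independent : ¬ (∃ λ t → l ≋ constP t ⊠ g) → NoExtra
      independent indep s η ρ _ _ _ e = case 1# ≟ ρ of λ
        { (yes q) → trans (cong (λ z → z * z) (sym q)) (𝔽R.*-identityˡ 1#)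
        ; (no q) → ⊥-elim (indep (quotient q)) }
        where
        quotient : 1# ≢ ρ → ∃ λ t → l ≋ constP t ⊠ g
        quotient q = (ρ * s + - b) * i , PR.trans (PR.sym (PR.*-identityˡ l)) (PR.trans (PR.*-congʳ (PR.trans (constP-cong (sym (trans (𝔽R.*-comm i _) (inverseʳ _ nz)))) (constP-* i (1# + - ρ))))
            (PR.trans (PR.*-assoc _ _ _) (PR.trans (PR.*-congˡ relation) (PR.trans (PR.sym (PR.*-assoc _ _ _)) (PR.*-congʳ (PR.trans (PR.*-comm _ _) (PR.sym (constP-* (ρ * s + - b) i))))))))
          where
          nz : 1# + - ρ ≢ 0#
          nz z = q (x-y≡0⇒x≡y z)
          i : F
          i = (1# + - ρ) ⁻¹
          relation : constP (1# + - ρ) ⊠ l ≋ constP (ρ * s + - b) ⊠ g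
          relation = PR.trans (PR.*-congʳ (PR.trans (constP-+ 1# (- ρ)) (PR.+-congˡ (constP-neg ρ))))
            (PR.trans (PS.solve 4 (λ r b g l → (PS.con (pos 1) PS.:- r) PS.:* l PS.:= (b PS.:* g PS.:+ l) PS.:- (r PS.:* l PS.:+ b PS.:* g)) PR.refl (constP ρ) (constP b) g l)
            (PR.trans (PR.+-congʳ e) (PR.trans (PS.solve 5 (λ r s b g l → r PS.:* (s PS.:* g PS.:+ l) PS.:- (r PS.:* l PS.:+ b PS.:* g) PS.:= (r PS.:* s PS.:- b) PS.:* g) PR.refl (constP ρ) (constP s) (constP b) g l)
            (PR.*-congʳ (PR.sym (PR.trans (constP-+ (ρ * s) (- b)) (PR.+-cong (constP-* ρ s) (constP-neg b))))))))

      module _ {t} (lt : l ≋ constP t ⊠ g) (g≉0 : ¬ (g ≋ 0P)) where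

        proportional : ∀ {s ρ} → γ b ≋ constP ρ ⊠ γ s → b + t ≡ ρ * (s + t)
        proportional {s} {ρ} e = constP-injective (⊠-cancelˡ g≉0 (PR.trans (PR.*-comm _ _) (PR.trans (PR.sym (γ≋ b)) (PR.trans e
            (PR.trans (PR.*-congˡ (γ≋ s)) (PR.trans (PR.sym (PR.*-assoc _ _ _)) (PR.trans (PR.*-congʳ (PR.sym (constP-* ρ (s + t)))) (PR.*-comm _ _))))))))
          where
          γ≋ : ∀ s → γ s ≋ constP (s + t) ⊠ g
          γ≋ s = PR.trans (PR.+-congˡ lt) (PR.trans (PR.sym (PR.distribʳ g (constP s) (constP t))) (PR.*-congʳ (PR.sym (constP-+ s t))))

        -- Now b = ρs as well as a = ρη, so a² - νb² = ρ²(η² - νs²), and both norms equal w₀².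
        multiple-zero : t ≡ 0# → NoExtra
        multiple-zero t0 s η ρ _ on aη e = *-cancelˡ (*-nonzero w₀≢0 w₀≢0) (trans (𝔽R.*-comm _ _) (trans (cong (ρ * ρ *_) (sym on))
            (trans (𝔽S.solve 4 (λ r η ν s → (r 𝔽S.:* r) 𝔽S.:* (η 𝔽S.:* η 𝔽S.:- ν 𝔽S.:* (s 𝔽S.:* s)) 𝔽S.:= (r 𝔽S.:* η) 𝔽S.:* (r 𝔽S.:* η) 𝔽S.:- ν 𝔽S.:* ((r 𝔽S.:* s) 𝔽S.:* (r 𝔽S.:* s))) refl ρ η ν s)
            (trans (cong₂ (λ u v → u * u + - (ν * (v * v))) (sym aη) (sym b≡)) (trans eqn (sym (𝔽R.*-identityʳ _)))))))
          where
          b≡ : b ≡ ρ * s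
          b≡ = trans (sym (trans (cong (b +_) t0) (𝔽R.+-identityʳ b))) (trans (proportional e) (cong (ρ *_) (trans (cong (s +_) t0) (𝔽R.+-identityʳ s))))

        -- The choice b = -t makes γ b vanish. Since ρ ≠ 0, γ s vanishes too, so s = b, and the
        -- conic leaves η² = a².
        multiple-opposite : b ≡ - t → NoExtra
        multiple-opposite bt s η ρ _ on aη e = *-cancelˡ (*-nonzero a≢0 a≢0) (trans (𝔽R.*-comm _ _) (trans (cong (ρ * ρ *_) (sym η²))
            (trans (𝔽S.solve 2 (λ r η → (r 𝔽S.:* r) 𝔽S.:* (η 𝔽S.:* η) 𝔽S.:= (r 𝔽S.:* η) 𝔽S.:* (r 𝔽S.:* η)) refl ρ η) (trans (cong (λ u → u * u) (sym aη)) (sym (𝔽R.*-identityʳ _))))))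
          where
          ρ≢0 : ρ ≢ 0#
          ρ≢0 z = a≢0 (trans aη (trans (cong (_* η) z) (𝔽R.zeroˡ η)))
          s+t≡0 : s + t ≡ 0#
          s+t≡0 = x*y≡0⇒y≡0 ρ≢0 (trans (sym (proportional e)) (trans (cong (_+ t) bt) (𝔽R.-‿inverseˡ t)))
          s≡b : s ≡ b
          s≡b = trans (𝔽S.solve 2 (λ s t → s 𝔽S.:= (s 𝔽S.:+ t) 𝔽S.:- t) refl s t) (trans (cong (_+ - t) s+t≡0) (trans (𝔽R.+-identityˡ _) (sym bt)))
          η² : η * η ≡ a * a
          η² = trans (restore (η * η) (ν * (s * s))) (trans (cong₂ _+_ (trans on (sym eqn)) (cong (λ z → ν * (z * z)) s≡b)) (sym (restore (a * a) (ν * (b * b)))))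
            where
            restore : ∀ u v → u ≡ (u + - v) + v
            restore = 𝔽S.solve 2 (λ u v → u 𝔽S.:= (u 𝔽S.:- v) 𝔽S.:+ v) refl

    module LargeCases (none : ¬ Success) (more : MoreThanThree) where

      point : ∀ {b} → b ≢ 0# → ConicPoint 2≢0 (ν * (b * b))
      point {b} b≢0 = scaled (conic-start 2≢0 nonSquare more)
        where
        scaled : ConicPoint 2≢0 ν → ConicPoint 2≢0 (ν * (b * b))
        scaled (conicPoint a w a≢0 w≢0 e) = conicPoint (b * a) (b * w) (*-nonzero b≢0 a≢0) (*-nonzero b≢0 w≢0)
          (trans (𝔽S.solve 3 (λ a b ν → (b 𝔽S.:* a) 𝔽S.:* (b 𝔽S.:* a) 𝔽S.:- ν 𝔽S.:* (b 𝔽S.:* b) 𝔽S.:= (b 𝔽S.:* b) 𝔽S.:* (a 𝔽S.:* a 𝔽S.:- ν)) refl a b ν)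
          (trans (cong (b * b *_) e) (𝔽S.solve 2 (λ b w → (b 𝔽S.:* b) 𝔽S.:* (w 𝔽S.:* w) 𝔽S.:= (b 𝔽S.:* w) 𝔽S.:* (b 𝔽S.:* w)) refl b w)))

      1≢0 : 1# ≢ 0#
      1≢0 e = 0≢1 (sym e)

      open Large none

      absurd : ⊥
      absurd = case g ≋? 0P of λ
        { (yes g0) → case l ≋? 0P of λ
          { (yes l0) → two-fold 1≢0 (point 1≢0) g0 l0
          ; (no nl) → one-fold 1≢0 (point 1≢0) (lone 1≢0 (point 1≢0) g0 nl) }
        ; (no ng) → case anyF? (λ t → l ≋? (constP t ⊠ g)) of λ
          { (no ind) → one-fold 1≢0 (point 1≢0) (independent 1≢0 (point 1≢0) ind)
          ; (yes (t , lt)) → case t ≟ 0# of λ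
            { (yes t0) → one-fold 1≢0 (point 1≢0) (multiple-zero 1≢0 (point 1≢0) lt ng t0)
            ; (no nt) → one-fold (-t≢0 nt) (point (-t≢0 nt)) (multiple-opposite (-t≢0 nt) (point (-t≢0 nt)) lt ng refl) } } }
        where
        -t≢0 : ∀ {t} → t ≢ 0# → - t ≢ 0#
        -t≢0 {t} nt z = nt (trans (𝔽S.solve 1 (λ t → t 𝔽S.:= 𝔽S.:- (𝔽S.:- t)) refl t) (trans (cong -_ z) -0≡0))

    module Small (few : ¬ MoreThanThree) where

      private
        α : F
        α = coeff m d₁
        sq : ∀ z → z ≢ 0# → z * z ≡ 1#
        sq = three-squares few
        h h' : Poly
        h  = a₂₃ M
        h' = a₂₃ M'
        Sq : Poly → Set
        Sq = SquareType α
        unary : Poly → Poly → Poly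
        unary γ y = m ⊠ (y ⊠ y) ⊞ (γ ⊠ y ⊞ γ ⊠ y)

      opaque
        -- Matching at x = 0 with b = 1 and b = -1, in both directions, yields sums and differences
        -- of u and v of square type. In every combination some p - r occurs together with r - p,
        -- and `squareType-antisym` makes p and r equal.
        same-or-opposite : twice h ≋ twice h' ⊎ twice h ≋ ⊟ twice h'
        same-or-opposite = combine' forward (squares-minus few {k = suc k'} R R' E A d₂≡) (squares-plus few {k = suc k'} R' R E' (agree-sym A) d₂≡) (squares-minus few {k = suc k'} R' R E' (agree-sym A) d₂≡)
          where
          u v : Poly
          u = twice h
          v = twice h'
          α' : F
          α' = coeff (a₁₁ M') d₁
          forward : SquareType α' (u ⊞ ⊟ v) ⊎ SquareType α' (u ⊞ ⊟ (⊟ v))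
          forward = squares-plus few {k = suc k'} R R' E A d₂≡
          conv' : ∀ {p} → SquareType α' p → Sq p
          conv' {p} = subst (λ a → SquareType a p) (sym (at e₁₁ d₁))
          same : Sq (u ⊞ ⊟ v) → Sq (v ⊞ ⊟ u) → u ≋ v ⊎ u ≋ ⊟ v
          same p q = inj₁ (squareType-antisym 2≢0 sq (Top.α₁≢0 R) p q)
          opp : Sq (u ⊞ ⊟ (⊟ v)) → Sq (⊟ v ⊞ ⊟ u) → u ≋ v ⊎ u ≋ ⊟ v
          opp p q = inj₂ (squareType-antisym 2≢0 sq (Top.α₁≢0 R) p q)
          plus : Sq (v ⊞ ⊟ (⊟ u)) → Sq (u ⊞ ⊟ (⊟ v))
          plus = SquareType-resp (PS.solve 2 (λ u v → v PS.:- (PS.:- u) PS.:= u PS.:- (PS.:- v)) PR.refl u v)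
          minus : Sq (⊟ u ⊞ ⊟ v) → Sq (⊟ v ⊞ ⊟ u)
          minus = SquareType-resp (PR.+-comm _ _)
          combine' : SquareType α' (u ⊞ ⊟ v) ⊎ SquareType α' (u ⊞ ⊟ (⊟ v)) → SquareType α' (⊟ v ⊞ ⊟ u) ⊎ SquareType α' (v ⊞ ⊟ u) →
                     Sq (v ⊞ ⊟ u) ⊎ Sq (v ⊞ ⊟ (⊟ u)) → Sq (⊟ u ⊞ ⊟ v) ⊎ Sq (u ⊞ ⊟ v) → u ≋ v ⊎ u ≋ ⊟ v
          combine' (inj₁ p) (inj₂ q) _        _        = same (conv' p) (conv' q)
          combine' (inj₂ p) (inj₁ q) _        _        = opp (conv' p) (conv' q)
          combine' (inj₁ p) (inj₁ q) (inj₁ r) _        = same (conv' p) r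
          combine' (inj₁ p) (inj₁ q) (inj₂ r) _        = opp (plus r) (conv' q)
          combine' (inj₂ p) (inj₂ q) _        (inj₁ r) = opp (conv' p) (minus r)
          combine' (inj₂ p) (inj₂ q) _        (inj₂ r) = same r (conv' q)

      module Opposite (opp : h' ≋ ⊟ h) where

        opaque
          -- With three elements s = b or s = -b. For s = -b the terms in a₂₃ cancel and
          -- `unary-match` relates γ b to γ s up to sign, which is success; for s = b they add up to
          -- 4b a₂₃.
          value-at-1 : ∀ {b} → b ≢ 0# → Success ⊎ ∃ λ y → unary (γ b) y ≋ (m ⊞ twice (γ b)) ⊞ twice (twice (constP b ⊠ h))
          value-at-1 {b} b≢0 = case affine-match {k = suc k'} R R' E A d₂≡ b≢0 1P (Bd-mono (s≤s z≤n) (Bd-const 1#)) of λ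
            { (y , s , _ , s≢0 , e) → go y s (rearrange y s (PR.trans (PR.sym (qa-unary N (sq s s≢0) y)) (PR.trans (qa-N y (constP s)) (PR.trans e (qa-unary M (sq b b≢0) 1P)))))
                (x²≡y²⇒x≡±y (trans (sq s s≢0) (sym (sq b b≢0)))) }
            where
            rearrange : ∀ y s → unary (γ s) y ⊞ (n ⊞ (constP s ⊠ h' ⊞ constP s ⊠ h')) ≋ (m ⊠ (1P ⊠ 1P) ⊞ (γ b ⊠ 1P ⊞ γ b ⊠ 1P)) ⊞ (n ⊞ (constP b ⊠ h ⊞ constP b ⊠ h)) →
                        unary (γ s) y ≋ (m ⊞ twice (γ b)) ⊞ (twice (constP b ⊠ h) ⊞ twice (constP s ⊠ h))
            rearrange y s e = PR.trans (PS.solve 2 (λ u t → u PS.:= (u PS.:+ t) PS.:- t) PR.refl (unary (γ s) y) (n ⊞ (constP s ⊠ h' ⊞ constP s ⊠ h')))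
              (PR.trans (PR.+-cong e (PR.-‿cong (PR.+-congˡ (PR.+-cong (PR.*-congˡ opp) (PR.*-congˡ opp)))))
              (PS.solve 6 (λ m g n b s h → let o = PS.con (pos 1) in
                ((m PS.:* (o PS.:* o) PS.:+ (g PS.:* o PS.:+ g PS.:* o)) PS.:+ (n PS.:+ (b PS.:* h PS.:+ b PS.:* h))) PS.:- (n PS.:+ (s PS.:* (PS.:- h) PS.:+ s PS.:* (PS.:- h)))
                PS.:= (m PS.:+ (g PS.:+ g)) PS.:+ ((b PS.:* h PS.:+ b PS.:* h) PS.:+ (s PS.:* h PS.:+ s PS.:* h))) PR.refl m (γ b) n (constP b) (constP s) h))
            go : ∀ y s → unary (γ s) y ≋ (m ⊞ twice (γ b)) ⊞ (twice (constP b ⊠ h) ⊞ twice (constP s ⊠ h)) → s ≡ b ⊎ s ≡ - b →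
                 Success ⊎ ∃ λ y → unary (γ b) y ≋ (m ⊞ twice (γ b)) ⊞ twice (twice (constP b ⊠ h))
            go y s e (inj₁ q) = inj₂ (y , PR.trans (PR.+-congˡ (PR.+-cong (PR.*-congʳ γ≋) (PR.*-congʳ γ≋))) (PR.trans e (PR.+-congˡ (PR.+-congˡ (PR.+-cong s≋ s≋)))))
              where
              γ≋ : γ b ≋ γ s
              γ≋ = PR.+-congʳ (PR.*-congʳ (constP-cong (sym q)))
              s≋ : constP s ⊠ h ≋ constP b ⊠ h
              s≋ = PR.*-congʳ (constP-cong q)
            go y s e (inj₂ q) = case unary-match 2≢0 {m} {γ s} {γ b} {y = y} Dm (bγ s) (bγ b) (PR.trans e (PR.trans (PR.+-congˡ (PR.+-congˡ (PR.+-cong s≋ s≋)))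
                (PS.solve 2 (λ t p → t PS.:+ ((p PS.:+ p) PS.:+ ((PS.:- p) PS.:+ (PS.:- p))) PS.:= t) PR.refl (m ⊞ twice (γ b)) (constP b ⊠ h)))) of λ
                  { (η , η² , eη) → inj₁ (opposite-success b≢0 q η² opp eη) }
              where
              s≋ : constP s ⊠ h ≋ ⊟ (constP b ⊠ h)
              s≋ = PR.trans (PR.*-congʳ (PR.trans (constP-cong q) (constP-neg b))) (PS.solve 2 (λ b h → (PS.:- b) PS.:* h PS.:= PS.:- (b PS.:* h)) PR.refl (constP b) h)

        -- The possible y in m y² + 2δy = m + 2δ + e, seen from e: y of positive degree, y = 1, y =
        -- -1, y = 0. In the first case e has degree above d₁.
        data Solution (δ e : Poly) : Set where
          high     : ∀ N → suc d₁ ℕ.≤ N → coeff e N ≢ 0# → Sq e → Solution δ e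
          at-one   : e ≋ 0P → Solution δ e
          at-minus : e ≋ ⊟ twice (twice δ) → Solution δ e
          at-zero  : e ≋ ⊟ (m ⊞ twice δ) → Solution δ e

        opaque
          solution : ∀ {δ e} → Bd d₁ δ → ∀ y → unary δ y ≋ (m ⊞ twice δ) ⊞ e → Solution δ e
          solution {δ} {e} bδ y eq = case degree y of λ
            { (inj₁ z) → at-zero (PR.trans e≋ (PR.trans (PR.+-congʳ (unary-0 m δ z)) (PR.+-identityˡ _)))
            ; (inj₂ (zero , Dy)) → case three-elements few (coeff y 0) (proj₂ Dy) of λ
                { (inj₁ q) → at-one (PR.trans e≋ (PR.trans (PR.+-congʳ (at-const (PR.trans (Bd1⇒const (proj₁ Dy)) (constP-cong q))))
                    (PS.solve 2 (λ m d → let o = PS.con (pos 1) in (m PS.:* (o PS.:* o) PS.:+ (d PS.:* o PS.:+ d PS.:* o)) PS.:- (m PS.:+ (d PS.:+ d)) PS.:= PS.con (pos 0)) PR.refl m δ)))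
                ; (inj₂ q) → at-minus (PR.trans e≋ (PR.trans (PR.+-congʳ (at-const (PR.trans (Bd1⇒const (proj₁ Dy)) (PR.trans (constP-cong q) (constP-neg 1#)))))
                    (PS.solve 2 (λ m d → let o = PS.:- (PS.con (pos 1)) in (m PS.:* (o PS.:* o) PS.:+ (d PS.:* o PS.:+ d PS.:* o)) PS.:- (m PS.:+ (d PS.:+ d)) PS.:= PS.:- ((d PS.:+ d) PS.:+ (d PS.:+ d))) PR.refl m δ))) }
            ; (inj₂ (suc j , Dy)) → top-case j Dy }
            where
            e≋ : e ≋ unary δ y ⊞ ⊟ (m ⊞ twice δ)
            e≋ = PR.trans (PS.solve 2 (λ e t → e PS.:= (t PS.:+ e) PS.:- t) PR.refl e (m ⊞ twice δ)) (PR.+-congʳ (PR.sym eq))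
            at-const : ∀ {t} → y ≋ t → unary δ y ≋ unary δ t
            at-const q = PR.+-cong (PR.*-congˡ (PR.*-cong q q)) (PR.+-cong (PR.*-congˡ q) (PR.*-congˡ q))
            low : Bd (suc d₁) (m ⊞ twice δ)
            low = Bd-+ _ _ R.b₁₁ (Bd-mono (ℕP.n≤1+n d₁) (Bd-+ _ _ bδ bδ))
            top-case : ∀ j → Deg= (suc j) y → Solution δ e
            top-case j Dy = high (d₁ ℕ.+ (suc j ℕ.+ suc j)) le (λ z → *-nonzero (Top.α₁≢0 R) (*-nonzero (proj₂ Dy) (proj₂ Dy)) (trans (sym coefficient) z))
                (inj₂ (d₁ ℕ.+ (suc j ℕ.+ suc j) , coeff y (suc j) , proj₂ Dy , Bd-resp (PR.sym e≋) (Bd-- _ _ (leading-bound Dm bδ Dy) (Bd-mono (ℕP.m≤n⇒m≤1+n le) low)) , coefficient))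
              where
              le : suc d₁ ℕ.≤ d₁ ℕ.+ (suc j ℕ.+ suc j)
              le = ℕP.≤-trans (ℕP.≤-reflexive (ℕP.+-comm 1 d₁)) (ℕP.+-monoʳ-≤ d₁ (s≤s z≤n))
              coefficient : coeff e (d₁ ℕ.+ (suc j ℕ.+ suc j)) ≡ α * (coeff y (suc j) * coeff y (suc j))
              coefficient = trans (at e≋ _) (trans (coeff-- (unary δ y) (m ⊞ twice δ) _) (trans (cong₂ (λ u v → u + - v) (leading-coeff Dm bδ Dy) (bz low _ le))
                (trans (cong (α * (coeff y (suc j) * coeff y (suc j)) +_) -0≡0) (𝔽R.+-identityʳ _))))

        private
          2h 4h : Poly
          2h = twice h
          4h = twice 2h
          ⊟0 : ⊟ 0P ≋ 0P
          ⊟0 = PS.solve 0 (PS.:- PS.con (pos 0) PS.:= PS.con (pos 0)) PR.refl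
          ⊟⊟ : ∀ {p r} → ⊟ p ≋ ⊟ r → p ≋ r
          ⊟⊟ {p} {r} e = PR.trans (PS.solve 1 (λ p → p PS.:= PS.:- (PS.:- p)) PR.refl p) (PR.trans (PR.-‿cong e) (PS.solve 1 (λ p → PS.:- (PS.:- p) PS.:= p) PR.refl r))
          vanishing : 4h ≋ 0P → Success
          vanishing z = inj₁ (PR.trans h0 (PR.sym (PR.trans opp (PR.trans (PR.-‿cong h0) ⊟0))))
            where
            h0 : h ≋ 0P
            h0 = p+p≋0⇒p≋0 (p+p≋0⇒p≋0 z)
          m-coeff : ∀ s → coeff (m ⊞ twice (γ s)) d₁ ≡ α
          m-coeff s = trans (coeff-⊞ m (twice (γ s)) d₁) (trans (cong (α +_) (bz (Bd-+ _ _ (bγ s) (bγ s)) d₁ ℕP.≤-refl)) (𝔽R.+-identityʳ _))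
          γ-coeff : ∀ s → coeff (twice (twice (γ s))) d₁ ≡ 0#
          γ-coeff s = bz (Bd-+ _ _ b b) d₁ ℕP.≤-refl
            where b = Bd-+ _ _ (bγ s) (bγ s)
          γ-bound : ∀ s → Bd (suc d₁) (twice (twice (γ s)))
          γ-bound s = Bd-mono (ℕP.n≤1+n d₁) (Bd-+ _ _ b b)
            where b = Bd-+ _ _ (bγ s) (bγ s)
          m-bound : ∀ s → Bd (suc d₁) (m ⊞ twice (γ s))
          m-bound s = Bd-+ _ _ R.b₁₁ (Bd-mono (ℕP.n≤1+n d₁) (Bd-+ _ _ (bγ s) (bγ s)))
          too-low : ∀ {N} → suc d₁ ℕ.≤ N → coeff 4h N ≢ 0# → Bd (suc d₁) 4h → Success
          too-low le nz b = ⊥-elim (nz (bz b _ le))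
          coeff-⊟4h : ∀ {N} → coeff (⊟ 4h) N ≢ 0# → coeff 4h N ≢ 0#
          coeff-⊟4h {N} nz z = nz (trans (coeff-⊟ 4h N) (trans (cong -_ z) -0≡0))
          negate : ∀ {p} → ⊟ 4h ≋ ⊟ p → 4h ≋ p
          negate = ⊟⊟

        -- Compares the solutions at b = 1 and b = -1, whose e are opposite. Two high ones force a₂₃
        -- = 0 by the sign of the leading coefficient; a high one and a low nonzero one differ in
        -- degree; y = 0 is excluded otherwise by the coefficient of t^(d₁). For y = -1 twice, 4γ(1)
        -- + 4γ(-1) = 0 gives a₁₃ = 0.
        finish : Solution (γ 1#) 4h → Solution (γ (- 1#)) (⊟ 4h) → Success
        finish (at-one z) _ = vanishing z
        finish _ (at-one z) = vanishing (⊟⊟ (PR.trans z (PR.sym ⊟0)))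
        finish (high _ _ _ s) (high _ _ _ s') = vanishing (squareType-antisym 2≢0 sq (Top.α₁≢0 R)
          (SquareType-resp (PS.solve 1 (λ p → p PS.:= p PS.:- PS.con (pos 0)) PR.refl 4h) s) (SquareType-resp (PR.sym (PR.+-identityˡ (⊟ 4h))) s'))
        finish (high N le nz _) (at-minus e) = too-low le nz (Bd-resp (PR.sym (negate e)) (γ-bound (- 1#)))
        finish (high N le nz _) (at-zero e) = too-low le nz (Bd-resp (PR.sym (negate e)) (m-bound (- 1#)))
        finish (at-minus e) (high N le nz _) = too-low le (coeff-⊟4h nz) (Bd-resp (PR.sym e) (Bd-neg _ (γ-bound 1#)))
        finish (at-zero e) (high N le nz _) = too-low le (coeff-⊟4h nz) (Bd-resp (PR.sym e) (Bd-neg _ (m-bound 1#)))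
        finish (at-minus e) (at-minus e') = inj₂ (opp , inj₂ (p+p≋0⇒p≋0 (p+p≋0⇒p≋0 (p+p≋0⇒p≋0 (PR.trans
          (PS.solve 2 (λ g l → let o = PS.con (pos 1) ; a = o PS.:* g PS.:+ l ; b = (PS.:- o) PS.:* g PS.:+ l in
            ((l PS.:+ l) PS.:+ (l PS.:+ l)) PS.:+ ((l PS.:+ l) PS.:+ (l PS.:+ l)) PS.:= ((b PS.:+ b) PS.:+ (b PS.:+ b)) PS.:- (PS.:- ((a PS.:+ a) PS.:+ (a PS.:+ a)))) PR.refl g l)
          (PR.trans (PR.+-congʳ (PR.+-cong c' c')) (p≋r⇒p-r≋0 (PR.trans (PR.sym (negate e')) e))))))))
          where
          γ≋ : ⊟ 1P ⊠ g ⊞ l ≋ γ (- 1#)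
          γ≋ = PR.+-congʳ (PR.*-congʳ (PR.sym (constP-neg 1#)))
          c' : twice (⊟ 1P ⊠ g ⊞ l) ≋ twice (γ (- 1#))
          c' = PR.+-cong γ≋ γ≋
        finish (at-minus e) (at-zero e') = ⊥-elim (Top.α₁≢0 R (trans (sym (m-coeff (- 1#))) (trans (sym (at (negate e') d₁)) (trans (at e d₁) (trans (coeff-⊟ (twice (twice (γ 1#))) d₁) (trans (cong -_ (γ-coeff 1#)) -0≡0))))))
        finish (at-zero e) (at-minus e') = ⊥-elim (Top.α₁≢0 R (trans (𝔽S.solve 1 (λ u → u 𝔽S.:= 𝔽S.:- (𝔽S.:- u)) refl α) (trans (cong -_ (trans (cong -_ (sym (m-coeff 1#))) (trans (sym (coeff-⊟ (m ⊞ twice (γ 1#)) d₁)) (trans (sym (at e d₁)) (trans (at (negate e') d₁) (γ-coeff (- 1#))))))) -0≡0)))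
        finish (at-zero e) (at-zero e') = ⊥-elim (Top.α₁≢0 R (x≡-x⇒x≡0 2≢0 (trans (sym (m-coeff (- 1#))) (trans (sym (at (negate e') d₁)) (trans (at e d₁) (trans (coeff-⊟ (m ⊞ twice (γ 1#)) d₁) (cong -_ (m-coeff 1#))))))))

        opposite : Success
        opposite = case value-at-1 {1#} (λ e → 0≢1 (sym e)) of λ
          { (inj₁ s) → s
          ; (inj₂ (y , e)) → case value-at-1 { - 1#} (square⇒nonzero [-1]²) of λ
            { (inj₁ s) → s
            ; (inj₂ (z , e')) → finish (solution (bγ 1#) y (PR.trans e (PR.+-congˡ (PR.+-cong (PR.+-cong one one) (PR.+-cong one one)))))
                (solution (bγ (- 1#)) z (PR.trans e' (PR.+-congˡ (PR.trans (PR.+-cong (PR.+-cong minus minus) (PR.+-cong minus minus))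
                  (PS.solve 1 (λ h → ((PS.:- h) PS.:+ (PS.:- h)) PS.:+ ((PS.:- h) PS.:+ (PS.:- h)) PS.:= PS.:- ((h PS.:+ h) PS.:+ (h PS.:+ h))) PR.refl h))))) } }
          where
          one : constP 1# ⊠ h ≋ h
          one = PR.*-identityˡ h
          minus : constP (- 1#) ⊠ h ≋ ⊟ h
          minus = PR.trans (PR.*-congʳ (constP-neg 1#)) (PS.solve 1 (λ p → (PS.:- PS.con (pos 1)) PS.:* p PS.:= PS.:- p) PR.refl h)

      small : Success
      small = case same-or-opposite of λ
        { (inj₁ e) → inj₁ (p+p≋r+r⇒p≋r e)
        ; (inj₂ e) → Opposite.opposite (p+p≋r+r⇒p≋r (PR.trans (PS.solve 1 (λ p → p PS.:+ p PS.:= PS.:- (PS.:- (p PS.:+ p))) PR.refl h')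
            (PR.trans (PR.-‿cong (PR.sym e)) (PS.solve 1 (λ p → PS.:- (p PS.:+ p) PS.:= (PS.:- p) PS.:+ (PS.:- p)) PR.refl h)))) }

    success : Success
    success = case success? of λ
      { (yes p) → p
      ; (no none) → case moreThanThree? of λ
        { (yes more) → ⊥-elim (LargeCases.absurd none more)
        ; (no few) → Small.small few } }

  -- From coefficients to equivalent forms

  open Form

  private
    1≢0 : 1# ≢ 0#
    1≢0 e = 0≢1 (sym e)

    unit : ∀ {p r t} → t ≡ 1# → p ≋ r → p ≋ constP t ⊠ r
    unit {r = r} q e = PR.trans e (PR.trans (PR.sym (PR.*-identityˡ r)) (PR.*-congʳ (constP-cong (sym q))))

    1² : 1# * 1# ≡ 1#
    1² = 𝔽R.*-identityˡ 1#

    1*-1 : 1# * - 1# ≡ - 1#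
    1*-1 = 𝔽R.*-identityˡ (- 1#)

    -1*1 : - 1# * 1# ≡ - 1#
    -1*1 = 𝔽R.*-identityʳ (- 1#)

    minus : ∀ {p r t} → t ≡ - 1# → r ≋ ⊟ p → p ≋ constP t ⊠ r
    minus {p} {r} q e = PR.trans (PS.solve 1 (λ p → p PS.:= (PS.:- PS.con (pos 1)) PS.:* (PS.:- p)) PR.refl p)
      (PR.*-cong (PR.sym (PR.trans (constP-cong q) (constP-neg 1#))) (PR.sym e))

    -- A vanishing coefficient absorbs any scalar, so the sign change that repairs a₂₃ does no harm
    -- to it.
    null : ∀ {p r t} → p ≋ 0P → p ≋ r → p ≋ constP t ⊠ r
    null z e = PR.trans z (PR.sym (PR.trans (PR.*-congˡ (PR.trans (PR.sym e) z)) (PR.zeroʳ _)))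

  module _ (2≢0 : 1# + 1# ≢ 0#) where

    equivalent-up-to-a₂₃ : ∀ {M M' d₁ d₂ d₃ k'} → ReducedForm M d₁ d₂ d₃ → ReducedForm M' d₁ d₂ d₃ → Emb (qv M) (qv M') → Emb (qv M') (qv M) →
                           d₂ ≡ suc k' ℕ.+ suc k' ℕ.+ d₁ → AgreeUpToA₂₃ M M' → Equivalent M M'
    equivalent-up-to-a₂₃ {k' = k'} R R' E E' d₂≡ A = case Last.success 2≢0 R R' E E' {k'} d₂≡ A of λ
      { (inj₁ e) → equivalent 1# 1# 1# 1≢0 1≢0 1≢0 (unit 1² e₁₁) (unit 1² e₁₂) (unit 1² e₁₃) (unit 1² e₂₂) (unit 1² e) (unit 1² e₃₃)
      ; (inj₂ (opp , inj₁ z)) → equivalent 1# (- 1#) 1# 1≢0 (square⇒nonzero [-1]²) 1≢0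
          (unit 1² e₁₁) (null z e₁₂) (unit 1² e₁₃) (unit [-1]² e₂₂) (minus -1*1 opp) (unit 1² e₃₃)
      ; (inj₂ (opp , inj₂ z)) → equivalent 1# 1# (- 1#) 1≢0 1≢0 (square⇒nonzero [-1]²)
          (unit 1² e₁₁) (unit 1² e₁₂) (null z e₁₃) (unit 1² e₂₂) (minus 1*-1 opp) (unit [-1]² e₃₃) }
      where open AgreeUpToA₂₃ A

    private
      first-factor : ∀ {p r} s → p ≋ constP s ⊠ r → p ≋ constP (1# * s) ⊠ r
      first-factor s e = PR.trans e (PR.*-congʳ (constP-cong (sym (𝔽R.*-identityˡ s))))

    module _ {M d₁ d₂ d₃ k'} (R : ReducedForm M d₁ d₂ d₃) (d₂≡ : d₂ ≡ suc k' ℕ.+ suc k' ℕ.+ d₁) where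

      equivalent₃ : ∀ {M'} → ReducedForm M' d₁ d₂ d₃ → Emb (qv M) (qv M') → Emb (qv M') (qv M) →
                    a₁₁ M ≋ a₁₁ M' → a₁₂ M ≋ a₁₂ M' → a₂₂ M ≋ a₂₂ M' → coeff (a₃₃ M) d₃ ≡ coeff (a₃₃ M') d₃ → Equivalent M M'
      equivalent₃ {M'} R' E E' e₁₁ e₁₂ e₂₂ α₃≡ = case Third.third-a₁₃ 2≢0 R R' E E' e₁₁ α₃≡ of λ { (η , η² , e₁₃) → go η η² e₁₃ }
        where
        go : ∀ η → η * η ≡ 1# → a₁₃ M ≋ constP η ⊠ a₁₃ M' → Equivalent M M'
        go η η² e₁₃ = Equivalent-scale 1≢0 1≢0 (square⇒nonzero η²) (equivalent-up-to-a₂₃ {k' = k'} R (reduced-scale R') (Emb-scale-to E) (Emb-scale-from E') d₂≡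
            (record { e₁₁ = unit 1² e₁₁ ; e₁₂ = unit 1² e₁₂ ; e₁₃ = first-factor η e₁₃ ; e₂₂ = unit 1² e₂₂ ; e₃₃ = unit η² (Third.third-a₃₃ 2≢0 R R' E E' e₁₁ α₃≡) }))
          where open Scaling 1≢0 1≢0 (square⇒nonzero η²)

      equivalent₂ : ∀ {M' d₃'} → ReducedForm M' d₁ d₂ d₃' → Emb (qv M) (qv M') → Emb (qv M') (qv M) →
                    a₁₁ M ≋ a₁₁ M' → a₁₂ M ≋ a₁₂ M' → a₂₂ M ≋ a₂₂ M' → Equivalent M M'
      equivalent₂ {M'} {d₃'} R' E E' e₁₁ e₁₂ e₂₂ = go (ℕP.≤-antisym (third-minimum-≤ R' R E') (third-minimum-≤ R R' E)) R'
        where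
        scaled : ReducedForm M' d₁ d₂ d₃ → ∀ s → s ≢ 0# → coeff (a₃₃ M) d₃ ≡ (s * s) * coeff (a₃₃ M') d₃ → Equivalent M M'
        scaled R' s s≢0 q = Equivalent-scale 1≢0 1≢0 s≢0 (equivalent₃ (reduced-scale R') (Emb-scale-to E) (Emb-scale-from E')
            (unit 1² e₁₁) (unit 1² e₁₂) (unit 1² e₂₂) (trans q (sym (coeff-const* (s * s) (a₃₃ M') d₃))))
          where open Scaling 1≢0 1≢0 s≢0
        -- The minimum of M' is a variable here, so that `refl` can identify it with that of M.
        go : ∀ {d} → d₃ ≡ d → ReducedForm M' d₁ d₂ d → Equivalent M M'
        go refl R' = case third-scale R R' E of λ { (s , s≢0 , q) → scaled R' s s≢0 q }

      equivalent₁ : ∀ {M' d₂' d₃'} → ReducedForm M' d₁ d₂' d₃' → Emb (qv M) (qv M') → Emb (qv M') (qv M) → a₁₁ M ≋ a₁₁ M' → Equivalent M M'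
      equivalent₁ {M'} R' E E' e₁₁ = go (ℕP.≤-antisym (second-minimum-≤ R' R E' (PR.sym e₁₁)) (second-minimum-≤ R R' E e₁₁)) R'
        where
        scaled : ∀ {d₃'} → ReducedForm M' d₁ d₂ d₃' → ∀ s → s ≢ 0# → a₂₂ M ≋ constP (s * s) ⊠ a₂₂ M' → a₁₂ M ≋ constP s ⊠ a₁₂ M' → Equivalent M M'
        scaled R' s s≢0 e₂₂ e₁₂ = Equivalent-scale 1≢0 s≢0 1≢0 (equivalent₂ (reduced-scale R') (Emb-scale-to E) (Emb-scale-from E') (unit 1² e₁₁) (first-factor s e₁₂) e₂₂)
          where open Scaling 1≢0 s≢0 1≢0
        go : ∀ {d d₃'} → d₂ ≡ d → ReducedForm M' d₁ d d₃' → Equivalent M M'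
        go refl R' = case Binary.binary-success 2≢0 R R' E E' {k'} d₂≡ e₁₁ of λ { (s , s≢0 , e₂₂ , e₁₂) → scaled R' s s≢0 e₂₂ e₁₂ }

      -- Each of `equivalent₀` to `equivalent₃` settles some coefficients up to a constant and
      -- rescales one basis vector of M', which turns this into equality for the next.
      equivalent₀ : ∀ {M' d₁' d₂' d₃'} → ReducedForm M' d₁' d₂' d₃' → Emb (qv M) (qv M') → Emb (qv M') (qv M) → Equivalent M M'
      equivalent₀ {M'} R' E E' = go (ℕP.≤-antisym (first-minimum-≤ R' R E') (first-minimum-≤ R R' E)) R'
        where
        scaled : ∀ {d₂' d₃'} → ReducedForm M' d₁ d₂' d₃' → ∀ s → s ≢ 0# → a₁₁ M ≋ constP (s * s) ⊠ a₁₁ M' → Equivalent M M'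
        scaled R' s s≢0 e₁₁ = Equivalent-scale s≢0 1≢0 1≢0 (equivalent₁ (reduced-scale R') (Emb-scale-to E) (Emb-scale-from E') e₁₁)
          where open Scaling s≢0 1≢0 1≢0
        go : ∀ {d d₂' d₃'} → d₁ ≡ d → ReducedForm M' d d₂' d₃' → Equivalent M M'
        go refl R' = case first-scale R R' E of λ { (s , s≢0 , e₁₁) → scaled R' s s≢0 e₁₁ }

    -- k = 0 would give d₁ = d₂. So k ≥ 1, and the families have a term in t^(k - 1).
    forms-equivalent : ∀ {M M' d₁ d₂ d₃ d₁' d₂' d₃' k} → ReducedForm M d₁ d₂ d₃ → ReducedForm M' d₁' d₂' d₃' → Emb (qv M) (qv M') → Emb (qv M') (qv M) →
                       d₂ ≡ k ℕ.+ k ℕ.+ d₁ → Equivalent M M'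
    forms-equivalent {k = zero}   R R' E E' d₂≡ = ⊥-elim (ℕP.<-irrefl (sym d₂≡) (ReducedForm.d₁<d₂ R))
    forms-equivalent {k = suc k'} R R' E E' d₂≡ = equivalent₀ {k' = k'} R d₂≡ R' E E'

  -- Isometries from equivalent forms

  Equivalent-value : ∀ {M M'} (e : Equivalent M M') → let open Equivalent e in ∀ v → qv M v ≋ qv M' (scaleV c₁ c₂ c₃ v)
  Equivalent-value {M} {M'} e v = PR.trans (PR.+-cong (PR.+-cong (PR.+-cong (PR.+-cong (PR.*-congʳ e₁₁) (PR.*-congʳ e₂₂)) (PR.+-cong (PR.*-congʳ e₁₂) (PR.*-congʳ e₁₂))) (PR.*-congʳ e₃₃)) (PR.+-cong l l)) (qv-scale c₁ c₂ c₃ M' v)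
    where
    open Equivalent e
    l : a₁₃ M ⊠ (v i₀ ⊠ v i₂) ⊞ a₂₃ M ⊠ (v i₁ ⊠ v i₂) ≋ (constP (c₁ * c₃) ⊠ a₁₃ M') ⊠ (v i₀ ⊠ v i₂) ⊞ (constP (c₂ * c₃) ⊠ a₂₃ M') ⊠ (v i₁ ⊠ v i₂)
    l = PR.+-cong (PR.*-congʳ e₁₃) (PR.*-congʳ e₂₃)

  -- The product A diag(s) B: B leads into the reduced basis of one lattice, s rescales, and A
  -- leaves by the reduced basis of the other.
  sandwich : Mat3 Poly → (Fin 3 → F) → Mat3 Poly → Mat3 Poly
  sandwich A s B i j = PB.S λ k → A i k ⊠ (constP (s k) ⊠ B k j)

  app-sandwich : ∀ A s B x i → PB.app (sandwich A s B) x i ≋ PB.app A (λ k → constP (s k) ⊠ PB.app B x k) i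
  app-sandwich A s B x i = PR.trans (PR.sym (PM.app-app A (λ k j → constP (s k) ⊠ B k j) x i))
    (PM.app-cong {A} {A} {PB.app (λ k j → constP (s k) ⊠ B k j) x} {λ k → constP (s k) ⊠ PB.app B x k} (λ _ _ → PR.refl)
      (λ k → PR.trans (PB.S-cong λ j → PR.*-assoc (constP (s k)) (B k j) (x j)) (PB.S-* (constP (s k)) (λ j → B k j ⊠ x j))) i)

  app-unit : ∀ U j i → PB.app U (λ k → I3 k j) i ≋ U i j
  app-unit U i₀ i = PS.solve 3 (λ a b d → a PS.:* PS.con (pos 1) PS.:+ (b PS.:* PS.con (pos 0) PS.:+ d PS.:* PS.con (pos 0)) PS.:= a) PR.refl (U i i₀) (U i i₁) (U i i₂)
  app-unit U i₁ i = PS.solve 3 (λ a b d → a PS.:* PS.con (pos 0) PS.:+ (b PS.:* PS.con (pos 1) PS.:+ d PS.:* PS.con (pos 0)) PS.:= b) PR.refl (U i i₀) (U i i₁) (U i i₂)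
  app-unit U i₂ i = PS.solve 3 (λ a b d → a PS.:* PS.con (pos 0) PS.:+ (b PS.:* PS.con (pos 0) PS.:+ d PS.:* PS.con (pos 1)) PS.:= d) PR.refl (U i i₀) (U i i₁) (U i i₂)

  -- A matrix is determined by its action on the unit vectors, the columns of `I3`.
  inverse⇒identity : ∀ T U → (∀ x i → PB.app T (PB.app U x) i ≋ x i) → (T ·M U) ≈M I3
  inverse⇒identity T U e = identity-·M T U (IsIdentity-resp (λ i j → PR.sym (PR.trans
      (PM.app-cong {T} {T} {λ k → U k j} {PB.app U (λ k → I3 k j)} (λ _ _ → PR.refl) (λ k → PR.sym (app-unit U j k)) i) (e (λ k → I3 k j) i))) I3-identity)

  sandwich-inverse : ∀ A A⁻ B B⁻ s t → (A ·M A⁻) ≈M I3 → (B ·M B⁻) ≈M I3 → (∀ i → s i * t i ≡ 1#) →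
                     (sandwich A s B ·M sandwich B⁻ t A⁻) ≈M I3
  sandwich-inverse A A⁻ B B⁻ s t AA⁻ BB⁻ st = inverse⇒identity (sandwich A s B) (sandwich B⁻ t A⁻) λ x i → begin
      PB.app (sandwich A s B) (y x) i                                              ≈⟨ app-sandwich A s B (y x) i ⟩
      PB.app A (λ k → constP (s k) ⊠ PB.app B (y x) k) i                           ≈⟨ PM.app-cong {A} {A} {λ k → constP (s k) ⊠ PB.app B (y x) k} {PB.app A⁻ x} (λ _ _ → PR.refl) (inner x) i ⟩
      PB.app A (PB.app A⁻ x) i                                                     ≈⟨ PM.app-inverse A A⁻ (·M-identity A A⁻ AA⁻) x i ⟩
      x i ∎
    where
    open import Relation.Binary.Reasoning.Setoid PR.setoid
    y : Vec3 Poly → Vec3 Poly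
    y x = PB.app (sandwich B⁻ t A⁻) x
    inner : ∀ x k → constP (s k) ⊠ PB.app B (y x) k ≋ PB.app A⁻ x k
    inner x k = PR.trans (PR.*-congˡ (PR.trans (PM.app-cong {B} {B} {y x} {PB.app B⁻ (λ k → constP (t k) ⊠ PB.app A⁻ x k)} (λ _ _ → PR.refl) (app-sandwich B⁻ t A⁻ x) k)
        (PM.app-inverse B B⁻ (·M-identity B B⁻ BB⁻) (λ k → constP (t k) ⊠ PB.app A⁻ x k) k)))
      (PR.trans (PR.sym (PR.*-assoc _ _ _)) (PR.trans (PR.*-congʳ (PR.trans (PR.sym (constP-* (s k) (t k))) (constP-cong (st k)))) (PR.*-identityˡ _)))

  ·v-cong : ∀ P {u v} → u ≋ᵥ v → (P ·v u) ≋ᵥ (P ·v v)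
  ·v-cong P {u} {v} e i = PR.trans (PR.reflexive (·v-def P u i)) (PR.trans (PM.app-cong {P} {P} {u} {v} (λ _ _ → PR.refl) e i) (PR.reflexive (sym (·v-def P v i))))

  -- From isospectral lattices to isospectral forms

  module _ {K K≉0 L cl} (D : LatticeData K K≉0 L cl) where
    open LatticeData D

    bf-P⁻ : ∀ v → qv form (P⁻ ·v v) ≋ PB.bf N v v
    bf-P⁻ v = PR.trans (PR.sym (N-P (P⁻ ·v v))) (PB.bf-cong {N} {N} {P ·v (P⁻ ·v v)} {v} {P ·v (P⁻ ·v v)} {v} (λ _ _ → PR.refl) (P-P⁻ v) (P-P⁻ v))

    form⇒lattice : ∀ p v → qv form v ≋ p → Q L (P ·v v) ≈K (p / K)
    form⇒lattice p v e = ≋⇒≈K K {x = Q L (P ·v v)} {y = p / K} K≉0 (Q-cl (P ·v v)) (Clears-/ K K≉0 p) (PR.trans (N-P v) e)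

    lattice⇒form : ∀ p v → Q L v ≈K (p / K) → qv form (P⁻ ·v v) ≋ p
    lattice⇒form p v e = PR.trans (bf-P⁻ v) (≈K⇒≋ K {x = Q L v} {y = p / K} K≉0 (Q-cl v) (Clears-/ K K≉0 p) e)

    private
      Rep : Poly → Vec3 Poly → Set
      Rep p v = Q L v ≈K (p / K)
      Val : Poly → Vec3 Poly → Set
      Val p v = qv form v ≋ p

    count⇒RepCount : ∀ p {n} → HasCount (λ v → qv form v ≋ p) n → RepCount L (p / K) n
    count⇒RepCount p = HasCount-map {Val p} {Rep p} (P ·v_) (P⁻ ·v_) (·v-cong P) (·v-cong P⁻) P⁻-P P-P⁻ (λ {v} → form⇒lattice p v) (λ {v} → lattice⇒form p v)

    RepCount⇒count : ∀ p {n} → RepCount L (p / K) n → HasCount (λ v → qv form v ≋ p) n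
    RepCount⇒count p = HasCount-map {Rep p} {Val p} (P⁻ ·v_) (P ·v_) (·v-cong P⁻) (·v-cong P) P-P⁻ P⁻-P (λ {v} → lattice⇒form p v) (λ {v} → form⇒lattice p v)

    form-count : ∀ p → ∃ (HasCount (λ v → qv form v ≋ p))
    form-count p = hasCount (fibre-bounded reduced p)

  module _ {K K≉0 L L' cl cl'} (D : LatticeData K K≉0 L cl) (D' : LatticeData K K≉0 L' cl') where
    private
      module D = LatticeData D
      module D' = LatticeData D'

    isospectral⇒Emb : (∀ p n → RepCount L (p / K) n → RepCount L' (p / K) n) → Emb (qv D.form) (qv D'.form)
    isospectral⇒Emb h = counts⇒Emb (qv-cong D.form) (qv-cong D'.form) (form-count D) (λ p n c → RepCount⇒count D' p (h p n (count⇒RepCount D p c)))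

    equivalent⇒isometric : Equivalent D.form D'.form → Isometric L L'
    equivalent⇒isometric e = T , (sandwich D.P t D'.P⁻ , sandwich-inverse D'.P D'.P⁻ D.P⁻ D.P s t D'.PP⁻ D.P⁻P st , sandwich-inverse D.P D.P⁻ D'.P⁻ D'.P t s D.PP⁻ D'.P⁻P (λ i → trans (𝔽R.*-comm _ _) (st i)))
        , λ x → ≋⇒≈K K {x = Q L' (T ·v x)} {y = Q L x} K≉0 (D'.Q-cl (T ·v x)) (D.Q-cl x) (value x)
      where
      open Equivalent e
      s t : Fin 3 → F
      s i₀ = c₁
      s i₁ = c₂
      s i₂ = c₃
      t i = s i ⁻¹
      st : ∀ i → s i * t i ≡ 1#
      st i₀ = inverseʳ c₁ c₁≢0
      st i₁ = inverseʳ c₂ c₂≢0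
      st i₂ = inverseʳ c₃ c₃≢0
      T : Mat3 Poly
      T = sandwich D'.P s D.P⁻
      value : ∀ x → PB.bf D'.N (T ·v x) (T ·v x) ≋ PB.bf D.N x x
      value x = begin
        PB.bf D'.N (T ·v x) (T ·v x)              ≈⟨ PB.bf-cong {D'.N} {D'.N} {T ·v x} {D'.P ·v w} {T ·v x} {D'.P ·v w} (λ _ _ → PR.refl) image image ⟩
        PB.bf D'.N (D'.P ·v w) (D'.P ·v w)        ≈⟨ D'.N-P w ⟩
        qv D'.form (scaleV c₁ c₂ c₃ (D.P⁻ ·v x))  ≈⟨ Equivalent-value e (D.P⁻ ·v x) ⟨
        qv D.form (D.P⁻ ·v x)                     ≈⟨ bf-P⁻ D x ⟩
        PB.bf D.N x x                             ∎
        where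
        open import Relation.Binary.Reasoning.Setoid PR.setoid
        w : Vec3 Poly
        w = scaleV c₁ c₂ c₃ (D.P⁻ ·v x)
        w≋ : ∀ k → constP (s k) ⊠ PB.app D.P⁻ x k ≋ w k
        w≋ i₀ = PR.*-congˡ (PR.reflexive (sym (·v-def D.P⁻ x i₀)))
        w≋ i₁ = PR.*-congˡ (PR.reflexive (sym (·v-def D.P⁻ x i₁)))
        w≋ i₂ = PR.*-congˡ (PR.reflexive (sym (·v-def D.P⁻ x i₂)))
        image : ∀ i → (T ·v x) i ≋ (D'.P ·v w) i
        image i = PR.trans (PR.reflexive (·v-def T x i)) (PR.trans (app-sandwich D'.P s D.P⁻ x i)
          (PR.trans (PM.app-cong {D'.P} {D'.P} {λ k → constP (s k) ⊠ PB.app D.P⁻ x k} {w} (λ _ _ → PR.refl) w≋ i) (PR.reflexive (sym (·v-def D'.P w i)))))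

  isospectral⇒isometric : OddOrder → (L L' : TernaryLattice) → Definite L → Definite L' → Isospectral L L' → MinimaCondition L → MinimaCondition L' → Isometric L L'
  isospectral⇒isometric odd L L' def def' iso min min' = case common-denominator L L' of λ
    { (K , K≉0 , cl , cl') → compare K K≉0 (latticeData (odd⇒2≢0 odd) K≉0 L cl def min) (latticeData (odd⇒2≢0 odd) K≉0 L' cl' def' min') }
    where
    compare : ∀ K (K≉0 : ¬ (K ≋ 0P)) {cl cl'} → LatticeData K K≉0 L cl → LatticeData K K≉0 L' cl' → Isometric L L'
    compare K K≉0 D D' = equivalent⇒isometric D D' (forms-equivalent (odd⇒2≢0 odd) {k = LatticeData.k D} (LatticeData.reduced D) (LatticeData.reduced D')
      (isospectral⇒Emb D D' (λ p n → proj₁ (iso (p / K) (λ z → K≉0 (mk≋ z)) n))) (isospectral⇒Emb D' D (λ p n → proj₂ (iso (p / K) (λ z → K≉0 (mk≋ z)) n))) (LatticeData.d₂≡ D))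

theorem6p5 : (𝔽 : FiniteField) → let open Over 𝔽 in
    OddOrder → (L L' : TernaryLattice) →
    Definite L → Definite L' → Isospectral L L' →
    MinimaCondition L → MinimaCondition L' →
    Isometric L L'
theorem6p5 = isospectral⇒isometric
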